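{- Let $a,b,c,d$ be nonnegative integers with $d\le b\le c$, and write $m=\lfloor\frac{c-b}{2}\rfloor$. Then \[ \frac{M(H_{2a,b,c;d})}{M(H_{2a,b,c})}=\prod_{k=0}^{d-1} \frac{(k+\frac{1}{2})_{b-2k}\,(a+k+1)_{b-2k-1}\,(b-k+\frac{1}{2})_{m}\,(c-k)_{ -m}}{(a+k+\frac{1}{2})_{b-2k}\,(k+1)_{b-2k-1}\,(a+b-k+\frac{1}{2})_{m}\,(a+c-k)_{ -m}} \] and \[ \frac{M(H_{2a+1,b,c;d})}{M(H_{2a+1,b,c})}=\frac{1}{4^d}\prod_{k=0}^{d-1} \frac{(a+k+1)_{c-2k}\,(k+\frac{3}{2})_{c-2k-2}\,(b-k)_{m}\,(c-k-\frac{1}{2})_{ -m}}{(k+1)_{c-2k-1}\,(a+k+\frac{3}{2})_{c-2k-1}\,(a+b-k+1)_{m}\,(a+c-k+\frac{1}{2})_{ -m}}. \]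
   Context: Work on the unit triangular lattice in the plane, one of whose families of lattice lines is vertical. For nonnegative integers $p,b,c$, $H_{p,b,c}$ denotes the hexagon on this lattice whose sides have lengths $p,b,c,p,b,c$ in clockwise order starting from the (vertical) left side. A lozenge is the union of two unit triangles sharing an edge; a lozenge tiling of a region is a covering of it by lozenges without gaps or overlaps. $M(R)$ denotes the number of lozenge tilings of a region $R$ (with $M(R)=1$ if $R$ has empty interior). For nonnegative integers $p,b,c,d$ (here $p=2a$ or $p=2a+1$): $H_{p,b,c;0}:=H_{p,b,c}$, and for $d>0$, $H_{p,b,c;d}$ is obtained from $H_{p,b,c}$ as follows: let $l$ be the perpendicular bisector of the left side of $H_{p,b,c}$ (a horizontal line); label the unit triangles lying on $l$ and contained in $H_{p,b,c}$ by $1,2,\dots$ from left to right; delete the $2d$ unit triangles labeled $1,2,\dots,2d$. (For $p$ even these form $d$ consecutive unit lozenges; for $p$ odd they form $d$ consecutive "bowties".) Extended shifted factorial: for $x$ a positive integer or positive half-integer and an integer $n$ with $x+n>0$, $(x)_n=x(x+1)\cdots(x+n-1)$ if $n>0$, $(x)_0=1$, and $(x)_n=\frac{1}{(x-1)(x-2)\cdots(x+n)}$ if $n<0$. An empty product equals $1$. -}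

module Defs where

open import Data.Bool using (Bool; true; false; if_then_else_; _∧_; _∨_; not)
open import Data.Nat as ℕ using (ℕ; zero; suc; _∸_; _⊓_)
import Data.Nat.Properties as ℕP
open import Data.Integer as ℤ using (ℤ; +_; _≤ᵇ_)
import Data.Integer.Properties as ℤP
open import Data.List using (List; []; _∷_; filter; length; map; concatMap; upTo; take; foldr)
open import Data.Product using (_×_; _,_)
open import Relation.Nullary using (yes; no; ¬_)
open import Relation.Nullary.Decidable using (⌊_⌋)
open import Data.Rational as ℚ using (ℚ; 0ℚ; 1ℚ; ½; 1/_; ≢-nonZero)
import Data.Rational.Properties as ℚP

-- Geometry of the triangular lattice (one family of lattice lines vertical).
--
-- Lattice points: (j , h) with j ∈ ℕ the index of the vertical lattice line
-- (column) and h ∈ ℤ the height measured in HALF units of the side length,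
-- with h ≡ j (mod 2).
--
-- Unit triangles: every unit triangle lies in a vertical strip between
-- columns i and i+1 and has one vertical side.  We index it by (i , t)
-- where t ∈ ℤ is twice the height (in unit lengths) of the midpoint of its
-- vertical side, i.e. in half units the vertical side is [t-1, t+1] and the
-- apex has height t.
--   * if t + i is odd, the triangle is right-pointing: vertical side on
--     column i (from (i,t-1) to (i,t+1)), apex (i+1,t);
--   * if t + i is even, it is left-pointing: vertical side on column i+1
--     (from (i+1,t-1) to (i+1,t+1)), apex (i,t).
-- This is a bijection between ℕ × ℤ and the unit triangles lying to the
-- right of column 0.

Triangle : Set
Triangle = ℕ × ℤ

isRight : Triangle → Bool
isRight (i , t) = ℤ.∣ t ℤ.+ + i ∣ ℕ.% 2 ℕ.≡ᵇ 1

-- Two unit triangles share an edge iff they are vertically consecutive in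
-- the same strip (shared slanted edge) or they are a left-pointing triangle
-- in strip i and the right-pointing triangle in strip i+1 with the same
-- vertical side (the left-pointing one is the one with smaller column).
infix 4 _≡ℤᵇ_ _≡Tᵇ_
_≡ℤᵇ_ : ℤ → ℤ → Bool
x ≡ℤᵇ y = ⌊ x ℤ.≟ y ⌋

adjacent : Triangle → Triangle → Bool
adjacent (i , t) (j , u) =
  ((i ℕ.≡ᵇ j) ∧ ((t ℤ.+ + 1 ≡ℤᵇ u) ∨ (u ℤ.+ + 1 ≡ℤᵇ t)))
  ∨
  ((t ≡ℤᵇ u) ∧ (((suc i ℕ.≡ᵇ j) ∧ not (isRight (i , t)))
                ∨ ((suc j ℕ.≡ᵇ i) ∧ not (isRight (j , u)))))

_≡Tᵇ_ : Triangle → Triangle → Bool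
(i , t) ≡Tᵇ (j , u) = (i ℕ.≡ᵇ j) ∧ (t ≡ℤᵇ u)

-- Regions are finite sets of unit triangles, given as duplicate-free lists.
--
-- M R = number of lozenge tilings of R = number of perfect matchings of
-- the dual graph (triangles, edge-adjacency).  Computed by the standard
-- expansion: the first triangle x of R must be covered by a lozenge made
-- of x and an adjacent triangle y of R; sum over y of the number of
-- tilings of R ∖ {x, y}.  (Fuel = number of triangles; each step removes
-- at least one triangle.)  M [] = 1 (empty region).

removeT : Triangle → List Triangle → List Triangle
removeT y = filter (λ z → not (y ≡Tᵇ z) Data.Bool.≟ true)

sumℕ : List ℕ → ℕ
sumℕ = foldr ℕ._+_ 0

countTilings : ℕ → List Triangle → ℕ
countTilings _ [] = 1
countTilings zero (_ ∷ _) = 0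
countTilings (suc n) (x ∷ xs) =
  sumℕ (map (λ y → countTilings n (removeT y xs))
            (filter (λ y → adjacent x y Data.Bool.≟ true) xs))

M : List Triangle → ℕ
M R = countTilings (length R) R

-- The hexagon H_{p,b,c}: sides p, b, c, p, b, c clockwise from the vertical
-- left side, which lies on column 0 between heights 0 and 2p (half units).
-- Its top boundary: NE for b columns, then SE for c columns;
-- its bottom boundary: SE for c columns, then NE for b columns.

topH : ℕ → ℕ → ℕ → ℤ
topH p b j = + (2 ℕ.* p ℕ.+ (j ⊓ b)) ℤ.- + (j ∸ b)

botH : ℕ → ℕ → ℤ
botH c j = + (j ∸ c) ℤ.- + (j ⊓ c)

-- a triangle lies in the (convex) hexagon iff its three vertices do
inHex : ℕ → ℕ → ℕ → Triangle → Bool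
inHex p b c (i , t) =
  (suc i ℕ.≤ᵇ b ℕ.+ c) ∧
  (if isRight (i , t)
   then (botH c i ≤ᵇ t ℤ.- + 1) ∧ (t ℤ.+ + 1 ≤ᵇ topH p b i) ∧
        (botH c (suc i) ≤ᵇ t) ∧ (t ≤ᵇ topH p b (suc i))
   else (botH c (suc i) ≤ᵇ t ℤ.- + 1) ∧ (t ℤ.+ + 1 ≤ᵇ topH p b (suc i)) ∧
        (botH c i ≤ᵇ t) ∧ (t ≤ᵇ topH p b i))

heightRange : ℕ → List ℤ
heightRange N = map (λ k → + k ℤ.- + N) (upTo (suc (2 ℕ.* N)))

-- all triangles of H_{p,b,c} (every triangle of the hexagon lies in a strip
-- i < b+c and has |t| ≤ 2(p+b+c)+1, so the search window is exhaustive)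
Hex : ℕ → ℕ → ℕ → List Triangle
Hex p b c =
  filter (λ T → inHex p b c T Data.Bool.≟ true)
    (concatMap (λ i → map (λ t → (i , t))
                          (heightRange (2 ℕ.* (p ℕ.+ b ℕ.+ c) ℕ.+ 1)))
               (upTo (b ℕ.+ c)))

-- The line l (perpendicular bisector of the left side) is the horizontal
-- line at height p (half units).  In strip i the unique unit triangle whose
-- interior meets l is (i , p).  The unit triangles lying on l and contained
-- in H_{p,b,c}, listed from left to right:
onL : ℕ → ℕ → ℕ → List Triangle
onL p b c = filter (λ T → inHex p b c T Data.Bool.≟ true)
                   (map (λ i → (i , + p)) (upTo (b ℕ.+ c)))

memT : Triangle → List Triangle → Bool
memT x [] = false
memT x (y ∷ ys) = (x ≡Tᵇ y) ∨ memT x ys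

HexD : ℕ → ℕ → ℕ → ℕ → List Triangle
HexD p b c d =
  filter (λ T → not (memT T (take (2 ℕ.* d) (onL p b c))) Data.Bool.≟ true)
         (Hex p b c)

-- total reciprocal (1/0 := 0; only ever applied to nonzero arguments below)
inv : ℚ → ℚ
inv p with p ℚP.≟ 0ℚ
... | yes _ = 0ℚ
... | no p≢0 = (1/ p) {{≢-nonZero p≢0}}

_÷'_ : ℚ → ℚ → ℚ
p ÷' q = p ℚ.* inv q

fromℕ : ℕ → ℚ
fromℕ n = + n ℚ./ 1

prodℚ : List ℚ → ℚ
prodℚ = foldr ℚ._*_ 1ℚ

risingℕ : ℚ → ℕ → ℚ
risingℕ x zero = 1ℚ
risingℕ x (suc n) = x ℚ.* risingℕ (x ℚ.+ 1ℚ) n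

fallingBelow : ℚ → ℕ → ℚ
fallingBelow x zero = 1ℚ
fallingBelow x (suc n) = (x ℚ.- 1ℚ) ℚ.* fallingBelow (x ℚ.- 1ℚ) n

poch : ℚ → ℤ → ℚ
poch x (+ n) = risingℕ x n
poch x ℤ.-[1+ n ] = inv (fallingBelow x (suc n))

prodRange : ℕ → (ℕ → ℚ) → ℚ
prodRange d f = prodℚ (map f (upTo d))

zℕ : ℕ → ℤ
zℕ n = + n

{-# OPTIONS --safe #-}
module Submission where

-- Lozenge tilings correspond to families of non-intersecting lattice paths crossing the vertical edges, so
-- they are counted by determinants of path counts; this is proved by transferring the determinant through
-- one strip after the other.  For p = 2 a the removed lozenges become walls, which no path may enter; for
-- p = 2 a + 1 there are also walls, and the path that would start in the middle of the left side starts at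
-- the tip of the intrusion instead.
--
-- Write X d, Y d for the two counts with d removals, as functions of b and c.  The three-term Plücker
-- relations between such determinants read
--   Y d (b , c) X e (b , c) = Y d (b , c - 1) X e (b , c + 1) + Y d (b - 1 , c) X e (b + 1 , c),
-- with e = d or e = d + 1.  The closed forms satisfy them too, so induction on c - b reduces everything to
-- b = c.  There the mirror symmetry splits the determinant into an antisymmetric part, which does not see
-- the walls on the axis, and a symmetric part.  In the symmetric part each removal replaces a reflecting
-- by a killing boundary condition, a perturbation of rank one, whose moments are of Cauchy type
-- β k β l / (k + l + 1) with β k = C(2k , k).  Finally the duplication formula for the gamma function turns
-- the closed forms into the stated products of shifted factorials.

open import Defs
open import Algebra.Bundles using (CommutativeRing)
open import Data.Bool as Bool using (T; Bool; true; false; if_then_else_; _∨_; _∧_; not)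
import Data.Bool.Properties as BoolP
open import Data.Empty using (⊥; ⊥-elim)
open import Data.Integer as ℤ using (ℤ; +_)
import Data.Integer.Properties as ℤP
open import Data.Integer.Tactic.RingSolver using () renaming (ring to ℤ-ring)
open import Data.List using (List; []; _∷_; _++_; map; length; downFrom; reverse; filter; concatMap; upTo; applyUpTo; take)
import Data.List.Properties as LP
open import Data.List.Membership.Propositional using (_∈_)
import Data.List.Membership.Propositional.Properties as MemP
open import Data.List.Relation.Unary.All as All using (All; []; _∷_)
import Data.List.Relation.Unary.All.Properties as AllP
open import Data.List.Relation.Unary.Any using (here; there)
open import Data.Maybe using (Maybe; just; nothing)
open import Data.Nat as ℕ using (ℕ; zero; suc; _∸_; _⊓_; ⌊_/2⌋; _≤_)
import Data.Nat.Coprimality as Coprime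
import Data.Nat.DivMod as ℕD
import Data.Nat.Properties as ℕP
open import Data.Nat.Tactic.RingSolver using () renaming (ring to ℕ-ring)
open import Data.Product using (_×_; _,_; proj₁; proj₂; Σ)
open import Data.Rational as ℚ using (ℚ; 0ℚ; 1ℚ; ½)
import Data.Rational.Properties as ℚP
open import Data.Sum using (_⊎_; inj₁; inj₂)
open import Function using (_∘_; flip; id)
open import Level using (0ℓ)
open import Relation.Binary.PropositionalEquality using (_≡_; _≢_; refl; sym; trans; cong; cong₂; subst; subst₂; module ≡-Reasoning)
open import Relation.Nullary using (yes; no; ¬_; Dec)
open import Tactic.RingSolver using (solve-∀)
import Tactic.RingSolver.Core.AlmostCommutativeRing as ACR

-- In the coordinates u = b - d, v = c - d, one more removal in a fixed hexagon lowers u and v by 1;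
-- hence the closed forms are recursions on d. X and Y are determined alternately: X 0 and Y 0 are
-- MacMahon's product, Y d yields X (d + 1), and X (d + 1) yields Y (d + 1). At u = v = l no
-- determinant is evaluated. The antisymmetric part and the Cauchy determinant of the symmetric part
-- depend on d + l alone, so both cancel between (d + 1 , l) and (d , l + 1). What remains is a
-- ratio of products of central binomial coefficients that telescopes, and this is the origin of the
-- factors in the closed forms. On the tiling side, `Hex` already lists the triangles strip by strip
-- and upwards. In this order a triangle has at most two possible partners after it, so the
-- expansion that defines `M` is followed literally and no invariance under reordering is required.
-- The rows of the determinant are the paths met so far; two paths that meet give two equal rows,
-- and a triangle with two partners is the linearity of the determinant in one row.

infixl 6 _+_ _-_
infixl 7 _*_
infix  8 -_

-- Sealed copies of the operations of ℚ: the originals match on their arguments, which blocks unification.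
opaque
  _+_ _*_ _-_ : ℚ → ℚ → ℚ
  _+_ = ℚ._+_
  _*_ = ℚ._*_
  _-_ = ℚ._-_
  -_ : ℚ → ℚ
  -_ = ℚ.-_

isZero : ∀ x → Maybe (0ℚ ≡ x)
isZero x with 0ℚ ℚP.≟ x
... | yes eq = just eq
... | no  _  = nothing

opaque
  unfolding _+_

  ℚ-commRing : CommutativeRing 0ℓ 0ℓ
  ℚ-commRing = record
    { Carrier = ℚ ; _≈_ = _≡_ ; _+_ = _+_ ; _*_ = _*_ ; -_ = -_ ; 0# = 0ℚ ; 1# = 1ℚ
    ; isCommutativeRing = ℚP.+-*-isCommutativeRing }

  ℚ-ring : ACR.AlmostCommutativeRing 0ℓ 0ℓ
  ℚ-ring = ACR.fromCommutativeRing ℚ-commRing isZero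

opaque
  unfolding ℚ-ring

  +-identityˡ : ∀ x → 0ℚ + x ≡ x
  +-identityˡ = ℚP.+-identityˡ

  +-identityʳ : ∀ x → x + 0ℚ ≡ x
  +-identityʳ = ℚP.+-identityʳ

  *-identityˡ : ∀ x → 1ℚ * x ≡ x
  *-identityˡ = ℚP.*-identityˡ

  *-zeroˡ : ∀ x → 0ℚ * x ≡ 0ℚ
  *-zeroˡ = ℚP.*-zeroˡ

  *-zeroʳ : ∀ x → x * 0ℚ ≡ 0ℚ
  *-zeroʳ = ℚP.*-zeroʳ

  *-comm : ∀ x y → x * y ≡ y * x
  *-comm = ℚP.*-comm

  *-assoc : ∀ x y z → (x * y) * z ≡ x * (y * z)
  *-assoc = ℚP.*-assoc

  x-0 : ∀ x → x - 0ℚ ≡ x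
  x-0 = solve-∀ ℚ-ring

  x+k0 : ∀ x k → x + k * 0ℚ ≡ x
  x+k0 = solve-∀ ℚ-ring

  lin-sub : ∀ x y k u v → (x + k * y) - (u + k * v) ≡ (x - u) + k * (y - v)
  lin-sub = solve-∀ ℚ-ring

  sub-neg1 : ∀ x y → x - y ≡ x + (- 1ℚ) * y
  sub-neg1 = solve-∀ ℚ-ring

  sub-swap : ∀ x y z → x - (y - (- z)) ≡ - (y - (x - z))
  sub-swap = solve-∀ ℚ-ring

  distrib-sub : ∀ x y z w → x * (y * z - w) ≡ y * (x * z) - x * w
  distrib-sub = solve-∀ ℚ-ring

  *-left-comm : ∀ x y z → x * (y * z) ≡ y * (x * z)
  *-left-comm = solve-∀ ℚ-ring

  *-rotate : ∀ x y z → x * (y * z) ≡ z * (x * y)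
  *-rotate = solve-∀ ℚ-ring

  halve : ∀ x → x ≡ ½ * (x + x)
  halve = solve-∀ ℚ-ring

  halve-neg : ∀ x → ½ * (x + (- x)) ≡ 0ℚ
  halve-neg = solve-∀ ℚ-ring

  neg-square : ∀ x → (- x) * (- x) ≡ x * x
  neg-square = solve-∀ ℚ-ring

  neg-shift : ∀ x y → x * (- y) ≡ (- x) * y
  neg-shift = solve-∀ ℚ-ring

  lin-* : ∀ x k y z → (x + k * y) * z ≡ x * z + k * (y * z)
  lin-* = solve-∀ ℚ-ring

  split-* : ∀ x y z → x * z ≡ y * z + (x - y) * z
  split-* = solve-∀ ℚ-ring

  -0≡0 : - 0ℚ ≡ 0ℚ
  -0≡0 = refl

+-congˡ : ∀ {x y z} → y ≡ z → x + y ≡ x + z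
+-congˡ refl = refl

+-congʳ : ∀ {x y z} → y ≡ z → y + x ≡ z + x
+-congʳ refl = refl

*-congˡ : ∀ {x y z} → y ≡ z → x * y ≡ x * z
*-congˡ refl = refl

*-congʳ : ∀ {x y z} → y ≡ z → y * x ≡ z * x
*-congʳ refl = refl

-‿congˡ : ∀ {x y z} → y ≡ z → x - y ≡ x - z
-‿congˡ refl = refl

-‿congʳ : ∀ {x y z} → y ≡ z → y - x ≡ z - x
-‿congʳ refl = refl

zero* : ∀ {x y} → x ≡ 0ℚ → x * y ≡ 0ℚ
zero* {y = y} refl = *-zeroˡ y

-- Determinants over lists, by Laplace expansion

private variable
  I J : Set

-- The function receives the chosen element together with the remaining ones in their order, so that
-- cofactors need no indices and no size.
altS : (J → List J → ℚ) → List J → ℚ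
altS f []       = 0ℚ
altS f (b ∷ bs) = f b bs - altS (λ c cs → f c (b ∷ cs)) bs

-- Lists of different lengths get determinant 0, which spares size hypotheses in most lemmas.
det : (I → J → ℚ) → List I → List J → ℚ
det m []       []      = 1ℚ
det m []       (_ ∷ _) = 0ℚ
det m (a ∷ as) bs      = altS (λ b bs′ → m a b * det m as bs′) bs

altS-congP : {f g : J → List J → ℚ} (Q : J → Set) → (∀ b bs → Q b → All Q bs → f b bs ≡ g b bs) →
  ∀ {bs} → All Q bs → altS f bs ≡ altS g bs
altS-congP Q h []       = refl
altS-congP Q h (q ∷ qs) = cong₂ _-_ (h _ _ q qs) (altS-congP Q (λ c cs r rs → h c _ r (q ∷ rs)) qs)

altS-cong : {f g : J → List J → ℚ} → (∀ b bs → f b bs ≡ g b bs) → ∀ bs → altS f bs ≡ altS g bs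
altS-cong h []       = refl
altS-cong h (b ∷ bs) = cong₂ _-_ (h b bs) (altS-cong (λ c cs → h c (b ∷ cs)) bs)

altS-lin : (f g : J → List J → ℚ) (k : ℚ) → ∀ bs →
  altS (λ b cs → f b cs + k * g b cs) bs ≡ altS f bs + k * altS g bs
altS-lin f g k []       = sym (x+k0 0ℚ k)
altS-lin f g k (b ∷ bs) = trans (cong (_-_ _) (altS-lin _ _ k bs)) (lin-sub _ _ k _ _)

altS-0 : ∀ bs → altS {J} (λ _ _ → 0ℚ) bs ≡ 0ℚ
altS-0 []       = refl
altS-0 (b ∷ bs) = trans (cong (_-_ 0ℚ) (altS-0 bs)) (x-0 0ℚ)

altS-* : (f : J → List J → ℚ) (k : ℚ) → ∀ bs → altS (λ b cs → k * f b cs) bs ≡ k * altS f bs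
altS-* f k bs = begin
  altS (λ b cs → k * f b cs) bs          ≡⟨ altS-cong (λ b cs → sym (+-identityˡ _)) bs ⟩
  altS (λ b cs → 0ℚ + k * f b cs) bs     ≡⟨ altS-lin (λ _ _ → 0ℚ) f k bs ⟩
  altS (λ _ _ → 0ℚ) bs + k * altS f bs   ≡⟨ +-congʳ (altS-0 bs) ⟩
  0ℚ + k * altS f bs                     ≡⟨ +-identityˡ _ ⟩
  k * altS f bs                          ∎
  where open ≡-Reasoning

altS-+ : (f g : J → List J → ℚ) → ∀ bs → altS (λ b cs → f b cs + g b cs) bs ≡ altS f bs + altS g bs
altS-+ f g bs = begin
  altS (λ b cs → f b cs + g b cs) bs        ≡⟨ altS-cong (λ b cs → +-congˡ (sym (*-identityˡ _))) bs ⟩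
  altS (λ b cs → f b cs + 1ℚ * g b cs) bs   ≡⟨ altS-lin f g 1ℚ bs ⟩
  altS f bs + 1ℚ * altS g bs                ≡⟨ +-congˡ (*-identityˡ _) ⟩
  altS f bs + altS g bs                     ∎
  where open ≡-Reasoning

altS-sub : (f g : J → List J → ℚ) → ∀ bs → altS (λ b cs → f b cs - g b cs) bs ≡ altS f bs - altS g bs
altS-sub f g bs = begin
  altS (λ b cs → f b cs - g b cs) bs           ≡⟨ altS-cong (λ b cs → sub-neg1 _ _) bs ⟩
  altS (λ b cs → f b cs + (- 1ℚ) * g b cs) bs  ≡⟨ altS-lin f g (- 1ℚ) bs ⟩
  altS f bs + (- 1ℚ) * altS g bs               ≡⟨ sym (sub-neg1 _ _) ⟩
  altS f bs - altS g bs                        ∎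
  where
  open ≡-Reasoning

-- The same two elements chosen in the other order come with the opposite sign; for the head this
-- compares choosing it first with choosing it second. All antisymmetry of `det` comes from here.
altS-anticomm : (u v : J → ℚ) (g : List J → ℚ) → ∀ bs →
  altS (λ b cs → u b * altS (λ c ds → v c * g ds) cs) bs ≡
  - altS (λ b cs → v b * altS (λ c ds → u c * g ds) cs) bs
altS-anticomm u v g []       = sym -0≡0
altS-anticomm u v g (b ∷ bs) = begin
  u b * V - altS (λ c cs → u c * (v b * g cs - altS (λ d ds → v d * g (b ∷ ds)) cs)) bs
    ≡⟨ cong (_-_ (u b * V)) (split u v) ⟩
  u b * V - (v b * U - P)
    ≡⟨ cong (λ z → u b * V - (v b * U - z)) (altS-anticomm u v (g ∘ (b ∷_)) bs) ⟩
  u b * V - (v b * U - (- Q))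
    ≡⟨ sub-swap _ _ _ ⟩
  - (v b * U - (u b * V - Q))
    ≡⟨ cong (λ z → - (v b * U - z)) (sym (split v u)) ⟩
  - (v b * U - altS (λ c cs → v c * (u b * g cs - altS (λ d ds → u d * g (b ∷ ds)) cs)) bs) ∎
  where
  open ≡-Reasoning
  U = altS (λ c ds → u c * g ds) bs
  V = altS (λ c ds → v c * g ds) bs
  P = altS (λ c cs → u c * altS (λ d ds → v d * g (b ∷ ds)) cs) bs
  Q = altS (λ c cs → v c * altS (λ d ds → u d * g (b ∷ ds)) cs) bs
  split : ∀ u v → altS (λ c cs → u c * (v b * g cs - altS (λ d ds → v d * g (b ∷ ds)) cs)) bs ≡
    v b * altS (λ c ds → u c * g ds) bs - altS (λ c cs → u c * altS (λ d ds → v d * g (b ∷ ds)) cs) bs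
  split u v = trans (altS-cong (λ c cs → distrib-sub _ _ _ _) bs)
    (trans (altS-sub _ _ bs) (-‿congʳ (altS-* _ (v b) bs)))

altS-swap : (F : I → List I → J → List J → ℚ) → ∀ as bs →
  altS (λ a as′ → altS (F a as′) bs) as ≡ altS (λ b bs′ → altS (λ a as′ → F a as′ b bs′) as) bs
altS-swap F []       bs = sym (altS-0 bs)
altS-swap F (a ∷ as) bs = trans (cong (_-_ (altS (F a as) bs)) (altS-swap (λ c cs → F c (a ∷ cs)) as bs))
  (sym (altS-sub _ _ bs))

altS-++ : (f : J → List J → ℚ) → ∀ bs cs → (∀ c ds → c ∈ cs → f c ds ≡ 0ℚ) →
  altS f (bs ++ cs) ≡ altS (λ b bs′ → f b (bs′ ++ cs)) bs
altS-++ f [] cs z = trans (altS-congP (_∈ cs) (λ c ds p _ → z c ds p) (All.tabulate id)) (altS-0 cs)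
altS-++ f (b ∷ bs) cs z = cong (_-_ (f b (bs ++ cs))) (altS-++ (λ c ds → f c (b ∷ ds)) bs cs (λ c ds → z c (b ∷ ds)))

module _ (m : I → J → ℚ) where

  -- Expand along the first row, expand the minors along the column by induction, and exchange the
  -- two sums. This makes `det` symmetric in rows and columns although it is defined by rows.
  det-expandCol : ∀ as b bs → det m as (b ∷ bs) ≡ altS (λ a as′ → m a b * det m as′ bs) as
  det-expandCol []       b bs = refl
  det-expandCol (a ∷ as) b bs = cong (_-_ (m a b * det m as bs)) (begin
    altS (λ c cs → m a c * det m as (b ∷ cs)) bs
      ≡⟨ altS-cong (λ c cs → trans (cong (m a c *_) (det-expandCol as b cs)) (sym (altS-* _ (m a c) as))) bs ⟩
    altS (λ c cs → altS (λ a′ as′ → m a c * (m a′ b * det m as′ cs)) as) bs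
      ≡⟨ altS-swap (λ c cs a′ as′ → m a c * (m a′ b * det m as′ cs)) bs as ⟩
    altS (λ a′ as′ → altS (λ c cs → m a c * (m a′ b * det m as′ cs)) bs) as
      ≡⟨ altS-cong (λ a′ as′ → trans (altS-cong (λ c cs → *-left-comm _ _ _) bs) (altS-* _ (m a′ b) bs)) as ⟩
    altS (λ a′ as′ → m a′ b * altS (λ c cs → m a c * det m as′ cs) bs) as ∎)
    where
    open ≡-Reasoning

  det-transpose : ∀ as bs → det m as bs ≡ det (flip m) bs as
  det-transpose []       []       = refl
  det-transpose (a ∷ as) []       = refl
  det-transpose as       (b ∷ bs) = trans (det-expandCol as b bs)
    (altS-cong (λ a as′ → cong (m a b *_) (det-transpose as′ bs)) as)

  det-swap : ∀ a a′ as bs → det m (a ∷ a′ ∷ as) bs ≡ - det m (a′ ∷ a ∷ as) bs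
  det-swap a a′ as = altS-anticomm (m a) (m a′) (det m as)

  det-dup : ∀ {a as} bs → a ∈ as → det m (a ∷ as) bs ≡ 0ℚ
  det-dup {a} {_ ∷ as} bs (here refl) = self-neg (det-swap a a as bs)
    where
    self-neg : ∀ {x} → x ≡ - x → x ≡ 0ℚ
    self-neg {x} e = trans (halve x) (trans (cong (λ z → ½ * (x + z)) e) (halve-neg x))
  det-dup {a} {a′ ∷ as} bs (there p) = trans (det-swap a a′ as bs) (trans (cong -_
    (trans (altS-cong (λ b cs → trans (cong (m a′ b *_) (det-dup cs p)) (*-zeroʳ _)) bs) (altS-0 bs))) -0≡0)

sgn : ℕ → ℚ
sgn zero    = 1ℚ
sgn (suc n) = - sgn n

sgn² : ∀ n → sgn n * sgn n ≡ 1ℚ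
sgn² zero    = *-identityˡ 1ℚ
sgn² (suc n) = trans (neg-square (sgn n)) (sgn² n)

module _ (m : I → J → ℚ) where

  det-move : ∀ pre a post bs → det m (pre ++ a ∷ post) bs ≡ sgn (length pre) * det m (a ∷ pre ++ post) bs
  det-move []        a post bs = sym (*-identityˡ _)
  det-move (x ∷ pre) a post bs = begin
    altS (λ b cs → m x b * det m (pre ++ a ∷ post) cs) bs
      ≡⟨ altS-cong (λ b cs → trans (cong (m x b *_) (det-move pre a post cs)) (*-left-comm _ _ _)) bs ⟩
    altS (λ b cs → sgn (length pre) * (m x b * det m (a ∷ pre ++ post) cs)) bs
      ≡⟨ altS-* _ (sgn (length pre)) bs ⟩
    sgn (length pre) * det m (x ∷ a ∷ pre ++ post) bs
      ≡⟨ cong (sgn (length pre) *_) (det-swap m x a (pre ++ post) bs) ⟩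
    sgn (length pre) * (- det m (a ∷ x ∷ pre ++ post) bs)
      ≡⟨ neg-shift _ _ ⟩
    (- sgn (length pre)) * det m (a ∷ x ∷ pre ++ post) bs ∎
    where
    open ≡-Reasoning

  det-zeroRow : ∀ pre a post {bs} → All (λ b → m a b ≡ 0ℚ) bs → det m (pre ++ a ∷ post) bs ≡ 0ℚ
  det-zeroRow pre a post {bs} z = trans (det-move pre a post bs)
    (trans (cong (sgn (length pre) *_) (trans (altS-congP _ (λ b cs e _ → zero* e) z) (altS-0 bs)))
           (*-zeroʳ _))

  -- Linear combinations of rows as functions on the columns. Equality is pointwise, since functions
  -- are never compared by `≡` here.
  data Span (rs : List I) : (J → ℚ) → Set where
    s0 : ∀ {f} → (∀ b → f b ≡ 0ℚ) → Span rs f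
    s+ : ∀ {f} k {g r} → r ∈ rs → Span rs g → (∀ b → f b ≡ g b + k * m r b) → Span rs f

  det-span₀ : ∀ {rs f} bs → Span rs f → altS (λ b cs → f b * det m rs cs) bs ≡ 0ℚ
  det-span₀ bs (s0 z) = trans (altS-cong (λ b cs → zero* (z b)) bs) (altS-0 bs)
  det-span₀ {rs} {f} bs (s+ k {g} {r} p s e) = begin
    altS (λ b cs → f b * det m rs cs) bs
      ≡⟨ altS-cong (λ b cs → trans (cong (_* det m rs cs) (e b)) (lin-* _ _ _ _)) bs ⟩
    altS (λ b cs → g b * det m rs cs + k * (m r b * det m rs cs)) bs
      ≡⟨ altS-lin _ _ k bs ⟩
    altS (λ b cs → g b * det m rs cs) bs + k * det m (r ∷ rs) bs
      ≡⟨ cong₂ (λ x y → x + k * y) (det-span₀ bs s) (det-dup m bs p) ⟩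
    0ℚ + k * 0ℚ ≡⟨ x+k0 0ℚ k ⟩
    0ℚ ∎
    where
    open ≡-Reasoning

  det-addHead : ∀ a′ a rs bs → Span rs (λ b → m a′ b - m a b) → det m (a′ ∷ rs) bs ≡ det m (a ∷ rs) bs
  det-addHead a′ a rs bs s = begin
    det m (a′ ∷ rs) bs
      ≡⟨ altS-cong (λ b cs → split-* _ _ _) bs ⟩
    altS (λ b cs → m a b * det m rs cs + (m a′ b - m a b) * det m rs cs) bs
      ≡⟨ altS-+ _ _ bs ⟩
    det m (a ∷ rs) bs + altS (λ b cs → (m a′ b - m a b) * det m rs cs) bs
      ≡⟨ +-congˡ (det-span₀ bs s) ⟩
    det m (a ∷ rs) bs + 0ℚ ≡⟨ +-identityʳ _ ⟩
    det m (a ∷ rs) bs ∎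
    where
    open ≡-Reasoning

  det-add : ∀ pre a′ a post bs → Span (pre ++ post) (λ b → m a′ b - m a b) →
    det m (pre ++ a′ ∷ post) bs ≡ det m (pre ++ a ∷ post) bs
  det-add pre a′ a post bs s = trans (det-move pre a′ post bs)
    (trans (cong (sgn (length pre) *_) (det-addHead a′ a (pre ++ post) bs s)) (sym (det-move pre a post bs)))

  det-congTail : ∀ pre {rs rs′} → (∀ bs → det m rs bs ≡ det m rs′ bs) → ∀ bs → det m (pre ++ rs) bs ≡ det m (pre ++ rs′) bs
  det-congTail []        h bs = h bs
  det-congTail (x ∷ pre) h bs = altS-cong (λ b cs → cong (m x b *_) (det-congTail pre h cs)) bs

  det-block : ∀ R₁ R₂ C₁ C₂ → length R₁ ≡ length C₁ → (∀ r c → r ∈ R₁ → c ∈ C₂ → m r c ≡ 0ℚ) →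
    det m (R₁ ++ R₂) (C₁ ++ C₂) ≡ det m R₁ C₁ * det m R₂ C₂
  det-block []       R₂ []       C₂ _ z = sym (*-identityˡ _)
  det-block (r ∷ R₁) R₂ C₁ C₂ l z = begin
    altS (λ c cs → m r c * det m (R₁ ++ R₂) cs) (C₁ ++ C₂)
      ≡⟨ altS-++ _ C₁ C₂ (λ c ds p → zero* (z r c (here refl) p)) ⟩
    altS (λ c cs → m r c * det m (R₁ ++ R₂) (cs ++ C₂)) C₁
      ≡⟨ go (λ _ cs → cs) (m r) C₁ (λ c cs e → ℕP.suc-injective (trans l e)) ⟩
    altS (λ c cs → det m R₂ C₂ * (m r c * det m R₁ cs)) C₁
      ≡⟨ altS-* _ (det m R₂ C₂) C₁ ⟩
    det m R₂ C₂ * det m (r ∷ R₁) C₁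
      ≡⟨ *-comm (det m R₂ C₂) _ ⟩
    det m (r ∷ R₁) C₁ * det m R₂ C₂ ∎
    where
    open ≡-Reasoning
    -- `k` restores the columns that `altS` has passed over: the recursion of `altS` puts them back
    -- inside the continuation, and the block rule is needed for the full list.
    go : ∀ (k : J → List J → List J) (w : J → ℚ) C → (∀ c cs → length C ≡ suc (length cs) → length R₁ ≡ length (k c cs)) →
      altS (λ c cs → w c * det m (R₁ ++ R₂) (k c cs ++ C₂)) C ≡
      altS (λ c cs → det m R₂ C₂ * (w c * det m R₁ (k c cs))) C
    go k w [] h = refl
    go k w (c ∷ C) h = cong₂ _-_
      (trans (cong (w c *_) (det-block R₁ R₂ (k c C) C₂ (h c C refl) (λ r c p → z r c (there p)))) (*-rotate _ _ _))
      (go (λ c′ cs → k c′ (c ∷ cs)) w C (λ c′ cs e → h c′ (c ∷ cs) (cong suc e)))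

module _ {A′ B′ : Set} (m : A′ → B′ → ℚ) where

  altS-map : (f : J → B′) (h : B′ → List B′ → ℚ) → ∀ bs → altS h (map f bs) ≡ altS (λ b cs → h (f b) (map f cs)) bs
  altS-map f h []       = refl
  altS-map f h (b ∷ bs) = cong (_-_ (h (f b) (map f bs))) (altS-map f (λ c cs → h c (f b ∷ cs)) bs)

  det-map : (f : I → A′) (g : J → B′) → ∀ as bs → det m (map f as) (map g bs) ≡ det (λ a b → m (f a) (g b)) as bs
  det-map f g []       []       = refl
  det-map f g []       (_ ∷ _)  = refl
  det-map f g (a ∷ as) bs       = trans (altS-map g _ bs) (altS-cong (λ b cs → cong (m (f a) (g b) *_) (det-map f g as cs)) bs)

det-congP : {m m′ : I → J → ℚ} (P : I → Set) (Q : J → Set) → (∀ a b → P a → Q b → m a b ≡ m′ a b) →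
  ∀ {as bs} → All P as → All Q bs → det m as bs ≡ det m′ as bs
det-congP P Q h []       []       = refl
det-congP P Q h []       (_ ∷ _)  = refl
det-congP P Q h (p ∷ ps) qs       = altS-congP Q (λ b cs q qs′ → cong₂ _*_ (h _ b p q) (det-congP P Q h ps qs′)) qs

det-cong : {m m′ : I → J → ℚ} → (∀ a b → m a b ≡ m′ a b) → ∀ as bs → det m as bs ≡ det m′ as bs
det-cong h []       []      = refl
det-cong h []       (_ ∷ _) = refl
det-cong h (a ∷ as) bs      = altS-cong (λ b cs → cong₂ _*_ (h a b) (det-cong h as cs)) bs

prod : (I → ℚ) → List I → ℚ
prod f []       = 1ℚ
prod f (a ∷ as) = f a * prod f as

opaque
  unfolding ℚ-ring

  *-interchange : ∀ x y z w → (x * y) * (z * w) ≡ (x * z) * (y * w)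
  *-interchange = solve-∀ ℚ-ring

det-scaleRows : (α : I → ℚ) (m : I → J → ℚ) → ∀ as bs → det (λ a b → α a * m a b) as bs ≡ prod α as * det m as bs
det-scaleRows α m []       []      = sym (*-identityˡ 1ℚ)
det-scaleRows α m []       (_ ∷ _) = sym (*-identityˡ 0ℚ)
det-scaleRows α m (a ∷ as) bs      =
  trans (altS-cong (λ b cs → trans (cong (_*_ (α a * m a b)) (det-scaleRows α m as cs)) (*-interchange _ _ _ _)) bs)
        (altS-* _ (α a * prod α as) bs)

det-scaleCols : (β : J → ℚ) (m : I → J → ℚ) → ∀ as bs → det (λ a b → β b * m a b) as bs ≡ prod β bs * det m as bs
det-scaleCols β m as bs = trans (det-transpose _ as bs)
  (trans (det-scaleRows β (flip m) bs as) (cong (prod β bs *_) (sym (det-transpose m as bs))))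

-- The three-term Plücker relation

-- Cramer's rule kills the p + 2 columns in the (p + 1)-dimensional space spanned by Γ; pair the resulting
-- relation with the functional c ↦ det V (c ∷ W), which vanishes on W.
module _ (m : I → J → ℚ) (V Γ : List I) (V⊆Γ : ∀ {v} → v ∈ V → v ∈ Γ) where

  -- For a fixed v the sum over the columns is the expansion of a determinant with rows `v ∷ Γ`, in
  -- which v occurs twice.
  cramer : ∀ (k : I → List I → ℚ) V′ → (∀ {v} → v ∈ V′ → v ∈ Γ) → ∀ cs →
    altS (λ c ds → altS (λ v vs → m v c * k v vs) V′ * det m Γ ds) cs ≡ 0ℚ
  cramer k V′ sub cs = begin
    altS (λ c ds → altS (λ v vs → m v c * k v vs) V′ * det m Γ ds) cs
      ≡⟨ altS-cong (λ c ds → trans (*-comm _ _) (sym (altS-* _ (det m Γ ds) V′))) cs ⟩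
    altS (λ c ds → altS (λ v vs → det m Γ ds * (m v c * k v vs)) V′) cs
      ≡⟨ altS-swap (λ c ds v vs → det m Γ ds * (m v c * k v vs)) cs V′ ⟩
    altS (λ v vs → altS (λ c ds → det m Γ ds * (m v c * k v vs)) cs) V′
      ≡⟨ altS-congP (_∈ Γ) (λ v vs p _ → trans (altS-cong (λ c ds → *-rotate _ _ _) cs)
           (trans (altS-cong (λ c ds → cong (k v vs *_) (*-comm _ _)) cs)
           (trans (altS-* _ (k v vs) cs) (trans (cong (k v vs *_) (det-dup m cs p)) (*-zeroʳ _)))))
           (All.tabulate sub) ⟩
    altS (λ v vs → 0ℚ) V′ ≡⟨ altS-0 V′ ⟩
    0ℚ ∎
    where open ≡-Reasoning

  det-dupCol : ∀ as {c W} → c ∈ W → det m as (c ∷ W) ≡ 0ℚ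
  det-dupCol as {c} {W} p = trans (det-transpose m as (c ∷ W)) (det-dup (flip m) as p)

  φ-relation : ∀ W cs → altS (λ c ds → det m V (c ∷ W) * det m Γ ds) cs ≡ 0ℚ
  φ-relation W cs = trans (altS-cong (λ c ds → cong (_* det m Γ ds) (det-expandCol m V c W)) cs)
    (cramer (λ v vs → det m vs W) V V⊆Γ cs)

  altS-W : ∀ W W′ x (g : List J → List J) → (∀ {w} → w ∈ W′ → w ∈ W) →
    altS (λ c ds → det m V (c ∷ W) * det m Γ (g ds)) (W′ ++ x ∷ []) ≡
    sgn (length W′) * (det m V (x ∷ W) * det m Γ (g W′))
  altS-W W []       x g sub = trans (x-0 _) (sym (*-identityˡ _))
  altS-W W (w ∷ W′) x g sub = trans
    (cong₂ _-_ (zero* (det-dupCol V (sub (here refl)))) (altS-W W W′ x (g ∘ (w ∷_)) (sub ∘ there)))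
    (0-* _ _)
    where
    opaque
      unfolding ℚ-ring
      0-* : ∀ x y → 0ℚ - x * y ≡ (- x) * y
      0-* = solve-∀ ℚ-ring

  moveCol : ∀ x W → det m V (x ∷ W) ≡ sgn (length W) * det m V (W ++ x ∷ [])
  moveCol x W = begin
    det m V (x ∷ W)  ≡⟨ det-transpose m V _ ⟩
    D                ≡⟨ sym (*-identityˡ _) ⟩
    1ℚ * D           ≡⟨ cong (_* D) (sym (sgn² (length W))) ⟩
    s * s * D        ≡⟨ *-assoc _ _ _ ⟩
    s * (s * D)      ≡⟨ cong (λ L → s * (s * det (flip m) (x ∷ L) V)) (sym (LP.++-identityʳ W)) ⟩
    s * (s * det (flip m) (x ∷ W ++ []) V) ≡⟨ cong (s *_) (sym (det-move (flip m) W x [] V)) ⟩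
    s * det (flip m) (W ++ x ∷ []) V ≡⟨ cong (s *_) (sym (det-transpose m V _)) ⟩
    s * det m V (W ++ x ∷ []) ∎
    where
    open ≡-Reasoning
    s = sgn (length W)
    D = det (flip m) (x ∷ W) V

  -- The relation is taken over the columns y, z, W, x. The functional vanishes on W, so three terms
  -- survive. Column x is moved across W in two places, and the two signs cancel.
  plücker : ∀ x y z W →
    det m Γ (y ∷ W ++ x ∷ []) * det m V (z ∷ W) ≡
    det m Γ (z ∷ W ++ x ∷ []) * det m V (y ∷ W) + det m Γ (y ∷ z ∷ W) * det m V (W ++ x ∷ [])
  plücker x y z W = begin
    gy * vz              ≡⟨ isolate vy vz gy gz _ (trans (cong (λ t → vy * gz - (vz * gy - t))
                              (sym (altS-W W W x (λ ds → y ∷ z ∷ ds) id))) (φ-relation W (y ∷ z ∷ W ++ x ∷ []))) ⟩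
    gz * vy + s * (det m V (x ∷ W) * gyz)
                         ≡⟨ cong (λ t → gz * vy + s * (t * gyz)) (moveCol x W) ⟩
    gz * vy + s * (s * vx * gyz)
                         ≡⟨ +-congˡ (trans (reassoc s vx gyz) (cong (_* (gyz * vx)) (sgn² (length W)))) ⟩
    gz * vy + 1ℚ * (gyz * vx)
                         ≡⟨ +-congˡ (*-identityˡ (gyz * vx)) ⟩
    gz * vy + gyz * vx   ∎
    where
    open ≡-Reasoning
    s   = sgn (length W)
    gy  = det m Γ (y ∷ W ++ x ∷ [])
    gz  = det m Γ (z ∷ W ++ x ∷ [])
    gyz = det m Γ (y ∷ z ∷ W)
    vy  = det m V (y ∷ W)
    vz  = det m V (z ∷ W)
    vx  = det m V (W ++ x ∷ [])
    opaque
      unfolding ℚ-ring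
      reassoc : ∀ s v g → s * (s * v * g) ≡ (s * s) * (g * v)
      reassoc = solve-∀ ℚ-ring
      rearr : ∀ a b c d t → c * b ≡ d * a + t - (a * d - (b * c - t))
      rearr = solve-∀ ℚ-ring
    isolate : ∀ a b c d t → a * d - (b * c - t) ≡ 0ℚ → c * b ≡ d * a + t
    isolate a b c d t e = trans (rearr a b c d t) (trans (cong (_-_ (d * a + t)) e) (x-0 _))

-- Lattice paths with walls

Walls : Set
Walls = ℕ → ℕ → Bool

[_≟_] : ℕ → ℕ → ℚ
[ u ≟ k ] = if u ℕ.≡ᵇ k then 1ℚ else 0ℚ

-- Number of n-step paths from (j , u) to height k, a step leading from (j , u) to (j + 1 , u) or (j + 1 , u + 1),
-- which do not arrive at a wall.
mutual
  pc : Walls → ℕ → ℕ → ℕ → ℕ → ℚ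
  pc w zero    j u k = [ u ≟ k ]
  pc w (suc n) j u k = arr w n (suc j) u k + arr w n (suc j) (suc u) k

  arr : Walls → ℕ → ℕ → ℕ → ℕ → ℚ
  arr w n j u k = if w j u then 0ℚ else pc w n j u k

opaque
  unfolding ℚ-ring

  +-interchange : ∀ x y z w → (x + y) + (z + w) ≡ (x + z) + (y + w)
  +-interchange = solve-∀ ℚ-ring

  +-comm : ∀ x y → x + y ≡ y + x
  +-comm = solve-∀ ℚ-ring

  *-distribʳ : ∀ x y z → (x + y) * z ≡ x * z + y * z
  *-distribʳ = solve-∀ ℚ-ring

  *-distribˡ : ∀ x y z → x * (y + z) ≡ x * y + x * z
  *-distribˡ = solve-∀ ℚ-ring

  +-*-interchange : ∀ x y z w v → (x + y * v) + (z + w * v) ≡ (x + z) + (y + w) * v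
  +-*-interchange = solve-∀ ℚ-ring

module _ (w : Walls) where

  -- The definition peels off the first step; this peels off the last one, which is legitimate
  -- because no wall stands in the final column.
  pc-evolve : ∀ n j u k → (∀ v → w (j ℕ.+ suc n) v ≡ false) →
    pc w (suc n) j u (suc k) ≡ pc w n j u k + pc w n j u (suc k)
  arr-evolve : ∀ n j u k → (∀ v → w (j ℕ.+ suc n) v ≡ false) →
    arr w (suc n) j u (suc k) ≡ arr w n j u k + arr w n j u (suc k)

  arr-evolve n j u k h with w j u
  ... | true  = sym (+-identityˡ 0ℚ)
  ... | false = pc-evolve n j u k h

  pc-evolve zero j u k h
    rewrite trans (cong (λ c → w c u) (ℕP.+-comm 1 j)) (h u) | trans (cong (λ c → w c (suc u)) (ℕP.+-comm 1 j)) (h (suc u))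
    = +-comm _ _
  pc-evolve (suc n) j u k h = trans
    (cong₂ _+_ (arr-evolve n (suc j) u k h′) (arr-evolve n (suc j) (suc u) k h′))
    (+-interchange _ _ _ _)
    where h′ = λ v → trans (cong (λ c → w c v) (sym (ℕP.+-suc j (suc n)))) (h v)

pc-cong : ∀ w w′ n j u k → (∀ i v → w (suc j ℕ.+ i) v ≡ w′ (suc j ℕ.+ i) v) → pc w n j u k ≡ pc w′ n j u k
pc-cong w w′ zero    j u k h = refl
pc-cong w w′ (suc n) j u k h = cong₂ _+_ (go u) (go (suc u))
  where
  go : ∀ u → arr w n (suc j) u k ≡ arr w′ n (suc j) u k
  go u rewrite trans (cong (λ c → w c u) (sym (ℕP.+-identityʳ (suc j))))
                (trans (h 0 u) (cong (λ c → w′ c u) (ℕP.+-identityʳ (suc j))))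
    with w′ (suc j) u
  ... | true  = refl
  ... | false = pc-cong w w′ n (suc j) u k
        (λ i v → trans (cong (λ c → w c v) (sym (ℕP.+-suc (suc j) i))) (trans (h (suc i) v) (cong (λ c → w′ c v) (ℕP.+-suc (suc j) i))))

-- W a d has its d walls at the points (2 m , a + m).
W : ℕ → ℕ → Walls
W a zero    j             u = false
W a (suc d) zero          u = u ℕ.≡ᵇ a
W a (suc d) (suc zero)    u = false
W a (suc d) (suc (suc j)) u = W (suc a) d j u

delay : Walls → Walls
delay w zero    u = false
delay w (suc j) u = w j u

noWall : Walls
noWall _ _ = false

dbl : ℕ → ℕ
dbl zero    = zero
dbl (suc n) = suc (suc (dbl n))

W-clear′ : ∀ a d i v → W a (suc d) (suc (dbl d ℕ.+ i)) v ≡ false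
W-clear′ a zero    zero    v = refl
W-clear′ a zero    (suc i) v = refl
W-clear′ a (suc d) i       v = W-clear′ (suc a) d i v

arr-delay : ∀ w n j u k → arr (delay w) n (suc j) u k ≡ arr w n j u k
pc-delay  : ∀ w n j u k → pc (delay w) n (suc j) u k ≡ pc w n j u k
arr-delay w n j u k with w j u
... | true  = refl
... | false = pc-delay w n j u k
pc-delay w zero    j u k = refl
pc-delay w (suc n) j u k = cong₂ _+_ (arr-delay w n (suc j) u k) (arr-delay w n (suc j) (suc u) k)

pc-free : ∀ w n j u k → (∀ i v → w (j ℕ.+ i) v ≡ false) → pc w n j u k ≡ pc noWall n 0 u k
pc-free w n j u k h = trans (pc-cong w noWall n j u k (λ i v → trans (cong (λ c → w c v) (sym (ℕP.+-suc j i))) (h (suc i) v))) (go n j 0 u)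
  where
  go : ∀ n j j′ u → pc noWall n j u k ≡ pc noWall n j′ u k
  go zero    j j′ u = refl
  go (suc n) j j′ u = cong₂ _+_ (go n (suc j) (suc j′) u) (go n (suc j) (suc j′) (suc u))

arr-shift : ∀ a d n j u k → arr (W a (suc d)) n (suc (suc j)) u k ≡ arr (W (suc a) d) n j u k
pc-shift  : ∀ a d n j u k → pc (W a (suc d)) n (suc (suc j)) u k ≡ pc (W (suc a) d) n j u k
arr-shift a d n j u k with W (suc a) d j u
... | true  = refl
... | false = pc-shift a d n j u k
pc-shift a d zero    j u k = refl
pc-shift a d (suc n) j u k = cong₂ _+_ (arr-shift a d n (suc j) u k) (arr-shift a d n (suc j) (suc u) k)

pc-two : ∀ a d n u k → let A = λ v → arr (W (suc a) d) n 0 v k in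
  pc (W a (suc d)) (suc (suc n)) 0 u k ≡ (A u + A (suc u)) + (A (suc u) + A (suc (suc u)))
pc-two a d n u k = cong₂ _+_ (cong₂ _+_ (arr-shift a d n 0 u k) (arr-shift a d n 0 (suc u) k))
                             (cong₂ _+_ (arr-shift a d n 0 (suc u) k) (arr-shift a d n 0 (suc (suc u)) k))

-- The number of paths from (0 , u) to the point (2 d , a + d) that avoid the d walls before it, the
-- starting point included. Two columns are crossed at a time, after which the next wall plays the
-- part of the first.
arrival : ℕ → ℕ → ℕ → ℚ
arrival a zero    u = [ u ≟ a ]
arrival a (suc d) u = if u ℕ.≡ᵇ a then 0ℚ else
  (arrival (suc a) d u + arrival (suc a) d (suc u)) + (arrival (suc a) d (suc u) + arrival (suc a) d (suc (suc u)))

-- The paths that W a d admits but W a (suc d) does not pass through the last wall of the latter.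
arr-lastWall : ∀ a d t u k → arr (W a d) (dbl d ℕ.+ t) 0 u k ≡
  arr (W a (suc d)) (dbl d ℕ.+ t) 0 u k + arrival a d u * pc noWall t 0 (d ℕ.+ a) k
arr-lastWall a zero t u k with u ℕ.≡ᵇ a in eq
... | true  rewrite ℕP.≡ᵇ⇒≡ u a (subst T (sym eq) _)
            = trans (pc-free (W a 0) t 0 a k (λ _ _ → refl)) (sym (trans (+-identityˡ _) (*-identityˡ _)))
... | false = trans (pc-cong (W a 0) (W a 1) t 0 u k (λ { zero _ → refl ; (suc _) _ → refl })) (sym (trans (+-congˡ (*-zeroˡ _)) (+-identityʳ _)))
arr-lastWall a (suc d) t u k = guard (u ℕ.≡ᵇ a) (begin
  pc (W a (suc d)) (suc (suc n)) 0 u k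
    ≡⟨ pc-two a d n u k ⟩
  (A u + A (suc u)) + (A (suc u) + A (suc (suc u)))
    ≡⟨ cong₂ _+_ (cong₂ _+_ (ih u) (ih (suc u))) (cong₂ _+_ (ih (suc u)) (ih (suc (suc u)))) ⟩
  ((A′ u + K u * F) + (A′ (suc u) + K (suc u) * F)) + ((A′ (suc u) + K (suc u) * F) + (A′ (suc (suc u)) + K (suc (suc u)) * F))
    ≡⟨ cong₂ _+_ (+-*-interchange _ _ _ _ _) (+-*-interchange _ _ _ _ _) ⟩
  ((A′ u + A′ (suc u)) + (K u + K (suc u)) * F) + ((A′ (suc u) + A′ (suc (suc u))) + (K (suc u) + K (suc (suc u))) * F)
    ≡⟨ +-*-interchange _ _ _ _ _ ⟩
  ((A′ u + A′ (suc u)) + (A′ (suc u) + A′ (suc (suc u)))) + ((K u + K (suc u)) + (K (suc u) + K (suc (suc u)))) * F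
    ≡⟨ +-congʳ (sym (pc-two a (suc d) n u k)) ⟩
  pc (W a (suc (suc d))) (suc (suc n)) 0 u k + ((K u + K (suc u)) + (K (suc u) + K (suc (suc u)))) * F ∎)
  where
  open ≡-Reasoning
  guard : ∀ b {x y k F} → x ≡ y + k * F → (if b then 0ℚ else x) ≡ (if b then 0ℚ else y) + (if b then 0ℚ else k) * F
  guard true  e = sym (trans (+-congˡ (*-zeroˡ _)) (+-identityˡ _))
  guard false e = e
  n  = dbl d ℕ.+ t
  A  = λ v → arr (W (suc a) d) n 0 v k
  A′ = λ v → arr (W (suc a) (suc d)) n 0 v k
  K  = arrival (suc a) d
  F  = pc noWall t 0 (suc d ℕ.+ a) k
  ih : ∀ v → A v ≡ A′ v + K v * F
  ih v = trans (arr-lastWall (suc a) d t v k) (cong (λ z → A′ v + K v * pc noWall t 0 z k) (ℕP.+-suc d a))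

range : ℕ → ℕ → List ℕ
range r zero    = []
range r (suc n) = r ∷ range (suc r) n

range-snoc : ∀ r n → range r (suc n) ≡ range r n ++ (r ℕ.+ n) ∷ []
range-snoc r zero    = cong (_∷ []) (sym (ℕP.+-identityʳ r))
range-snoc r (suc n) = cong (r ∷_) (trans (range-snoc (suc r) n) (cong (λ z → range (suc r) n ++ z ∷ []) (sym (ℕP.+-suc r n))))

range-++ : ∀ r n m → range r (n ℕ.+ m) ≡ range r n ++ range (r ℕ.+ n) m
range-++ r zero    m = cong (λ z → range z m) (sym (ℕP.+-identityʳ r))
range-++ r (suc n) m = cong (r ∷_) (trans (range-++ (suc r) n m) (cong (λ z → range (suc r) n ++ range z m) (sym (ℕP.+-suc r n))))

length-range : ∀ r n → length (range r n) ≡ n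
length-range r zero    = refl
length-range r (suc n) = cong suc (length-range (suc r) n)

∈-pre : {A : Set} (pre : List A) {x : A} {post : List A} → x ∈ pre ++ x ∷ post
∈-pre []        = here refl
∈-pre (_ ∷ pre) = there (∈-pre pre)

-- Windows of consecutive columns and their relations

record Row : Set where
  constructor row
  field
    at     : ℕ → ℕ → ℚ
    evolve : ∀ t k → at (suc t) (suc k) ≡ at t k + at t (suc k)
open Row

paths : Row → ℕ × ℕ → ℚ
paths f (t , k) = at f t k

opaque
  unfolding ℚ-ring

  sub-left : ∀ x y → (x + y) - y ≡ 0ℚ + 1ℚ * x
  sub-left = solve-∀ ℚ-ring

  sub-right : ∀ x y → (x + y) - x ≡ 0ℚ + 1ℚ * y
  sub-right = solve-∀ ℚ-ring

  sub-scaled : ∀ x k y → (x + k * y) - x ≡ 0ℚ + k * y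
  sub-scaled = solve-∀ ℚ-ring

span₁ : {A B : Set} {m : A → B → ℚ} {rs : List A} {r : A} {f : B → ℚ} (k : ℚ) → r ∈ rs → (∀ b → f b ≡ 0ℚ + k * m r b) → Span m rs f
span₁ k p e = s+ k p (s0 (λ _ → refl)) e

win : List Row → ℕ → ℕ → ℕ → ℚ
win rows t r p = det paths rows (map (t ,_) (range r p))

module _ (rows : List Row) where

  private
    D : List (ℕ × ℕ) → ℚ
    D = det paths rows

  addCol : ∀ pre c′ c post → Span (flip paths) (pre ++ post) (λ f → paths f c′ - paths f c) →
    D (pre ++ c′ ∷ post) ≡ D (pre ++ c ∷ post)
  addCol pre c′ c post s = trans (det-transpose paths rows _)
    (trans (det-add (flip paths) pre c′ c post rows s) (sym (det-transpose paths rows _)))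

  -- The column (t + 1 , s + 1) is the sum of (t , s) and (t , s + 1), and (t , s) already stands to
  -- its left. So one column at the earlier time pulls the whole window back in time.
  lowerCols : ∀ t s n pre → D (pre ++ (t , s) ∷ map (suc t ,_) (range (suc s) n)) ≡ D (pre ++ map (t ,_) (range s (suc n)))
  lowerCols t s zero    pre = refl
  lowerCols t s (suc n) pre = begin
    D (pre ++ (t , s) ∷ (suc t , suc s) ∷ rest)         ≡⟨ cong D (sym (LP.++-assoc pre ((t , s) ∷ []) _)) ⟩
    D (pre′ ++ (suc t , suc s) ∷ rest)                  ≡⟨ addCol pre′ (suc t , suc s) (t , suc s) rest
        (span₁ 1ℚ (MemP.∈-++⁺ˡ (∈-pre pre)) (λ f → trans (-‿congʳ (evolve f t s)) (sub-left _ _))) ⟩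
    D (pre′ ++ (t , suc s) ∷ rest)                      ≡⟨ lowerCols t (suc s) n pre′ ⟩
    D (pre′ ++ map (t ,_) (range (suc s) (suc n)))      ≡⟨ cong D (LP.++-assoc pre ((t , s) ∷ []) _) ⟩
    D (pre ++ map (t ,_) (range s (suc (suc n))))       ∎
    where
    open ≡-Reasoning
    pre′ = pre ++ (t , s) ∷ []
    rest = map (suc t ,_) (range (suc (suc s)) n)

map-snoc : ∀ (t r n : ℕ) → map (t ,_) (range r (suc n)) ≡ map (t ,_) (range r n) ++ (t , r ℕ.+ n) ∷ []
map-snoc t r n = trans (cong (map (t ,_)) (range-snoc r n)) (LP.map-++ (t ,_) (range r n) _)

-- The Plücker relation for y = (t + 1 , r + 1), z = (t , r + 1) and the later columns at time t +
-- 1. A determinant that contains z is a window at time t by `lowerCols`; one that contains y and z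
-- first has y replaced by (t , r).
win-relation : ∀ V Γ → (∀ {v} → v ∈ V → v ∈ Γ) → ∀ t r p →
  win Γ (suc t) (suc r) (suc p) * win V t (suc r) p ≡
  win Γ t (suc r) (suc p) * win V (suc t) (suc r) p + win Γ t r (suc p) * win V (suc t) (suc (suc r)) p
-- With p = 0 the columns x and y coincide, and only the evolution of a single column is left.
win-relation V Γ sub t r zero = trans (cong (_* det paths V []) lin) (trans (*-distribʳ _ _ _) (+-comm _ _))
  where
  lin : det paths Γ ((suc t , suc r) ∷ []) ≡ det paths Γ ((t , r) ∷ []) + det paths Γ ((t , suc r) ∷ [])
  lin = begin
    det paths Γ ((suc t , suc r) ∷ [])  ≡⟨ det-expandCol paths Γ _ [] ⟩
    _ ≡⟨ altS-cong (λ f fs → trans (cong (_* det paths fs []) (evolve f t r)) (*-distribʳ _ _ _)) Γ ⟩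
    _ ≡⟨ altS-+ _ _ Γ ⟩
    _ ≡⟨ cong₂ _+_ (sym (det-expandCol paths Γ (t , r) [])) (sym (det-expandCol paths Γ (t , suc r) [])) ⟩
    det paths Γ ((t , r) ∷ []) + det paths Γ ((t , suc r) ∷ []) ∎
    where open ≡-Reasoning
win-relation V Γ sub t r (suc q) = begin
  win Γ (suc t) (suc r) (suc (suc q)) * win V t (suc r) (suc q)
    ≡⟨ cong₂ _*_ (cong (λ L → det paths Γ (y ∷ L)) snoc) (sym (lowerCols V t (suc r) q [])) ⟩
  det paths Γ (y ∷ Wd ++ x ∷ []) * det paths V (z ∷ Wd)
    ≡⟨ plücker paths V Γ sub x y z Wd ⟩
  det paths Γ (z ∷ Wd ++ x ∷ []) * det paths V (y ∷ Wd) + det paths Γ (y ∷ z ∷ Wd) * det paths V (Wd ++ x ∷ [])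
    ≡⟨ cong₂ (λ g v → g * det paths V (y ∷ Wd) + v)
         (trans (cong (λ L → det paths Γ (z ∷ L)) (sym snoc)) (lowerCols Γ t (suc r) (suc q) []))
         (cong₂ _*_ (trans (addCol Γ [] y (t , r) (z ∷ Wd) (span₁ 1ℚ (here refl) (λ f → trans (-‿congʳ (evolve f t r)) (sub-right _ _))))
                           (lowerCols Γ t (suc r) q ((t , r) ∷ [])))
                    (cong (det paths V) (sym snoc))) ⟩
  win Γ t (suc r) (suc (suc q)) * win V (suc t) (suc r) (suc q) + win Γ t r (suc (suc q)) * win V (suc t) (suc (suc r)) (suc q) ∎
  where
  open ≡-Reasoning
  y = (suc t , suc r)
  z = (t , suc r)
  x = (suc t , suc (suc r) ℕ.+ q)
  Wd = map (suc t ,_) (range (suc (suc r)) q)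
  snoc : map (suc t ,_) (range (suc (suc r)) (suc q)) ≡ Wd ++ x ∷ []
  snoc = map-snoc (suc t) (suc (suc r)) q

module _ {A B : Set} (m : A → B → ℚ) where

  det-addMultiples : (f g : ℕ → A) (κ : ℕ → ℚ) (e : A) → (∀ i b → m (f i) b ≡ m (g i) b + κ i * m e b) →
    ∀ pre is bs → e ∈ pre → det m (pre ++ map f is) bs ≡ det m (pre ++ map g is) bs
  det-addMultiples f g κ e h pre []       bs p = refl
  det-addMultiples f g κ e h pre (i ∷ is) bs p = begin
    det m (pre ++ f i ∷ map f is) bs            ≡⟨ det-add m pre (f i) (g i) (map f is) bs
                                                     (span₁ (κ i) (MemP.∈-++⁺ˡ p) (λ b → trans (-‿congʳ (h i b)) (sub-scaled _ _ _))) ⟩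
    det m (pre ++ g i ∷ map f is) bs            ≡⟨ cong (λ L → det m L bs) (sym (LP.++-assoc pre (g i ∷ []) _)) ⟩
    det m ((pre ++ g i ∷ []) ++ map f is) bs    ≡⟨ det-addMultiples f g κ e h (pre ++ g i ∷ []) is bs (MemP.∈-++⁺ˡ p) ⟩
    det m ((pre ++ g i ∷ []) ++ map g is) bs    ≡⟨ cong (λ L → det m L bs) (LP.++-assoc pre (g i ∷ []) _) ⟩
    det m (pre ++ g i ∷ map g is) bs            ∎
    where open ≡-Reasoning

  module _ (F s : ℕ → A) (F-sum : ∀ i b → m (F i) b ≡ m (s i) b + m (s (suc i)) b) where

    -- Bidiagonal elimination from the last row upwards: the last sum loses its second summand,
    -- which is zero, and then each row is freed from the one below it.
    det-sumsDown : ∀ i n post bs → (∀ b → m (s (i ℕ.+ n)) b ≡ 0ℚ) →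
      det m (map F (range i n) ++ post) bs ≡ det m (map s (range i n) ++ post) bs
    det-sumsDown i zero          post bs z = refl
    det-sumsDown i (suc zero)    post bs z = det-addHead m (F i) (s i) post bs (s0 (λ b →
      trans (-‿congʳ (F-sum i b)) (trans (sub-right _ _) (trans (+-identityˡ _) (trans (*-identityˡ _) (trans (cong (λ j → m (s j) b) (ℕP.+-comm 1 i)) (z b)))))))
    det-sumsDown i (suc (suc n)) post bs z = trans
      (det-congTail m (F i ∷ []) {map F (range (suc i) (suc n)) ++ post} {map s (range (suc i) (suc n)) ++ post} (λ cs → det-sumsDown (suc i) (suc n) post cs
        (λ b → trans (cong (λ j → m (s j) b) (sym (ℕP.+-suc i (suc n)))) (z b))) bs)
      (det-addHead m (F i) (s i) (map s (range (suc i) (suc n)) ++ post) bs (span₁ 1ℚ (here refl) (λ b → trans (-‿congʳ (F-sum i b)) (sub-right _ _))))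

    -- The same elimination from the first row downwards; the sums now lose their first summand, so
    -- the indices shift by one.
    det-sumsUp : ∀ i n pre bs → Span m pre (m (s i)) →
      det m (pre ++ map F (range i n)) bs ≡ det m (pre ++ map s (range (suc i) n)) bs
    det-sumsUp i zero    pre bs p = refl
    det-sumsUp i (suc n) pre bs p = begin
      det m (pre ++ F i ∷ rest) bs                 ≡⟨ det-add m pre (F i) (s (suc i)) rest bs (weaken p (λ b → trans (-‿congʳ (F-sum i b)) (trans (sub-left _ _) (trans (+-identityˡ _) (*-identityˡ _))))) ⟩
      det m (pre ++ s (suc i) ∷ rest) bs           ≡⟨ cong (λ L → det m L bs) (sym (LP.++-assoc pre (s (suc i) ∷ []) _)) ⟩
      det m ((pre ++ s (suc i) ∷ []) ++ rest) bs   ≡⟨ det-sumsUp (suc i) n (pre ++ s (suc i) ∷ []) bs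
                                                        (span₁ 1ℚ (∈-pre pre) (λ b → sym (trans (+-identityˡ _) (*-identityˡ _)))) ⟩
      det m ((pre ++ s (suc i) ∷ []) ++ map s (range (suc (suc i)) n)) bs ≡⟨ cong (λ L → det m L bs) (LP.++-assoc pre (s (suc i) ∷ []) _) ⟩
      det m (pre ++ map s (range (suc i) (suc n))) bs ∎
      where
      open ≡-Reasoning
      rest = map F (range (suc i) n)
      weaken : ∀ {pre post f g} → Span m pre f → (∀ b → g b ≡ f b) → Span m (pre ++ post) g
      weaken (s0 z) e = s0 (λ b → trans (e b) (z b))
      weaken (s+ k q p e′) e = s+ k (MemP.∈-++⁺ˡ q) (weaken p (λ _ → refl)) (λ b → trans (e b) (e′ b))

dbl≡2* : ∀ n → 2 ℕ.* n ≡ dbl n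
dbl≡2* zero    = refl
dbl≡2* (suc n) = cong suc (trans (ℕP.+-suc n (n ℕ.+ 0)) (cong suc (dbl≡2* n)))

dbl≡+ : ∀ n → dbl n ≡ n ℕ.+ n
dbl≡+ zero    = refl
dbl≡+ (suc n) = cong suc (trans (cong suc (dbl≡+ n)) (sym (ℕP.+-suc n n)))

-- Plain hexagons

freeRow : ℕ → Row
freeRow i = row (λ t k → pc noWall t 0 i k) (λ t k → pc-evolve noWall t 0 i k (λ _ → refl))

freeRow⁺ : ℕ → Row
freeRow⁺ i = row (λ t k → pc noWall (suc t) 0 i k) (λ t k → pc-evolve noWall (suc t) 0 i k (λ _ → refl))

-- The number of tilings of H_{p,b,c} is D₀ p (b + c) b.
D₀ : ℕ → ℕ → ℕ → ℚ
D₀ p t r = win (map freeRow (range 0 p)) t r p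

win-map : ∀ (f : ℕ → Row) is t r p → win (map f is) t r p ≡ det (λ i k → at (f i) t k) is (range r p)
win-map f is t r p = det-map paths f (t ,_) is (range r p)

-- The rows V are the p lowest starting points observed one step later. Each is the sum of two
-- neighbouring free rows, so together with `freeRow 0` they give the same determinant as p + 1 free
-- rows. This realises p and p + 1 as nested lists of rows.
D₀-relation : ∀ p t r →
  D₀ (suc p) (suc t) (suc r) * D₀ p (suc t) (suc r) ≡
  D₀ (suc p) t (suc r) * D₀ p (suc (suc t)) (suc r) + D₀ (suc p) t r * D₀ p (suc (suc t)) (suc (suc r))
D₀-relation p t r = begin
  D₀ (suc p) (suc t) (suc r) * D₀ p (suc t) (suc r)
    ≡⟨ cong₂ _*_ (sym (Γ≡ (suc t) (suc r))) (sym (V≡ t (suc r))) ⟩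
  win Γ (suc t) (suc r) (suc p) * win V t (suc r) p
    ≡⟨ win-relation V Γ there t r p ⟩
  win Γ t (suc r) (suc p) * win V (suc t) (suc r) p + win Γ t r (suc p) * win V (suc t) (suc (suc r)) p
    ≡⟨ cong₂ _+_ (cong₂ _*_ (Γ≡ t (suc r)) (V≡ (suc t) (suc r))) (cong₂ _*_ (Γ≡ t r) (V≡ (suc t) (suc (suc r)))) ⟩
  D₀ (suc p) t (suc r) * D₀ p (suc (suc t)) (suc r) + D₀ (suc p) t r * D₀ p (suc (suc t)) (suc (suc r)) ∎
  where
  open ≡-Reasoning
  V = map freeRow⁺ (range 0 p)
  Γ = freeRow 0 ∷ V
  V≡ : ∀ t r → win V t r p ≡ D₀ p (suc t) r
  V≡ t r = trans (win-map freeRow⁺ (range 0 p) t r p) (sym (win-map freeRow (range 0 p) (suc t) r p))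
  Γ≡ : ∀ t r → win Γ t r (suc p) ≡ D₀ (suc p) t r
  Γ≡ t r = det-sumsUp paths freeRow⁺ freeRow
    (λ i → λ { (t , k) → cong₂ _+_ (pc-free noWall t 1 i k (λ _ _ → refl)) (pc-free noWall t 1 (suc i) k (λ _ _ → refl)) })
    0 p (freeRow 0 ∷ []) (map (t ,_) (range r (suc p))) (span₁ 1ℚ (here refl) (λ b → sym (trans (+-identityˡ _) (*-identityˡ _))))

pc-below : ∀ w n j u k → k ℕ.< u → pc w n j u k ≡ 0ℚ
pc-below w zero j u k k<u with u ℕ.≡ᵇ k in eq
... | false = refl
... | true  with ℕP.≡ᵇ⇒≡ u k (subst T (sym eq) _)
...   | refl with ℕP.<-irrefl refl k<u
...     | ()
pc-below w (suc n) j u k k<u = trans (cong₂ _+_ (go u k<u) (go (suc u) (ℕP.m<n⇒m<1+n k<u))) (+-identityˡ 0ℚ)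
  where
  go : ∀ v → k ℕ.< v → arr w n (suc j) v k ≡ 0ℚ
  go v k<v with w (suc j) v
  ... | true  = refl
  ... | false = pc-below w n (suc j) v k k<v

pc-level : ∀ n j u → pc noWall n j u u ≡ 1ℚ
pc-level zero    j u with u ℕ.≡ᵇ u in eq
... | true  = refl
... | false with subst T eq (ℕP.≡⇒≡ᵇ u u refl)
...   | ()
pc-level (suc n) j u = trans (cong₂ _+_ (pc-level n (suc j) u) (pc-below noWall n (suc j) (suc u) u (ℕP.n<1+n u))) (+-identityʳ 1ℚ)

All-range : ∀ (P : ℕ → Set) r n → (∀ k → r ℕ.≤ k → k ℕ.< r ℕ.+ n → P k) → All P (range r n)
All-range P r zero    h = []
All-range P r (suc n) h = h r ℕP.≤-refl (subst (r ℕ.<_) (sym (ℕP.+-suc r n)) (ℕ.s≤s (ℕP.m≤m+n r n)))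
  ∷ All-range P (suc r) n (λ k p q → h k (ℕP.<⇒≤ p) (subst (k ℕ.<_) (sym (ℕP.+-suc r n)) q))

∈-range : ∀ {k} r n → k ∈ range r n → r ℕ.≤ k × k ℕ.< r ℕ.+ n
∈-range r n p = All.lookup (All-range (λ k → r ℕ.≤ k × k ℕ.< r ℕ.+ n) r n (λ _ → _,_)) p

D₀-bottom : ∀ p t → D₀ p t 0 ≡ 1ℚ
D₀-bottom p t = trans (win-map freeRow (range 0 p) t 0 p) (trans (det-transpose m (range 0 p) (range 0 p)) (go 0 p))
  where
  m = λ i k → pc noWall t 0 i k
  go : ∀ r n → det (flip m) (range r n) (range r n) ≡ 1ℚ
  go r zero    = refl
  go r (suc n) = trans (det-block (flip m) (r ∷ []) (range (suc r) n) (r ∷ []) (range (suc r) n) refl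
                          (λ { k i (here refl) q → pc-below noWall t 0 i k (proj₁ (∈-range (suc r) n q)) }))
                 (trans (cong₂ _*_ (trans (x-0 _) (trans (*-comm _ 1ℚ) (trans (*-identityˡ _) (pc-level t 0 r)))) (go (suc r) n)) (*-identityˡ 1ℚ))

pc-above : ∀ w n j u k → u ℕ.+ n ℕ.< k → pc w n j u k ≡ 0ℚ
pc-above w zero j u k h with u ℕ.≡ᵇ k in eq
... | false = refl
... | true  with ℕP.≡ᵇ⇒≡ u k (subst T (sym eq) _)
...   | refl with ℕP.<-irrefl refl (ℕP.≤-<-trans (ℕP.m≤m+n u 0) h)
...     | ()
pc-above w (suc n) j u k h = trans (cong₂ _+_
    (go u (ℕP.≤-<-trans (ℕP.+-monoʳ-≤ u (ℕP.n≤1+n n)) h)) (go (suc u) (subst (ℕ._< k) (ℕP.+-suc u n) h))) (+-identityˡ 0ℚ)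
  where
  go : ∀ v → v ℕ.+ n ℕ.< k → arr w n (suc j) v k ≡ 0ℚ
  go v h with w (suc j) v
  ... | true  = refl
  ... | false = pc-above w n (suc j) v k h

pc-climb : ∀ n j u → pc noWall n j u (u ℕ.+ n) ≡ 1ℚ
pc-climb zero    j u = trans (cong (pc noWall 0 j u) (ℕP.+-identityʳ u)) (pc-level 0 j u)
pc-climb (suc n) j u = trans (cong₂ _+_ (pc-above noWall n (suc j) u (u ℕ.+ suc n) (ℕP.+-monoʳ-< u (ℕP.n<1+n n)))
    (trans (cong (pc noWall n (suc j) (suc u)) (ℕP.+-suc u n)) (pc-climb n (suc j) (suc u)))) (+-identityˡ 1ℚ)

D₀-top : ∀ p t → D₀ p t t ≡ 1ℚ
D₀-top p t = trans (win-map freeRow (range 0 p) t t p) (go 0 p)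
  where
  m = λ i k → pc noWall t 0 i k
  go : ∀ r n → det m (range r n) (range (r ℕ.+ t) n) ≡ 1ℚ
  go r zero    = refl
  go r (suc n) = trans (det-block m (r ∷ []) (range (suc r) n) (r ℕ.+ t ∷ []) (range (suc (r ℕ.+ t)) n) refl
                          (λ { i k (here refl) q → pc-above noWall t 0 i k (proj₁ (∈-range (suc (r ℕ.+ t)) n q)) }))
                 (trans (cong₂ _*_ (trans (x-0 _) (trans (*-comm _ 1ℚ) (trans (*-identityˡ _) (pc-climb t 0 r)))) (go (suc r) n)) (*-identityˡ 1ℚ))

-- Hexagons with an intrusion

module Intrusion (a : ℕ) where

  -- The heights 0, ..., 2 a without a, which is the place of the first wall.
  idx : List ℕ
  idx = range 0 a ++ range (suc a) a

  clear : ∀ d t v → W a (suc d) (suc (t ℕ.+ dbl d)) v ≡ false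
  clear d t v = trans (cong (λ c → W a (suc d) (suc c) v) (ℕP.+-comm t (dbl d))) (W-clear′ a d t v)

  -- time is counted from column 2 d on
  wallRow : ℕ → ℕ → Row
  wallRow d i = row (λ t k → arr (W a (suc d)) (t ℕ.+ dbl d) 0 i k)
                    (λ t k → arr-evolve (W a (suc d)) (t ℕ.+ dbl d) 0 i k (clear d t))

  wallRow₂ : ℕ → ℕ → Row
  wallRow₂ d i = row (λ t k → at (wallRow d i) (suc (suc t)) k) (λ t k → evolve (wallRow d i) (suc (suc t)) k)

  tipRow : ℕ → Row
  tipRow d = freeRow (d ℕ.+ a)

  -- XT d t r and YT d t r are, up to the sign (-1)^a of YT, the numbers of tilings of the hexagons
  -- with p = 2 a, b = r, b + c = t + 2 d + 1, and d + 1 removed lozenges,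
  -- resp. p = 2 a + 1, b = r, b + c = t + 2 d, and d removed bowties.
  XT YT : ℕ → ℕ → ℕ → ℚ
  XT d t r = win (map (wallRow d) idx) t r (dbl a)
  YT d t r = win (tipRow d ∷ map (wallRow d) idx) t r (suc (dbl a))

  YX-relation : ∀ d t r →
    YT d (suc t) (suc r) * XT d t (suc r) ≡
    YT d t (suc r) * XT d (suc t) (suc r) + YT d t r * XT d (suc t) (suc (suc r))
  YX-relation d t r = win-relation (map (wallRow d) idx) (tipRow d ∷ map (wallRow d) idx) there t r (dbl a)

  -- A path that avoids the first d + 1 walls either avoids the next one as well or passes through
  -- it. The latter contribute a multiple of the tip row, which belongs to Γ. Hence the rows of
  -- `XT d`, read two columns later, also serve for `YT (suc d)`.
  XY-relation : ∀ d t r →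
    YT (suc d) (suc t) (suc r) * XT d (2 ℕ.+ t) (suc r) ≡
    YT (suc d) t (suc r) * XT d (3 ℕ.+ t) (suc r) + YT (suc d) t r * XT d (3 ℕ.+ t) (suc (suc r))
  XY-relation d t r = begin
    YT (suc d) (suc t) (suc r) * XT d (2 ℕ.+ t) (suc r)
      ≡⟨ cong₂ _*_ (sym (Γ≡ (suc t) (suc r))) (sym (V≡ t (suc r))) ⟩
    win Γ (suc t) (suc r) (suc (dbl a)) * win V t (suc r) (dbl a)
      ≡⟨ win-relation V Γ there t r (dbl a) ⟩
    win Γ t (suc r) (suc (dbl a)) * win V (suc t) (suc r) (dbl a) + win Γ t r (suc (dbl a)) * win V (suc t) (suc (suc r)) (dbl a)
      ≡⟨ cong₂ _+_ (cong₂ _*_ (Γ≡ t (suc r)) (V≡ (suc t) (suc r))) (cong₂ _*_ (Γ≡ t r) (V≡ (suc t) (suc (suc r)))) ⟩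
    YT (suc d) t (suc r) * XT d (3 ℕ.+ t) (suc r) + YT (suc d) t r * XT d (3 ℕ.+ t) (suc (suc r)) ∎
    where
    open ≡-Reasoning
    V = map (wallRow₂ d) idx
    Γ = tipRow (suc d) ∷ V
    V≡ : ∀ t r → win V t r (dbl a) ≡ XT d (suc (suc t)) r
    V≡ t r = trans (win-map (wallRow₂ d) idx t r (dbl a)) (sym (win-map (wallRow d) idx (suc (suc t)) r (dbl a)))
    Γ≡ : ∀ t r → win Γ t r (suc (dbl a)) ≡ YT (suc d) t r
    Γ≡ t r = det-addMultiples paths (wallRow₂ d) (wallRow (suc d)) (arrival a (suc d)) (tipRow (suc d))
      (λ i → λ { (t , k) → trans (cong (λ n → arr (W a (suc d)) n 0 i k) (lem t)) (trans (arr-lastWall a (suc d) t i k)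
                  (+-congʳ (cong (λ n → arr (W a (suc (suc d))) n 0 i k) (ℕP.+-comm (dbl (suc d)) t)))) })
      (tipRow (suc d) ∷ []) idx (map (t ,_) (range r (suc (dbl a)))) (here refl)
      where
      lem : ∀ t → suc (suc t) ℕ.+ dbl d ≡ dbl (suc d) ℕ.+ t
      lem t = cong (suc ∘ suc) (ℕP.+-comm t (dbl d))

  -- the same numbers, for p = 2 a, with paths starting on the left side of the hexagon
  XZ : ℕ → ℕ → ℕ → ℚ
  XZ d N r = det (λ i k → pc (delay (W a d)) N 0 i k) (range 0 (dbl a)) (range r (dbl a))

  -- The first step turns the 2 a starting points into sums of neighbouring rows at heights 0, ...,
  -- 2 a. The row at height a vanishes because of the wall, so elimination from both ends towards it
  -- leaves the rows of `idx`.
  XZ≡XT : ∀ d t r → XZ (suc d) (suc (t ℕ.+ dbl d)) r ≡ XT d t r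
  XZ≡XT d t r = begin
    XZ (suc d) (suc n) r
      ≡⟨ cong (λ L → det F L cols) (trans (cong (range 0) (dbl≡+ a)) (range-++ 0 a a)) ⟩
    det F (range 0 a ++ range a a) cols
      ≡⟨ sym (trans (cong (λ L → det m (map F (range 0 a) ++ map F (range a a)) L) (sym (LP.map-id cols)))
           (trans (cong (λ L → det m L (map id cols)) (sym (LP.map-++ F (range 0 a) (range a a)))) (det-map m F id (range 0 a ++ range a a) cols))) ⟩
    det m (map F (range 0 a) ++ map F (range a a)) cols
      ≡⟨ det-sumsDown m F s F-sum 0 a (map F (range a a)) cols s-a ⟩
    det m (map s (range 0 a) ++ map F (range a a)) cols
      ≡⟨ det-sumsUp m F s F-sum a a (map s (range 0 a)) cols (s0 s-a) ⟩
    det m (map s (range 0 a) ++ map s (range (suc a) a)) cols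
      ≡⟨ trans (cong (λ L → det m L cols) (sym (LP.map-++ s (range 0 a) (range (suc a) a))))
           (trans (cong (λ L → det m (map s idx) L) (sym (LP.map-id cols))) (det-map m s id idx cols)) ⟩
    det s idx cols
      ≡⟨ sym (win-map (wallRow d) idx t r (dbl a)) ⟩
    XT d t r ∎
    where
    open ≡-Reasoning
    n = t ℕ.+ dbl d
    cols = range r (dbl a)
    m : (ℕ → ℚ) → ℕ → ℚ
    m f = f
    F s : ℕ → ℕ → ℚ
    F i k = pc (delay (W a (suc d))) (suc n) 0 i k
    s i k = arr (W a (suc d)) n 0 i k
    F-sum : ∀ i k → F i k ≡ s i k + s (suc i) k
    F-sum i k = cong₂ _+_ (arr-delay (W a (suc d)) n 0 i k) (arr-delay (W a (suc d)) n 0 (suc i) k)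
    s-a : ∀ k → s a k ≡ 0ℚ
    s-a k with a ℕ.≡ᵇ a in eq
    ... | true  = refl
    ... | false with subst T eq (ℕP.≡⇒≡ᵇ a a refl)
    ...   | ()

-- Rational arithmetic, factorials and MacMahon's product

fromℕ-mkℚ : ∀ n → fromℕ n ≡ ℚ.mkℚ (+ n) 0 (Coprime.sym (Coprime.1-coprimeTo n))
fromℕ-mkℚ n = ℚP.normalize-coprime (Coprime.sym (Coprime.1-coprimeTo n))

opaque
  unfolding ℚ-ring

  nat : ℕ → ℚ
  nat = fromℕ

  nat-+ : ∀ m n → nat (m ℕ.+ n) ≡ nat m + nat n
  nat-+ m n = sym (trans (cong₂ ℚ._+_ (fromℕ-mkℚ m) (fromℕ-mkℚ n))
    (ℚP./-cong (cong₂ ℤ._+_ (ℤP.*-identityʳ (+ m)) (ℤP.*-identityʳ (+ n))) refl))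

  nat-* : ∀ m n → nat (m ℕ.* n) ≡ nat m * nat n
  nat-* m n = sym (trans (cong₂ ℚ._*_ (fromℕ-mkℚ m) (fromℕ-mkℚ n)) (ℚP./-cong (sym (ℤP.pos-* m n)) refl))

  nat-0 : nat 0 ≡ 0ℚ
  nat-0 = refl

  nat-1 : nat 1 ≡ 1ℚ
  nat-1 = refl

  nat-inj : ∀ m → nat m ≡ 0ℚ → m ≡ 0
  nat-inj m e = ℤP.+-injective (cong ℚ.numerator (trans (sym (fromℕ-mkℚ m)) e))

  inv-*ʳ : ∀ x → x ≢ 0ℚ → x * inv x ≡ 1ℚ
  inv-*ʳ x x≢0 with x ℚP.≟ 0ℚ
  ... | yes e = ⊥-elim (x≢0 e)
  ... | no  p = ℚP.*-inverseʳ x {{ℚ.≢-nonZero p}}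

  1≢0 : 1ℚ ≢ 0ℚ
  1≢0 ()

NZ : ℚ → Set
NZ x = x ≢ 0ℚ

nat-suc : ∀ n → nat (suc n) ≡ 1ℚ + nat n
nat-suc n = trans (nat-+ 1 n) (+-congʳ nat-1)

NZ-nat : ∀ n → NZ (nat (suc n))
NZ-nat n e with nat-inj (suc n) e
... | ()

*-cancelˡ : ∀ x {y z} → NZ x → x * y ≡ x * z → y ≡ z
*-cancelˡ x {y} {z} nz e = begin
  y                ≡⟨ sym (*-identityˡ y) ⟩
  1ℚ * y           ≡⟨ *-congʳ (trans (sym (inv-*ʳ x nz)) (*-comm x (inv x))) ⟩
  inv x * x * y    ≡⟨ *-assoc _ _ _ ⟩
  inv x * (x * y)  ≡⟨ *-congˡ e ⟩
  inv x * (x * z)  ≡⟨ sym (*-assoc _ _ _) ⟩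
  inv x * x * z    ≡⟨ *-congʳ (trans (*-comm (inv x) x) (inv-*ʳ x nz)) ⟩
  1ℚ * z           ≡⟨ *-identityˡ z ⟩
  z                ∎
  where open ≡-Reasoning

*-cancelʳ : ∀ x {y z} → NZ x → y * x ≡ z * x → y ≡ z
*-cancelʳ x nz e = *-cancelˡ x nz (trans (*-comm x _) (trans e (*-comm _ x)))

NZ-* : ∀ {x y} → NZ x → NZ y → NZ (x * y)
NZ-* {x} {y} nx ny e = ny (*-cancelˡ x nx (trans e (sym (*-zeroʳ x))))

NZ-unit : ∀ {x y} → x * y ≡ 1ℚ → NZ y
NZ-unit {x} e refl = 1≢0 (trans (sym e) (*-zeroʳ x))

fac ifac : ℕ → ℚ
fac zero    = 1ℚ
fac (suc n) = nat (suc n) * fac n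

ifac n = inv (fac n)

NZ-fac : ∀ n → NZ (fac n)
NZ-fac zero    = 1≢0
NZ-fac (suc n) = NZ-* (NZ-nat n) (NZ-fac n)

fac-ifac : ∀ n → fac n * ifac n ≡ 1ℚ
fac-ifac n = inv-*ʳ (fac n) (NZ-fac n)

NZ-ifac : ∀ n → NZ (ifac n)
NZ-ifac n = NZ-unit (fac-ifac n)

ifac-suc : ∀ n → nat (suc n) * ifac (suc n) ≡ ifac n
ifac-suc n = *-cancelˡ (fac n) (NZ-fac n) (trans (trans (*-rot (fac n) _ _) (fac-ifac (suc n))) (sym (fac-ifac n)))
  where
  opaque
    unfolding ℚ-ring
    *-rot : ∀ f x y → f * (x * y) ≡ (x * f) * y
    *-rot = solve-∀ ℚ-ring

-- The ratio quo p u v = (u + v + p)! p! / ((u + p)! (v + p)!) is the quotient of the counts for p + 1 and p.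
quo : ℕ → ℕ → ℕ → ℚ
quo p u v = (fac (u ℕ.+ v ℕ.+ p) * fac p) * (ifac (u ℕ.+ p) * ifac (v ℕ.+ p))

MM : ℕ → ℕ → ℕ → ℚ
MM zero    u v = 1ℚ
MM (suc p) u v = MM p u v * quo p u v

NZ-q : ∀ p u v → NZ (quo p u v)
NZ-q p u v = NZ-* (NZ-* (NZ-fac (u ℕ.+ v ℕ.+ p)) (NZ-fac p)) (NZ-* (NZ-ifac (u ℕ.+ p)) (NZ-ifac (v ℕ.+ p)))

NZ-MM : ∀ p u v → NZ (MM p u v)
NZ-MM zero    u v = 1≢0
NZ-MM (suc p) u v = NZ-* (NZ-MM p u v) (NZ-q p u v)

MM-sym : ∀ p u v → MM p u v ≡ MM p v u
MM-sym zero    u v = refl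
MM-sym (suc p) u v = cong₂ _*_ (MM-sym p u v)
  (cong₂ _*_ (cong (λ z → fac (z ℕ.+ p) * fac p) (ℕP.+-comm u v)) (*-comm _ _))

MM-0 : ∀ p v → MM p 0 v ≡ 1ℚ
MM-0 zero    v = refl
MM-0 (suc p) v = trans (cong₂ _*_ (MM-0 p v) (trans (*-interchange′ _ _ _ _) (trans (cong₂ _*_ (fac-ifac (v ℕ.+ p)) (fac-ifac p)) (*-identityˡ 1ℚ)))) (*-identityˡ 1ℚ)
  where
  opaque
    unfolding ℚ-ring
    *-interchange′ : ∀ x y z w → (x * y) * (z * w) ≡ (x * w) * (y * z)
    *-interchange′ = solve-∀ ℚ-ring

opaque
  unfolding ℚ-ring

  ring-q₀ : ∀ s v f h i iv → s * ((f * h) * (i * (v * iv))) ≡ v * ((s * f * h) * (i * iv))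
  ring-q₀ = solve-∀ ℚ-ring

  ring-T′ : ∀ s m₁ m₂ x y → (s * (m₁ * m₂)) * (x * y) ≡ s * ((m₁ * x) * (m₂ * y))
  ring-T′ = solve-∀ ℚ-ring

  ring-qq : ∀ A B C D E F G H → ((A * B) * (C * D)) * ((E * F) * (G * H)) ≡ ((E * B) * (C * H)) * ((A * F) * (G * D))
  ring-qq = solve-∀ ℚ-ring

q-exchange : ∀ p u v → quo (suc p) u v * quo p u (2 ℕ.+ v) ≡ quo (suc p) u (suc v) * quo p u (suc v)
q-exchange p u v = trans (ring-qq _ _ _ _ _ _ _ _) (cong₂ _*_
  (cong₂ (λ x y → (fac x * fac (suc p)) * (ifac (u ℕ.+ suc p) * ifac y)) (e₁ u v) (sym (ℕP.+-suc (suc v) p)))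
  (cong₂ (λ x y → (fac x * fac p) * (ifac (u ℕ.+ p) * ifac y)) (e₂ u v) (ℕP.+-suc v p)))
  where
  e₁ : ∀ u v → u ℕ.+ (2 ℕ.+ v) ℕ.+ p ≡ u ℕ.+ suc v ℕ.+ suc p
  e₁ u v = trans (cong (ℕ._+ p) (ℕP.+-suc u (suc v))) (sym (ℕP.+-suc (u ℕ.+ suc v) p))
  e₂ : ∀ u v → u ℕ.+ v ℕ.+ suc p ≡ u ℕ.+ suc v ℕ.+ p
  e₂ u v = trans (ℕP.+-suc (u ℕ.+ v) p) (cong (ℕ._+ p) (sym (ℕP.+-suc u v)))

-- By `q-exchange` a further factor `quo` multiplies both sides by the same number, so everything
-- rests on p = 0.
MM-exchange : ∀ p u v → nat (suc (u ℕ.+ v)) * (MM (suc p) u v * MM p u (2 ℕ.+ v)) ≡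
  nat (suc v) * (MM (suc p) u (suc v) * MM p u (suc v))
MM-exchange zero u v = begin
  nat (suc (u ℕ.+ v)) * (1ℚ * quo 0 u v * 1ℚ)
    ≡⟨ *-congˡ (ring-1 _) ⟩
  nat (suc (u ℕ.+ v)) * quo 0 u v
    ≡⟨ *-congˡ (cong₂ (λ x y → (fac x * 1ℚ) * (ifac (u ℕ.+ 0) * y)) (ℕP.+-identityʳ (u ℕ.+ v)) (trans (cong ifac (ℕP.+-identityʳ v)) (sym (ifac-suc v)))) ⟩
  nat (suc (u ℕ.+ v)) * ((fac (u ℕ.+ v) * 1ℚ) * (ifac (u ℕ.+ 0) * (nat (suc v) * ifac (suc v))))
    ≡⟨ ring-q₀ _ _ _ _ _ _ ⟩
  nat (suc v) * ((nat (suc (u ℕ.+ v)) * fac (u ℕ.+ v) * 1ℚ) * (ifac (u ℕ.+ 0) * ifac (suc v)))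
    ≡⟨ *-congˡ (cong₂ (λ x y → (fac x * 1ℚ) * (ifac (u ℕ.+ 0) * ifac y)) (trans (sym (ℕP.+-suc u v)) (sym (ℕP.+-identityʳ (u ℕ.+ suc v)))) (sym (ℕP.+-identityʳ (suc v)))) ⟩
  nat (suc v) * quo 0 u (suc v)
    ≡⟨ *-congˡ (sym (ring-1 _)) ⟩
  nat (suc v) * (1ℚ * quo 0 u (suc v) * 1ℚ) ∎
  where
  open ≡-Reasoning
  opaque
    unfolding ℚ-ring
    ring-1 : ∀ x → 1ℚ * x * 1ℚ ≡ x
    ring-1 = solve-∀ ℚ-ring
MM-exchange (suc p) u v = begin
  s * ((MM (suc p) u v * quo (suc p) u v) * (MM p u (2 ℕ.+ v) * quo p u (2 ℕ.+ v)))
    ≡⟨ sym (ring-T′ _ _ _ _ _) ⟩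
  (s * (MM (suc p) u v * MM p u (2 ℕ.+ v))) * (quo (suc p) u v * quo p u (2 ℕ.+ v))
    ≡⟨ cong₂ _*_ (MM-exchange p u v) (q-exchange p u v) ⟩
  (nat (suc v) * (MM (suc p) u (suc v) * MM p u (suc v))) * (quo (suc p) u (suc v) * quo p u (suc v))
    ≡⟨ ring-T′ _ _ _ _ _ ⟩
  nat (suc v) * ((MM (suc p) u (suc v) * quo (suc p) u (suc v)) * (MM p u (suc v) * quo p u (suc v))) ∎
  where
  open ≡-Reasoning
  s = nat (suc (u ℕ.+ v))

opaque
  unfolding ℚ-ring

  add-weights : ∀ p quo x y z n → n ≡ p + quo → n * x ≡ p * z → n * y ≡ quo * z → n * (x + y) ≡ n * z
  add-weights p quo x y z n e f g = trans (ℚP.*-distribˡ-+ n x y) (trans (cong₂ _+_ f g) (trans (sym (ℚP.*-distribʳ-+ z p quo)) (cong (_* z) (sym e))))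

  isolateʳ : ∀ x y z → z ≡ x + y → y ≡ z - x
  isolateʳ x y z refl = solve₁ x y
    where solve₁ : ∀ x y → y ≡ (x + y) - x
          solve₁ = solve-∀ ℚ-ring

  isolateˡ : ∀ x y z → z ≡ x + y → x ≡ z - y
  isolateˡ x y z refl = solve₁ x y
    where solve₁ : ∀ x y → x ≡ (x + y) - y
          solve₁ = solve-∀ ℚ-ring

  halve-sum : ∀ x z → z ≡ x + x → x ≡ ½ * z
  halve-sum x z refl = solve₁ x
    where solve₁ : ∀ x → x ≡ ½ * (x + x)
          solve₁ = solve-∀ ℚ-ring

combine : ∀ N P Q {x y z} → suc N ≡ P ℕ.+ Q → nat (suc N) * x ≡ nat P * z → nat (suc N) * y ≡ nat Q * z → z ≡ x + y
combine N P Q e f g = sym (*-cancelˡ (nat (suc N)) (NZ-nat N) (add-weights (nat P) (nat Q) _ _ _ _ (trans (cong nat e) (nat-+ P Q)) f g))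

-- Recurrences in u and v, and how they determine a count

-- The Plücker relations in the coordinates u = b - d, v = c - d. In `Rel₁` both counts have the
-- same number of removals; in `Rel₂` X has one more than Y, which shifts its arguments by 1.
Rel₁ Rel₂ : (Y X : ℕ → ℕ → ℚ) → Set
Rel₁ Y X = ∀ u v → Y (suc u) (suc v) * X (suc u) (suc v) ≡ Y (suc u) v * X (suc u) (2 ℕ.+ v) + Y u (suc v) * X (2 ℕ.+ u) (suc v)
Rel₂ Y X = ∀ u v → Y (suc u) (suc v) * X u v ≡ Y (suc u) v * X u (suc v) + Y u (suc v) * X (suc u) v

-- Each term on the right of a relation is a rational multiple of the left side, with numerators r +
-- v + 1 and r + u + 1 over their sum. The exchange rules state this for one term; symmetry gives
-- the other, and the two multiples add up to 1.
Exch₁ Exch₂ : (Y X : ℕ → ℕ → ℚ) (r : ℕ) → Set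
Exch₁ Y X r = ∀ u v → nat (suc (dbl r ℕ.+ (u ℕ.+ v))) * (Y u v * X u (2 ℕ.+ v)) ≡ nat (suc (r ℕ.+ v)) * (Y u (suc v) * X u (suc v))
Exch₂ Y X r = ∀ u v → nat (2 ℕ.+ (dbl r ℕ.+ (u ℕ.+ v))) * (Y (suc u) v * X u (suc v)) ≡ nat (suc (r ℕ.+ v)) * (Y (suc u) (suc v) * X u v)

Symm : (ℕ → ℕ → ℚ) → Set
Symm X = ∀ u v → X u v ≡ X v u

sum-lemma : ∀ r u v → 2 ℕ.+ (dbl r ℕ.+ (u ℕ.+ v)) ≡ suc (r ℕ.+ v) ℕ.+ suc (r ℕ.+ u)
sum-lemma r u v = trans (cong (λ n → 2 ℕ.+ (n ℕ.+ (u ℕ.+ v))) (dbl≡+ r)) (lem r u v)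
  where
  lem : ∀ r u v → 2 ℕ.+ ((r ℕ.+ r) ℕ.+ (u ℕ.+ v)) ≡ suc (r ℕ.+ v) ℕ.+ suc (r ℕ.+ u)
  lem = solve-∀ ℕ-ring

Exch₁⇒Rel₁ : ∀ {Y X} → Symm Y → Symm X → Exch₁ Y X 0 → Rel₁ Y X
Exch₁⇒Rel₁ {Y} {X} sY sX ex u v = combine (suc (u ℕ.+ v)) (suc v) (suc u) (sum-lemma 0 u v)
  (ex (suc u) v)
  (trans (cong₂ (λ n z → nat (2 ℕ.+ n) * z) (ℕP.+-comm u v) (cong₂ _*_ (sY u (suc v)) (sX (2 ℕ.+ u) (suc v))))
   (trans (ex (suc v) u) (*-congˡ (cong₂ _*_ (sY (suc v) (suc u)) (sX (suc v) (suc u))))))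

Exch₂⇒Rel₂ : ∀ {Y X} r → Symm Y → Symm X → Exch₂ Y X r → Rel₂ Y X
Exch₂⇒Rel₂ {Y} {X} r sY sX ex u v = combine (suc (dbl r ℕ.+ (u ℕ.+ v))) (suc (r ℕ.+ v)) (suc (r ℕ.+ u)) (sum-lemma r u v)
  (ex u v)
  (trans (cong₂ (λ n z → nat (2 ℕ.+ (dbl r ℕ.+ n)) * z) (ℕP.+-comm u v) (cong₂ _*_ (sY u (suc v)) (sX (suc u) v)))
   (trans (ex v u) (*-congˡ (cong₂ _*_ (sY (suc v) (suc u)) (sX v u)))))

by-offset : ∀ {Z Z′ : ℕ → ℕ → ℚ} → Symm Z → Symm Z′ → (∀ δ u → Z u (δ ℕ.+ u) ≡ Z′ u (δ ℕ.+ u)) → ∀ u v → Z u v ≡ Z′ u v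
by-offset {Z} {Z′} s s′ h u v with ℕP.≤-total u v
... | inj₁ u≤v = subst (λ w → Z u w ≡ Z′ u w) (ℕP.m∸n+n≡m u≤v) (h (v ℕ.∸ u) u)
... | inj₂ v≤u = trans (s u v) (trans (subst (λ w → Z v w ≡ Z′ v w) (ℕP.m∸n+n≡m v≤u) (h (u ℕ.∸ v) v)) (s′ v u))

module _ {Y Y′ X X′ : ℕ → ℕ → ℚ} (sY : Symm Y) (sY′ : Symm Y′) (sX : Symm X) (sX′ : Symm X′) where

  -- Recovers Y from X by induction on the distance v - u: the relation gives Y at distance δ + 2
  -- from the distances δ + 1 and δ. At distance 1 its two terms are equal by symmetry, so each is
  -- half of the left side.
  agree₁ : Rel₁ Y X → Rel₁ Y′ X′ → (∀ u v → NZ (X′ u v)) → (∀ u v → X u v ≡ X′ u v) → (∀ u → Y u u ≡ Y′ u u) → ∀ u v → Y u v ≡ Y′ u v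
  agree₁ rel rel′ nz X≡ diag = by-offset sY sY′ go
    where
    twice : ∀ {Y X} → Symm Y → Symm X → Rel₁ Y X → ∀ u → Y u (suc u) * X (suc u) (2 ℕ.+ u) ≡ ½ * (Y (suc u) (suc u) * X (suc u) (suc u))
    twice sY sX rel u = halve-sum _ _ (trans (rel u u) (cong₂ _+_ (*-congʳ (sY (suc u) u)) (*-congˡ (sX (2 ℕ.+ u) (suc u)))))
    go : ∀ δ u → Y u (δ ℕ.+ u) ≡ Y′ u (δ ℕ.+ u)
    go zero u = diag u
    go (suc zero) u = *-cancelʳ (X′ (suc u) (2 ℕ.+ u)) (nz _ _) (begin
      Y u (suc u) * X′ (suc u) (2 ℕ.+ u)   ≡⟨ *-congˡ (sym (X≡ _ _)) ⟩
      Y u (suc u) * X (suc u) (2 ℕ.+ u)    ≡⟨ twice sY sX rel u ⟩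
      ½ * (Y (suc u) (suc u) * X (suc u) (suc u))   ≡⟨ *-congˡ (cong₂ _*_ (diag (suc u)) (X≡ (suc u) (suc u))) ⟩
      ½ * (Y′ (suc u) (suc u) * X′ (suc u) (suc u)) ≡⟨ sym (twice sY′ sX′ rel′ u) ⟩
      Y′ u (suc u) * X′ (suc u) (2 ℕ.+ u)  ∎)
      where open ≡-Reasoning
    go (suc (suc δ)) u = *-cancelʳ (X′ (2 ℕ.+ u) (suc v)) (nz _ _) (begin
      Y u (suc v) * X′ (2 ℕ.+ u) (suc v)   ≡⟨ *-congˡ (sym (X≡ _ _)) ⟩
      Y u (suc v) * X (2 ℕ.+ u) (suc v)    ≡⟨ isolateʳ _ _ _ (rel u v) ⟩
      Y (suc u) (suc v) * X (suc u) (suc v) - Y (suc u) v * X (suc u) (2 ℕ.+ v)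
        ≡⟨ cong₂ _-_ (cong₂ _*_ (subst (λ w → Y (suc u) (suc w) ≡ Y′ (suc u) (suc w)) (ℕP.+-suc δ u) (go (suc δ) (suc u))) (X≡ (suc u) (suc v)))
                     (cong₂ _*_ (subst (λ w → Y (suc u) w ≡ Y′ (suc u) w) (ℕP.+-suc δ u) (go δ (suc u))) (X≡ (suc u) (2 ℕ.+ v))) ⟩
      Y′ (suc u) (suc v) * X′ (suc u) (suc v) - Y′ (suc u) v * X′ (suc u) (2 ℕ.+ v)
        ≡⟨ sym (isolateʳ _ _ _ (rel′ u v)) ⟩
      Y′ u (suc v) * X′ (2 ℕ.+ u) (suc v)  ∎)
      where
      open ≡-Reasoning
      v = suc (δ ℕ.+ u)

  -- The same induction with exchanged roles: Y is known everywhere, and X is recovered from the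
  -- diagonal.
  agree₂ : Rel₂ Y X → Rel₂ Y′ X′ → (∀ u v → NZ (Y′ u v)) → (∀ u v → Y u v ≡ Y′ u v) → (∀ u → X u u ≡ X′ u u) → ∀ u v → X u v ≡ X′ u v
  agree₂ rel rel′ nz Y≡ diag = by-offset sX sX′ go
    where
    twice : ∀ {Y X} → Symm Y → Symm X → Rel₂ Y X → ∀ u → Y (suc u) u * X u (suc u) ≡ ½ * (Y (suc u) (suc u) * X u u)
    twice sY sX rel u = halve-sum _ _ (trans (rel u u) (cong₂ _+_ refl (cong₂ _*_ (sY u (suc u)) (sX (suc u) u))))
    go : ∀ δ u → X u (δ ℕ.+ u) ≡ X′ u (δ ℕ.+ u)
    go zero u = diag u
    go (suc zero) u = *-cancelˡ (Y′ (suc u) u) (nz _ _) (begin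
      Y′ (suc u) u * X u (suc u)   ≡⟨ *-congʳ (sym (Y≡ _ _)) ⟩
      Y (suc u) u * X u (suc u)    ≡⟨ twice sY sX rel u ⟩
      ½ * (Y (suc u) (suc u) * X u u)   ≡⟨ *-congˡ (cong₂ _*_ (Y≡ (suc u) (suc u)) (diag u)) ⟩
      ½ * (Y′ (suc u) (suc u) * X′ u u) ≡⟨ sym (twice sY′ sX′ rel′ u) ⟩
      Y′ (suc u) u * X′ u (suc u)  ∎)
      where open ≡-Reasoning
    go (suc (suc δ)) u = *-cancelˡ (Y′ (suc u) v) (nz _ _) (begin
      Y′ (suc u) v * X u (suc v)   ≡⟨ *-congʳ (sym (Y≡ _ _)) ⟩
      Y (suc u) v * X u (suc v)    ≡⟨ isolateˡ _ _ _ (rel u v) ⟩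
      Y (suc u) (suc v) * X u v - Y u (suc v) * X (suc u) v
        ≡⟨ cong₂ _-_ (cong₂ _*_ (Y≡ (suc u) (suc v)) (go (suc δ) u))
                     (cong₂ _*_ (Y≡ u (suc v)) (subst (λ w → X (suc u) w ≡ X′ (suc u) w) (ℕP.+-suc δ u) (go δ (suc u)))) ⟩
      Y′ (suc u) (suc v) * X′ u v - Y′ u (suc v) * X′ (suc u) v
        ≡⟨ sym (isolateˡ _ _ _ (rel′ u v)) ⟩
      Y′ (suc u) v * X′ u (suc v)  ∎)
      where
      open ≡-Reasoning
      v = suc (δ ℕ.+ u)

-- MacMahon's formula

hex : ℕ → ℕ → ℕ → ℚ
hex p u v = D₀ p (u ℕ.+ v) u

hex-relation : ∀ p → Rel₁ (hex (suc p)) (hex p)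
hex-relation p u v
  rewrite ℕP.+-suc u (suc v) | ℕP.+-suc u v = D₀-relation p (suc (u ℕ.+ v)) u

MM-relation : ∀ p → Rel₁ (MM (suc p)) (MM p)
MM-relation p = Exch₁⇒Rel₁ {MM (suc p)} {MM p} (MM-sym (suc p)) (MM-sym p) (MM-exchange p)

hex-top : ∀ p u → hex p u 0 ≡ 1ℚ
hex-top p u = trans (cong (λ t → D₀ p t u) (ℕP.+-identityʳ u)) (D₀-top p u)

-- The relation expresses the count for p + 1 at (u + 1 , v + 1) by counts for p + 1 with a smaller
-- u or v and by counts for p; on the borders u = 0 and v = 0 there is one tiling.
macmahon : ∀ p u v → hex p u v ≡ MM p u v
macmahon zero    u v = refl
macmahon (suc p) zero v = trans (D₀-bottom (suc p) v) (sym (MM-0 (suc p) v))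
macmahon (suc p) (suc u) zero = trans (hex-top (suc p) (suc u)) (sym (trans (MM-sym (suc p) (suc u) 0) (MM-0 (suc p) (suc u))))
macmahon (suc p) (suc u) (suc v) = *-cancelʳ (MM p (suc u) (suc v)) (NZ-MM p (suc u) (suc v)) (begin
  hex (suc p) (suc u) (suc v) * MM p (suc u) (suc v)   ≡⟨ *-congˡ (sym (macmahon p (suc u) (suc v))) ⟩
  hex (suc p) (suc u) (suc v) * hex p (suc u) (suc v)  ≡⟨ hex-relation p u v ⟩
  hex (suc p) (suc u) v * hex p (suc u) (2 ℕ.+ v) + hex (suc p) u (suc v) * hex p (2 ℕ.+ u) (suc v)
    ≡⟨ cong₂ _+_ (cong₂ _*_ (macmahon (suc p) (suc u) v) (macmahon p (suc u) (2 ℕ.+ v))) (cong₂ _*_ (macmahon (suc p) u (suc v)) (macmahon p (2 ℕ.+ u) (suc v))) ⟩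
  MM (suc p) (suc u) v * MM p (suc u) (2 ℕ.+ v) + MM (suc p) u (suc v) * MM p (2 ℕ.+ u) (suc v)
    ≡⟨ sym (MM-relation p u v) ⟩
  MM (suc p) (suc u) (suc v) * MM p (suc u) (suc v) ∎)
  where open ≡-Reasoning

-- Closed forms for the hexagons with an intrusion

module Hats (a : ℕ) where

  K : (s₁ s₂ s₃ u v : ℕ) → ℚ
  K s₁ s₂ s₃ u v = (fac (s₁ ℕ.+ (u ℕ.+ v)) * (ifac u * ifac v)) * ((fac (s₂ ℕ.+ u) * fac (s₂ ℕ.+ v)) * ifac (s₃ ℕ.+ (u ℕ.+ v)))

  K-sym : ∀ s₁ s₂ s₃ → Symm (K s₁ s₂ s₃)
  K-sym s₁ s₂ s₃ u v rewrite ℕP.+-comm u v = cong₂ _*_ (*-congˡ (*-comm _ _)) (*-congʳ (*-comm _ _))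

  NZ-K : ∀ s₁ s₂ s₃ u v → NZ (K s₁ s₂ s₃ u v)
  NZ-K s₁ s₂ s₃ u v = NZ-* (NZ-* (NZ-fac (s₁ ℕ.+ (u ℕ.+ v))) (NZ-* (NZ-ifac u) (NZ-ifac v)))
    (NZ-* (NZ-* (NZ-fac (s₂ ℕ.+ u)) (NZ-fac (s₂ ℕ.+ v))) (NZ-ifac (s₃ ℕ.+ (u ℕ.+ v))))

  -- Multiplication by a `K` converts one exchange rule into another: the weights s₁ + u + v + 1 and
  -- v + 1 become s₃ + u + v + 1 and s₂ + v + 1. This fixes the parameters of `G` and `H`.
  K-step : ∀ s₁ s₂ s₃ u v → nat (suc (s₃ ℕ.+ (u ℕ.+ v))) * (nat (suc v) * K s₁ s₂ s₃ u (suc v)) ≡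
    nat (suc (s₁ ℕ.+ (u ℕ.+ v))) * (nat (suc (s₂ ℕ.+ v)) * K s₁ s₂ s₃ u v)
  K-step s₁ s₂ s₃ u v
    rewrite ℕP.+-suc u v | ℕP.+-suc s₁ (u ℕ.+ v) | ℕP.+-suc s₂ v | ℕP.+-suc s₃ (u ℕ.+ v)
          | sym (ifac-suc v) | sym (ifac-suc (s₃ ℕ.+ (u ℕ.+ v))) = ring-K _ _ _ _ _ _ _ _ _ _
    where
    opaque
      unfolding ℚ-ring
      ring-K : ∀ n₃ nv n₁ f iu iv n₂ fu fv i₃ → n₃ * (nv * ((n₁ * f * (iu * iv)) * ((fu * (n₂ * fv)) * i₃))) ≡
        n₁ * (n₂ * ((f * (iu * (nv * iv))) * ((fu * fv) * (n₃ * i₃))))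
      ring-K = solve-∀ ℚ-ring

  G H : ℕ → ℕ → ℚ
  G = K 1 a (suc (dbl a))
  H = K 0 (suc a) (2 ℕ.+ dbl a)

  -- fe d = C(2(a+d),a+d) / C(2d,d), and fo d is the same ratio for (d+1) C(2(d+1),d+1).
  fe fo : ℕ → ℚ
  fe d = (fac (dbl (d ℕ.+ a)) * (ifac (d ℕ.+ a) * ifac (d ℕ.+ a))) * ((fac d * fac d) * ifac (dbl d))
  fo d = (fac (dbl (suc (d ℕ.+ a))) * (ifac (d ℕ.+ a) * ifac (suc (d ℕ.+ a)))) * ((fac d * fac (suc d)) * ifac (dbl (suc d)))

  NZ-fe : ∀ d → NZ (fe d)
  NZ-fe d = NZ-* (NZ-* (NZ-fac (dbl (d ℕ.+ a))) (NZ-* (NZ-ifac (d ℕ.+ a)) (NZ-ifac (d ℕ.+ a)))) (NZ-* (NZ-* (NZ-fac d) (NZ-fac d)) (NZ-ifac (dbl d)))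

  NZ-fo : ∀ d → NZ (fo d)
  NZ-fo d = NZ-* (NZ-* (NZ-fac (dbl (suc (d ℕ.+ a)))) (NZ-* (NZ-ifac (d ℕ.+ a)) (NZ-ifac (suc (d ℕ.+ a))))) (NZ-* (NZ-* (NZ-fac d) (NZ-fac (suc d))) (NZ-ifac (dbl (suc d))))

  -- The multiplier is the effect of one more removal in the same hexagon, split into a factor in d
  -- and a factor in u and v. The sign of `Yh` is that of moving the middle path, whose row comes
  -- first in `YT`, to its place among the 2 a + 1 rows.
  Xh Yh : ℕ → ℕ → ℕ → ℚ
  Xh zero    u v = MM (dbl a) u v
  Xh (suc d) u v = Xh d (suc u) (suc v) * (fe d * G u v)
  Yh zero    u v = sgn a * MM (suc (dbl a)) u v
  Yh (suc d) u v = Yh d (suc u) (suc v) * (fo d * H u v)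

  Xh-sym : ∀ d → Symm (Xh d)
  Xh-sym zero    u v = MM-sym (dbl a) u v
  Xh-sym (suc d) u v = cong₂ _*_ (Xh-sym d (suc u) (suc v)) (*-congˡ (K-sym 1 a (suc (dbl a)) u v))

  Yh-sym : ∀ d → Symm (Yh d)
  Yh-sym zero    u v = *-congˡ (MM-sym (suc (dbl a)) u v)
  Yh-sym (suc d) u v = cong₂ _*_ (Yh-sym d (suc u) (suc v)) (*-congˡ (K-sym 0 (suc a) (2 ℕ.+ dbl a) u v))

  NZ-Xh : ∀ d u v → NZ (Xh d u v)
  NZ-Xh zero    u v = NZ-MM (dbl a) u v
  NZ-Xh (suc d) u v = NZ-* (NZ-Xh d (suc u) (suc v)) (NZ-* (NZ-fe d) (NZ-K 1 a (suc (dbl a)) u v))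

  NZ-Yh : ∀ d u v → NZ (Yh d u v)
  NZ-Yh zero    u v = NZ-* (NZ-unit (sgn² a)) (NZ-MM (suc (dbl a)) u v)
  NZ-Yh (suc d) u v = NZ-* (NZ-Yh d (suc u) (suc v)) (NZ-* (NZ-fo d) (NZ-K 0 (suc a) (2 ℕ.+ dbl a) u v))

  opaque
    unfolding ℚ-ring
    exch-scale : ∀ n s x y → n * ((s * x) * y) ≡ s * (n * (x * y))
    exch-scale = solve-∀ ℚ-ring
    ring-L₂ : ∀ n₃ nv y x f g → nv * (n₃ * (y * (x * (f * g)))) ≡ (n₃ * (nv * g)) * (f * (y * x))
    ring-L₂ = solve-∀ ℚ-ring
    ring-M₂ : ∀ n₁ n₂ g f y x → (n₁ * (n₂ * g)) * (f * (y * x)) ≡ (n₂ * (f * g)) * (n₁ * (y * x))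
    ring-M₂ = solve-∀ ℚ-ring
    ring-R₂ : ∀ n₂ f g nv y x → (n₂ * (f * g)) * (nv * (y * x)) ≡ nv * (n₂ * (y * (x * (f * g))))
    ring-R₂ = solve-∀ ℚ-ring
    ring-L₁ : ∀ n₂ n₁ y f h x → n₂ * (n₁ * ((y * (f * h)) * x)) ≡ (n₁ * (n₂ * h)) * (f * (y * x))
    ring-L₁ = solve-∀ ℚ-ring
    ring-M₁ : ∀ n₃ nv h f y x → (n₃ * (nv * h)) * (f * (y * x)) ≡ (nv * (f * h)) * (n₃ * (y * x))
    ring-M₁ = solve-∀ ℚ-ring
    ring-R₁ : ∀ nv f h n₂ y x → (nv * (f * h)) * (n₂ * (y * x)) ≡ n₂ * (nv * ((y * (f * h)) * x))
    ring-R₁ = solve-∀ ℚ-ring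

  -- A zigzag in d: `exch₁ d` multiplied by `K-step` for `G` gives `exch₂ d`, which multiplied by
  -- `K-step` for `H` gives `exch₁ (suc d)`.
  mutual
    exch₁ : ∀ d → Exch₁ (Yh d) (Xh d) 0
    exch₁ zero u v = trans (exch-scale _ _ _ _) (trans (*-congˡ (MM-exchange (dbl a) u v)) (sym (exch-scale _ _ _ _)))
    exch₁ (suc d) u v = *-cancelˡ (nat (suc (suc a ℕ.+ v))) (NZ-nat (suc a ℕ.+ v)) (begin
      nat (suc (suc a ℕ.+ v)) * (nat (suc (u ℕ.+ v)) * ((Yh d (suc u) (suc v) * (fo d * H u v)) * Xh (suc d) u (2 ℕ.+ v)))
        ≡⟨ ring-L₁ _ _ _ _ _ _ ⟩
      (nat (suc (u ℕ.+ v)) * (nat (suc (suc a ℕ.+ v)) * H u v)) * (fo d * (Yh d (suc u) (suc v) * Xh (suc d) u (2 ℕ.+ v)))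
        ≡⟨ *-congʳ (sym (K-step 0 (suc a) (2 ℕ.+ dbl a) u v)) ⟩
      (nat (3 ℕ.+ (dbl a ℕ.+ (u ℕ.+ v))) * (nat (suc v) * H u (suc v))) * (fo d * (Yh d (suc u) (suc v) * Xh (suc d) u (2 ℕ.+ v)))
        ≡⟨ ring-M₁ _ _ _ _ _ _ ⟩
      (nat (suc v) * (fo d * H u (suc v))) * (nat (3 ℕ.+ (dbl a ℕ.+ (u ℕ.+ v))) * (Yh d (suc u) (suc v) * Xh (suc d) u (2 ℕ.+ v)))
        ≡⟨ *-congˡ (trans (*-congʳ (cong nat (cong (suc ∘ suc) (trans (sym (ℕP.+-suc (dbl a) (u ℕ.+ v))) (cong (dbl a ℕ.+_) (sym (ℕP.+-suc u v)))))))
                    (trans (exch₂ d u (suc v)) (*-congʳ (cong (nat ∘ suc) (ℕP.+-suc a v))))) ⟩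
      (nat (suc v) * (fo d * H u (suc v))) * (nat (suc (suc a ℕ.+ v)) * (Yh d (suc u) (2 ℕ.+ v) * Xh (suc d) u (suc v)))
        ≡⟨ ring-R₁ _ _ _ _ _ _ ⟩
      nat (suc (suc a ℕ.+ v)) * (nat (suc v) * ((Yh d (suc u) (2 ℕ.+ v) * (fo d * H u (suc v))) * Xh (suc d) u (suc v))) ∎)
      where open ≡-Reasoning

    exch₂ : ∀ d → Exch₂ (Yh d) (Xh (suc d)) a
    exch₂ d u v = *-cancelˡ (nat (suc v)) (NZ-nat v) (begin
      nat (suc v) * (nat (2 ℕ.+ (dbl a ℕ.+ (u ℕ.+ v))) * (Yh d (suc u) v * (Xh d (suc u) (2 ℕ.+ v) * (fe d * G u (suc v)))))
        ≡⟨ ring-L₂ _ _ _ _ _ _ ⟩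
      (nat (2 ℕ.+ (dbl a ℕ.+ (u ℕ.+ v))) * (nat (suc v) * G u (suc v))) * (fe d * (Yh d (suc u) v * Xh d (suc u) (2 ℕ.+ v)))
        ≡⟨ *-congʳ (K-step 1 a (suc (dbl a)) u v) ⟩
      (nat (2 ℕ.+ (u ℕ.+ v)) * (nat (suc (a ℕ.+ v)) * G u v)) * (fe d * (Yh d (suc u) v * Xh d (suc u) (2 ℕ.+ v)))
        ≡⟨ ring-M₂ _ _ _ _ _ _ ⟩
      (nat (suc (a ℕ.+ v)) * (fe d * G u v)) * (nat (2 ℕ.+ (u ℕ.+ v)) * (Yh d (suc u) v * Xh d (suc u) (2 ℕ.+ v)))
        ≡⟨ *-congˡ (exch₁ d (suc u) v) ⟩
      (nat (suc (a ℕ.+ v)) * (fe d * G u v)) * (nat (suc v) * (Yh d (suc u) (suc v) * Xh d (suc u) (suc v)))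
        ≡⟨ ring-R₂ _ _ _ _ _ _ ⟩
      nat (suc v) * (nat (suc (a ℕ.+ v)) * (Yh d (suc u) (suc v) * (Xh d (suc u) (suc v) * (fe d * G u v)))) ∎)
      where open ≡-Reasoning

-- Functions on the half-line ℕ, and two-step operators of a path near the axis of symmetry

Fun : Set
Fun = ℕ → ℚ

δ : ℕ → Fun
δ i y = [ y ≟ i ]

2ℚ 3ℚ : ℚ
2ℚ = 1ℚ + 1ℚ
3ℚ = 1ℚ + 2ℚ

opaque
  unfolding ℚ-ring
  step-lin : ∀ f₀ f₁ f₂ g₀ g₁ g₂ k → ((f₀ + k * g₀) + (f₁ + k * g₁)) + ((f₁ + k * g₁) + (f₂ + k * g₂)) ≡
    ((f₀ + f₁) + (f₁ + f₂)) + k * ((g₀ + g₁) + (g₁ + g₂))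
  step-lin = solve-∀ ℚ-ring
  edge-lin : ∀ p q f₀ f₁ g₀ g₁ k → p * (f₀ + k * g₀) + q * (f₁ + k * g₁) ≡ (p * f₀ + q * f₁) + k * (p * g₀ + q * g₁)
  edge-lin = solve-∀ ℚ-ring

iter : {A : Set} → (A → A) → ℕ → A → A
iter f zero    x = x
iter f (suc n) x = f (iter f n x)

iter-+ : {A : Set} (f : A → A) (m n : ℕ) (x : A) → iter f m (iter f n x) ≡ iter f (m ℕ.+ n) x
iter-+ f zero    n x = refl
iter-+ f (suc m) n x = cong f (iter-+ f m n x)

-- Two columns are crossed at once, with weights 1, 2, 1 away from the axis; p and q encode the
-- boundary condition at the axis.
module Step (p q : ℚ) where

  step : Fun → Fun
  step f zero    = p * f 0 + q * f 1
  step f (suc y) = (f y + f (suc y)) + (f (suc y) + f (suc (suc y)))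

  step-ext : ∀ {f g} → (∀ y → f y ≡ g y) → ∀ y → step f y ≡ step g y
  step-ext e zero    = cong₂ (λ a b → p * a + q * b) (e 0) (e 1)
  step-ext e (suc y) = cong₂ _+_ (cong₂ _+_ (e y) (e (suc y))) (cong₂ _+_ (e (suc y)) (e (suc (suc y))))

  step-linear : ∀ f g k y → step (λ z → f z + k * g z) y ≡ step f y + k * step g y
  step-linear f g k zero    = edge-lin p q _ _ _ _ k
  step-linear f g k (suc y) = step-lin _ _ _ _ _ _ k

  steps-ext : ∀ n {f g} → (∀ y → f y ≡ g y) → ∀ y → iter step n f y ≡ iter step n g y
  steps-ext zero    e = e
  steps-ext (suc n) e = step-ext (steps-ext n e)

  steps-linear : ∀ n f g k y → iter step n (λ z → f z + k * g z) y ≡ iter step n f y + k * iter step n g y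
  steps-linear zero    f g k y = refl
  steps-linear (suc n) f g k y = trans (step-ext (steps-linear n f g k) y) (step-linear _ _ k y)


-- Triangular changes of basis

opaque
  unfolding ℚ-ring
  assoc-lin : ∀ x y k z → x + (y + k * z) ≡ (x + y) + k * z
  assoc-lin = solve-∀ ℚ-ring
  scale-lin : ∀ c x k z → c * (x + k * z) ≡ c * x + (c * k) * z
  scale-lin = solve-∀ ℚ-ring
  insert-mid : ∀ x y z → x - z ≡ (x - y) + (y - z)
  insert-mid = solve-∀ ℚ-ring
  self-sub : ∀ x → x - x ≡ 0ℚ
  self-sub = solve-∀ ℚ-ring

module _ {A B : Set} {m : A → B → ℚ} where

  span-resp : ∀ {rs f g} → (∀ b → g b ≡ f b) → Span m rs f → Span m rs g
  span-resp e (s0 z)        = s0 (λ b → trans (e b) (z b))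
  span-resp e (s+ k p s e′) = s+ k p s (λ b → trans (e b) (e′ b))

  span-+ : ∀ {rs f g h} → Span m rs f → Span m rs g → (∀ b → h b ≡ f b + g b) → Span m rs h
  span-+ s (s0 z)                e = span-resp (λ b → trans (e b) (trans (+-congˡ (z b)) (+-identityʳ _))) s
  span-+ s (s+ k {g′} p s′ e′)   e = s+ k p (span-+ s s′ (λ _ → refl)) (λ b → trans (e b) (trans (+-congˡ (e′ b)) (assoc-lin _ _ _ _)))

  span-scale : ∀ {rs f} c → Span m rs f → Span m rs (λ b → c * f b)
  span-scale c (s0 z)        = s0 (λ b → trans (*-congˡ (z b)) (*-zeroʳ c))
  span-scale c (s+ k p s e)  = s+ (c * k) p (span-scale c s) (λ b → trans (*-congˡ (e b)) (scale-lin _ _ _ _))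

  span-mono : ∀ {rs rs′ f} → (∀ {r} → r ∈ rs → r ∈ rs′) → Span m rs f → Span m rs′ f
  span-mono sub (s0 z)       = s0 z
  span-mono sub (s+ k p s e) = s+ k (sub p) (span-mono sub s) e

  span-gen : ∀ {rs r} → r ∈ rs → Span m rs (m r)
  span-gen p = span₁ 1ℚ p (λ b → sym (trans (+-identityˡ _) (*-identityˡ _)))

  span-map : ∀ {A′ B′ : Set} {m′ : A′ → B′ → ℚ} (ρ : A → A′) (g : B′ → B) → (∀ r b → m (r) (g b) ≡ m′ (ρ r) b) →
    ∀ {rs f} → Span m rs f → Span m′ (map ρ rs) (f ∘ g)
  span-map ρ g h (s0 z)       = s0 (z ∘ g)
  span-map ρ g h (s+ k p s e) = s+ k (MemP.∈-map⁺ ρ p) (span-map ρ g h s) (λ b → trans (e (g b)) (+-congˡ (*-congˡ (h _ b))))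

  det-triangular : ∀ (φ ρ : ℕ → A) → (∀ i → Span m (map ρ (downFrom i)) (λ b → m (φ i) b - m (ρ i) b)) →
    ∀ n bs → det m (map φ (downFrom n)) bs ≡ det m (map ρ (downFrom n)) bs
  det-triangular φ ρ h zero    bs = refl
  det-triangular φ ρ h (suc n) bs = trans
    (det-congTail m (φ n ∷ []) {map φ (downFrom n)} {map ρ (downFrom n)} (det-triangular φ ρ h n) bs)
    (det-addHead m (φ n) (ρ n) (map ρ (downFrom n)) bs (h n))

∈-downFrom : ∀ {s n} → s ℕ.< n → s ∈ downFrom n
∈-downFrom {s} {suc n} (ℕ.s≤s s≤n) with s ℕ.≟ n
... | yes refl = here refl
... | no  s≢n  = there (∈-downFrom (ℕP.≤∧≢⇒< s≤n s≢n))

downFrom-mono : ∀ {m n s} → m ℕ.≤ n → s ∈ downFrom m → s ∈ downFrom n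
downFrom-mono m≤n p = ∈-downFrom (ℕP.<-≤-trans (MemP.∈-downFrom⁻ p) m≤n)

eval : ℕ → Fun → ℚ
eval y f = f y

iter-suc : {A : Set} (f : A → A) (n : ℕ) (x : A) → iter f (suc n) x ≡ iter f n (f x)
iter-suc f zero    x = refl
iter-suc f (suc n) x = cong f (iter-suc f n x)

opaque
  unfolding ℚ-ring
  edge-top : ∀ p f₀ f₁ → (p * f₀ + 1ℚ * f₁) - f₁ ≡ 0ℚ + p * f₀
  edge-top = solve-∀ ℚ-ring
  step-top : ∀ f₀ f₁ f₂ → ((f₀ + f₁) + (f₁ + f₂)) - f₂ ≡ (0ℚ + 1ℚ * f₀) + 2ℚ * f₁
  step-top = solve-∀ ℚ-ring
  step-sum : ∀ x y z → (x + y) + (y + z) ≡ ((0ℚ + 1ℚ * x) + 2ℚ * y) + 1ℚ * z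
  step-sum = solve-∀ ℚ-ring
  edge-sum : ∀ p q x y → p * x + q * y ≡ (0ℚ + p * x) + q * y
  edge-sum = solve-∀ ℚ-ring
  add-1 : ∀ x y → x ≡ y + 1ℚ * (x - y)
  add-1 = solve-∀ ℚ-ring
  drop-1 : ∀ x y z → (x + 1ℚ * y) - z ≡ (x - z) + y
  drop-1 = solve-∀ ℚ-ring

opaque
  unfolding ℚ-ring
  δ₀-edge : ∀ p q → (p * 1ℚ + q * 0ℚ) - 0ℚ ≡ 0ℚ + p * 1ℚ
  δ₀-edge = solve-∀ ℚ-ring
  δ₀-suc : ∀ p x → ((x + 0ℚ) + (0ℚ + 0ℚ)) - x ≡ 0ℚ + p * 0ℚ
  δ₀-suc = solve-∀ ℚ-ring
  δ₁-edge : ∀ p q → (p * 0ℚ + q * 1ℚ) - 0ℚ ≡ (0ℚ + q * 1ℚ) + 2ℚ * 0ℚ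
  δ₁-edge = solve-∀ ℚ-ring
  δ₁-suc : ∀ q x y → ((x + y) + (y + 0ℚ)) - x ≡ (0ℚ + q * 0ℚ) + 2ℚ * y
  δ₁-suc = solve-∀ ℚ-ring
  δ₂-edge : ∀ p q → (p * 0ℚ + q * 0ℚ) - 0ℚ ≡ (0ℚ + 1ℚ * 0ℚ) + 2ℚ * 0ℚ
  δ₂-edge = solve-∀ ℚ-ring
  δ₂-suc : ∀ x y z → ((x + y) + (y + z)) - x ≡ (0ℚ + 1ℚ * z) + 2ℚ * y
  δ₂-suc = solve-∀ ℚ-ring
  edge-0 : ∀ p q → p * 0ℚ + q * 0ℚ ≡ 0ℚ
  edge-0 = solve-∀ ℚ-ring
  step-0 : (0ℚ + 0ℚ) + (0ℚ + 0ℚ) ≡ 0ℚ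
  step-0 = refl
  insert-0 : ∀ x y → x ≡ (x - y) + y
  insert-0 = solve-∀ ℚ-ring

module Triangular (p q : ℚ) where
  open Step p q

  step-eval : ∀ {n} s → suc s ℕ.< n → Span eval (downFrom n) (λ f → step f s)
  step-eval zero    h = s+ q (∈-downFrom h) (s+ p (∈-downFrom (ℕP.<⇒≤ h)) (s0 (λ _ → refl)) (λ _ → refl)) (λ f → edge-sum p q _ _)
  step-eval (suc s) h = s+ 1ℚ (∈-downFrom h) (s+ 2ℚ (∈-downFrom (ℕP.<⇒≤ h)) (s+ 1ℚ (∈-downFrom (ℕP.<⇒≤ (ℕP.<⇒≤ h))) (s0 (λ _ → refl)) (λ _ → refl)) (λ _ → refl))
    (λ f → step-sum _ _ _)

  span-eval-step : ∀ {n φ} → Span eval (downFrom n) φ → Span eval (downFrom (suc n)) (φ ∘ step)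
  span-eval-step (s0 z) = s0 (z ∘ step)
  span-eval-step (s+ k {r = r} p s e) = span-+ (span-eval-step s) (span-scale k (step-eval r (ℕ.s≤s (MemP.∈-downFrom⁻ p)))) (e ∘ step)

  -- Evaluation at 0 after i steps reaches as far as i, with leading coefficient q for the step away
  -- from the axis; q = 1 makes the change of basis unitriangular.
  rowSpan : q ≡ 1ℚ → ∀ i → Span eval (downFrom i) (λ f → iter step i f 0 - f i)
  rowSpan refl zero    = s0 (λ f → self-sub _)
  rowSpan refl (suc i) = span-+ (span-eval-step (rowSpan refl i)) (top i)
    (λ f → trans (cong (λ g → g 0 - f (suc i)) (iter-suc step i f)) (insert-mid _ _ _))
    where
    top : ∀ i → Span eval (downFrom (suc i)) (λ f → step f i - f (suc i))
    top zero    = s+ p (here refl) (s0 (λ _ → refl)) (λ f → edge-top p _ _)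
    top (suc i) = s+ 2ℚ (here refl) (s+ 1ℚ (there (here refl)) (s0 (λ _ → refl)) (λ _ → refl)) (λ f → step-top _ _ _)

  step-δ : ∀ j → Span δ (downFrom (suc j)) (λ y → step (δ j) y - δ (suc j) y)
  step-δ zero = s+ p (here refl) (s0 (λ _ → refl)) (λ { zero → δ₀-edge p q ; (suc y) → δ₀-suc p [ y ≟ 0 ] })
  step-δ (suc zero) = s+ 2ℚ (here refl) (s+ q (there (here refl)) (s0 (λ _ → refl)) (λ _ → refl)) (λ { zero → δ₁-edge p q ; (suc y) → δ₁-suc q [ y ≟ 1 ] [ y ≟ 0 ] })
  step-δ (suc (suc j)) = s+ 2ℚ (here refl) (s+ 1ℚ (there (here refl)) (s0 (λ _ → refl)) (λ _ → refl)) (λ { zero → δ₂-edge p q ; (suc y) → δ₂-suc [ y ≟ suc (suc j) ] [ y ≟ suc j ] [ y ≟ j ] })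

  span-δ-step : ∀ {n f} → Span δ (downFrom n) f → Span δ (downFrom (suc n)) (step f)
  span-δ-step (s0 z) = s0 (λ { zero → trans (step-ext z 0) (edge-0 p q) ; (suc y) → trans (step-ext z (suc y)) step-0 })
  span-δ-step (s+ k {r = r} m s e) = span-+ (span-δ-step s)
    (span-scale k (span-+ (span-mono (downFrom-mono (ℕP.<⇒≤ m′)) (step-δ r)) (span-gen (∈-downFrom m′)) (λ y → trans (insert-0 _ _) refl)))
    (λ y → trans (step-ext e y) (step-linear _ _ k y))
    where
    m′ = ℕ.s≤s (MemP.∈-downFrom⁻ m)

  -- The support of a point mass at 0 grows by one in each step, and its outermost value stays 1
  -- whatever p and q are.
  colSpan : ∀ j → Span δ (downFrom j) (λ y → iter step j (δ 0) y - δ j y)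
  colSpan zero    = s0 (λ y → self-sub _)
  colSpan (suc j) = span-+ (step-δ j) (span-δ-step (colSpan j)) (λ y →
    trans (-‿congʳ (trans (step-ext (λ z → add-1 _ (δ j z)) y) (step-linear (δ j) _ 1ℚ y))) (drop-1 _ _ _))

-- Central binomial coefficients and boundary conditions

Bi : ℕ → ℕ → ℚ
Bi zero    zero    = 1ℚ
Bi zero    (suc k) = 0ℚ
Bi (suc n) zero    = 1ℚ
Bi (suc n) (suc k) = Bi n k + Bi n (suc k)

Bi-0 : ∀ n → Bi n 0 ≡ 1ℚ
Bi-0 zero    = refl
Bi-0 (suc n) = refl

Bi-above : ∀ n k → Bi n (suc (n ℕ.+ k)) ≡ 0ℚ
Bi-above zero    k = refl
Bi-above (suc n) k = trans (cong₂ _+_ (Bi-above n k) (trans (cong (Bi n ∘ suc) (sym (ℕP.+-suc n k))) (Bi-above n (suc k)))) (+-identityˡ 0ℚ)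

Bi-n : ∀ n → Bi n n ≡ 1ℚ
Bi-n zero    = refl
Bi-n (suc n) = trans (cong₂ _+_ (Bi-n n) (trans (cong (Bi n ∘ suc) (sym (ℕP.+-identityʳ n))) (Bi-above n 0))) (+-identityʳ 1ℚ)

opaque
  unfolding ℚ-ring
  ring-Bi : ∀ x y f i j → f * ((x * i) * j) + f * (i * (y * j)) ≡ ((x + y) * f) * (i * j)
  ring-Bi = solve-∀ ℚ-ring

ifac-0 : ifac 0 ≡ 1ℚ
ifac-0 = trans (sym (*-identityˡ _)) (fac-ifac 0)

Bi-fac : ∀ i j → Bi (i ℕ.+ j) i ≡ fac (i ℕ.+ j) * (ifac i * ifac j)
Bi-fac zero    j = trans (Bi-0 j) (sym (trans (*-congˡ (trans (*-congʳ ifac-0) (*-identityˡ _))) (fac-ifac j)))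
Bi-fac (suc i) zero rewrite ℕP.+-identityʳ i = trans (Bi-n (suc i)) (sym (trans (*-congˡ (trans (*-congˡ ifac-0) (trans (*-comm _ _) (*-identityˡ _)))) (fac-ifac (suc i))))
Bi-fac (suc i) (suc j) = begin
  Bi (i ℕ.+ suc j) i + Bi (i ℕ.+ suc j) (suc i)
    ≡⟨ cong₂ _+_ (Bi-fac i (suc j)) (trans (cong (λ n → Bi n (suc i)) (ℕP.+-suc i j)) (Bi-fac (suc i) j)) ⟩
  fac (i ℕ.+ suc j) * (ifac i * ifac (suc j)) + fac (suc i ℕ.+ j) * (ifac (suc i) * ifac j)
    ≡⟨ cong₂ (λ x y → fac (i ℕ.+ suc j) * (x * ifac (suc j)) + y) (sym (ifac-suc i))
         (cong₂ (λ n z → fac n * (ifac (suc i) * z)) (sym (ℕP.+-suc i j)) (sym (ifac-suc j))) ⟩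
  F * ((nat (suc i) * ifac (suc i)) * ifac (suc j)) + F * (ifac (suc i) * (nat (suc j) * ifac (suc j)))
    ≡⟨ ring-Bi _ _ _ _ _ ⟩
  ((nat (suc i) + nat (suc j)) * F) * (ifac (suc i) * ifac (suc j))
    ≡⟨ *-congʳ (*-congʳ (sym (nat-+ (suc i) (suc j)))) ⟩
  fac (suc i ℕ.+ suc j) * (ifac (suc i) * ifac (suc j)) ∎
  where
  open ≡-Reasoning
  F = fac (i ℕ.+ suc j)

cen : ℕ → ℕ → ℚ
cen l y = Bi (dbl l) (l ℕ.+ y)

β : ℕ → ℚ
β l = cen l 0

β-fac : ∀ l → β l ≡ fac (dbl l) * (ifac l * ifac l)
β-fac l = trans (cong₂ Bi (dbl≡+ l) (ℕP.+-identityʳ l)) (trans (Bi-fac l l) (cong (λ n → fac n * (ifac l * ifac l)) (sym (dbl≡+ l))))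

b-suc : ∀ l y → cen (suc l) (suc y) ≡ (cen l y + cen l (suc y)) + (cen l (suc y) + cen l (suc (suc y)))
b-suc l y rewrite ℕP.+-suc l (suc y) | ℕP.+-suc l y = refl

opaque
  unfolding ℚ-ring
  *-2 : ∀ x y → (x + y) + (x + y) ≡ 2ℚ * x + 2ℚ * y
  *-2 = solve-∀ ℚ-ring

b-edge : ∀ l → cen (suc l) 0 ≡ 2ℚ * cen l 0 + 2ℚ * cen l 1
b-edge l = begin
  Bi (suc (dbl l)) (l ℕ.+ 0) + Bi (suc (dbl l)) (suc (l ℕ.+ 0))
    ≡⟨ +-congʳ mid ⟩
  Bi (suc (dbl l)) (suc (l ℕ.+ 0)) + Bi (suc (dbl l)) (suc (l ℕ.+ 0))
    ≡⟨ cong (λ k → (Bi (dbl l) (l ℕ.+ 0) + Bi (dbl l) k) + (Bi (dbl l) (l ℕ.+ 0) + Bi (dbl l) k)) (sym (ℕP.+-suc l 0)) ⟩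
  (cen l 0 + cen l 1) + (cen l 0 + cen l 1)
    ≡⟨ *-2 _ _ ⟩
  2ℚ * cen l 0 + 2ℚ * cen l 1 ∎
  where
  open ≡-Reasoning
  mid : Bi (suc (dbl l)) (l ℕ.+ 0) ≡ Bi (suc (dbl l)) (suc (l ℕ.+ 0))
  mid rewrite ℕP.+-identityʳ l | dbl≡+ l = begin
    Bi (suc (l ℕ.+ l)) l            ≡⟨ cong (λ n → Bi n l) (sym (ℕP.+-suc l l)) ⟩
    Bi (l ℕ.+ suc l) l              ≡⟨ Bi-fac l (suc l) ⟩
    fac (l ℕ.+ suc l) * (ifac l * ifac (suc l)) ≡⟨ cong₂ _*_ (cong fac (ℕP.+-suc l l)) (*-comm _ _) ⟩
    fac (suc l ℕ.+ l) * (ifac (suc l) * ifac l) ≡⟨ sym (Bi-fac (suc l) l) ⟩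
    Bi (suc (l ℕ.+ l)) (suc l) ∎

-- `Tk` and `Tr` belong to an axis halfway between lattice heights: `Tr` reflects (f (-1) = f 0
-- gives the weight 3), and `Tk` forbids the axis point in between. `Ti` and `Dk` belong to an axis
-- through lattice heights: `Ti` reflects at the axis point 0, and `Dk` acts on the points off the
-- axis and lets the axis kill.
module Tk = Step 1ℚ 1ℚ
module Tr = Step 3ℚ 1ℚ
module Ti = Step 2ℚ 2ℚ
module Dk = Step 2ℚ 1ℚ

b-0 : ∀ y → cen 0 y ≡ δ 0 y
b-0 zero    = refl
b-0 (suc y) = refl

opaque
  unfolding ℚ-ring
  ring-k₀ : ∀ x y z → (2ℚ * x + 2ℚ * y) - ((x + y) + (y + z)) ≡ 1ℚ * (x - y) + 1ℚ * (y - z)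
  ring-k₀ = solve-∀ ℚ-ring
  ring-k : ∀ x y z w → ((x + y) + (y + z)) - ((y + z) + (z + w)) ≡ ((x - y) + (y - z)) + ((y - z) + (z - w))
  ring-k = solve-∀ ℚ-ring
  ring-r₀ : ∀ x y z → (2ℚ * x + 2ℚ * y) + ((x + y) + (y + z)) ≡ 3ℚ * (x + y) + 1ℚ * (y + z)
  ring-r₀ = solve-∀ ℚ-ring
  ring-d₀ : ∀ x y z w → (2ℚ * x + 2ℚ * y) - ((y + z) + (z + w)) ≡ 2ℚ * (x - z) + 1ℚ * (y - w)
  ring-d₀ = solve-∀ ℚ-ring
  ring-d : ∀ x y z w v → ((x + y) + (y + z)) - ((z + w) + (w + v)) ≡ ((x - z) + (y - w)) + ((y - w) + (z - v))
  ring-d = solve-∀ ℚ-ring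
  ring-δ₀ : 1ℚ - 0ℚ ≡ 1ℚ
  ring-δ₀ = refl
  ring-δ₁ : 0ℚ - 0ℚ ≡ 0ℚ
  ring-δ₁ = refl

-- Here and in the next three lemmas the method of images applies. For `Ti` the source lies on the
-- axis and is its own image; the image of the source 0 is at -1 for `Tr` and, with a minus sign,
-- for `Tk`; for `Dk` it is at -2, with a minus sign.
Ti-b : ∀ l y → iter Ti.step l (δ 0) y ≡ cen l y
Ti-b zero    y       = sym (b-0 y)
Ti-b (suc l) zero    = trans (Ti.step-ext (Ti-b l) 0) (sym (b-edge l))
Ti-b (suc l) (suc y) = trans (Ti.step-ext (Ti-b l) (suc y)) (sym (b-suc l y))

Tk-b : ∀ l y → iter Tk.step l (δ 0) y ≡ cen l y - cen l (suc y)
Tk-b zero    zero    = sym ring-δ₀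
Tk-b zero    (suc y) = sym ring-δ₁
Tk-b (suc l) zero    = trans (Tk.step-ext (Tk-b l) 0) (sym (trans (cong₂ _-_ (b-edge l) (b-suc l 0)) (ring-k₀ _ _ _)))
Tk-b (suc l) (suc y) = trans (Tk.step-ext (Tk-b l) (suc y)) (sym (trans (cong₂ _-_ (b-suc l y) (b-suc l (suc y))) (ring-k _ _ _ _)))

Tr-b : ∀ l y → iter Tr.step l (δ 0) y ≡ cen l y + cen l (suc y)
Tr-b zero    zero    = sym (+-identityʳ 1ℚ)
Tr-b zero    (suc y) = sym (+-identityʳ 0ℚ)
Tr-b (suc l) zero    = trans (Tr.step-ext (Tr-b l) 0) (sym (trans (cong₂ _+_ (b-edge l) (b-suc l 0)) (ring-r₀ _ _ _)))
Tr-b (suc l) (suc y) = trans (Tr.step-ext (Tr-b l) (suc y)) (sym (cong₂ _+_ (b-suc l y) (b-suc l (suc y))))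

Dk-b : ∀ l y → iter Dk.step l (δ 0) y ≡ cen l y - cen l (suc (suc y))
Dk-b zero    zero    = sym ring-δ₀
Dk-b zero    (suc y) = sym ring-δ₁
Dk-b (suc l) zero    = trans (Dk.step-ext (Dk-b l) 0) (sym (trans (cong₂ _-_ (b-edge l) (b-suc l 1)) (ring-d₀ _ _ _ _)))
Dk-b (suc l) (suc y) = trans (Dk.step-ext (Dk-b l) (suc y)) (sym (trans (cong₂ _-_ (b-suc l y) (b-suc l (suc (suc y)))) (ring-d _ _ _ _ _)))

nat-dbl : ∀ k → nat (dbl k) ≡ nat k + nat k
nat-dbl k = trans (cong nat (dbl≡+ k)) (nat-+ k k)

opaque
  unfolding ℚ-ring
  ring-β : ∀ n d f i → n * (((1ℚ + (1ℚ + (n - 1ℚ + (n - 1ℚ)))) * (d * f)) * (i * i)) ≡ (2ℚ * d) * (f * ((n * i) * (n * i)))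
  ring-β = solve-∀ ℚ-ring
  suc-pred : ∀ x → x ≡ (1ℚ + x) - 1ℚ
  suc-pred = solve-∀ ℚ-ring

β-suc : ∀ k → nat (suc k) * β (suc k) ≡ (2ℚ * nat (suc (dbl k))) * β k
β-suc k = begin
  nat (suc k) * β (suc k)
    ≡⟨ *-congˡ (β-fac (suc k)) ⟩
  nat (suc k) * ((nat (suc (suc (dbl k))) * (nat (suc (dbl k)) * fac (dbl k))) * (ifac (suc k) * ifac (suc k)))
    ≡⟨ cong (λ z → nat (suc k) * ((z * (nat (suc (dbl k)) * fac (dbl k))) * (ifac (suc k) * ifac (suc k)))) e ⟩
  nat (suc k) * (((1ℚ + (1ℚ + (nat (suc k) - 1ℚ + (nat (suc k) - 1ℚ)))) * (nat (suc (dbl k)) * fac (dbl k))) * (ifac (suc k) * ifac (suc k)))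
    ≡⟨ ring-β _ _ _ _ ⟩
  (2ℚ * nat (suc (dbl k))) * (fac (dbl k) * ((nat (suc k) * ifac (suc k)) * (nat (suc k) * ifac (suc k))))
    ≡⟨ *-congˡ (trans (*-congˡ (cong₂ _*_ (ifac-suc k) (ifac-suc k))) (sym (β-fac k))) ⟩
  (2ℚ * nat (suc (dbl k))) * β k ∎
  where
  open ≡-Reasoning
  pre : nat k ≡ nat (suc k) - 1ℚ
  pre = trans (suc-pred _) (-‿congʳ (sym (nat-suc k)))
  e : nat (suc (suc (dbl k))) ≡ 1ℚ + (1ℚ + (nat (suc k) - 1ℚ + (nat (suc k) - 1ℚ)))
  e = trans (nat-suc _) (+-congˡ (trans (nat-suc _) (+-congˡ (trans (nat-dbl k) (cong₂ _+_ pre pre)))))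


opaque
  unfolding ℚ-ring
  ring-c : ∀ n x y → n * (x - y) ≡ (2ℚ * n) * x - ½ * (n * (2ℚ * x + 2ℚ * y))
  ring-c = solve-∀ ℚ-ring
  ring-c′ : ∀ k x → (2ℚ * (1ℚ + k)) * x - ½ * ((2ℚ * (1ℚ + (k + k))) * x) ≡ x
  ring-c′ = solve-∀ ℚ-ring
  ring-λ : ∀ x y → x + y ≡ ½ * (2ℚ * x + 2ℚ * y)
  ring-λ = solve-∀ ℚ-ring

-- the Catalan numbers β k / (k + 1)
catalan : ∀ k → nat (suc k) * (cen k 0 - cen k 1) ≡ β k
catalan k = begin
  nat (suc k) * (cen k 0 - cen k 1)
    ≡⟨ ring-c _ _ _ ⟩
  (2ℚ * nat (suc k)) * β k - ½ * (nat (suc k) * (2ℚ * cen k 0 + 2ℚ * cen k 1))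
    ≡⟨ -‿congˡ (*-congˡ (trans (*-congˡ (sym (b-edge k))) (β-suc k))) ⟩
  (2ℚ * nat (suc k)) * β k - ½ * ((2ℚ * nat (suc (dbl k))) * β k)
    ≡⟨ cong₂ (λ x y → (2ℚ * x) * β k - ½ * ((2ℚ * y) * β k)) (nat-suc k) (trans (nat-suc _) (+-congˡ (nat-dbl k))) ⟩
  (2ℚ * (1ℚ + nat k)) * β k - ½ * ((2ℚ * (1ℚ + (nat k + nat k))) * β k)
    ≡⟨ ring-c′ _ _ ⟩
  β k ∎
  where open ≡-Reasoning

opaque
  unfolding ℚ-ring
  ring-mr : ∀ f₀ f₁ → 3ℚ * f₀ + 1ℚ * f₁ ≡ (1ℚ * f₀ + 1ℚ * f₁) + (2ℚ * f₀) * 1ℚ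
  ring-mr = solve-∀ ℚ-ring
  ring-mr′ : ∀ x y → x ≡ x + y * 0ℚ
  ring-mr′ = solve-∀ ℚ-ring
  ring-md : ∀ f₀ f₁ f₂ → (f₀ + f₁) + (f₁ + f₂) ≡ (2ℚ * f₁ + 1ℚ * f₂) + f₀ * 1ℚ
  ring-md = solve-∀ ℚ-ring

-- Moments: in either symmetry type the difference of the reflecting and the killing operator has rank one.
μ : ℕ → ℕ → ℚ
μ k l = iter Tk.step k (iter Tr.step l (δ 0)) 0

-- `Tr.step` exceeds `Tk.step` by the rank-one operator sending f to 2 f 0 times the point mass at
-- 0, so exchanging one step costs a product of two explicit values.
μ-suc : ∀ k l → μ k (suc l) ≡ μ (suc k) l + (2ℚ * (cen l 0 + cen l 1)) * (cen k 0 - cen k 1)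
μ-suc k l = begin
  iter Tk.step k (Tr.step g) 0
    ≡⟨ Tk.steps-ext k {Tr.step g} {λ y → Tk.step g y + (2ℚ * g 0) * δ 0 y} (λ { zero → ring-mr _ _ ; (suc y) → ring-mr′ _ _ }) 0 ⟩
  iter Tk.step k (λ y → Tk.step g y + (2ℚ * g 0) * δ 0 y) 0
    ≡⟨ Tk.steps-linear k (Tk.step g) (δ 0) (2ℚ * g 0) 0 ⟩
  iter Tk.step k (Tk.step g) 0 + (2ℚ * g 0) * iter Tk.step k (δ 0) 0
    ≡⟨ cong₂ _+_ (sym (cong (λ h → h 0) (iter-suc Tk.step k g))) (cong₂ (λ x y → (2ℚ * x) * y) (Tr-b l 0) (Tk-b k 0)) ⟩
  μ (suc k) l + (2ℚ * (cen l 0 + cen l 1)) * (cen k 0 - cen k 1) ∎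
  where
  open ≡-Reasoning
  g = iter Tr.step l (δ 0)

opaque
  unfolding ℚ-ring
  ring-μ : ∀ k l m x c → (1ℚ + (k + (1ℚ + l))) * (m + (2ℚ * (½ * x)) * c) ≡ (1ℚ + ((1ℚ + k) + l)) * m + (1ℚ + (k + (1ℚ + l))) * (x * c)
  ring-μ = solve-∀ ℚ-ring
  ring-μ₁ : ∀ k l bk₁ bl bl₁ c → ((1ℚ + k) * (1ℚ + l)) * ((1ℚ + (l + l)) * (bk₁ * bl) + (1ℚ + (k + (1ℚ + l))) * (bl₁ * c)) ≡
    ((1ℚ + l) * ((1ℚ + (l + l)) * ((1ℚ + k) * bk₁) * bl)) + (1ℚ + (k + (1ℚ + l))) * (((1ℚ + l) * bl₁) * ((1ℚ + k) * c))
  ring-μ₁ = solve-∀ ℚ-ring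
  ring-μ₂ : ∀ k l bk bl → ((1ℚ + l) * ((1ℚ + (l + l)) * ((2ℚ * (1ℚ + (k + k))) * bk) * bl)) + (1ℚ + (k + (1ℚ + l))) * (((2ℚ * (1ℚ + (l + l))) * bl) * bk) ≡
    (1ℚ + k) * ((1ℚ + ((1ℚ + l) + (1ℚ + l))) * (bk * ((2ℚ * (1ℚ + (l + l))) * bl)))
  ring-μ₂ = solve-∀ ℚ-ring
  ring-μ₃ : ∀ k l bk bl₁ → (1ℚ + k) * ((1ℚ + ((1ℚ + l) + (1ℚ + l))) * (bk * ((1ℚ + l) * bl₁))) ≡ ((1ℚ + k) * (1ℚ + l)) * ((1ℚ + ((1ℚ + l) + (1ℚ + l))) * (bk * bl₁))
  ring-μ₃ = solve-∀ ℚ-ring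

nat-sdbl : ∀ k → nat (suc (dbl k)) ≡ 1ℚ + (nat k + nat k)
nat-sdbl k = trans (nat-suc _) (+-congˡ (nat-dbl k))

β-suc′ : ∀ k → (1ℚ + nat k) * β (suc k) ≡ (2ℚ * (1ℚ + (nat k + nat k))) * β k
β-suc′ k = trans (*-congʳ (sym (nat-suc k))) (trans (β-suc k) (*-congʳ (*-congˡ (nat-sdbl k))))

catalan′ : ∀ k → (1ℚ + nat k) * (cen k 0 - cen k 1) ≡ β k
catalan′ k = trans (*-congʳ (sym (nat-suc k))) (catalan k)

NZ-1+ : ∀ k → NZ (1ℚ + nat k)
NZ-1+ k e = NZ-nat k (trans (nat-suc k) e)

-- Induction on l for all k at once, since `μ-suc` trades an l for a k; l = 0 is the Catalan number.
μ-formula′ : ∀ l k → (1ℚ + (nat k + nat l)) * μ k l ≡ (1ℚ + (nat l + nat l)) * (β k * β l)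
μ-formula′ zero    k = begin
  (1ℚ + (nat k + nat 0)) * μ k 0  ≡⟨ cong₂ _*_ (+-congˡ (trans (+-congˡ nat-0) (+-identityʳ _))) (Tk-b k 0) ⟩
  (1ℚ + nat k) * (cen k 0 - cen k 1)  ≡⟨ catalan′ k ⟩
  β k                             ≡⟨ sym (ring-μ₀ _) ⟩
  (1ℚ + (0ℚ + 0ℚ)) * (β k * 1ℚ)   ≡⟨ cong (λ z → (1ℚ + (z + z)) * (β k * 1ℚ)) (sym nat-0) ⟩
  (1ℚ + (nat 0 + nat 0)) * (β k * β 0) ∎
  where
  open ≡-Reasoning
  opaque
    unfolding ℚ-ring
    ring-μ₀ : ∀ x → (1ℚ + (0ℚ + 0ℚ)) * (x * 1ℚ) ≡ x
    ring-μ₀ = solve-∀ ℚ-ring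
μ-formula′ (suc l) k = *-cancelˡ ((1ℚ + nat k) * (1ℚ + nat l)) (NZ-* (NZ-1+ k) (NZ-1+ l)) (begin
  P * ((1ℚ + (nat k + nat (suc l))) * μ k (suc l))
    ≡⟨ *-congˡ (cong₂ _*_ (+-congˡ (+-congˡ (nat-suc l))) (trans (μ-suc k l) (+-congˡ (*-congʳ (*-congˡ (trans (ring-λ _ _) (*-congˡ (sym (b-edge l))))))))) ⟩
  P * ((1ℚ + (nat k + (1ℚ + nat l))) * (μ (suc k) l + (2ℚ * (½ * β (suc l))) * c))
    ≡⟨ *-congˡ (ring-μ _ _ _ _ _) ⟩
  P * ((1ℚ + ((1ℚ + nat k) + nat l)) * μ (suc k) l + (1ℚ + (nat k + (1ℚ + nat l))) * (β (suc l) * c))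
    ≡⟨ *-congˡ (+-congʳ (trans (*-congʳ (+-congˡ (+-congʳ (sym (nat-suc k))))) (μ-formula′ l (suc k)))) ⟩
  P * ((1ℚ + (nat l + nat l)) * (β (suc k) * β l) + (1ℚ + (nat k + (1ℚ + nat l))) * (β (suc l) * c))
    ≡⟨ ring-μ₁ _ _ _ _ _ _ ⟩
  ((1ℚ + nat l) * ((1ℚ + (nat l + nat l)) * ((1ℚ + nat k) * β (suc k)) * β l)) + (1ℚ + (nat k + (1ℚ + nat l))) * (((1ℚ + nat l) * β (suc l)) * ((1ℚ + nat k) * c))
    ≡⟨ cong₂ (λ x y → ((1ℚ + nat l) * ((1ℚ + (nat l + nat l)) * x * β l)) + (1ℚ + (nat k + (1ℚ + nat l))) * y) (β-suc′ k) (cong₂ _*_ (β-suc′ l) (catalan′ k)) ⟩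
  ((1ℚ + nat l) * ((1ℚ + (nat l + nat l)) * ((2ℚ * (1ℚ + (nat k + nat k))) * β k) * β l)) + (1ℚ + (nat k + (1ℚ + nat l))) * (((2ℚ * (1ℚ + (nat l + nat l))) * β l) * β k)
    ≡⟨ ring-μ₂ _ _ _ _ ⟩
  (1ℚ + nat k) * ((1ℚ + ((1ℚ + nat l) + (1ℚ + nat l))) * (β k * ((2ℚ * (1ℚ + (nat l + nat l))) * β l)))
    ≡⟨ *-congˡ (*-congˡ (*-congˡ (sym (β-suc′ l)))) ⟩
  (1ℚ + nat k) * ((1ℚ + ((1ℚ + nat l) + (1ℚ + nat l))) * (β k * ((1ℚ + nat l) * β (suc l))))
    ≡⟨ ring-μ₃ _ _ _ _ ⟩
  P * ((1ℚ + ((1ℚ + nat l) + (1ℚ + nat l))) * (β k * β (suc l)))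
    ≡⟨ *-congˡ (*-congʳ (+-congˡ (cong₂ _+_ (sym (nat-suc l)) (sym (nat-suc l))))) ⟩
  P * ((1ℚ + (nat (suc l) + nat (suc l))) * (β k * β (suc l))) ∎)
  where
  open ≡-Reasoning
  P = (1ℚ + nat k) * (1ℚ + nat l)
  c = cen k 0 - cen k 1

opaque
  unfolding ℚ-ring
  ring-c″ : ∀ x y z → x - z ≡ (2ℚ * x + 2ℚ * y) - ((x + y) + (y + z))
  ring-c″ = solve-∀ ℚ-ring
  ring-ν : ∀ k l m x c → (2ℚ * (k + (1ℚ + l))) * (m + x * c) ≡ (2ℚ * ((1ℚ + k) + l)) * m + (2ℚ * (k + (1ℚ + l))) * (x * c)
  ring-ν = solve-∀ ℚ-ring
  ring-ν₁ : ∀ k l bk₁ bl c → (1ℚ + k) * (l * (bk₁ * bl) + (2ℚ * (k + (1ℚ + l))) * (bl * c)) ≡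
    l * (((1ℚ + k) * bk₁) * bl) + (2ℚ * (k + (1ℚ + l))) * (bl * ((1ℚ + k) * c))
  ring-ν₁ = solve-∀ ℚ-ring
  ring-ν₂ : ∀ k l bk bl → l * (((2ℚ * (1ℚ + (k + k))) * bk) * bl) + (2ℚ * (k + (1ℚ + l))) * (bl * bk) ≡
    (1ℚ + k) * (bk * ((2ℚ * (1ℚ + (l + l))) * bl))
  ring-ν₂ = solve-∀ ℚ-ring
  ring-ν₃ : ∀ k l bk bl₁ → (1ℚ + k) * (bk * ((1ℚ + l) * bl₁)) ≡ (1ℚ + k) * ((1ℚ + l) * (bk * bl₁))
  ring-ν₃ = solve-∀ ℚ-ring
  0*-sym : ∀ x y → x * 0ℚ ≡ 0ℚ * y
  0*-sym = solve-∀ ℚ-ring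

-- The shift by `suc` drops the axis point: `Dk` is indexed by the distance from the axis minus 1.
ν : ℕ → ℕ → ℚ
ν k l = iter Dk.step k (iter Ti.step l (δ 0) ∘ suc) 0

-- Off the axis a `Ti` step differs from a `Dk` step only by what flows in from the axis point,
-- again an operator of rank one.
ν-suc : ∀ k l → ν k (suc l) ≡ ν (suc k) l + β l * (cen (suc k) 0 - cen (suc k) 1)
ν-suc k l = begin
  iter Dk.step k (Ti.step g ∘ suc) 0
    ≡⟨ Dk.steps-ext k {Ti.step g ∘ suc} {λ y → Dk.step (g ∘ suc) y + g 0 * δ 0 y} (λ { zero → ring-md _ _ _ ; (suc y) → ring-mr′ _ _ }) 0 ⟩
  iter Dk.step k (λ y → Dk.step (g ∘ suc) y + g 0 * δ 0 y) 0
    ≡⟨ Dk.steps-linear k (Dk.step (g ∘ suc)) (δ 0) (g 0) 0 ⟩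
  iter Dk.step k (Dk.step (g ∘ suc)) 0 + g 0 * iter Dk.step k (δ 0) 0
    ≡⟨ cong₂ _+_ (sym (cong (λ h → h 0) (iter-suc Dk.step k (g ∘ suc))))
         (cong₂ _*_ (Ti-b l 0) (trans (Dk-b k 0) (trans (ring-c″ _ _ _) (cong₂ _-_ (sym (b-edge k)) (sym (b-suc k 0)))))) ⟩
  ν (suc k) l + β l * (cen (suc k) 0 - cen (suc k) 1) ∎
  where
  open ≡-Reasoning
  g = iter Ti.step l (δ 0)

ν-0 : ∀ k y → iter Dk.step k (δ 0 ∘ suc) y ≡ 0ℚ
ν-0 zero    y       = refl
ν-0 (suc k) zero    = trans (Dk.step-ext (ν-0 k) 0) (edge-0 2ℚ 1ℚ)
ν-0 (suc k) (suc y) = trans (Dk.step-ext (ν-0 k) (suc y)) step-0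

ν-formula′ : ∀ l k → (2ℚ * (nat (suc k) + nat l)) * ν k l ≡ nat l * (β (suc k) * β l)
ν-formula′ zero    k = trans (*-congˡ (ν-0 k 0)) (trans (0*-sym _ _) (*-congʳ (sym nat-0)))
ν-formula′ (suc l) k = *-cancelˡ (1ℚ + K) (NZ-1+ (suc k)) (begin
  (1ℚ + K) * ((2ℚ * (K + nat (suc l))) * ν k (suc l))
    ≡⟨ *-congˡ (cong₂ _*_ (*-congˡ (+-congˡ (nat-suc l))) (ν-suc k l)) ⟩
  (1ℚ + K) * ((2ℚ * (K + (1ℚ + nat l))) * (ν (suc k) l + β l * c))
    ≡⟨ *-congˡ (ring-ν _ _ _ _ _) ⟩
  (1ℚ + K) * ((2ℚ * ((1ℚ + K) + nat l)) * ν (suc k) l + (2ℚ * (K + (1ℚ + nat l))) * (β l * c))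
    ≡⟨ *-congˡ (+-congʳ (trans (*-congʳ (*-congˡ (+-congʳ (sym (nat-suc (suc k)))))) (ν-formula′ l (suc k)))) ⟩
  (1ℚ + K) * (nat l * (β (suc (suc k)) * β l) + (2ℚ * (K + (1ℚ + nat l))) * (β l * c))
    ≡⟨ ring-ν₁ _ _ _ _ _ ⟩
  nat l * (((1ℚ + K) * β (suc (suc k))) * β l) + (2ℚ * (K + (1ℚ + nat l))) * (β l * ((1ℚ + K) * c))
    ≡⟨ cong₂ (λ x y → nat l * (x * β l) + (2ℚ * (K + (1ℚ + nat l))) * (β l * y)) (β-suc′ (suc k)) (catalan′ (suc k)) ⟩
  nat l * (((2ℚ * (1ℚ + (K + K))) * β (suc k)) * β l) + (2ℚ * (K + (1ℚ + nat l))) * (β l * β (suc k))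
    ≡⟨ ring-ν₂ _ _ _ _ ⟩
  (1ℚ + K) * (β (suc k) * ((2ℚ * (1ℚ + (nat l + nat l))) * β l))
    ≡⟨ *-congˡ (*-congˡ (sym (β-suc′ l))) ⟩
  (1ℚ + K) * (β (suc k) * ((1ℚ + nat l) * β (suc l)))
    ≡⟨ ring-ν₃ K _ _ _ ⟩
  (1ℚ + K) * ((1ℚ + nat l) * (β (suc k) * β (suc l)))
    ≡⟨ *-congˡ (*-congʳ (sym (nat-suc l))) ⟩
  (1ℚ + K) * (nat (suc l) * (β (suc k) * β (suc l))) ∎)
  where
  open ≡-Reasoning
  K = nat (suc k)
  c = cen (suc k) 0 - cen (suc k) 1

-- Functionals as rows, functions as columns

record Functional : Set where
  constructor functional
  field
    fn  : Fun → ℚ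
    ext : ∀ {f g} → (∀ y → f y ≡ g y) → fn f ≡ fn g
    lin : ∀ f g k → fn (λ y → f y + k * g y) ≡ fn f + k * fn g
open Functional

opaque
  unfolding ℚ-ring
  ring-φ0 : ∀ x → x + (- 1ℚ) * x ≡ 0ℚ
  ring-φ0 = solve-∀ ℚ-ring
  ring-φ- : ∀ x y → x - y ≡ x + (- 1ℚ) * y
  ring-φ- = solve-∀ ℚ-ring
  ring-φ00 : 0ℚ ≡ 0ℚ + (- 1ℚ) * 0ℚ
  ring-φ00 = refl

fn-0 : ∀ φ → fn φ (λ _ → 0ℚ) ≡ 0ℚ
fn-0 φ = trans (ext φ (λ _ → ring-φ00)) (trans (lin φ _ _ (- 1ℚ)) (ring-φ0 _))

fn-sub : ∀ φ f g → fn φ (λ y → f y - g y) ≡ fn φ f - fn φ g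
fn-sub φ f g = trans (ext φ (λ y → ring-φ- (f y) (g y))) (trans (lin φ f g (- 1ℚ)) (sym (ring-φ- _ _)))

span-fn : ∀ {rs h} → Span δ rs h → Span (flip fn) (map δ rs) (λ φ → fn φ h)
span-fn (s0 z)                     = s0 (λ φ → trans (ext φ z) (fn-0 φ))
span-fn (s+ k {g} {r} p s e)       = s+ k (MemP.∈-map⁺ δ p) (span-fn s) (λ φ → trans (ext φ e) (lin φ g (δ r) k))

module _ (p q : ℚ) where
  open Step p q
  open Triangular p q

  -- The point masses at 0, ..., n - 1 may be replaced by the successive images of the point mass at
  -- 0, so that all columns are powers of one operator applied to one vector.
  evolveCols : ∀ n rows → det fn rows (map δ (downFrom n)) ≡ det fn rows (map (λ j → iter step j (δ 0)) (downFrom n))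
  evolveCols n rows = begin
    det fn rows (map δ (downFrom n))                                 ≡⟨ det-transpose fn rows _ ⟩
    det (flip fn) (map δ (downFrom n)) rows                          ≡⟨ sym (det-triangular {m = flip fn} (λ j → iter step j (δ 0)) δ
                                                                          (λ j → span-resp (λ φ → sym (fn-sub φ _ _)) (span-fn (colSpan j))) n rows) ⟩
    det (flip fn) (map (λ j → iter step j (δ 0)) (downFrom n)) rows  ≡⟨ sym (det-transpose fn rows _) ⟩
    det fn rows (map (λ j → iter step j (δ 0)) (downFrom n))         ∎
    where open ≡-Reasoning

  module _ (op : Fun → Fun) (op-ext : ∀ {f g} → (∀ y → f y ≡ g y) → ∀ y → op f y ≡ op g y)
           (op-lin : ∀ f g k y → op (λ z → f z + k * g z) y ≡ op f y + k * op g y) where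

    pointRow stepsRow : ℕ → Functional
    pointRow y = functional (λ f → op f y) (λ e → op-ext e y) (λ f g k → op-lin f g k y)
    stepsRow i = functional (λ f → iter step i (op f) 0) (λ e → steps-ext i (op-ext e) 0)
      (λ f g k → trans (steps-ext i (op-lin f g k) 0) (steps-linear i (op f) (op g) k 0))

    -- The counterpart for rows: evaluations at 0, ..., n - 1 become evaluation at 0 after 0, ..., n
    -- - 1 further steps. Together with `evolveCols` the determinant becomes one of moments.
    evolveRows : q ≡ 1ℚ → ∀ n cols → det fn (map pointRow (downFrom n)) cols ≡ det fn (map stepsRow (downFrom n)) cols
    evolveRows e n cols = sym (det-triangular {m = fn} stepsRow pointRow
      (λ i → span-map pointRow op (λ r f → refl) (rowSpan e i)) n cols)

prod-shift : ∀ (α : ℕ → ℚ) d n → prod (λ i → α (i ℕ.+ suc d)) (downFrom n) * α d ≡ prod (λ i → α (i ℕ.+ d)) (downFrom n) * α (n ℕ.+ d)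
prod-shift α d zero    = refl
prod-shift α d (suc n) = trans (trans (*-assoc _ _ _) (*-congˡ (prod-shift α d n)))
  (trans (cong (λ k → α k * (prod (λ i → α (i ℕ.+ d)) (downFrom n) * α (n ℕ.+ d))) (ℕP.+-suc n d)) (lem _ _ _))
  where
  opaque
    unfolding ℚ-ring
    lem : ∀ x y z → x * (y * z) ≡ (z * y) * x
    lem = solve-∀ ℚ-ring

-- The symmetric part for p = 2 a

γ : ℕ → ℚ
γ l = (1ℚ + (nat l + nat l)) * β l

opaque
  unfolding ℚ-ring
  ring-div : ∀ n i m → m ≡ (1ℚ - n * i) * m + i * (n * m)
  ring-div = solve-∀ ℚ-ring
  ring-div′ : ∀ m x y → (1ℚ - 1ℚ) * m + x * y ≡ x * y
  ring-div′ = solve-∀ ℚ-ring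
  ring-μγ : ∀ i g bk bl → i * (g * (bk * bl)) ≡ bk * ((g * bl) * i)
  ring-μγ = solve-∀ ℚ-ring

divide : ∀ n {m x} → NZ n → n * m ≡ x → m ≡ inv n * x
divide n {m} nz e = trans (ring-div n (inv n) m) (trans (cong (λ z → (1ℚ - z) * m + inv n * (n * m)) (inv-*ʳ n nz)) (trans (ring-div′ m _ _) (*-congˡ e)))

nat-suc-sum : ∀ k l → 1ℚ + (nat k + nat l) ≡ nat (suc (k ℕ.+ l))
nat-suc-sum k l = sym (trans (nat-suc _) (+-congˡ (nat-+ k l)))

μ-formula : ∀ k l → μ k l ≡ β k * (γ l * inv (nat (suc (k ℕ.+ l))))
μ-formula k l = trans (divide (nat (suc (k ℕ.+ l))) (NZ-nat (k ℕ.+ l)) (trans (*-congʳ (sym (nat-suc-sum k l))) (μ-formula′ l k))) (ring-μγ _ _ _ _)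

-- The symmetric part for a hexagon with b = c: d double steps along the walls, then l free double
-- steps, with y and j the distances from the axis at the two ends.
HE : ℕ → ℕ → ℕ → ℚ
HE a d l = det (λ y j → iter Tk.step d (iter Tr.step l (δ j)) y) (downFrom a) (downFrom a)

-- A shifted Hilbert determinant. Its value is irrelevant; what counts is that n is its only
-- parameter besides a.
hilbert : ℕ → ℕ → ℚ
hilbert a n = det (λ i j → inv (nat (suc ((i ℕ.+ j) ℕ.+ n)))) (downFrom a) (downFrom a)

-- In the evolved bases the entry (i , j) is the moment μ (i + d) (j + l), whose row and column
-- factors split off and whose denominator i + j + d + l + 1 sees d and l only through their sum.
HE-formula : ∀ a d l → HE a d l ≡
  prod (λ i → β (i ℕ.+ d)) (downFrom a) * (prod (λ j → γ (j ℕ.+ l)) (downFrom a) * hilbert a (d ℕ.+ l))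
HE-formula a d l = begin
  HE a d l
    ≡⟨ sym (det-map fn P δ L L) ⟩
  det fn (map P L) (map δ L)
    ≡⟨ evolveRows 1ℚ 1ℚ op op-ext op-lin refl a (map δ L) ⟩
  det fn (map S L) (map δ L)
    ≡⟨ evolveCols 3ℚ 1ℚ a (map S L) ⟩
  det fn (map S L) (map (λ j → iter Tr.step j (δ 0)) L)
    ≡⟨ det-map fn S (λ j → iter Tr.step j (δ 0)) L L ⟩
  det (λ i j → iter Tk.step i (op (iter Tr.step j (δ 0))) 0) L L
    ≡⟨ det-cong entry L L ⟩
  det (λ i j → β (i ℕ.+ d) * (γ (j ℕ.+ l) * inv (nat (suc ((i ℕ.+ j) ℕ.+ (d ℕ.+ l)))))) L L
    ≡⟨ det-scaleRows (λ i → β (i ℕ.+ d)) (λ i j → γ (j ℕ.+ l) * inv (nat (suc ((i ℕ.+ j) ℕ.+ (d ℕ.+ l))))) L L ⟩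
  _ ≡⟨ *-congˡ (det-scaleCols (λ j → γ (j ℕ.+ l)) (λ i j → inv (nat (suc ((i ℕ.+ j) ℕ.+ (d ℕ.+ l))))) L L) ⟩
  prod (λ i → β (i ℕ.+ d)) L * (prod (λ j → γ (j ℕ.+ l)) L * hilbert a (d ℕ.+ l)) ∎
  where
  open ≡-Reasoning
  L = downFrom a
  op : Fun → Fun
  op f = iter Tk.step d (iter Tr.step l f)
  op-ext : ∀ {f g} → (∀ y → f y ≡ g y) → ∀ y → op f y ≡ op g y
  op-ext e = Tk.steps-ext d (Tr.steps-ext l e)
  op-lin : ∀ f g k y → op (λ z → f z + k * g z) y ≡ op f y + k * op g y
  op-lin f g k y = trans (Tk.steps-ext d (Tr.steps-linear l f g k) y) (Tk.steps-linear d _ _ k y)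
  P = pointRow 1ℚ 1ℚ op op-ext op-lin
  S = stepsRow 1ℚ 1ℚ op op-ext op-lin
  idx-lem : ∀ i d l j → (i ℕ.+ d) ℕ.+ (j ℕ.+ l) ≡ (i ℕ.+ j) ℕ.+ (d ℕ.+ l)
  idx-lem = solve-∀ ℕ-ring
  entry : ∀ i j → iter Tk.step i (op (iter Tr.step j (δ 0))) 0 ≡ β (i ℕ.+ d) * (γ (j ℕ.+ l) * inv (nat (suc ((i ℕ.+ j) ℕ.+ (d ℕ.+ l)))))
  entry i j = begin
    iter Tk.step i (iter Tk.step d (iter Tr.step l (iter Tr.step j (δ 0)))) 0
      ≡⟨ cong (λ f → f 0) (iter-+ Tk.step i d _) ⟩
    iter Tk.step (i ℕ.+ d) (iter Tr.step l (iter Tr.step j (δ 0))) 0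
      ≡⟨ cong (λ f → iter Tk.step (i ℕ.+ d) f 0) (trans (iter-+ Tr.step l j (δ 0)) (cong (λ n → iter Tr.step n (δ 0)) (ℕP.+-comm l j))) ⟩
    μ (i ℕ.+ d) (j ℕ.+ l)
      ≡⟨ μ-formula (i ℕ.+ d) (j ℕ.+ l) ⟩
    β (i ℕ.+ d) * (γ (j ℕ.+ l) * inv (nat (suc ((i ℕ.+ d) ℕ.+ (j ℕ.+ l)))))
      ≡⟨ cong (λ n → β (i ℕ.+ d) * (γ (j ℕ.+ l) * inv (nat (suc n)))) (idx-lem i d l j) ⟩
    β (i ℕ.+ d) * (γ (j ℕ.+ l) * inv (nat (suc ((i ℕ.+ j) ℕ.+ (d ℕ.+ l))))) ∎

opaque
  unfolding ℚ-ring
  ring-tele : ∀ p q h x y → (p * (q * h)) * (x * y) ≡ (p * x) * ((q * y) * h)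
  ring-tele = solve-∀ ℚ-ring

-- d + l is the same on both sides, so the Hilbert determinants coincide, and the two products
-- telescope to their end factors.
HE-ratio : ∀ a d l → HE a (suc d) l * (β d * γ (a ℕ.+ l)) ≡ HE a d (suc l) * (β (a ℕ.+ d) * γ l)
HE-ratio a d l = begin
  HE a (suc d) l * (β d * γ (a ℕ.+ l))
    ≡⟨ trans (*-congʳ (HE-formula a (suc d) l)) (ring-tele _ _ _ _ _) ⟩
  (prod (λ i → β (i ℕ.+ suc d)) L * β d) * ((prod (λ j → γ (j ℕ.+ l)) L * γ (a ℕ.+ l)) * hilbert a (suc d ℕ.+ l))
    ≡⟨ cong₂ _*_ (prod-shift β d a) (cong₂ _*_ (sym (prod-shift γ l a)) (cong (hilbert a) (sym (ℕP.+-suc d l)))) ⟩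
  (prod (λ i → β (i ℕ.+ d)) L * β (a ℕ.+ d)) * ((prod (λ j → γ (j ℕ.+ suc l)) L * γ l) * hilbert a (d ℕ.+ suc l))
    ≡⟨ sym (trans (*-congʳ (HE-formula a d (suc l))) (ring-tele _ _ _ _ _)) ⟩
  HE a d (suc l) * (β (a ℕ.+ d) * γ l) ∎
  where
  open ≡-Reasoning
  L = downFrom a

-- The symmetric part for p = 2 a + 1

opaque
  unfolding ℚ-ring
  ring-ν-split : ∀ k l h bk bl x → ((2ℚ * (k + l)) * x ≡ l * (bk * bl)) → (k + l) * h ≡ 1ℚ →
    x ≡ bl * (½ * bk + (- (½ * (k * bk))) * h)
  ring-ν-split k l h bk bl x e f = begin
    x                                            ≡⟨ r₁ x ⟩
    ½ * ((2ℚ * 1ℚ) * x)                          ≡⟨ cong (λ z → ½ * ((2ℚ * z) * x)) (sym f) ⟩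
    ½ * ((2ℚ * ((k + l) * h)) * x)               ≡⟨ r₂ k l h x ⟩
    (½ * h) * ((2ℚ * (k + l)) * x)               ≡⟨ cong ((½ * h) *_) e ⟩
    (½ * h) * (l * (bk * bl))                    ≡⟨ r₃ k l h bk bl ⟩
    bl * (½ * (((k + l) * h) * bk) + (- (½ * (k * bk))) * h) ≡⟨ cong (λ z → bl * (½ * (z * bk) + (- (½ * (k * bk))) * h)) f ⟩
    bl * (½ * (1ℚ * bk) + (- (½ * (k * bk))) * h) ≡⟨ cong (λ z → bl * (½ * z + (- (½ * (k * bk))) * h)) (*-identityˡ bk) ⟩
    bl * (½ * bk + (- (½ * (k * bk))) * h)       ∎
    where
    open ≡-Reasoning
    r₁ : ∀ x → x ≡ ½ * ((2ℚ * 1ℚ) * x)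
    r₁ = solve-∀ ℚ-ring
    r₂ : ∀ k l h x → ½ * ((2ℚ * ((k + l) * h)) * x) ≡ (½ * h) * ((2ℚ * (k + l)) * x)
    r₂ = solve-∀ ℚ-ring
    r₃ : ∀ k l h bk bl → (½ * h) * (l * (bk * bl)) ≡ bl * (½ * (((k + l) * h) * bk) + (- (½ * (k * bk))) * h)
    r₃ = solve-∀ ℚ-ring

ε : ℕ → ℚ
ε k = - (½ * (nat (suc k) * β (suc k)))

-- The moment carries the quotient l / (k + 1 + l), which is 1 - (k + 1) / (k + 1 + l). Only the
-- second part is of Cauchy type; the constant part is later removed by the tip row.
ν-formula : ∀ k l → ν k l ≡ β l * (½ * β (suc k) + ε k * inv (nat (suc (k ℕ.+ l))))
ν-formula k l = ring-ν-split (nat (suc k)) (nat l) (inv (nat (suc (k ℕ.+ l)))) (β (suc k)) (β l) (ν k l) (ν-formula′ l k)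
  (trans (*-congʳ (sym (nat-+ (suc k) l))) (inv-*ʳ (nat (suc (k ℕ.+ l))) (NZ-nat (k ℕ.+ l))))

tipF : ℕ → Functional
tipF l = functional (λ f → iter Ti.step l f 0) (λ e → Ti.steps-ext l e 0) (λ f g k → Ti.steps-linear l f g k 0)

module OddRows (d l : ℕ) where
  op : Fun → Fun
  op f = iter Dk.step d (iter Ti.step l f ∘ suc)

  op-ext : ∀ {f g} → (∀ y → f y ≡ g y) → ∀ y → op f y ≡ op g y
  op-ext e = Dk.steps-ext d (λ y → Ti.steps-ext l e (suc y))

  op-lin : ∀ f g k y → op (λ z → f z + k * g z) y ≡ op f y + k * op g y
  op-lin f g k y = trans (Dk.steps-ext d (λ z → Ti.steps-linear l f g k (suc z)) y) (Dk.steps-linear d _ _ k y)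

  lowRow sRow : ℕ → Functional
  lowRow = pointRow 2ℚ 1ℚ op op-ext op-lin
  sRow   = stepsRow 2ℚ 1ℚ op op-ext op-lin

HO : ℕ → ℕ → ℕ → ℚ
HO a d l = det fn (tipF l ∷ map (OddRows.lowRow d l) (downFrom a)) (map δ (downFrom (suc a)))

hilbert′ : ℕ → ℕ → ℚ
hilbert′ a n = det id ((λ _ → 1ℚ) ∷ map (λ i j → inv (nat (suc ((i ℕ.+ j) ℕ.+ n)))) (downFrom a)) (downFrom (suc a))

det-map-id : {B : Set} (f : ℕ → B → ℚ) (rs : List ℕ) (cs : List B) → det id (map f rs) cs ≡ det f rs cs
det-map-id f rs cs = trans (cong (det id (map f rs)) (sym (LP.map-id cs))) (det-map id f id rs cs)

-- After removal of the column factors β (j + l) the tip row consists of ones. Subtracting its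
-- multiples cancels the constant part of the other rows and leaves a Cauchy matrix bordered by
-- ones, which again depends on d + l only.
HO-formula : ∀ a d l → HO a d l ≡
  prod (λ j → β (j ℕ.+ l)) (downFrom (suc a)) * (prod (λ i → ε (i ℕ.+ d)) (downFrom a) * hilbert′ a (d ℕ.+ l))
HO-formula a d l = begin
  det fn (tipF l ∷ map lowRow L) (map δ L′)
    ≡⟨ det-congTail fn (tipF l ∷ []) {map lowRow L} {map sRow L} (evolveRows 2ℚ 1ℚ op op-ext op-lin refl a) (map δ L′) ⟩
  det fn (tipF l ∷ map sRow L) (map δ L′)
    ≡⟨ evolveCols 2ℚ 2ℚ (suc a) (tipF l ∷ map sRow L) ⟩
  det fn (tipF l ∷ map sRow L) (map g L′)
    ≡⟨ altS-map fn g (λ f fs → fn (tipF l) f * det fn (map sRow L) fs) L′ ⟩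
  altS (λ j js → fn (tipF l) (g j) * det fn (map sRow L) (map g js)) L′
    ≡⟨ altS-cong (λ j js → cong₂ _*_ (tip-entry j) (trans (det-map fn sRow g L js) (trans (det-cong entry L js) (sym (det-map-id _ L js))))) L′ ⟩
  det id ((λ j → β (j ℕ.+ l) * 1ℚ) ∷ map (λ i j → β (j ℕ.+ l) * r₁ i j) L) L′
    ≡⟨ unscale ⟩
  prod (λ j → β (j ℕ.+ l)) L′ * det id ((λ _ → 1ℚ) ∷ map r₁ L) L′
    ≡⟨ *-congˡ (det-addMultiples id r₁ r₂ (λ i → ½ * β (suc (i ℕ.+ d))) (λ _ → 1ℚ) (λ i j → r₁-split _ _) ((λ _ → 1ℚ) ∷ []) L L′ (here refl)) ⟩
  prod (λ j → β (j ℕ.+ l)) L′ * det id ((λ _ → 1ℚ) ∷ map r₂ L) L′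
    ≡⟨ *-congˡ (trans (altS-cong (λ j js → trans (*-congˡ (trans (det-map-id r₂ L js)
          (trans (det-scaleRows (λ i → ε (i ℕ.+ d)) (λ i j → inv (nat (suc ((i ℕ.+ j) ℕ.+ (d ℕ.+ l))))) L js) (*-congˡ (sym (det-map-id _ L js)))))) (*-left-comm _ _ _)) L′)
          (altS-* (λ j js → 1ℚ * det id (map (λ i j → inv (nat (suc ((i ℕ.+ j) ℕ.+ (d ℕ.+ l))))) L) js) (prod (λ i → ε (i ℕ.+ d)) L) L′)) ⟩
  prod (λ j → β (j ℕ.+ l)) L′ * (prod (λ i → ε (i ℕ.+ d)) L * hilbert′ a (d ℕ.+ l)) ∎
  where
  open ≡-Reasoning
  open OddRows d l
  L = downFrom a
  L′ = downFrom (suc a)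
  g = λ j → iter Ti.step j (δ 0)
  r₁ r₂ : ℕ → ℕ → ℚ
  r₁ i j = ½ * β (suc (i ℕ.+ d)) + ε (i ℕ.+ d) * inv (nat (suc ((i ℕ.+ j) ℕ.+ (d ℕ.+ l))))
  r₂ i j = ε (i ℕ.+ d) * inv (nat (suc ((i ℕ.+ j) ℕ.+ (d ℕ.+ l))))
  opaque
    unfolding ℚ-ring
    r₁-split : ∀ x y → x + y ≡ y + x * 1ℚ
    r₁-split = solve-∀ ℚ-ring
    *-1 : ∀ x → x ≡ x * 1ℚ
    *-1 = solve-∀ ℚ-ring
  idx-lem : ∀ i d l j → (i ℕ.+ d) ℕ.+ (j ℕ.+ l) ≡ (i ℕ.+ j) ℕ.+ (d ℕ.+ l)
  idx-lem = solve-∀ ℕ-ring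
  joined : ∀ j → iter Ti.step l (g j) ≡ g (j ℕ.+ l)
  joined j = trans (iter-+ Ti.step l j (δ 0)) (cong g (ℕP.+-comm l j))
  tip-entry : ∀ j → iter Ti.step l (g j) 0 ≡ β (j ℕ.+ l) * 1ℚ
  tip-entry j = trans (cong (λ f → f 0) (joined j)) (trans (Ti-b (j ℕ.+ l) 0) (*-1 _))
  entry : ∀ i j → iter Dk.step i (op (g j)) 0 ≡ β (j ℕ.+ l) * r₁ i j
  entry i j = begin
    iter Dk.step i (iter Dk.step d (iter Ti.step l (g j) ∘ suc)) 0  ≡⟨ cong (λ f → f 0) (iter-+ Dk.step i d _) ⟩
    iter Dk.step (i ℕ.+ d) (iter Ti.step l (g j) ∘ suc) 0           ≡⟨ cong (λ f → iter Dk.step (i ℕ.+ d) (f ∘ suc) 0) (joined j) ⟩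
    ν (i ℕ.+ d) (j ℕ.+ l)                                           ≡⟨ ν-formula (i ℕ.+ d) (j ℕ.+ l) ⟩
    _ ≡⟨ cong (λ n → β (j ℕ.+ l) * (½ * β (suc (i ℕ.+ d)) + ε (i ℕ.+ d) * inv (nat (suc n)))) (idx-lem i d l j) ⟩
    β (j ℕ.+ l) * r₁ i j ∎
  unscale : det id ((λ j → β (j ℕ.+ l) * 1ℚ) ∷ map (λ i j → β (j ℕ.+ l) * r₁ i j) L) L′ ≡ prod (λ j → β (j ℕ.+ l)) L′ * det id ((λ _ → 1ℚ) ∷ map r₁ L) L′
  unscale = trans (cong (λ R → det id R L′) (cong ((λ j → β (j ℕ.+ l) * 1ℚ) ∷_) (LP.map-∘ L)))
    (trans (trans (cong (det id (map scaled ((λ _ → 1ℚ) ∷ map r₁ L))) (sym (LP.map-id L′))) (det-map id scaled id ((λ _ → 1ℚ) ∷ map r₁ L) L′))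
      (det-scaleCols (λ j → β (j ℕ.+ l)) id ((λ _ → 1ℚ) ∷ map r₁ L) L′))
    where
    scaled : Fun → Fun
    scaled f j = β (j ℕ.+ l) * f j

HO-ratio : ∀ a d l → HO a (suc d) l * (ε d * β (suc a ℕ.+ l)) ≡ HO a d (suc l) * (ε (a ℕ.+ d) * β l)
HO-ratio a d l = begin
  HO a (suc d) l * (ε d * β (suc a ℕ.+ l))
    ≡⟨ trans (*-congʳ (HO-formula a (suc d) l)) (ring-tele′ _ _ _ _ _) ⟩
  (prod (λ i → ε (i ℕ.+ suc d)) L * ε d) * ((prod (λ j → β (j ℕ.+ l)) L′ * β (suc a ℕ.+ l)) * hilbert′ a (suc d ℕ.+ l))
    ≡⟨ cong₂ _*_ (prod-shift ε d a) (cong₂ _*_ (sym (prod-shift β l (suc a))) (cong (hilbert′ a) (sym (ℕP.+-suc d l)))) ⟩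
  (prod (λ i → ε (i ℕ.+ d)) L * ε (a ℕ.+ d)) * ((prod (λ j → β (j ℕ.+ suc l)) L′ * β l) * hilbert′ a (d ℕ.+ suc l))
    ≡⟨ sym (trans (*-congʳ (HO-formula a d (suc l))) (ring-tele′ _ _ _ _ _)) ⟩
  HO a d (suc l) * (ε (a ℕ.+ d) * β l) ∎
  where
  open ≡-Reasoning
  L = downFrom a
  L′ = downFrom (suc a)
  opaque
    unfolding ℚ-ring
    ring-tele′ : ∀ p q h x y → (q * (p * h)) * (x * y) ≡ (p * x) * ((q * y) * h)
    ring-tele′ = solve-∀ ℚ-ring

-- Separation of the symmetric and the antisymmetric part

opaque
  unfolding ℚ-ring
  add-sub : ∀ x y → (x + y) - x ≡ 0ℚ + 1ℚ * y
  add-sub = solve-∀ ℚ-ring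
  sub-self : ∀ x y → (x - y) - x ≡ 0ℚ + (- 1ℚ) * y
  sub-self = solve-∀ ℚ-ring

module _ {A B I : Set} (m : A → B → ℚ) where

  det-replaceSpan : (f g : I → A) → ∀ pre is bs → (∀ i → i ∈ is → Span m pre (λ b → m (f i) b - m (g i) b)) →
    det m (pre ++ map f is) bs ≡ det m (pre ++ map g is) bs
  det-replaceSpan f g pre []       bs h = refl
  det-replaceSpan f g pre (i ∷ is) bs h = begin
    det m (pre ++ f i ∷ map f is) bs          ≡⟨ det-add m pre (f i) (g i) (map f is) bs (span-mono MemP.∈-++⁺ˡ (h i (here refl))) ⟩
    det m (pre ++ g i ∷ map f is) bs          ≡⟨ cong (λ L → det m L bs) (sym (LP.++-assoc pre (g i ∷ []) _)) ⟩
    det m ((pre ++ g i ∷ []) ++ map f is) bs  ≡⟨ det-replaceSpan f g (pre ++ g i ∷ []) is bs (λ i′ p → span-mono MemP.∈-++⁺ˡ (h i′ (there p))) ⟩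
    det m ((pre ++ g i ∷ []) ++ map g is) bs  ≡⟨ cong (λ L → det m L bs) (LP.++-assoc pre (g i ∷ []) _) ⟩
    det m (pre ++ g i ∷ map g is) bs          ∎
    where open ≡-Reasoning

  det-replaceFrom : (f g h : I → A) → (∀ i b → m (f i) b ≡ m (g i) b + m (h i) b) → ∀ is post bs → (∀ i → i ∈ is → h i ∈ post) →
    det m (map f is ++ post) bs ≡ det m (map g is ++ post) bs
  det-replaceFrom f g h e []       post bs p = refl
  det-replaceFrom f g h e (i ∷ is) post bs p = trans
    (det-congTail m (f i ∷ []) {map f is ++ post} {map g is ++ post} (λ cs → det-replaceFrom f g h e is post cs (λ i′ q → p i′ (there q))) bs)
    (det-addHead m (f i) (g i) (map g is ++ post) bs (span₁ 1ℚ (MemP.∈-++⁺ʳ (map g is) (p i (here refl))) (λ b → trans (-‿congʳ (e i b)) (add-sub _ _))))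

-- Splitting a centrosymmetric determinant into its symmetric and antisymmetric parts.
module Split (m : ℕ → ℕ → ℚ) (mi mc : ℕ → ℕ) (T : List Fun) (lows ups lowc upc : List ℕ)
  (mi∈ : ∀ i → i ∈ lows → mi i ∈ ups) (mc∈ : ∀ k → k ∈ upc → mc k ∈ lowc)
  (len : length T ℕ.+ length lows ≡ length lowc)
  (mirror : ∀ i k → i ∈ lows → k ∈ upc → m i k + m (mi i) k ≡ m i (mc k) + m (mi i) (mc k))
  (mirrorT : ∀ f k → f ∈ T → k ∈ upc → f k ≡ f (mc k)) where

  even : ℕ → Fun
  even i k = m i k + m (mi i) k

  at′ diff : ℕ → Fun → ℚ
  at′ k f = f k
  diff k f = f k - f (mc k)

  -- Adding the mirror images makes the lower rows symmetric, and subtracting mirror columns makes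
  -- the upper columns antisymmetric. The block where they meet is zero; the rows T are symmetric
  -- from the outset.
  split : det id (T ++ map m (lows ++ ups)) (lowc ++ upc) ≡
    det id (T ++ map even lows) lowc * det (λ i k → m i k - m i (mc k)) ups upc
  split = begin
    det id (T ++ map m (lows ++ ups)) (lowc ++ upc)
      ≡⟨ cong (λ L → det id (T ++ L) (lowc ++ upc)) (LP.map-++ m lows ups) ⟩
    det id (T ++ map m lows ++ map m ups) (lowc ++ upc)
      ≡⟨ det-congTail id T {map m lows ++ map m ups} {map even lows ++ map m ups}
           (λ cs → sym (det-replaceFrom id even m (m ∘ mi) (λ i k → refl) lows (map m ups) cs (λ i p → MemP.∈-map⁺ m (mi∈ i p)))) (lowc ++ upc) ⟩
    det id (T ++ map even lows ++ map m ups) (lowc ++ upc)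
      ≡⟨ cong (λ L → det id L (lowc ++ upc)) (sym (LP.++-assoc T (map even lows) (map m ups))) ⟩
    det id rows (lowc ++ upc)
      ≡⟨ sym (trans (cong (λ R → det ev R (map at′ lowc ++ map at′ upc)) (sym (LP.map-id rows)))
           (trans (cong (det ev (map id rows)) (sym (LP.map-++ at′ lowc upc))) (det-map ev id at′ rows (lowc ++ upc)))) ⟩
    det ev rows (map at′ lowc ++ map at′ upc)
      ≡⟨ det-transpose ev rows _ ⟩
    det (flip ev) (map at′ lowc ++ map at′ upc) rows
      ≡⟨ sym (det-replaceSpan (flip ev) diff at′ (map at′ lowc) upc rows
           (λ k p → span₁ (- 1ℚ) (MemP.∈-map⁺ at′ (mc∈ k p)) (λ f → sub-self _ _))) ⟩
    det (flip ev) (map at′ lowc ++ map diff upc) rows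
      ≡⟨ sym (det-transpose ev rows _) ⟩
    det ev rows (map at′ lowc ++ map diff upc)
      ≡⟨ det-block ev (T ++ map even lows) (map m ups) (map at′ lowc) (map diff upc)
           (trans (LP.length-++ T) (trans (cong (length T ℕ.+_) (LP.length-map even lows)) (trans len (sym (LP.length-map at′ lowc))))) zeros ⟩
    det ev (T ++ map even lows) (map at′ lowc) * det ev (map m ups) (map diff upc)
      ≡⟨ cong₂ _*_ (trans (cong (λ R → det ev R (map at′ lowc)) (sym (LP.map-id (T ++ map even lows)))) (det-map ev id at′ (T ++ map even lows) lowc))
           (det-map ev m diff ups upc) ⟩
    det id (T ++ map even lows) lowc * det (λ i k → m i k - m i (mc k)) ups upc ∎
    where
    open ≡-Reasoning
    ev : Fun → (Fun → ℚ) → ℚ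
    ev f c = c f
    rows = (T ++ map even lows) ++ map m ups
    zeros : ∀ r c → r ∈ T ++ map even lows → c ∈ map diff upc → ev r c ≡ 0ℚ
    zeros r c p q with MemP.∈-map⁻ diff q
    ... | k , k∈ , refl with MemP.∈-++⁻ T p
    ...   | inj₁ r∈T = trans (-‿congʳ (mirrorT r k r∈T k∈)) (self-sub _)
    ...   | inj₂ r∈  with MemP.∈-map⁻ even r∈
    ...     | i , i∈ , refl = trans (-‿congʳ (mirror i k i∈ k∈)) (self-sub _)

-- Mirror symmetry of path counts: at column j the mirror image of u is the u′ with e + u + u′ = s + j.

Mirrored Axial : ℕ → ℕ → Walls → Set
Mirrored e s w = ∀ j u u′ → e ℕ.+ (u ℕ.+ u′) ≡ s ℕ.+ j → w j u ≡ w j u′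
Axial    e s w = ∀ j u → w j u ≡ true → e ℕ.+ (u ℕ.+ u) ≡ s ℕ.+ j

[≟]-true : ∀ {u k} → u ≡ k → [ u ≟ k ] ≡ 1ℚ
[≟]-true {u} refl with u ℕ.≡ᵇ u in eq
... | true  = refl
... | false = ⊥-elim (subst T eq (ℕP.≡⇒≡ᵇ u u refl))

[≟]-false : ∀ {u k} → u ≢ k → [ u ≟ k ] ≡ 0ℚ
[≟]-false {u} {k} ne with u ℕ.≡ᵇ k in eq
... | false = refl
... | true  = ⊥-elim (ne (ℕP.≡ᵇ⇒≡ u k (subst T (sym eq) _)))

[≟]-iff : ∀ {u k u′ k′} → (u ≡ k → u′ ≡ k′) → (u′ ≡ k′ → u ≡ k) → [ u ≟ k ] ≡ [ u′ ≟ k′ ]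
[≟]-iff {u} {k} f g with u ℕ.≟ k
... | yes p = trans ([≟]-true p) (sym ([≟]-true (f p)))
... | no  p = trans ([≟]-false p) (sym ([≟]-false (p ∘ g)))

module _ (e s : ℕ) where

  pc-mirror : ∀ w → Mirrored e s w → ∀ n j u u′ k k′ → e ℕ.+ (u ℕ.+ u′) ≡ s ℕ.+ j → e ℕ.+ (k ℕ.+ k′) ≡ s ℕ.+ (j ℕ.+ n) →
    pc w n j u k ≡ pc w n j u′ k′
  pc-mirror w sy zero j u u′ k k′ h h′ = [≟]-iff {u} {k} {u′} {k′}
    (λ { refl → ℕP.+-cancelˡ-≡ u _ _ sum }) (λ { refl → ℕP.+-cancelʳ-≡ u′ _ _ sum })
    where
    sum : u ℕ.+ u′ ≡ k ℕ.+ k′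
    sum = ℕP.+-cancelˡ-≡ e _ _ (trans h (trans (cong (s ℕ.+_) (sym (ℕP.+-identityʳ j))) (sym h′)))
  pc-mirror w sy (suc n) j u u′ k k′ h h′ = trans (cong₂ _+_ (go u (suc u′) h₁) (go (suc u) u′ h₂)) (+-comm _ _)
    where
    h₁ : e ℕ.+ (u ℕ.+ suc u′) ≡ s ℕ.+ suc j
    h₁ = trans (cong (e ℕ.+_) (ℕP.+-suc u u′)) (trans (ℕP.+-suc e _) (trans (cong suc h) (sym (ℕP.+-suc s j))))
    h₂ : e ℕ.+ (suc u ℕ.+ u′) ≡ s ℕ.+ suc j
    h₂ = trans (ℕP.+-suc e _) (trans (cong suc h) (sym (ℕP.+-suc s j)))
    go : ∀ v v′ → e ℕ.+ (v ℕ.+ v′) ≡ s ℕ.+ suc j → arr w n (suc j) v k ≡ arr w n (suc j) v′ k′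
    go v v′ q rewrite sy (suc j) v v′ q with w (suc j) v′
    ... | true  = refl
    ... | false = pc-mirror w sy n (suc j) v v′ k k′ q (trans h′ (cong (s ℕ.+_) (ℕP.+-suc j n)))

  -- Walls on the axis do not affect the antisymmetric part.
  pc-odd : ∀ w → Axial e s w → ∀ n j u k k′ → e ℕ.+ (k ℕ.+ k′) ≡ s ℕ.+ (j ℕ.+ n) →
    pc w n j u k - pc w n j u k′ ≡ pc noWall n j u k - pc noWall n j u k′
  arr-odd : ∀ w → Axial e s w → ∀ n j u k k′ → e ℕ.+ (k ℕ.+ k′) ≡ s ℕ.+ (j ℕ.+ n) →
    arr w n j u k - arr w n j u k′ ≡ pc noWall n j u k - pc noWall n j u k′
  arr-odd w ax n j u k k′ h with w j u in eq
  -- A wall point lies on the axis, so the free paths from it reach k and its mirror image equally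
  -- often.
  ... | true  = trans (self-sub 0ℚ) (sym (trans (-‿congʳ (pc-mirror noWall (λ _ _ _ _ → refl) n j u u k k′ (ax j u eq) h)) (self-sub _)))
  ... | false = pc-odd w ax n j u k k′ h
  pc-odd w ax zero    j u k k′ h = refl
  pc-odd w ax (suc n) j u k k′ h = trans (regroup _ _ _ _)
    (trans (cong₂ _+_ (arr-odd w ax n (suc j) u k k′ h′) (arr-odd w ax n (suc j) (suc u) k k′ h′)) (sym (regroup _ _ _ _)))
    where
    h′ = trans h (cong (s ℕ.+_) (ℕP.+-suc j n))
    opaque
      unfolding ℚ-ring
      regroup : ∀ x y z w → (x + y) - (z + w) ≡ (x - z) + (y - w)
      regroup = solve-∀ ℚ-ring

dbl-suc : ∀ a j → dbl (suc a) ℕ.+ j ≡ dbl a ℕ.+ suc (suc j)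
dbl-suc a j = sym (trans (ℕP.+-suc (dbl a) (suc j)) (cong suc (ℕP.+-suc (dbl a) j)))

dbl-inj : ∀ u a → u ℕ.+ u ≡ dbl a → u ≡ a
dbl-inj zero    zero    e = refl
dbl-inj (suc u) (suc a) e = cong suc (dbl-inj u a (ℕP.suc-injective (trans (sym (ℕP.+-suc u u)) (ℕP.suc-injective e))))
dbl-inj zero    (suc a) ()
dbl-inj (suc u) zero    ()

W-axial : ∀ a d → Axial 0 (dbl a) (W a d)
W-axial a (suc d) zero u p with ℕP.≡ᵇ⇒≡ u a (subst T (sym p) _)
... | refl = trans (sym (dbl≡+ u)) (sym (ℕP.+-identityʳ _))
W-axial a (suc d) (suc (suc j)) u p = trans (W-axial (suc a) d j u p) (dbl-suc a j)

W-mirrored : ∀ a d → Mirrored 0 (dbl a) (W a d)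
W-mirrored a zero    j u u′ h = refl
W-mirrored a (suc d) zero u u′ h with u ℕ.≡ᵇ a in eq | u′ ℕ.≡ᵇ a in eq′
... | true  | true  = refl
... | false | false = refl
... | true  | false with ℕP.≡ᵇ⇒≡ u a (subst T (sym eq) _)
...   | refl = ⊥-elim (subst T eq′ (ℕP.≡⇒≡ᵇ u′ u (ℕP.+-cancelˡ-≡ u u′ u (trans h (trans (ℕP.+-identityʳ _) (dbl≡+ u))))))
W-mirrored a (suc d) zero u u′ h | false | true with ℕP.≡ᵇ⇒≡ u′ a (subst T (sym eq′) _)
...   | refl = ⊥-elim (subst T eq (ℕP.≡⇒≡ᵇ u u′ (ℕP.+-cancelʳ-≡ u′ u u′ (trans h (trans (ℕP.+-identityʳ _) (dbl≡+ u′))))))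
W-mirrored a (suc d) (suc zero) u u′ h = refl
W-mirrored a (suc d) (suc (suc j)) u u′ h = W-mirrored (suc a) d j u u′ (trans h (sym (dbl-suc a j)))

delay-axial : ∀ s w → Axial 0 s w → Axial 1 s (delay w)
delay-axial s w ax (suc j) u p = trans (cong suc (ax j u p)) (sym (ℕP.+-suc s j))

delay-mirrored : ∀ s w → Mirrored 0 s w → Mirrored 1 s (delay w)
delay-mirrored s w sy zero    u u′ h = refl
delay-mirrored s w sy (suc j) u u′ h = sy j u u′ (ℕP.suc-injective (trans h (ℕP.+-suc s j)))

-- Half-line form of the symmetric part

pc-shift₁ : ∀ a d n j u k → pc (delay (W (suc a) d)) n j u k ≡ pc (W a (suc d)) n (suc j) u k
arr-shift₁ : ∀ a d n j u k → arr (delay (W (suc a) d)) n (suc j) u k ≡ arr (W a (suc d)) n (suc (suc j)) u k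
arr-shift₁ a d n j u k with W (suc a) d j u
... | true  = refl
... | false = pc-shift₁ a d n (suc j) u k
pc-shift₁ a d zero    j u k = refl
pc-shift₁ a d (suc n) j u k = cong₂ _+_ (arr-shift₁ a d n j u k) (arr-shift₁ a d n j (suc u) k)

pc-two-free : ∀ n u k → let F = λ v → pc noWall n 0 v k in
  pc noWall (suc (suc n)) 0 u k ≡ (F u + F (suc u)) + (F (suc u) + F (suc (suc u)))
pc-two-free n u k = cong₂ _+_ (cong₂ _+_ (f u) (f (suc u))) (cong₂ _+_ (f (suc u)) (f (suc (suc u))))
  where f = λ v → pc-free noWall n 2 v k (λ _ _ → refl)

opaque
  unfolding ℚ-ring
  pair-step : ∀ x y z x′ y′ z′ → ((x + y) + (y + z)) + ((x′ + y′) + (y′ + z′)) ≡ ((x + x′) + (y + y′)) + ((y + y′) + (z + z′))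
  pair-step = solve-∀ ℚ-ring
  edge-31 : ∀ x y → (y + x) + (x + x) ≡ 3ℚ * x + 1ℚ * y
  edge-31 = solve-∀ ℚ-ring
  edge-22 : ∀ x y → (y + x) + (x + y) ≡ 2ℚ * x + 2ℚ * y
  edge-22 = solve-∀ ℚ-ring
  edge-21 : ∀ x y → (y + x) + (x + 0ℚ) ≡ 2ℚ * x + 1ℚ * y
  edge-21 = solve-∀ ℚ-ring
  edge-11 : ∀ x y x′ y′ → ((x + y) + 0ℚ) + ((x′ + y′) + 0ℚ) ≡ 1ℚ * (y + y′) + 1ℚ * (x + x′)
  edge-11 = solve-∀ ℚ-ring
  rev-step : ∀ x y z → (x + y) + (y + z) ≡ (z + y) + (y + x)
  rev-step = solve-∀ ℚ-ring
  2*1 : 1ℚ + 1ℚ ≡ 2ℚ * 1ℚ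
  2*1 = refl
  0+0 : ∀ x → 0ℚ + 0ℚ ≡ x * 0ℚ
  0+0 = solve-∀ ℚ-ring

lower-equal : ∀ {u y k j a} → u ℕ.+ suc y ≡ a → k ℕ.+ suc j ≡ a → [ u ≟ k ] ≡ δ j y
lower-equal {u} {y} {k} {j} h h′ = [≟]-iff {u} {k} {y} {j}
  (λ { refl → ℕP.suc-injective (ℕP.+-cancelˡ-≡ u _ _ (trans h (sym h′))) })
  (λ { refl → ℕP.+-cancelʳ-≡ (suc y) _ _ (trans h (sym h′)) })

-- Here y + ½ is the distance of u from the axis. Summing over the end point and its mirror image
-- makes the count symmetric in the start, so the point across the axis repeats the value at
-- distance y = 0: a reflecting boundary.
evenFree₁ : ∀ l a u y k k′ j → u ℕ.+ suc y ≡ a → k ℕ.+ suc j ≡ a ℕ.+ l → suc (k ℕ.+ k′) ≡ dbl (a ℕ.+ l) →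
  pc noWall (dbl l) 0 u k + pc noWall (dbl l) 0 u k′ ≡ iter Tr.step l (δ j) y
evenFree₁ zero a u y k k′ j h₁ h₂ h₃ = trans (cong₂ _+_
    (lower-equal {u} {y} {k} {j} h₁ (trans h₂ (ℕP.+-identityʳ a)))
    ([≟]-false {u} {k′} (λ e → ℕP.<-irrefl (trans (cong (λ z → suc (k ℕ.+ z)) e) bad) lt))) (+-identityʳ _)
  where
  u<a : suc u ℕ.≤ a
  u<a = subst (suc u ℕ.≤_) (trans (sym (ℕP.+-suc u y)) h₁) (ℕP.m≤m+n (suc u) y)
  k<a : suc k ℕ.≤ a
  k<a = subst (suc k ℕ.≤_) (trans (sym (ℕP.+-suc k j)) (trans h₂ (ℕP.+-identityʳ a))) (ℕP.m≤m+n (suc k) j)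
  bad : suc (k ℕ.+ k′) ≡ a ℕ.+ a
  bad = trans h₃ (trans (cong dbl (ℕP.+-identityʳ a)) (dbl≡+ a))
  lt : suc (k ℕ.+ u) ℕ.< a ℕ.+ a
  lt = subst (ℕ._≤ a ℕ.+ a) (cong suc (ℕP.+-suc k u)) (ℕP.+-mono-≤ k<a u<a)
evenFree₁ (suc l) a u y k k′ j h₁ h₂ h₃ = trans (cong₂ _+_ (pc-two-free n u k) (pc-two-free n u k′)) (trans (pair-step _ _ _ _ _ _) (go y h₁))
  where
  n = dbl l
  F = λ v → pc noWall n 0 v k + pc noWall n 0 v k′
  h₂′ : k ℕ.+ suc j ≡ suc a ℕ.+ l
  h₂′ = trans h₂ (ℕP.+-suc a l)
  h₃′ : suc (k ℕ.+ k′) ≡ dbl (suc a ℕ.+ l)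
  h₃′ = trans h₃ (cong dbl (ℕP.+-suc a l))
  ih : ∀ v y → v ℕ.+ suc y ≡ suc a → F v ≡ iter Tr.step l (δ j) y
  ih v y h = evenFree₁ l (suc a) v y k k′ j h h₂′ h₃′
  up : ∀ u y → u ℕ.+ suc y ≡ a → u ℕ.+ suc (suc y) ≡ suc a
  up u y h = trans (ℕP.+-suc u (suc y)) (cong suc h)
  go : ∀ y → u ℕ.+ suc y ≡ a → (F u + F (suc u)) + (F (suc u) + F (suc (suc u))) ≡ Tr.step (iter Tr.step l (δ j)) y
  go zero h = trans (cong₂ _+_ (cong₂ _+_ (ih u 1 (up u 0 h)) (ih (suc u) 0 (cong suc h)))
     (cong₂ _+_ (ih (suc u) 0 (cong suc h)) (trans flipped (ih (suc u) 0 (cong suc h))))) (edge-31 _ _)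
    where
    ax : suc (suc (suc u) ℕ.+ suc u) ≡ dbl (suc a) ℕ.+ 0
    ax = sym (trans (ℕP.+-identityʳ _) (trans (cong (dbl ∘ suc) (trans (sym h) (ℕP.+-comm u 1))) (cong (suc ∘ suc) (trans (dbl≡+ (suc u)) refl))))
    ax₂ : suc (k ℕ.+ k′) ≡ dbl (suc a) ℕ.+ (0 ℕ.+ n)
    ax₂ = trans h₃′ (trans (dbl≡+ (suc a ℕ.+ l)) (trans (mid (suc a) l) (cong₂ ℕ._+_ (sym (dbl≡+ (suc a))) (sym (dbl≡+ l)))))
      where
      mid : ∀ a l → (a ℕ.+ l) ℕ.+ (a ℕ.+ l) ≡ (a ℕ.+ a) ℕ.+ (l ℕ.+ l)
      mid = solve-∀ ℕ-ring
    flipped : F (suc (suc u)) ≡ F (suc u)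
    flipped = trans (cong₂ _+_ (pc-mirror 1 (dbl (suc a)) noWall (λ _ _ _ _ → refl) n 0 (suc (suc u)) (suc u) k k′ ax ax₂)
                               (pc-mirror 1 (dbl (suc a)) noWall (λ _ _ _ _ → refl) n 0 (suc (suc u)) (suc u) k′ k ax (trans (cong suc (ℕP.+-comm k′ k)) ax₂)))
                    (+-comm _ _)
  go (suc y) h = trans (cong₂ _+_ (cong₂ _+_ (ih u (suc (suc y)) (up u (suc y) h)) (ih (suc u) (suc y) (cong suc h)))
     (cong₂ _+_ (ih (suc u) (suc y) (cong suc h)) (ih (suc (suc u)) y (cong suc (trans (sym (ℕP.+-suc u (suc y))) h))))) (rev-step _ _ _)

-- The walls are met first, at the intermediate axis points of the first d double steps. Next to the
-- axis the step towards it is blocked, which turns `Tr` into `Tk`.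
evenWalls₁ : ∀ d l a u y k k′ j → u ℕ.+ suc y ≡ a → k ℕ.+ suc j ≡ a ℕ.+ (d ℕ.+ l) → suc (k ℕ.+ k′) ≡ dbl (a ℕ.+ (d ℕ.+ l)) →
  pc (delay (W a d)) (dbl (d ℕ.+ l)) 0 u k + pc (delay (W a d)) (dbl (d ℕ.+ l)) 0 u k′ ≡ iter Tk.step d (iter Tr.step l (δ j)) y
evenWalls₁ zero l a u y k k′ j h₁ h₂ h₃ = trans (cong₂ _+_ (free k) (free k′)) (evenFree₁ l a u y k k′ j h₁ h₂ h₃)
  where free = λ k → pc-free (delay (W a 0)) (dbl l) 0 u k (λ { zero _ → refl ; (suc _) _ → refl })
evenWalls₁ (suc d) l a u y k k′ j h₁ h₂ h₃ = trans (cong₂ _+_ (two k) (two k′)) (go y h₁)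
  where
  n = dbl (d ℕ.+ l)
  P : ℕ → ℕ → ℚ
  P k v = pc (delay (W (suc a) d)) n 0 v k
  F = λ v → P k v + P k′ v
  blocked : Bool → ℚ → ℚ
  blocked b x = if b then 0ℚ else x
  two : ∀ k → pc (delay (W a (suc d))) (suc (suc n)) 0 u k ≡ blocked (u ℕ.≡ᵇ a) (P k u + P k (suc u)) + blocked (suc u ℕ.≡ᵇ a) (P k (suc u) + P k (suc (suc u)))
  two k = cong₂ (λ x y → blocked (u ℕ.≡ᵇ a) x + blocked (suc u ℕ.≡ᵇ a) y) (cong₂ _+_ (p u) (p (suc u))) (cong₂ _+_ (p (suc u)) (p (suc (suc u))))
    where
    p : ∀ v → pc (delay (W a (suc d))) n 2 v k ≡ P k v
    p v = trans (pc-delay (W a (suc d)) n 1 v k) (sym (pc-shift₁ a d n 0 v k))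
  h₂′ : k ℕ.+ suc j ≡ suc a ℕ.+ (d ℕ.+ l)
  h₂′ = trans h₂ (ℕP.+-suc a (d ℕ.+ l))
  h₃′ : suc (k ℕ.+ k′) ≡ dbl (suc a ℕ.+ (d ℕ.+ l))
  h₃′ = trans h₃ (cong dbl (ℕP.+-suc a (d ℕ.+ l)))
  ih : ∀ v y → v ℕ.+ suc y ≡ suc a → F v ≡ iter Tk.step d (iter Tr.step l (δ j)) y
  ih v y h = evenWalls₁ d l (suc a) v y k k′ j h h₂′ h₃′
  up : ∀ u y → u ℕ.+ suc y ≡ a → u ℕ.+ suc (suc y) ≡ suc a
  up u y h = trans (ℕP.+-suc u (suc y)) (cong suc h)
  unblock : ∀ v x → v ℕ.< a → blocked (v ℕ.≡ᵇ a) x ≡ x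
  unblock v x v<a with v ℕ.≡ᵇ a in eq
  ... | false = refl
  ... | true  = ⊥-elim (ℕP.<-irrefl (ℕP.≡ᵇ⇒≡ v a (subst T (sym eq) _)) v<a)
  block : ∀ v x → v ≡ a → blocked (v ℕ.≡ᵇ a) x ≡ 0ℚ
  block v x v≡a with v ℕ.≡ᵇ a in eq
  ... | true  = refl
  ... | false = ⊥-elim (subst T eq (ℕP.≡⇒≡ᵇ v a v≡a))
  u<a : ∀ {u y} → u ℕ.+ suc y ≡ a → u ℕ.< a
  u<a {u} {y} h = subst (u ℕ.<_) (trans (sym (ℕP.+-suc u y)) h) (ℕP.m≤m+n (suc u) y)
  R : ℕ → ℚ
  R k = blocked (u ℕ.≡ᵇ a) (P k u + P k (suc u)) + blocked (suc u ℕ.≡ᵇ a) (P k (suc u) + P k (suc (suc u)))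
  go : ∀ y → u ℕ.+ suc y ≡ a → R k + R k′ ≡ Tk.step (iter Tk.step d (iter Tr.step l (δ j))) y
  go zero h = trans (cong₂ _+_ (r k) (r k′)) (trans (edge-11 _ _ _ _) (cong₂ (λ x y → 1ℚ * x + 1ℚ * y) (ih (suc u) 0 (cong suc h)) (ih u 1 (up u 0 h))))
    where
    r : ∀ k → R k ≡ (P k u + P k (suc u)) + 0ℚ
    r k = cong₂ _+_ (unblock u _ (u<a h)) (block (suc u) _ (trans (ℕP.+-comm 1 u) h))
  go (suc y) h = trans (cong₂ _+_ (r k) (r k′)) (trans (pair-step _ _ _ _ _ _)
    (trans (cong₂ _+_ (cong₂ _+_ (ih u (suc (suc y)) (up u (suc y) h)) (ih (suc u) (suc y) (cong suc h)))
             (cong₂ _+_ (ih (suc u) (suc y) (cong suc h)) (ih (suc (suc u)) y (cong suc h″)))) (rev-step _ _ _)))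
    where
    h″ : suc u ℕ.+ suc y ≡ a
    h″ = trans (sym (ℕP.+-suc u (suc y))) h
    r : ∀ k → R k ≡ (P k u + P k (suc u)) + (P k (suc u) + P k (suc (suc u)))
    r k = cong₂ _+_ (unblock u _ (u<a h)) (unblock (suc u) _ (u<a h″))

-- An end point on the axis is its own mirror image and is counted twice; hence the 2 at distance 0.
δ₂ : ℕ → Fun
δ₂ zero    y = 2ℚ * δ 0 y
δ₂ (suc j) y = 1ℚ * δ (suc j) y

evenFree₂ : ∀ l a u y k k′ j → u ℕ.+ y ≡ a → k ℕ.+ j ≡ a ℕ.+ l → k ℕ.+ k′ ≡ dbl (a ℕ.+ l) →
  pc noWall (dbl l) 0 u k + pc noWall (dbl l) 0 u k′ ≡ iter Ti.step l (δ₂ j) y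
evenFree₂ zero a u y k k′ j h₁ h₂ h₃ = base j y h₁ (trans h₂ (ℕP.+-identityʳ a))
  where
  k+k′ : k ℕ.+ k′ ≡ a ℕ.+ a
  k+k′ = trans h₃ (trans (cong dbl (ℕP.+-identityʳ a)) (dbl≡+ a))
  base : ∀ j y → u ℕ.+ y ≡ a → k ℕ.+ j ≡ a → [ u ≟ k ] + [ u ≟ k′ ] ≡ δ₂ j y
  base zero zero h h′ = trans (cong₂ _+_ ([≟]-true {u} {k} u≡k) ([≟]-true {u} {k′} u≡k′)) 2*1
    where
    u≡a = trans (sym (ℕP.+-identityʳ u)) h
    k≡a = trans (sym (ℕP.+-identityʳ k)) h′
    u≡k = trans u≡a (sym k≡a)
    u≡k′ = trans u≡a (sym (ℕP.+-cancelˡ-≡ k k′ a (trans k+k′ (cong (ℕ._+ a) (sym k≡a)))))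
  base zero (suc y) h h′ = trans (cong₂ _+_ ([≟]-false {u} {k} (λ e → ℕP.<-irrefl (trans e k≡a) u<a)) ([≟]-false {u} {k′} (λ e → ℕP.<-irrefl (trans e k′≡a) u<a))) (0+0 2ℚ)
    where
    u<a : u ℕ.< a
    u<a = subst (u ℕ.<_) (trans (sym (ℕP.+-suc u y)) h) (ℕP.m≤m+n (suc u) y)
    k≡a = trans (sym (ℕP.+-identityʳ k)) h′
    k′≡a = ℕP.+-cancelˡ-≡ k k′ a (trans k+k′ (cong (ℕ._+ a) (sym k≡a)))
  base (suc j) y h h′ = trans (cong₂ _+_ (eq y h) ([≟]-false {u} {k′} λ e → ℕP.<-irrefl (trans (cong (k ℕ.+_) e) k+k′) lt)) (trans (+-identityʳ _) (sym (*-identityˡ _)))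
    where
    k<a : k ℕ.< a
    k<a = subst (k ℕ.<_) (trans (sym (ℕP.+-suc k j)) h′) (ℕP.m≤m+n (suc k) j)
    lt : k ℕ.+ u ℕ.< a ℕ.+ a
    lt = ℕP.+-mono-<-≤ k<a (subst (u ℕ.≤_) h (ℕP.m≤m+n u y))
    eq : ∀ y → u ℕ.+ y ≡ a → [ u ≟ k ] ≡ δ (suc j) y
    eq y h = [≟]-iff {u} {k} {y} {suc j} (λ { refl → ℕP.+-cancelˡ-≡ u _ _ (trans h (sym h′)) }) (λ { refl → ℕP.+-cancelʳ-≡ (suc j) _ _ (trans h (sym h′)) })
evenFree₂ (suc l) a u y k k′ j h₁ h₂ h₃ = trans (cong₂ _+_ (pc-two-free n u k) (pc-two-free n u k′)) (trans (pair-step _ _ _ _ _ _) (go y h₁))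
  where
  n = dbl l
  F = λ v → pc noWall n 0 v k + pc noWall n 0 v k′
  h₂′ : k ℕ.+ j ≡ suc a ℕ.+ l
  h₂′ = trans h₂ (ℕP.+-suc a l)
  h₃′ : k ℕ.+ k′ ≡ dbl (suc a ℕ.+ l)
  h₃′ = trans h₃ (cong dbl (ℕP.+-suc a l))
  ih : ∀ v y → v ℕ.+ y ≡ suc a → F v ≡ iter Ti.step l (δ₂ j) y
  ih v y h = evenFree₂ l (suc a) v y k k′ j h h₂′ h₃′
  up : ∀ u y → u ℕ.+ y ≡ a → u ℕ.+ suc y ≡ suc a
  up u y h = trans (ℕP.+-suc u y) (cong suc h)
  go : ∀ y → u ℕ.+ y ≡ a → (F u + F (suc u)) + (F (suc u) + F (suc (suc u))) ≡ Ti.step (iter Ti.step l (δ₂ j)) y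
  go zero h = trans (cong₂ _+_ (cong₂ _+_ (ih u 1 (up u 0 h)) (ih (suc u) 0 (cong suc h)))
     (cong₂ _+_ (ih (suc u) 0 (cong suc h)) (trans flipped (ih u 1 (up u 0 h))))) (edge-22 _ _)
    where
    ax : suc (suc u) ℕ.+ u ≡ dbl (suc a) ℕ.+ 0
    ax = sym (trans (ℕP.+-identityʳ _) (cong (suc ∘ suc) (trans (cong dbl (trans (sym h) (ℕP.+-identityʳ u))) (dbl≡+ u))))
    ax₂ : k ℕ.+ k′ ≡ dbl (suc a) ℕ.+ (0 ℕ.+ n)
    ax₂ = trans h₃′ (trans (dbl≡+ (suc a ℕ.+ l)) (trans (mid (suc a) l) (cong₂ ℕ._+_ (sym (dbl≡+ (suc a))) (sym (dbl≡+ l)))))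
      where
      mid : ∀ a l → (a ℕ.+ l) ℕ.+ (a ℕ.+ l) ≡ (a ℕ.+ a) ℕ.+ (l ℕ.+ l)
      mid = solve-∀ ℕ-ring
    flipped : F (suc (suc u)) ≡ F u
    flipped = trans (cong₂ _+_ (pc-mirror 0 (dbl (suc a)) noWall (λ _ _ _ _ → refl) n 0 (suc (suc u)) u k k′ ax ax₂)
                               (pc-mirror 0 (dbl (suc a)) noWall (λ _ _ _ _ → refl) n 0 (suc (suc u)) u k′ k ax (trans (ℕP.+-comm k′ k) ax₂)))
                    (+-comm _ _)
  go (suc y) h = trans (cong₂ _+_ (cong₂ _+_ (ih u (suc (suc y)) (up u (suc y) h)) (ih (suc u) (suc y) (cong suc h)))
     (cong₂ _+_ (ih (suc u) (suc y) (cong suc h)) (ih (suc (suc u)) y (cong suc (trans (sym (ℕP.+-suc u y)) h))))) (rev-step _ _ _)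

-- Here the walls occupy the axis points reached after each double step, the start and the last wall
-- included. So the value on the axis is 0 during the d blocked steps, and the remaining function is
-- read off the axis, hence `∘ suc`.
evenWalls₂ : ∀ d l a u y k k′ j → u ℕ.+ suc y ≡ a → k ℕ.+ j ≡ a ℕ.+ (d ℕ.+ l) → k ℕ.+ k′ ≡ dbl (a ℕ.+ (d ℕ.+ l)) →
  arr (W a (suc d)) (dbl (d ℕ.+ l)) 0 u k + arr (W a (suc d)) (dbl (d ℕ.+ l)) 0 u k′ ≡ iter Dk.step d (iter Ti.step l (δ₂ j) ∘ suc) y
evenWalls₂ d l a u y k k′ j h₁ h₂ h₃ = trans (cong₂ _+_ (open-start k) (open-start k′)) (main d y h₁ h₂ h₃)
  where
  open-start : ∀ k → arr (W a (suc d)) (dbl (d ℕ.+ l)) 0 u k ≡ pc (W a (suc d)) (dbl (d ℕ.+ l)) 0 u k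
  open-start k with u ℕ.≡ᵇ a in eq
  ... | false = refl
  ... | true  = ⊥-elim (ℕP.<-irrefl (ℕP.≡ᵇ⇒≡ u a (subst T (sym eq) _)) (subst (u ℕ.<_) (trans (sym (ℕP.+-suc u y)) h₁) (ℕP.m≤m+n (suc u) y)))
  main : ∀ d y → u ℕ.+ suc y ≡ a → k ℕ.+ j ≡ a ℕ.+ (d ℕ.+ l) → k ℕ.+ k′ ≡ dbl (a ℕ.+ (d ℕ.+ l)) →
    pc (W a (suc d)) (dbl (d ℕ.+ l)) 0 u k + pc (W a (suc d)) (dbl (d ℕ.+ l)) 0 u k′ ≡ iter Dk.step d (iter Ti.step l (δ₂ j) ∘ suc) y
  main zero y h₁ h₂ h₃ = trans (cong₂ _+_ (free k) (free k′)) (evenFree₂ l a u (suc y) k k′ j h₁ h₂ h₃)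
    where
    free : ∀ k → pc (W a 1) (dbl l) 0 u k ≡ pc noWall (dbl l) 0 u k
    free k = pc-cong (W a 1) noWall (dbl l) 0 u k (λ { zero _ → refl ; (suc _) _ → refl })
  main (suc d) y h₁ h₂ h₃ = trans (cong₂ _+_ (pc-two a (suc d) n u k) (pc-two a (suc d) n u k′)) (trans (pair-step _ _ _ _ _ _) (go y h₁))
    where
    n = dbl (d ℕ.+ l)
    F = λ v → arr (W (suc a) (suc d)) n 0 v k + arr (W (suc a) (suc d)) n 0 v k′
    h₂′ : k ℕ.+ j ≡ suc a ℕ.+ (d ℕ.+ l)
    h₂′ = trans h₂ (ℕP.+-suc a (d ℕ.+ l))
    h₃′ : k ℕ.+ k′ ≡ dbl (suc a ℕ.+ (d ℕ.+ l))
    h₃′ = trans h₃ (cong dbl (ℕP.+-suc a (d ℕ.+ l)))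
    ih : ∀ v y → v ℕ.+ suc y ≡ suc a → F v ≡ iter Dk.step d (iter Ti.step l (δ₂ j) ∘ suc) y
    ih v y h = evenWalls₂ d l (suc a) v y k k′ j h h₂′ h₃′
    up : ∀ u y → u ℕ.+ suc y ≡ a → u ℕ.+ suc (suc y) ≡ suc a
    up u y h = trans (ℕP.+-suc u (suc y)) (cong suc h)
    go : ∀ y → u ℕ.+ suc y ≡ a → (F u + F (suc u)) + (F (suc u) + F (suc (suc u))) ≡ Dk.step (iter Dk.step d (iter Ti.step l (δ₂ j) ∘ suc)) y
    go zero h = trans (cong₂ _+_ (cong₂ _+_ (ih u 1 (up u 0 h)) (ih (suc u) 0 (cong suc h)))
       (cong₂ _+_ (ih (suc u) 0 (cong suc h)) wall)) (edge-21 _ _)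
      where
      wall : F (suc (suc u)) ≡ 0ℚ
      wall with suc u ℕ.≡ᵇ a in eq
      ... | true  = +-identityʳ 0ℚ
      ... | false = ⊥-elim (subst T eq (ℕP.≡⇒≡ᵇ (suc u) a (trans (ℕP.+-comm 1 u) h)))
    go (suc y) h = trans (cong₂ _+_ (cong₂ _+_ (ih u (suc (suc y)) (up u (suc y) h)) (ih (suc u) (suc y) (cong suc h)))
       (cong₂ _+_ (ih (suc u) (suc y) (cong suc h)) (ih (suc (suc u)) y (cong suc (trans (sym (ℕP.+-suc u (suc y))) h))))) (rev-step _ _ _)

-- Reversal of ranges and its sign

range-∈ : ∀ {k} r n → r ℕ.≤ k → k ℕ.< r ℕ.+ n → k ∈ range r n
range-∈ {k} r zero    h h′ = ⊥-elim (ℕP.<-irrefl refl (ℕP.<-≤-trans h′ (subst (ℕ._≤ k) (sym (ℕP.+-identityʳ r)) h)))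
range-∈ {k} r (suc n) h h′ with r ℕ.≟ k
... | yes refl = here refl
... | no  r≢k  = there (range-∈ (suc r) n (ℕP.≤∧≢⇒< h r≢k) (subst (k ℕ.<_) (ℕP.+-suc r n) h′))

range-downFrom : ∀ r n → range r n ≡ map (λ y → (r ℕ.+ n) ℕ.∸ suc y) (downFrom n)
range-downFrom r zero    = refl
range-downFrom r (suc n) = cong₂ _∷_ (sym (trans (cong (ℕ._∸ suc n) (ℕP.+-suc r n)) (ℕP.m+n∸n≡m r n)))
  (trans (range-downFrom (suc r) n) (LP.map-cong (λ y → cong (ℕ._∸ suc y) (sym (ℕP.+-suc r n))) (downFrom n)))

map-∸-range : ∀ C r r′ n → r ℕ.+ r′ ℕ.+ n ≡ suc C → map (C ℕ.∸_) (range r n) ≡ reverse (range r′ n)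
map-∸-range C r r′ zero    h = refl
map-∸-range C r r′ (suc n) h = trans (cong₂ _∷_ top (map-∸-range C (suc r) r′ n (trans (sym (ℕP.+-suc (r ℕ.+ r′) n)) h)))
  (sym (trans (cong reverse (range-snoc r′ n)) (LP.reverse-++ (range r′ n) (r′ ℕ.+ n ∷ []))))
  where
  top : C ℕ.∸ r ≡ r′ ℕ.+ n
  top = trans (cong (ℕ._∸ r) (ℕP.suc-injective (trans (sym h) (trans (ℕP.+-suc (r ℕ.+ r′) n) (cong suc (ℕP.+-assoc r r′ n)))))) (ℕP.m+n∸m≡n r (r′ ℕ.+ n))

revSgn : ℕ → ℚ
revSgn zero    = 1ℚ
revSgn (suc n) = sgn n * revSgn n

revSgn² : ∀ n → revSgn n * revSgn n ≡ 1ℚ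
revSgn² zero    = *-identityˡ 1ℚ
revSgn² (suc n) = trans (*-interchange _ _ _ _) (trans (cong₂ _*_ (sgn² n) (revSgn² n)) (*-identityˡ 1ℚ))

sgn-dbl : ∀ n → sgn (dbl n) ≡ 1ℚ
sgn-dbl zero    = refl
sgn-dbl (suc n) = trans (neg-neg _) (sgn-dbl n)
  where
  opaque
    unfolding ℚ-ring
    neg-neg : ∀ x → - (- x) ≡ x
    neg-neg = solve-∀ ℚ-ring

module _ {A B : Set} (m : A → B → ℚ) where

  det-reverseRows : ∀ as bs → det m (reverse as) bs ≡ revSgn (length as) * det m as bs
  det-reverseRows []       bs = sym (*-identityˡ _)
  det-reverseRows (a ∷ as) bs = begin
    det m (reverse (a ∷ as)) bs             ≡⟨ cong (λ L → det m L bs) (LP.unfold-reverse a as) ⟩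
    det m (reverse as ++ a ∷ []) bs         ≡⟨ det-move m (reverse as) a [] bs ⟩
    sgn (length (reverse as)) * det m (a ∷ reverse as ++ []) bs
      ≡⟨ cong₂ (λ n L → sgn n * det m (a ∷ L) bs) (LP.length-reverse as) (LP.++-identityʳ (reverse as)) ⟩
    sgn (length as) * det m (a ∷ reverse as) bs
      ≡⟨ *-congˡ (trans (altS-cong (λ b cs → trans (*-congˡ (det-reverseRows as cs)) (*-left-comm _ _ _)) bs) (altS-* (λ b cs → m a b * det m as cs) (revSgn (length as)) bs)) ⟩
    sgn (length as) * (revSgn (length as) * det m (a ∷ as) bs)
      ≡⟨ sym (*-assoc _ _ _) ⟩
    revSgn (suc (length as)) * det m (a ∷ as) bs ∎
    where open ≡-Reasoning

module _ {A B : Set} (m : A → B → ℚ) where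

  det-reverseCols : ∀ as bs → det m as (reverse bs) ≡ revSgn (length bs) * det m as bs
  det-reverseCols as bs = trans (det-transpose m as (reverse bs))
    (trans (det-reverseRows (flip m) bs as) (*-congˡ (sym (det-transpose m as bs))))

arr-mirror : ∀ e s w → Mirrored e s w → ∀ n j u u′ k k′ → e ℕ.+ (u ℕ.+ u′) ≡ s ℕ.+ j → e ℕ.+ (k ℕ.+ k′) ≡ s ℕ.+ (j ℕ.+ n) →
  arr w n j u k ≡ arr w n j u′ k′
arr-mirror e s w sy n j u u′ k k′ h h′ rewrite sy j u u′ h with w j u′
... | true  = refl
... | false = pc-mirror e s w sy n j u u′ k k′ h h′

∸-+ : ∀ {k C} → k ℕ.≤ C → k ℕ.+ (C ℕ.∸ k) ≡ C
∸-+ {k} {C} h = trans (ℕP.+-comm k _) (ℕP.m∸n+n≡m h)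

suc-∸-+ : ∀ {k C} → k ℕ.< C → suc (k ℕ.+ (C ℕ.∸ suc k)) ≡ C
suc-∸-+ h = ∸-+ h

∸-suc-+ : ∀ {C y} → y ℕ.< C → (C ℕ.∸ suc y) ℕ.+ suc y ≡ C
∸-suc-+ h = ℕP.m∸n+n≡m h

dbl-+ : ∀ a n → dbl (a ℕ.+ n) ≡ dbl a ℕ.+ dbl n
dbl-+ zero    n = refl
dbl-+ (suc a) n = cong (suc ∘ suc) (dbl-+ a n)

-- The case b = c and the determination of all counts

module Diagonal (a : ℕ) where
  open Intrusion a

  idx-< : ∀ {i} → i ∈ idx → i ℕ.≤ dbl a
  idx-< p with MemP.∈-++⁻ (range 0 a) p
  ... | inj₁ q = ℕP.≤-trans (ℕP.<⇒≤ (proj₂ (∈-range 0 a q))) (subst (a ℕ.≤_) (sym (dbl≡+ a)) (ℕP.m≤m+n a a))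
  ... | inj₂ q = subst (_ ℕ.≤_) (sym (dbl≡+ a)) (ℕP.≤-pred (proj₂ (∈-range (suc a) a q)))

  idx-mirror : map (dbl a ℕ.∸_) idx ≡ reverse idx
  idx-mirror = trans (LP.map-++ (dbl a ℕ.∸_) (range 0 a) (range (suc a) a))
    (trans (cong₂ _++_ (map-∸-range (dbl a) 0 (suc a) a (cong suc (sym (dbl≡+ a))))
                       (map-∸-range (dbl a) (suc a) 0 a (trans (cong (ℕ._+ a) (ℕP.+-identityʳ (suc a))) (cong suc (sym (dbl≡+ a))))))
           (sym (LP.reverse-++ (range 0 a) (range (suc a) a))))

  wall : ℕ → ℕ → ℕ → ℕ → ℚ
  wall d t i k = at (wallRow d i) t k
    where open Row

  wall-mirror : ∀ d t i k → i ℕ.≤ dbl a → k ℕ.≤ dbl a ℕ.+ (t ℕ.+ dbl d) →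
    wall d t i k ≡ wall d t (dbl a ℕ.∸ i) ((dbl a ℕ.+ (t ℕ.+ dbl d)) ℕ.∸ k)
  wall-mirror d t i k hi hk = arr-mirror 0 (dbl a) (W a (suc d)) (W-mirrored a (suc d)) (t ℕ.+ dbl d) 0 i (dbl a ℕ.∸ i) k _
    (trans (∸-+ hi) (sym (ℕP.+-identityʳ _))) (∸-+ hk)

  -- Reflection in the axis reverses both the rows and the columns; the two lists have the same
  -- length, so the signs cancel.
  XT-sym : ∀ d t r r′ → r ℕ.+ r′ ≡ suc (t ℕ.+ dbl d) → XT d t r ≡ XT d t r′
  XT-sym d t r r′ h = begin
    XT d t r                                    ≡⟨ win-map (wallRow d) idx t r (dbl a) ⟩
    det m idx cols                              ≡⟨ det-congP (_∈ idx) (_∈ cols) (λ i k p q → wall-mirror d t i k (idx-< p) (bound k q)) (All.tabulate id) (All.tabulate id) ⟩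
    det (λ i k → m (dbl a ℕ.∸ i) (C ℕ.∸ k)) idx cols ≡⟨ sym (det-map m (dbl a ℕ.∸_) (C ℕ.∸_) idx cols) ⟩
    det m (map (dbl a ℕ.∸_) idx) (map (C ℕ.∸_) cols) ≡⟨ cong₂ (det m) idx-mirror (map-∸-range C r r′ (dbl a) sum) ⟩
    det m (reverse idx) (reverse cols′)         ≡⟨ trans (det-reverseRows m idx (reverse cols′)) (*-congˡ (det-reverseCols m idx cols′)) ⟩
    revSgn (length idx) * (revSgn (length cols′) * det m idx cols′) ≡⟨ cong (λ n → revSgn (length idx) * (revSgn n * det m idx cols′)) lens ⟩
    revSgn (length idx) * (revSgn (length idx) * det m idx cols′)   ≡⟨ trans (sym (*-assoc _ _ _)) (trans (*-congʳ (revSgn² (length idx))) (*-identityˡ _)) ⟩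
    det m idx cols′                             ≡⟨ sym (win-map (wallRow d) idx t r′ (dbl a)) ⟩
    XT d t r′                                   ∎
    where
    open ≡-Reasoning
    m = wall d t
    C = dbl a ℕ.+ (t ℕ.+ dbl d)
    cols = range r (dbl a)
    cols′ = range r′ (dbl a)
    sum : r ℕ.+ r′ ℕ.+ dbl a ≡ suc C
    sum = trans (cong (ℕ._+ dbl a) h) (cong suc (ℕP.+-comm (t ℕ.+ dbl d) (dbl a)))
    lens : length cols′ ≡ length idx
    lens = trans (length-range r′ (dbl a)) (sym (trans (LP.length-++ (range 0 a)) (trans (cong₂ ℕ._+_ (length-range 0 a) (length-range (suc a) a)) (sym (dbl≡+ a)))))
    bound : ∀ k → k ∈ cols → k ℕ.≤ C
    bound k q = ℕP.≤-pred (ℕP.≤-trans (proj₂ (∈-range r (dbl a) q)) (subst (r ℕ.+ dbl a ℕ.≤_) sum (ℕP.+-monoˡ-≤ (dbl a) (ℕP.m≤m+n r r′))))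

  YM : ℕ → ℕ → Maybe ℕ → ℕ → ℚ
  YM d t nothing  k = pc noWall t 0 (d ℕ.+ a) k
  YM d t (just i) k = wall d t i k

  YT≡ : ∀ d t r → YT d t r ≡ det (YM d t) (nothing ∷ map just idx) (range r (suc (dbl a)))
  YT≡ d t r = trans (cong (λ L → det paths (tipRow d ∷ L) (map (t ,_) (range r (suc (dbl a))))) (LP.map-∘ idx))
    (trans (det-map paths row′ (t ,_) (nothing ∷ map just idx) (range r (suc (dbl a))))
      (det-cong (λ { nothing k → refl ; (just i) k → refl }) (nothing ∷ map just idx) (range r (suc (dbl a)))))
    where
    row′ : Maybe ℕ → Row
    row′ nothing  = tipRow d
    row′ (just i) = wallRow d i

  tip-mirror : ∀ d t k → k ℕ.≤ dbl a ℕ.+ (t ℕ.+ dbl d) → YM d t nothing k ≡ YM d t nothing ((dbl a ℕ.+ (t ℕ.+ dbl d)) ℕ.∸ k)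
  tip-mirror d t k hk = pc-mirror 0 (dbl (d ℕ.+ a)) noWall (λ _ _ _ _ → refl) t 0 (d ℕ.+ a) (d ℕ.+ a) k _
    (trans (sym (dbl≡+ (d ℕ.+ a))) (sym (ℕP.+-identityʳ _)))
    (trans (∸-+ hk) (trans (shuffle (dbl a) t (dbl d)) (cong (ℕ._+ t) (sym (dbl-+ d a)))))
    where
    shuffle : ∀ x y z → x ℕ.+ (y ℕ.+ z) ≡ (z ℕ.+ x) ℕ.+ y
    shuffle = solve-∀ ℕ-ring

  -- The tip row is its own mirror image and stays in front, so 2 a rows but 2 a + 1 columns are
  -- reversed. The reversal signs differ by the sign of moving one column past 2 a others, which is
  -- 1.
  YT-sym : ∀ d t r r′ → r ℕ.+ r′ ≡ t ℕ.+ dbl d → YT d t r ≡ YT d t r′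
  YT-sym d t r r′ h = begin
    YT d t r                                    ≡⟨ YT≡ d t r ⟩
    det m rows cols                             ≡⟨ det-congP ok (_∈ cols) (λ { nothing k p q → tip-mirror d t k (bound k q) ; (just i) k p q → wall-mirror d t i k p (bound k q) }) all-ok (All.tabulate id) ⟩
    det (λ i k → m (mi i) (C ℕ.∸ k)) rows cols  ≡⟨ sym (det-map m mi (C ℕ.∸_) rows cols) ⟩
    det m (nothing ∷ map mi (map just idx)) (map (C ℕ.∸_) cols) ≡⟨ cong₂ (λ L L′ → det m (nothing ∷ L) L′) mi-rows (map-∸-range C r r′ (suc (dbl a)) sum) ⟩
    det m (nothing ∷ reverse (map just idx)) (reverse cols′)
      ≡⟨ trans (altS-cong (λ b cs → trans (*-congˡ (det-reverseRows m (map just idx) cs)) (*-left-comm _ _ _)) (reverse cols′))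
               (altS-* (λ b cs → m nothing b * det m (map just idx) cs) (revSgn (length (map just idx))) (reverse cols′)) ⟩
    revSgn (length (map just idx)) * det m rows (reverse cols′)
      ≡⟨ *-congˡ (det-reverseCols m rows cols′) ⟩
    revSgn (length (map just idx)) * (revSgn (length cols′) * det m rows cols′)
      ≡⟨ cong₂ (λ x y → revSgn x * (revSgn y * det m rows cols′)) len₁ (length-range r′ (suc (dbl a))) ⟩
    revSgn (dbl a) * ((sgn (dbl a) * revSgn (dbl a)) * det m rows cols′)
      ≡⟨ cong (λ z → revSgn (dbl a) * ((z * revSgn (dbl a)) * det m rows cols′)) (sgn-dbl a) ⟩
    revSgn (dbl a) * ((1ℚ * revSgn (dbl a)) * det m rows cols′)
      ≡⟨ trans (*-congˡ (*-congʳ (*-identityˡ _))) (trans (sym (*-assoc _ _ _)) (trans (*-congʳ (revSgn² (dbl a))) (*-identityˡ _))) ⟩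
    det m rows cols′                            ≡⟨ sym (YT≡ d t r′) ⟩
    YT d t r′                                   ∎
    where
    open ≡-Reasoning
    m = YM d t
    C = dbl a ℕ.+ (t ℕ.+ dbl d)
    rows = nothing ∷ map just idx
    cols = range r (suc (dbl a))
    cols′ = range r′ (suc (dbl a))
    mi : Maybe ℕ → Maybe ℕ
    mi nothing  = nothing
    mi (just i) = just (dbl a ℕ.∸ i)
    ok : Maybe ℕ → Set
    ok nothing  = ℕ
    ok (just i) = i ℕ.≤ dbl a
    all-ok : All ok rows
    all-ok = 0 ∷ AllP.map⁺ (All.tabulate idx-<)
    mi-rows : map mi (map just idx) ≡ reverse (map just idx)
    mi-rows = trans (sym (LP.map-∘ idx)) (trans (LP.map-∘ idx) (trans (cong (map just) idx-mirror) (LP.reverse-map just idx)))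
    sum : r ℕ.+ r′ ℕ.+ suc (dbl a) ≡ suc C
    sum = trans (cong (ℕ._+ suc (dbl a)) h) (trans (ℕP.+-suc _ (dbl a)) (cong suc (ℕP.+-comm (t ℕ.+ dbl d) (dbl a))))
    len₁ : length (map just idx) ≡ dbl a
    len₁ = trans (LP.length-map just idx) (trans (LP.length-++ (range 0 a)) (trans (cong₂ ℕ._+_ (length-range 0 a) (length-range (suc a) a)) (sym (dbl≡+ a))))
    bound : ∀ k → k ∈ cols → k ℕ.≤ C
    bound k q = ℕP.≤-pred (ℕP.≤-trans (proj₂ (∈-range r (suc (dbl a)) q)) (subst (r ℕ.+ suc (dbl a) ℕ.≤_) sum (ℕP.+-monoˡ-≤ (suc (dbl a)) (ℕP.m≤m+n r r′))))

  -- The antisymmetric parts, written without walls; this is why they depend on n = d + l only.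
  oddE oddO : ℕ → ℚ
  oddE n = det (λ i k → pc noWall (dbl n) 0 i k - pc noWall (dbl n) 0 i (dbl (a ℕ.+ n) ℕ.∸ suc k)) (range a a) (range (n ℕ.+ a) a)
  oddO n = det (λ i k → pc noWall (dbl n) 0 i k - pc noWall (dbl n) 0 i (dbl (a ℕ.+ n) ℕ.∸ k)) (range (suc a) a) (range (n ℕ.+ suc a) a)

  a≤dbl : a ℕ.≤ dbl a
  a≤dbl = subst (a ℕ.≤_) (sym (dbl≡+ a)) (ℕP.m≤m+n a a)

  ∸-bounds : ∀ {i} → i ℕ.< a → a ℕ.≤ dbl a ℕ.∸ suc i × dbl a ℕ.∸ suc i ℕ.< a ℕ.+ a
  ∸-bounds {i} h = subst (ℕ._≤ dbl a ℕ.∸ suc i) (trans (cong (ℕ._∸ a) (dbl≡+ a)) (ℕP.m+n∸n≡m a a)) (ℕP.∸-monoʳ-≤ (dbl a) h)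
    , subst (dbl a ℕ.∸ suc i ℕ.<_) (dbl≡+ a) (ℕP.∸-monoʳ-< {dbl a} {suc i} {0} ℕ.z<s (ℕP.≤-trans h a≤dbl))

  XZ-split : ∀ d l → XZ d (dbl (d ℕ.+ l)) (d ℕ.+ l) ≡ HE a d l * oddE (d ℕ.+ l)
  XZ-split d l = begin
    XZ d (dbl n) n
      ≡⟨ cong₂ (det m) (trans (cong (range 0) (dbl≡+ a)) (range-++ 0 a a)) (trans (cong (range n) (dbl≡+ a)) (range-++ n a a)) ⟩
    det m (lows ++ ups) (lowc ++ upc)
      ≡⟨ sym (det-map-id m (lows ++ ups) (lowc ++ upc)) ⟩
    det id (map m (lows ++ ups)) (lowc ++ upc)
      ≡⟨ S.split ⟩
    det id (map S.even lows) lowc * det (λ i k → m i k - m i (mc k)) ups upc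
      ≡⟨ cong₂ _*_ evenPart (det-congP (_∈ ups) (_∈ upc) (λ i k p q → pc-odd 1 (dbl a) w (delay-axial (dbl a) (W a d) (W-axial a d)) (dbl n) 0 i k (mc k) (k+mc k (upc< q))) (All.tabulate id) (All.tabulate id)) ⟩
    HE a d l * oddE n ∎
    where
    open ≡-Reasoning
    n = d ℕ.+ l
    w = delay (W a d)
    m = λ i k → pc w (dbl n) 0 i k
    mi mc : ℕ → ℕ
    mi i = dbl a ℕ.∸ suc i
    mc k = dbl (a ℕ.+ n) ℕ.∸ suc k
    lows = range 0 a
    ups = range a a
    lowc = range n a
    upc = range (n ℕ.+ a) a
    upc< : ∀ {k} → k ∈ upc → k ℕ.< dbl (a ℕ.+ n)
    upc< q = ℕP.<-≤-trans (proj₂ (∈-range (n ℕ.+ a) a q)) (subst (n ℕ.+ a ℕ.+ a ℕ.≤_) (trans (lem n a) (sym (dbl≡+ (a ℕ.+ n)))) (ℕP.m≤m+n _ n))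
      where
      lem : ∀ n a → n ℕ.+ a ℕ.+ a ℕ.+ n ≡ a ℕ.+ n ℕ.+ (a ℕ.+ n)
      lem = solve-∀ ℕ-ring
    k+mc : ∀ k → k ℕ.< dbl (a ℕ.+ n) → suc (k ℕ.+ mc k) ≡ dbl a ℕ.+ (0 ℕ.+ dbl n)
    k+mc k h = trans (suc-∸-+ h) (dbl-+ a n)
    i+mi : ∀ i → i ∈ lows → suc (i ℕ.+ mi i) ≡ dbl a ℕ.+ 0
    i+mi i p = trans (suc-∸-+ (ℕP.<-≤-trans (proj₂ (∈-range 0 a p)) a≤dbl)) (sym (ℕP.+-identityʳ _))
    sym-w = delay-mirrored (dbl a) (W a d) (W-mirrored a d)
    swap : ∀ i k k′ → i ∈ lows → suc (k ℕ.+ k′) ≡ dbl a ℕ.+ (0 ℕ.+ dbl n) → m (mi i) k ≡ m i k′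
    swap i k k′ p h = pc-mirror 1 (dbl a) w sym-w (dbl n) 0 (mi i) i k k′ (trans (cong suc (ℕP.+-comm (mi i) i)) (i+mi i p)) h
    lo : ∀ {k} → k ∈ upc → n ℕ.≤ mc k
    lo {k} q = ℕP.+-cancelʳ-≤ (suc k) n (mc k) (subst (n ℕ.+ suc k ℕ.≤_) (sym (ℕP.m∸n+n≡m (upc< q)))
      (subst (n ℕ.+ suc k ℕ.≤_) (trans (lem n a) (sym (dbl≡+ (a ℕ.+ n)))) (ℕP.+-monoʳ-≤ n (proj₂ (∈-range (n ℕ.+ a) a q)))))
      where
      lem : ∀ n a → n ℕ.+ (n ℕ.+ a ℕ.+ a) ≡ a ℕ.+ n ℕ.+ (a ℕ.+ n)
      lem = solve-∀ ℕ-ring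
    hi : ∀ {k} → k ∈ upc → mc k ℕ.< n ℕ.+ a
    hi {k} q = ℕP.+-cancelʳ-< (suc k) (mc k) (n ℕ.+ a) (subst (ℕ._< n ℕ.+ a ℕ.+ suc k) (sym (ℕP.m∸n+n≡m (upc< q)))
      (subst (ℕ._< n ℕ.+ a ℕ.+ suc k) (trans (lem n a) (sym (dbl≡+ (a ℕ.+ n)))) (ℕP.+-monoʳ-< (n ℕ.+ a) (ℕ.s≤s (proj₁ (∈-range (n ℕ.+ a) a q))))))
      where
      lem : ∀ n a → n ℕ.+ a ℕ.+ (n ℕ.+ a) ≡ a ℕ.+ n ℕ.+ (a ℕ.+ n)
      lem = solve-∀ ℕ-ring
    mi∈ : ∀ i → i ∈ lows → mi i ∈ ups
    mi∈ i p = range-∈ a a (proj₁ (∸-bounds (proj₂ (∈-range 0 a p)))) (proj₂ (∸-bounds (proj₂ (∈-range 0 a p))))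
    module S = Split m mi mc [] lows ups lowc upc
      mi∈
      (λ k q → range-∈ n a (lo q) (hi q))
      (trans (length-range 0 a) (sym (length-range n a)))
      (λ i k p q → trans (+-congˡ (swap i k (mc k) p (k+mc k (upc< q))))
        (trans (+-comm _ _) (+-congˡ (sym (swap i (mc k) k p (trans (cong suc (ℕP.+-comm (mc k) k)) (k+mc k (upc< q))))))))
      (λ _ _ ())
    evenPart : det id (map S.even lows) lowc ≡ HE a d l
    evenPart = begin
      det id (map S.even lows) lowc ≡⟨ det-map-id S.even lows lowc ⟩
      det S.even lows lowc ≡⟨ cong₂ (det S.even) (range-downFrom 0 a) (range-downFrom n a) ⟩
      det S.even (map (λ y → a ℕ.∸ suc y) (downFrom a)) (map (λ j → (n ℕ.+ a) ℕ.∸ suc j) (downFrom a))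
        ≡⟨ det-map S.even _ _ (downFrom a) (downFrom a) ⟩
      det (λ y j → S.even (a ℕ.∸ suc y) ((n ℕ.+ a) ℕ.∸ suc j)) (downFrom a) (downFrom a)
        ≡⟨ det-congP (ℕ._< a) (ℕ._< a) entry (All.tabulate MemP.∈-downFrom⁻) (All.tabulate MemP.∈-downFrom⁻) ⟩
      HE a d l ∎
      where
      entry : ∀ y j → y ℕ.< a → j ℕ.< a → S.even (a ℕ.∸ suc y) ((n ℕ.+ a) ℕ.∸ suc j) ≡ iter Tk.step d (iter Tr.step l (δ j)) y
      entry y j y<a j<a = trans (+-congˡ (swap u k (mc k) u∈ (k+mc k k<)))
        (evenWalls₁ d l a u y k (mc k) j (∸-suc-+ y<a) (trans kj (ℕP.+-comm n a)) (suc-∸-+ k<))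
        where
        u = a ℕ.∸ suc y
        k = (n ℕ.+ a) ℕ.∸ suc j
        j<na : j ℕ.< n ℕ.+ a
        j<na = ℕP.<-≤-trans j<a (ℕP.m≤n+m a n)
        kj : k ℕ.+ suc j ≡ n ℕ.+ a
        kj = ∸-suc-+ j<na
        k< : k ℕ.< dbl (a ℕ.+ n)
        k< = ℕP.<-≤-trans (subst (k ℕ.<_) kj (ℕP.m<m+n k ℕ.z<s)) (subst (n ℕ.+ a ℕ.≤_) (trans (cong (ℕ._+ (a ℕ.+ n)) (ℕP.+-comm n a)) (sym (dbl≡+ (a ℕ.+ n)))) (ℕP.m≤m+n (n ℕ.+ a) (a ℕ.+ n)))
        u∈ : u ∈ lows
        u∈ = range-∈ 0 a ℕ.z≤n (subst (u ℕ.<_) (∸-suc-+ y<a) (ℕP.m<m+n u ℕ.z<s))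

  -- The column factors by which `δ₂` differs from `δ`.
  scale₂ : ℕ → ℚ
  scale₂ zero    = 2ℚ
  scale₂ (suc _) = 1ℚ

  δ₂-scale : ∀ j y → δ₂ j y ≡ 0ℚ + scale₂ j * δ j y
  δ₂-scale zero    y = sym (+-identityˡ _)
  δ₂-scale (suc j) y = sym (+-identityˡ _)

  fn-δ₂ : ∀ φ j → Functional.fn φ (δ₂ j) ≡ scale₂ j * Functional.fn φ (δ j)
  fn-δ₂ φ j = trans (Functional.ext φ (δ₂-scale j)) (trans (Functional.lin φ (λ _ → 0ℚ) (δ j) (scale₂ j)) (trans (+-congʳ (fn-0 φ)) (+-identityˡ _)))

  -- The half comes from the tip row, a single entry of which is half of the sum over an end point
  -- and its mirror image; the product comes from the end point on the axis. The constant is the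
  -- same for all d and l, so it may stay unevaluated.
  YT-split : ∀ d l → YT d (dbl l) (d ℕ.+ l) ≡ ((½ * prod scale₂ (downFrom (suc a))) * HO a d l) * oddO (d ℕ.+ l)
  YT-split d l = begin
    YT d t n
      ≡⟨ YT≡ d t n ⟩
    det (YM d t) (nothing ∷ map just idx) (range n (suc (dbl a)))
      ≡⟨ cong (det (YM d t) (nothing ∷ map just idx)) (trans (cong (λ z → range n (suc z)) (dbl≡+ a)) (range-++ n (suc a) a)) ⟩
    det (YM d t) (nothing ∷ map just idx) (lowc ++ upc)
      ≡⟨ altS-cong (λ k ks → *-congˡ {tip k} (trans (cong (det (YM d t) (map just idx)) (sym (LP.map-id ks))) (trans (det-map (YM d t) just id idx ks) (sym (det-map-id m idx ks))))) (lowc ++ upc) ⟩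
    det id (tip ∷ map m (lows ++ ups)) (lowc ++ upc)
      ≡⟨ S.split ⟩
    det id (tip ∷ map S.even lows) lowc * det (λ i k → m i k - m i (mc k)) ups upc
      ≡⟨ cong₂ _*_ evenPart (det-congP (_∈ ups) (_∈ upc) (λ i k p q → trans (arr-odd 0 (dbl a) w (W-axial a (suc d)) (t ℕ.+ dbl d) 0 i k (mc k) (k+mc k (upc≤ q)))
           (cong (λ N → pc noWall N 0 i k - pc noWall N 0 i (mc k)) N≡)) (All.tabulate id) (All.tabulate id)) ⟩
    ((½ * prod scale₂ (downFrom (suc a))) * HO a d l) * oddO n ∎
    where
    open ≡-Reasoning
    n = d ℕ.+ l
    t = dbl l
    N≡ : t ℕ.+ dbl d ≡ dbl n
    N≡ = trans (ℕP.+-comm t (dbl d)) (sym (dbl-+ d l))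
    w = W a (suc d)
    m = wall d t
    tip : Fun
    tip k = pc noWall t 0 (d ℕ.+ a) k
    mi mc : ℕ → ℕ
    mi i = dbl a ℕ.∸ i
    mc k = dbl (a ℕ.+ n) ℕ.∸ k
    lows = range 0 a
    ups = range (suc a) a
    lowc = range n (suc a)
    upc = range (n ℕ.+ suc a) a
    C≡ : dbl (a ℕ.+ n) ≡ dbl a ℕ.+ (t ℕ.+ dbl d)
    C≡ = trans (dbl-+ a n) (cong (dbl a ℕ.+_) (sym N≡))
    upc≤ : ∀ {k} → k ∈ upc → k ℕ.≤ dbl (a ℕ.+ n)
    upc≤ {k} q = ℕP.≤-trans (ℕP.≤-pred (subst (k ℕ.<_) (lem n a) (proj₂ (∈-range (n ℕ.+ suc a) a q)))) (subst (n ℕ.+ a ℕ.+ a ℕ.≤_) (trans (lem₂ n a) (sym (dbl≡+ (a ℕ.+ n)))) (ℕP.m≤m+n _ n))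
      where
      lem : ∀ n a → n ℕ.+ suc a ℕ.+ a ≡ suc (n ℕ.+ a ℕ.+ a)
      lem = solve-∀ ℕ-ring
      lem₂ : ∀ n a → n ℕ.+ a ℕ.+ a ℕ.+ n ≡ a ℕ.+ n ℕ.+ (a ℕ.+ n)
      lem₂ = solve-∀ ℕ-ring
    k+mc : ∀ k → k ℕ.≤ dbl (a ℕ.+ n) → k ℕ.+ mc k ≡ dbl a ℕ.+ (t ℕ.+ dbl d)
    k+mc k h = trans (∸-+ h) C≡
    i+mi : ∀ i → i ∈ lows → i ℕ.+ mi i ≡ dbl a ℕ.+ 0
    i+mi i p = trans (∸-+ (ℕP.≤-trans (ℕP.<⇒≤ (proj₂ (∈-range 0 a p))) a≤dbl)) (sym (ℕP.+-identityʳ _))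
    swap : ∀ i k k′ → i ∈ lows → k ℕ.+ k′ ≡ dbl a ℕ.+ (t ℕ.+ dbl d) → m (mi i) k ≡ m i k′
    swap i k k′ p h = arr-mirror 0 (dbl a) w (W-mirrored a (suc d)) (t ℕ.+ dbl d) 0 (mi i) i k k′ (trans (ℕP.+-comm (mi i) i) (i+mi i p)) h
    tip-swap : ∀ k → k ℕ.≤ dbl (a ℕ.+ n) → tip k ≡ tip (mc k)
    tip-swap k h = trans (tip-mirror d t k (subst (k ℕ.≤_) C≡ h)) (cong (λ c → tip (c ℕ.∸ k)) (sym C≡))
    lo : ∀ i → i ℕ.< a → suc a ℕ.≤ mi i
    lo i h = ℕP.+-cancelʳ-≤ i (suc a) (mi i) (subst (suc a ℕ.+ i ℕ.≤_) (sym (trans (ℕP.m∸n+n≡m (ℕP.≤-trans (ℕP.<⇒≤ h) a≤dbl)) (dbl≡+ a)))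
      (subst (ℕ._≤ a ℕ.+ a) (ℕP.+-suc a i) (ℕP.+-monoʳ-≤ a h)))
    loc : ∀ {k} → k ∈ upc → n ℕ.≤ mc k
    loc {k} q = ℕP.+-cancelʳ-≤ k n (mc k) (subst (n ℕ.+ k ℕ.≤_) (sym (ℕP.m∸n+n≡m (upc≤ q)))
      (ℕP.≤-pred (subst (suc (n ℕ.+ k) ℕ.≤_) (trans (lem n a) (cong suc (sym (dbl≡+ (a ℕ.+ n))))) (ℕP.+-monoʳ-< n (proj₂ (∈-range (n ℕ.+ suc a) a q))))))
      where
      lem : ∀ n a → n ℕ.+ (n ℕ.+ suc a ℕ.+ a) ≡ suc (a ℕ.+ n ℕ.+ (a ℕ.+ n))
      lem = solve-∀ ℕ-ring
    hic : ∀ {k} → k ∈ upc → mc k ℕ.< n ℕ.+ suc a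
    hic {k} q = ℕP.+-cancelʳ-< k (mc k) (n ℕ.+ suc a) (subst (ℕ._< n ℕ.+ suc a ℕ.+ k) (sym (ℕP.m∸n+n≡m (upc≤ q)))
      (ℕP.<-≤-trans (subst (dbl (a ℕ.+ n) ℕ.<_) (sym (trans (lem n a) (cong (suc ∘ suc) (sym (dbl≡+ (a ℕ.+ n)))))) (ℕP.m<n⇒m<1+n (ℕP.n<1+n _))) (ℕP.+-monoʳ-≤ (n ℕ.+ suc a) (proj₁ (∈-range (n ℕ.+ suc a) a q)))))
      where
      lem : ∀ n a → n ℕ.+ suc a ℕ.+ (n ℕ.+ suc a) ≡ suc (suc (a ℕ.+ n ℕ.+ (a ℕ.+ n)))
      lem = solve-∀ ℕ-ring
    pre-swap : ∀ f k → f ∈ tip ∷ [] → k ∈ upc → f k ≡ f (mc k)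
    pre-swap f k (here refl) q = tip-swap k (upc≤ q)
    module S = Split m mi mc (tip ∷ []) lows ups lowc upc
      (λ i p → range-∈ (suc a) a (lo i (proj₂ (∈-range 0 a p))) (subst (mi i ℕ.<_) (cong suc (dbl≡+ a)) (ℕ.s≤s (ℕP.m∸n≤m (dbl a) i))))
      (λ k q → range-∈ n (suc a) (loc q) (hic q))
      (trans (cong suc (length-range 0 a)) (sym (length-range n (suc a))))
      (λ i k p q → trans (+-congˡ (swap i k (mc k) p (k+mc k (upc≤ q))))
        (trans (+-comm _ _) (+-congˡ (sym (swap i (mc k) k p (trans (ℕP.+-comm (mc k) k) (k+mc k (upc≤ q))))))))
      pre-swap
    L = downFrom a
    L′ = downFrom (suc a)
    open OddRows d l using (lowRow)
    kcol : ℕ → ℕ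
    kcol j = (n ℕ.+ suc a) ℕ.∸ suc j
    kj : ∀ j → j ℕ.< suc a → kcol j ℕ.+ j ≡ n ℕ.+ a
    kj j h = ℕP.suc-injective (trans (sym (ℕP.+-suc (kcol j) j)) (trans (∸-suc-+ (ℕP.<-≤-trans h (ℕP.m≤n+m (suc a) n))) (ℕP.+-suc n a)))
    kcol≤ : ∀ j → j ℕ.< suc a → kcol j ℕ.≤ dbl (a ℕ.+ n)
    kcol≤ j h = ℕP.≤-trans (subst (kcol j ℕ.≤_) (kj j h) (ℕP.m≤m+n (kcol j) j)) (subst (n ℕ.+ a ℕ.≤_) (trans (cong (ℕ._+ (a ℕ.+ n)) (ℕP.+-comm n a)) (sym (dbl≡+ (a ℕ.+ n)))) (ℕP.m≤m+n (n ℕ.+ a) (a ℕ.+ n)))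
    tip-entry : ∀ j → j ℕ.< suc a → tip (kcol j) ≡ ½ * (scale₂ j * Functional.fn (tipF l) (δ j))
    tip-entry j h = trans (halve (tip k)) (*-congˡ (trans (+-congˡ (tip-swap k (kcol≤ j h)))
      (trans (evenFree₂ l (d ℕ.+ a) (d ℕ.+ a) 0 k (mc k) j (ℕP.+-identityʳ _) (trans (kj j h) (lem d l a)) (trans (∸-+ (kcol≤ j h)) (cong dbl (lem₂ d l a)))) (fn-δ₂ (tipF l) j))))
      where
      k = kcol j
      lem : ∀ d l a → d ℕ.+ l ℕ.+ a ≡ d ℕ.+ a ℕ.+ l
      lem = solve-∀ ℕ-ring
      lem₂ : ∀ d l a → a ℕ.+ (d ℕ.+ l) ≡ d ℕ.+ a ℕ.+ l
      lem₂ = solve-∀ ℕ-ring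
    low-entry : ∀ y j → y ℕ.< a → j ℕ.< suc a → S.even (a ℕ.∸ suc y) (kcol j) ≡ scale₂ j * Functional.fn (lowRow y) (δ j)
    low-entry y j y<a h = trans (+-congˡ (swap u k (mc k) u∈ (k+mc k (kcol≤ j h))))
      (trans (cong (λ N → arr w N 0 u k + arr w N 0 u (mc k)) N≡)
      (trans (evenWalls₂ d l a u y k (mc k) j (∸-suc-+ y<a) (trans (kj j h) (ℕP.+-comm n a)) (∸-+ (kcol≤ j h))) (fn-δ₂ (lowRow y) j)))
      where
      u = a ℕ.∸ suc y
      k = kcol j
      u∈ : u ∈ lows
      u∈ = range-∈ 0 a ℕ.z≤n (subst (u ℕ.<_) (∸-suc-+ y<a) (ℕP.m<m+n u ℕ.z<s))
    evenPart : det id (tip ∷ map S.even lows) lowc ≡ (½ * prod scale₂ L′) * HO a d l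
    evenPart = begin
      det id (tip ∷ map S.even lows) lowc
        ≡⟨ cong₂ (λ R C → det id (tip ∷ R) C) (trans (cong (map S.even) (range-downFrom 0 a)) (sym (LP.map-∘ L))) (range-downFrom n (suc a)) ⟩
      det id (tip ∷ map (λ y → S.even (a ℕ.∸ suc y)) L) (map kcol L′)
        ≡⟨ altS-map id kcol (λ k ks → tip k * det id (map (λ y → S.even (a ℕ.∸ suc y)) L) ks) L′ ⟩
      altS (λ j js → tip (kcol j) * det id (map (λ y → S.even (a ℕ.∸ suc y)) L) (map kcol js)) L′
        ≡⟨ altS-congP (ℕ._< suc a) (λ j js h hs → trans (cong₂ _*_ (tip-entry j h)
             (trans (det-map id (λ y → S.even (a ℕ.∸ suc y)) kcol L js) (det-congP (ℕ._< a) (ℕ._< suc a) low-entry (All.tabulate MemP.∈-downFrom⁻) hs)))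
             (*-assoc _ _ _)) (All.tabulate MemP.∈-downFrom⁻) ⟩
      altS (λ j js → ½ * ((scale₂ j * fn′ nothing j) * det (λ y j → scale₂ j * fn′ (just y) j) L js)) L′
        ≡⟨ altS-* (λ j js → (scale₂ j * fn′ nothing j) * det (λ y j → scale₂ j * fn′ (just y) j) L js) ½ L′ ⟩
      ½ * altS (λ j js → (scale₂ j * fn′ nothing j) * det (λ y j → scale₂ j * fn′ (just y) j) L js) L′
        ≡⟨ *-congˡ (altS-cong (λ j js → *-congˡ {scale₂ j * fn′ nothing j} (trans (sym (det-map (λ r j → scale₂ j * fn′ r j) just id L js)) (cong (det (λ r j → scale₂ j * fn′ r j) (map just L)) (LP.map-id js)))) L′) ⟩
      ½ * det (λ r j → scale₂ j * fn′ r j) (nothing ∷ map just L) L′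
        ≡⟨ *-congˡ (det-scaleCols scale₂ fn′ (nothing ∷ map just L) L′) ⟩
      ½ * (prod scale₂ L′ * det fn′ (nothing ∷ map just L) L′)
        ≡⟨ sym (*-assoc _ _ _) ⟩
      (½ * prod scale₂ L′) * det fn′ (nothing ∷ map just L) L′
        ≡⟨ *-congˡ (sym (trans (cong (λ R → det Functional.fn (tipF l ∷ R) (map δ L′)) (LP.map-∘ L)) (det-map Functional.fn row′ δ (nothing ∷ map just L) L′))) ⟩
      (½ * prod scale₂ L′) * HO a d l ∎
      where
      row′ : Maybe ℕ → Functional
      row′ nothing  = tipF l
      row′ (just y) = lowRow y
      fn′ : Maybe ℕ → ℕ → ℚ
      fn′ r j = Functional.fn (row′ r) (δ j)

  open Hats a

  -- The counts in the coordinates of the closed forms. `XT d` has d + 1 removals, so the index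
  -- moves by one, and d = 0 is the plain hexagon.
  Xv Yv : ℕ → ℕ → ℕ → ℚ
  Xv zero    u v = hex (dbl a) u v
  Xv (suc d) u v = XT d (suc (u ℕ.+ v)) (suc d ℕ.+ u)
  Yv d u v = YT d (u ℕ.+ v) (d ℕ.+ u)

  Xv≡XZ : ∀ d u v → Xv d u v ≡ XZ d (dbl d ℕ.+ (u ℕ.+ v)) (d ℕ.+ u)
  Xv≡XZ zero u v = trans (win-map freeRow (range 0 (dbl a)) (u ℕ.+ v) u (dbl a))
    (det-cong (λ i k → sym (pc-free (delay (W a 0)) (u ℕ.+ v) 0 i k (λ { zero _ → refl ; (suc _) _ → refl }))) (range 0 (dbl a)) (range u (dbl a)))
  Xv≡XZ (suc d) u v = trans (sym (XZ≡XT d (suc (u ℕ.+ v)) (suc d ℕ.+ u))) (cong (λ N → XZ (suc d) (suc (suc N)) (suc d ℕ.+ u)) (ℕP.+-comm (u ℕ.+ v) (dbl d)))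

  Xv-diag : ∀ d l → Xv d l l ≡ HE a d l * oddE (d ℕ.+ l)
  Xv-diag d l = trans (Xv≡XZ d l l) (trans (cong (λ N → XZ d N (d ℕ.+ l)) (sym (trans (dbl-+ d l) (cong (dbl d ℕ.+_) (dbl≡+ l))))) (XZ-split d l))

  γ-fac : ∀ l → γ l ≡ fac (suc (dbl l)) * (ifac l * ifac l)
  γ-fac l = trans (cong₂ _*_ (sym (nat-sdbl l)) (β-fac l)) (sym (*-assoc _ _ _))

  NZ-β : ∀ l → NZ (β l)
  NZ-β l = subst NZ (sym (β-fac l)) (NZ-* (NZ-fac (dbl l)) (NZ-* (NZ-ifac l) (NZ-ifac l)))

  NZ-γ : ∀ l → NZ (γ l)
  NZ-γ l = subst NZ (sym (γ-fac l)) (NZ-* (NZ-fac (suc (dbl l))) (NZ-* (NZ-ifac l) (NZ-ifac l)))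

  opaque
    unfolding ℚ-ring
    ring-unit₂ : ∀ x f if g ig → f * if ≡ 1ℚ → g * ig ≡ 1ℚ → (x * ((f * f) * ig)) * (g * (if * if)) ≡ x
    ring-unit₂ x f if g ig e e′ = trans (r x f if g ig) (trans (cong₂ (λ p q → x * (p * p) * q) e e′) (trans (ℚP.*-identityʳ _) (ℚP.*-identityʳ x)))
      where
      r : ∀ x f if g ig → (x * ((f * f) * ig)) * (g * (if * if)) ≡ x * ((f * if) * (f * if)) * (g * ig)
      r = solve-∀ ℚ-ring
    ring-unit₃ : ∀ x f if f′ if′ g ig → f * if ≡ 1ℚ → f′ * if′ ≡ 1ℚ → g * ig ≡ 1ℚ → (x * ((f * f′) * ig)) * (g * (if * if′)) ≡ x
    ring-unit₃ x f if f′ if′ g ig e e₂ e′ = trans (r x f if f′ if′ g ig) (trans (cong₂ (λ p q → x * p * q) (cong₂ _*_ e e₂) e′) (trans (ℚP.*-identityʳ _) (ℚP.*-identityʳ x)))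
      where
      r : ∀ x f if f′ if′ g ig → (x * ((f * f′) * ig)) * (g * (if * if′)) ≡ x * ((f * if) * (f′ * if′)) * (g * ig)
      r = solve-∀ ℚ-ring
    ring-pair : ∀ f g b c → (f * g) * (b * c) ≡ (f * b) * (g * c)
    ring-pair = solve-∀ ℚ-ring
    ring-diag : ∀ h o bc → (h * o) * bc ≡ (h * bc) * o
    ring-diag = solve-∀ ℚ-ring
    ring-diag′ : ∀ c h o bc → ((c * h) * o) * bc ≡ (h * bc) * (c * o)
    ring-diag′ = solve-∀ ℚ-ring
    ring-ε : ∀ n b → - (½ * (n * b)) ≡ (- ½) * (n * b)
    ring-ε = solve-∀ ℚ-ring
    ring-γ′ : ∀ n s f i → n * ((s * f) * ((i * i))) ≡ ((s * f) * ((n * i) * i))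
    ring-γ′ = solve-∀ ℚ-ring
    NZ-neg½ : NZ (- ½)
    NZ-neg½ ()

  fe-β : ∀ d → fe d * β d ≡ β (a ℕ.+ d)
  fe-β d = trans (cong (fe d *_) (β-fac d)) (trans (ring-unit₂ _ (fac d) (ifac d) (fac (dbl d)) (ifac (dbl d)) (fac-ifac d) (fac-ifac (dbl d)))
    (trans (sym (β-fac (d ℕ.+ a))) (cong β (ℕP.+-comm d a))))

  G-γ : ∀ l → G l l * γ (a ℕ.+ l) ≡ γ l
  G-γ l = trans (cong (G l l *_) (trans (γ-fac (a ℕ.+ l)) (cong (λ n → fac (suc n) * (ifac (a ℕ.+ l) * ifac (a ℕ.+ l))) (trans (dbl-+ a l) (cong (dbl a ℕ.+_) (dbl≡+ l))))))
    (trans (ring-unit₂ _ (fac (a ℕ.+ l)) (ifac (a ℕ.+ l)) (fac (suc (dbl a ℕ.+ (l ℕ.+ l)))) (ifac (suc (dbl a ℕ.+ (l ℕ.+ l)))) (fac-ifac (a ℕ.+ l)) (fac-ifac (suc (dbl a ℕ.+ (l ℕ.+ l)))))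
    (sym (trans (γ-fac l) (cong (λ n → fac (suc n) * (ifac l * ifac l)) (dbl≡+ l)))))

  -- Passing from (d , l + 1) to (d + 1 , l) keeps d + l and hence `oddE`. The ratio left by
  -- `HE-ratio` is β (a + d) / β d times γ l / γ (a + l), and these are `fe d` and the diagonal
  -- values of `G`.
  diagX : ∀ d l → Xv (suc d) l l ≡ Xv d (suc l) (suc l) * (fe d * G l l)
  diagX d l = *-cancelʳ (β d * γ (a ℕ.+ l)) (NZ-* (NZ-β d) (NZ-γ (a ℕ.+ l))) (begin
    Xv (suc d) l l * (β d * γ (a ℕ.+ l))
      ≡⟨ trans (*-congʳ (Xv-diag (suc d) l)) (ring-diag _ _ _) ⟩
    (HE a (suc d) l * (β d * γ (a ℕ.+ l))) * oddE (suc d ℕ.+ l)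
      ≡⟨ cong₂ _*_ (HE-ratio a d l) (cong oddE (sym (ℕP.+-suc d l))) ⟩
    (HE a d (suc l) * (β (a ℕ.+ d) * γ l)) * oddE (d ℕ.+ suc l)
      ≡⟨ trans (sym (ring-diag _ _ _)) (*-congʳ (sym (Xv-diag d (suc l)))) ⟩
    Xv d (suc l) (suc l) * (β (a ℕ.+ d) * γ l)
      ≡⟨ *-congˡ (trans (cong₂ _*_ (sym (fe-β d)) (sym (G-γ l))) (sym (ring-pair _ _ _ _))) ⟩
    Xv d (suc l) (suc l) * ((fe d * G l l) * (β d * γ (a ℕ.+ l)))
      ≡⟨ sym (*-assoc _ _ _) ⟩
    (Xv d (suc l) (suc l) * (fe d * G l l)) * (β d * γ (a ℕ.+ l)) ∎)
    where open ≡-Reasoning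

  Yv-diag : ∀ d l → Yv d l l ≡ ((½ * prod scale₂ (downFrom (suc a))) * HO a d l) * oddO (d ℕ.+ l)
  Yv-diag d l = trans (cong (λ t → YT d t (d ℕ.+ l)) (sym (dbl≡+ l))) (YT-split d l)

  -- (k + 1) β (k + 1)
  κ : ℕ → ℚ
  κ k = fac (dbl (suc k)) * (ifac k * ifac (suc k))

  ε-κ : ∀ k → ε k ≡ (- ½) * κ k
  ε-κ k = trans (ring-ε _ _) (*-congˡ (trans (*-congˡ (β-fac (suc k))) (trans (ring-γ′ _ _ _ _) (*-congˡ (*-congʳ (ifac-suc k))))))

  NZ-ε : ∀ k → NZ (ε k)
  NZ-ε k = subst NZ (sym (ε-κ k)) (NZ-* NZ-neg½ (NZ-* (NZ-fac (dbl (suc k))) (NZ-* (NZ-ifac k) (NZ-ifac (suc k)))))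

  fo-ε : ∀ d → fo d * ε d ≡ ε (a ℕ.+ d)
  fo-ε d = trans (trans (*-congˡ (ε-κ d)) (*-left-comm _ _ _)) (trans (*-congˡ
    (trans (ring-unit₃ _ (fac d) (ifac d) (fac (suc d)) (ifac (suc d)) (fac (dbl (suc d))) (ifac (dbl (suc d))) (fac-ifac d) (fac-ifac (suc d)) (fac-ifac (dbl (suc d))))
      (cong κ (ℕP.+-comm d a)))) (sym (ε-κ (a ℕ.+ d))))

  H-β : ∀ l → H l l * β (suc a ℕ.+ l) ≡ β l
  H-β l = trans (cong (H l l *_) (trans (β-fac (suc a ℕ.+ l)) (cong (λ n → fac (suc (suc n)) * (ifac (suc a ℕ.+ l) * ifac (suc a ℕ.+ l))) (trans (dbl-+ a l) (cong (dbl a ℕ.+_) (dbl≡+ l))))))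
    (trans (ring-unit₂ _ (fac (suc a ℕ.+ l)) (ifac (suc a ℕ.+ l)) (fac (2 ℕ.+ (dbl a ℕ.+ (l ℕ.+ l)))) (ifac (2 ℕ.+ (dbl a ℕ.+ (l ℕ.+ l)))) (fac-ifac (suc a ℕ.+ l)) (fac-ifac (2 ℕ.+ (dbl a ℕ.+ (l ℕ.+ l)))))
    (sym (trans (β-fac l) (cong (λ n → fac n * (ifac l * ifac l)) (dbl≡+ l)))))

  -- As for X: the ratio is ε (a + d) / ε d times β l / β (a + 1 + l), that is `fo d` times the
  -- diagonal values of `H`.
  diagY : ∀ d l → Yv (suc d) l l ≡ Yv d (suc l) (suc l) * (fo d * H l l)
  diagY d l = *-cancelʳ (ε d * β (suc a ℕ.+ l)) (NZ-* (NZ-ε d) (NZ-β (suc a ℕ.+ l))) (begin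
    Yv (suc d) l l * (ε d * β (suc a ℕ.+ l))
      ≡⟨ trans (*-congʳ (Yv-diag (suc d) l)) (ring-diag′ _ _ _ _) ⟩
    (HO a (suc d) l * (ε d * β (suc a ℕ.+ l))) * (c₀ * oddO (suc d ℕ.+ l))
      ≡⟨ cong₂ _*_ (HO-ratio a d l) (cong (λ n → c₀ * oddO n) (sym (ℕP.+-suc d l))) ⟩
    (HO a d (suc l) * (ε (a ℕ.+ d) * β l)) * (c₀ * oddO (d ℕ.+ suc l))
      ≡⟨ trans (sym (ring-diag′ _ _ _ _)) (*-congʳ (sym (Yv-diag d (suc l)))) ⟩
    Yv d (suc l) (suc l) * (ε (a ℕ.+ d) * β l)
      ≡⟨ *-congˡ (trans (cong₂ _*_ (sym (fo-ε d)) (sym (H-β l))) (sym (ring-pair _ _ _ _))) ⟩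
    Yv d (suc l) (suc l) * ((fo d * H l l) * (ε d * β (suc a ℕ.+ l)))
      ≡⟨ sym (*-assoc _ _ _) ⟩
    (Yv d (suc l) (suc l) * (fo d * H l l)) * (ε d * β (suc a ℕ.+ l)) ∎)
    where
    open ≡-Reasoning
    c₀ = ½ * prod scale₂ (downFrom (suc a))

  Xv-sym : ∀ d → Symm (Xv (suc d))
  Xv-sym d u v = trans (XT-sym d (suc (u ℕ.+ v)) (suc d ℕ.+ u) (suc d ℕ.+ v) (trans (lem d u v) (cong (λ n → suc (suc (u ℕ.+ v) ℕ.+ n)) (sym (dbl≡+ d)))))
    (cong (λ n → XT d (suc n) (suc d ℕ.+ v)) (ℕP.+-comm u v))
    where
    lem : ∀ d u v → suc d ℕ.+ u ℕ.+ (suc d ℕ.+ v) ≡ suc (suc (u ℕ.+ v) ℕ.+ (d ℕ.+ d))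
    lem = solve-∀ ℕ-ring

  Yv-sym : ∀ d → Symm (Yv d)
  Yv-sym d u v = trans (YT-sym d (u ℕ.+ v) (d ℕ.+ u) (d ℕ.+ v) (trans (lem d u v) (cong (λ n → u ℕ.+ v ℕ.+ n) (sym (dbl≡+ d)))))
    (cong (λ n → YT d n (d ℕ.+ v)) (ℕP.+-comm u v))
    where
    lem : ∀ d u v → d ℕ.+ u ℕ.+ (d ℕ.+ v) ≡ u ℕ.+ v ℕ.+ (d ℕ.+ d)
    lem = solve-∀ ℕ-ring

  -- Without a removal the tip is the ordinary starting point a. The only wall is that point itself,
  -- where no path arrives, so moving the tip row to its place gives the plain hexagon with 2 a + 1
  -- paths, up to the sign.
  Yv-0 : ∀ u v → Yv 0 u v ≡ Yh 0 u v
  Yv-0 u v = begin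
    YT 0 t u
      ≡⟨ YT≡ 0 t u ⟩
    det (YM 0 t) (nothing ∷ map just idx) cols
      ≡⟨ det-congP ok (_∈ cols) (λ { nothing k _ _ → refl ; (just i) k p _ → free i k p }) all-ok (All.tabulate id) ⟩
    det m′ (nothing ∷ map just idx) cols
      ≡⟨ trans (cong (λ L → det m′ (nothing ∷ L) cols) (LP.map-++ just (range 0 a) (range (suc a) a))) (sym (trans (*-congˡ (det-move m′ (map just (range 0 a)) nothing (map just (range (suc a) a)) cols))
           (trans (cong (λ n → sgn a * (sgn n * det m′ (nothing ∷ map just (range 0 a) ++ map just (range (suc a) a)) cols)) (trans (LP.length-map just (range 0 a)) (length-range 0 a)))
             (trans (sym (*-assoc _ _ _)) (trans (*-congʳ (sgn² a)) (*-identityˡ _)))))) ⟩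
    sgn a * det m′ (map just (range 0 a) ++ nothing ∷ map just (range (suc a) a)) cols
      ≡⟨ *-congˡ (merge) ⟩
    sgn a * hex (suc (dbl a)) u v
      ≡⟨ *-congˡ (macmahon (suc (dbl a)) u v) ⟩
    sgn a * MM (suc (dbl a)) u v ∎
    where
    open ≡-Reasoning
    t = u ℕ.+ v
    cols = range u (suc (dbl a))
    ix : Maybe ℕ → ℕ
    ix nothing  = a
    ix (just i) = i
    m = λ i k → pc noWall t 0 i k
    m′ = λ r k → m (ix r) k
    ok : Maybe ℕ → Set
    ok nothing  = ℕ
    ok (just i) = i ≢ a
    ne : ∀ {i} → i ∈ idx → i ≢ a
    ne p refl with MemP.∈-++⁻ (range 0 a) p
    ... | inj₁ q = ℕP.<-irrefl refl (proj₂ (∈-range 0 a q))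
    ... | inj₂ q = ℕP.<-irrefl refl (proj₁ (∈-range (suc a) a q))
    all-ok : All ok (nothing ∷ map just idx)
    all-ok = 0 ∷ AllP.map⁺ (All.tabulate ne)
    free : ∀ i k → i ≢ a → wall 0 t i k ≡ m i k
    free i k h with i ℕ.≡ᵇ a in eq
    ... | true  = ⊥-elim (h (ℕP.≡ᵇ⇒≡ i a (subst T (sym eq) _)))
    ... | false = trans (cong (λ n → pc (W a 1) n 0 i k) (ℕP.+-identityʳ t)) (pc-cong (W a 1) noWall t 0 i k (λ { zero _ → refl ; (suc _) _ → refl }))
    merge : det m′ (map just (range 0 a) ++ nothing ∷ map just (range (suc a) a)) cols ≡ hex (suc (dbl a)) u v
    merge = trans (trans (sym (det-map m ix id (map just (range 0 a) ++ nothing ∷ map just (range (suc a) a)) cols)) (cong₂ (det m) rows≡ (LP.map-id cols))) (sym (win-map freeRow (range 0 (suc (dbl a))) t u (suc (dbl a))))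
      where
      rows≡ : map ix (map just (range 0 a) ++ nothing ∷ map just (range (suc a) a)) ≡ range 0 (suc (dbl a))
      rows≡ = trans (LP.map-++ ix (map just (range 0 a)) _) (trans (cong₂ (λ x y → x ++ a ∷ y) (ij (range 0 a)) (ij (range (suc a) a)))
        (sym (trans (cong (range 0) (trans (cong suc (dbl≡+ a)) (sym (ℕP.+-suc a a)))) (range-++ 0 a (suc a)))))
        where
        ij : ∀ L → map ix (map just L) ≡ L
        ij L = trans (sym (LP.map-∘ L)) (LP.map-id L)

  Rel₂-v : ∀ d → Rel₂ (Yv d) (Xv (suc d))
  Rel₂-v d u v
    rewrite ℕP.+-suc d u | ℕP.+-suc u v = YX-relation d (suc (u ℕ.+ v)) (d ℕ.+ u)

  Rel₁-v : ∀ d → Rel₁ (Yv (suc d)) (Xv (suc d))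
  Rel₁-v d u v
    rewrite ℕP.+-suc d (suc u) | ℕP.+-suc d u | ℕP.+-suc u (suc v) | ℕP.+-suc u v = XY-relation d (suc (u ℕ.+ v)) (suc (d ℕ.+ u))

  -- Each relation has one unknown function: X (d + 1) follows from Y d by `agree₂`, and Y (d + 1)
  -- from X (d + 1) by `agree₁`. The diagonals come from the previous d at (l + 1 , l + 1).
  mutual
    Xv≡Xh : ∀ d u v → Xv d u v ≡ Xh d u v
    Xv≡Xh zero    u v = macmahon (dbl a) u v
    Xv≡Xh (suc d) u v = agree₂ {Yv d} {Yh d} {Xv (suc d)} {Xh (suc d)} (Yv-sym d) (Yh-sym d) (Xv-sym d) (Xh-sym (suc d))
      (Rel₂-v d) (Exch₂⇒Rel₂ {Yh d} {Xh (suc d)} a (Yh-sym d) (Xh-sym (suc d)) (exch₂ d)) (NZ-Yh d) (Yv≡Yh d)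
      (λ l → trans (diagX d l) (*-congʳ (Xv≡Xh d (suc l) (suc l)))) u v

    Yv≡Yh : ∀ d u v → Yv d u v ≡ Yh d u v
    Yv≡Yh zero    u v = Yv-0 u v
    Yv≡Yh (suc d) u v = agree₁ {Yv (suc d)} {Yh (suc d)} {Xv (suc d)} {Xh (suc d)} (Yv-sym (suc d)) (Yh-sym (suc d)) (Xv-sym d) (Xh-sym (suc d))
      (Rel₁-v d) (Exch₁⇒Rel₁ {Yh (suc d)} {Xh (suc d)} (Yh-sym (suc d)) (Xh-sym (suc d)) (exch₁ (suc d))) (NZ-Xh (suc d)) (Xv≡Xh (suc d))
      (λ l → trans (diagY d l) (*-congʳ (Yv≡Yh d (suc l) (suc l)))) u v

-- Unit triangles as cells

-- The vertical unit edge u of column j has its midpoint at height 2 u + 1 - j; L j u is the left-pointing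
-- triangle of strip j whose vertical side is the edge u of column j + 1, and R j u is the right-pointing
-- triangle of strip j whose vertical side is the edge u of column j.
data Cell : Set where
  L R : ℕ → ℕ → Cell

emb : Cell → Triangle
emb (L j u) = j , + (u ℕ.+ u) ℤ.- + j
emb (R j u) = j , + suc (u ℕ.+ u) ℤ.- + j

-- Without an arrow the common side is slanted and both cells lie in one strip; with an arrow it is
-- the vertical side u of column j + 1.
data Adj : Cell → Cell → Set where
  LR : ∀ {j u} → Adj (L j u) (R j u)
  RL : ∀ {j u} → Adj (R j u) (L j u)
  LR′ : ∀ {j u} → Adj (L j (suc u)) (R j u)
  RL′ : ∀ {j u} → Adj (R j u) (L j (suc u))
  LR→ : ∀ {j u} → Adj (L j u) (R (suc j) u)
  RL← : ∀ {j u} → Adj (R (suc j) u) (L j u)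

diff-inj : ∀ m n o q → + m ℤ.- + n ≡ + o ℤ.- + q → m ℕ.+ q ≡ o ℕ.+ n
diff-inj m n o q e = ℤP.+-injective (begin
  + m ℤ.+ + q                          ≡⟨ lem (+ m) (+ n) (+ q) ⟩
  (+ m ℤ.- + n) ℤ.+ (+ n ℤ.+ + q)      ≡⟨ cong (ℤ._+ (+ n ℤ.+ + q)) e ⟩
  (+ o ℤ.- + q) ℤ.+ (+ n ℤ.+ + q)      ≡⟨ lem₂ (+ o) (+ q) (+ n) ⟩
  + o ℤ.+ + n                          ∎)
  where
  open ≡-Reasoning
  lem : ∀ m n q → m ℤ.+ q ≡ (m ℤ.- n) ℤ.+ (n ℤ.+ q)
  lem = solve-∀ ℤ-ring
  lem₂ : ∀ o q n → (o ℤ.- q) ℤ.+ (n ℤ.+ q) ≡ o ℤ.+ n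
  lem₂ = solve-∀ ℤ-ring

diff-suc : ∀ m n → (+ m ℤ.- + n) ℤ.+ + 1 ≡ + suc m ℤ.- + n
diff-suc m n = trans (lem (+ m) (+ n)) (cong (ℤ._- + n) (cong +_ (ℕP.+-comm m 1)))
  where
  lem : ∀ m n → (m ℤ.- n) ℤ.+ + 1 ≡ (m ℤ.+ + 1) ℤ.- n
  lem = solve-∀ ℤ-ring

even≢odd : ∀ u v → u ℕ.+ u ≢ suc (v ℕ.+ v)
even≢odd (suc u) (suc v) e = even≢odd u v (ℕP.suc-injective (trans (sym (ℕP.+-suc u u)) (trans (ℕP.suc-injective e) (cong suc (ℕP.+-suc v v)))))
even≢odd (suc u) zero    e with trans (sym (ℕP.+-suc u u)) (ℕP.suc-injective e)
... | ()
even≢odd zero v ()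

double-inj : ∀ u v → u ℕ.+ u ≡ v ℕ.+ v → u ≡ v
double-inj zero    zero    e = refl
double-inj (suc u) (suc v) e = cong suc (double-inj u v (ℕP.suc-injective (trans (sym (ℕP.+-suc u u)) (trans (ℕP.suc-injective e) (ℕP.+-suc v v)))))
double-inj zero    (suc v) ()
double-inj (suc u) zero    ()

parity : ℕ → Bool
parity zero          = false
parity (suc zero)    = true
parity (suc (suc n)) = parity n

parity-% : ∀ n → (n ℕ.% 2 ℕ.≡ᵇ 1) ≡ parity n
parity-% zero          = refl
parity-% (suc zero)    = refl
parity-% (suc (suc n)) = trans (cong (ℕ._≡ᵇ 1) (trans (cong (ℕ._% 2) (ℕP.+-comm 2 n)) (ℕD.[m+n]%n≡m%n n 2))) (parity-% n)

parity-even : ∀ u → parity (u ℕ.+ u) ≡ false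
parity-even zero    = refl
parity-even (suc u) = trans (cong (parity ∘ suc) (ℕP.+-suc u u)) (parity-even u)

parity-odd : ∀ u → parity (suc (u ℕ.+ u)) ≡ true
parity-odd zero    = refl
parity-odd (suc u) = trans (cong (parity ∘ suc ∘ suc) (ℕP.+-suc u u)) (parity-odd u)

diff-cancel : ∀ m j → (+ m ℤ.- + j) ℤ.+ + j ≡ + m
diff-cancel m j = lem (+ m) (+ j)
  where
  lem : ∀ m n → (m ℤ.- n) ℤ.+ n ≡ m
  lem = solve-∀ ℤ-ring

isRight-L : ∀ j u → isRight (emb (L j u)) ≡ false
isRight-L j u = trans (cong (λ z → ℤ.∣ z ∣ ℕ.% 2 ℕ.≡ᵇ 1) (diff-cancel (u ℕ.+ u) j)) (trans (parity-% (u ℕ.+ u)) (parity-even u))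

isRight-R : ∀ j u → isRight (emb (R j u)) ≡ true
isRight-R j u = trans (cong (λ z → ℤ.∣ z ∣ ℕ.% 2 ℕ.≡ᵇ 1) (diff-cancel (suc (u ℕ.+ u)) j)) (trans (parity-% (suc (u ℕ.+ u))) (parity-odd u))

∧-true : ∀ {x y} → x ∧ y ≡ true → x ≡ true × y ≡ true
∧-true {true} {true} refl = refl , refl

∨-true : ∀ {x y} → x ∨ y ≡ true → x ≡ true ⊎ y ≡ true
∨-true {true}  e = inj₁ refl
∨-true {false} e = inj₂ e

≡ᵇ-true : ∀ {m n} → (m ℕ.≡ᵇ n) ≡ true → m ≡ n
≡ᵇ-true {m} {n} e = ℕP.≡ᵇ⇒≡ m n (subst T (sym e) _)

≡ᵇ-refl : ∀ n → (n ℕ.≡ᵇ n) ≡ true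
≡ᵇ-refl zero    = refl
≡ᵇ-refl (suc n) = ≡ᵇ-refl n

≡ᵇ-false : ∀ {m n} → m ≢ n → (m ℕ.≡ᵇ n) ≡ false
≡ᵇ-false {m} {n} ne with m ℕ.≡ᵇ n in e
... | false = refl
... | true  = ⊥-elim (ne (≡ᵇ-true e))

≡ℤᵇ-true : ∀ {x y} → (x ≡ℤᵇ y) ≡ true → x ≡ y
≡ℤᵇ-true {x} {y} e with x ℤ.≟ y
... | yes p = p

≡ℤᵇ-refl : ∀ {x y} → x ≡ y → (x ≡ℤᵇ y) ≡ true
≡ℤᵇ-refl {x} {y} e with x ℤ.≟ y
... | yes _ = refl
... | no  p = ⊥-elim (p e)

not-true : ∀ {x} → not x ≡ true → x ≡ false
not-true {false} _ = refl

adjacent-cases : ∀ {i t j u} → adjacent (i , t) (j , u) ≡ true →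
  (i ≡ j × (t ℤ.+ + 1 ≡ u ⊎ u ℤ.+ + 1 ≡ t)) ⊎ (t ≡ u × ((suc i ≡ j × isRight (i , t) ≡ false) ⊎ (suc j ≡ i × isRight (j , u) ≡ false)))
adjacent-cases e with ∨-true e
... | inj₁ p with ∧-true p
...   | i≡j , q with ∨-true q
...     | inj₁ r = inj₁ (≡ᵇ-true i≡j , inj₁ (≡ℤᵇ-true r))
...     | inj₂ r = inj₁ (≡ᵇ-true i≡j , inj₂ (≡ℤᵇ-true r))
adjacent-cases e | inj₂ p with ∧-true p
...   | t≡u , q with ∨-true q
...     | inj₁ r = let (x , y) = ∧-true r in inj₂ (≡ℤᵇ-true t≡u , inj₁ (≡ᵇ-true x , not-true y))
...     | inj₂ r = let (x , y) = ∧-true r in inj₂ (≡ℤᵇ-true t≡u , inj₂ (≡ᵇ-true x , not-true y))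

true≢false : true ≢ false
true≢false ()

level : Cell → ℕ
level (L _ u) = u ℕ.+ u
level (R _ u) = suc (u ℕ.+ u)

column : Cell → ℕ
column (L j _) = j
column (R j _) = j

emb-level : ∀ x → emb x ≡ (column x , + level x ℤ.- + column x)
emb-level (L _ _) = refl
emb-level (R _ _) = refl

level-cases : ∀ i m j n → adjacent (i , + m ℤ.- + i) (j , + n ℤ.- + j) ≡ true →
  (i ≡ j × (suc m ≡ n ⊎ suc n ≡ m))
  ⊎ (suc i ≡ j × suc m ≡ n × isRight (i , + m ℤ.- + i) ≡ false)
  ⊎ (suc j ≡ i × suc n ≡ m × isRight (j , + n ℤ.- + j) ≡ false)
level-cases i m j n e with adjacent-cases {i} {+ m ℤ.- + i} {j} {+ n ℤ.- + j} e
... | inj₁ (refl , inj₁ h) = inj₁ (refl , inj₁ (ℕP.+-cancelʳ-≡ i _ _ (diff-inj (suc m) i n i (trans (sym (diff-suc m i)) h))))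
... | inj₁ (refl , inj₂ h) = inj₁ (refl , inj₂ (ℕP.+-cancelʳ-≡ i _ _ (diff-inj (suc n) i m i (trans (sym (diff-suc n i)) h))))
... | inj₂ (h , inj₁ (refl , r)) = inj₂ (inj₁ (refl , ℕP.+-cancelʳ-≡ i _ _ (trans (sym (ℕP.+-suc m i)) (diff-inj m i n (suc i) h)) , r))
... | inj₂ (h , inj₂ (refl , r)) = inj₂ (inj₂ (refl , ℕP.+-cancelʳ-≡ j _ _ (sym (trans (diff-inj m (suc j) n j h) (ℕP.+-suc n j))) , r))

suc-double : ∀ u v → suc (suc (v ℕ.+ v)) ≡ u ℕ.+ u → suc v ≡ u
suc-double u v e = double-inj (suc v) u (trans (cong suc (ℕP.+-suc v v)) e)

adjacent-sound : ∀ x y → adjacent (emb x) (emb y) ≡ true → Adj x y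
adjacent-sound (L i u) (L j v) e with level-cases i (u ℕ.+ u) j (v ℕ.+ v) e
... | inj₁ (_ , inj₁ h)            = ⊥-elim (even≢odd v u (sym h))
... | inj₁ (_ , inj₂ h)            = ⊥-elim (even≢odd u v (sym h))
... | inj₂ (inj₁ (_ , h , _))      = ⊥-elim (even≢odd v u (sym h))
... | inj₂ (inj₂ (_ , h , _))      = ⊥-elim (even≢odd u v (sym h))
adjacent-sound (R i u) (R j v) e with level-cases i (suc (u ℕ.+ u)) j (suc (v ℕ.+ v)) e
... | inj₁ (_ , inj₁ h)            = ⊥-elim (even≢odd v u (sym (ℕP.suc-injective h)))
... | inj₁ (_ , inj₂ h)            = ⊥-elim (even≢odd u v (sym (ℕP.suc-injective h)))
... | inj₂ (inj₁ (_ , h , _))      = ⊥-elim (even≢odd v u (sym (ℕP.suc-injective h)))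
... | inj₂ (inj₂ (_ , h , _))      = ⊥-elim (even≢odd u v (sym (ℕP.suc-injective h)))
adjacent-sound (L i u) (R j v) e with level-cases i (u ℕ.+ u) j (suc (v ℕ.+ v)) e
... | inj₁ (refl , inj₁ h) with double-inj u v (ℕP.suc-injective h)
...   | refl = LR
adjacent-sound (L i u) (R j v) e | inj₁ (refl , inj₂ h) with suc-double u v h
...   | refl = LR′
adjacent-sound (L i u) (R j v) e | inj₂ (inj₁ (refl , h , _)) with double-inj u v (ℕP.suc-injective h)
...   | refl = LR→
adjacent-sound (L i u) (R j v) e | inj₂ (inj₂ (_ , _ , r)) = ⊥-elim (true≢false (trans (sym (isRight-R j v)) r))
adjacent-sound (R i u) (L j v) e with level-cases i (suc (u ℕ.+ u)) j (v ℕ.+ v) e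
... | inj₁ (refl , inj₁ h) with suc-double v u h
...   | refl = RL′
adjacent-sound (R i u) (L j v) e | inj₁ (refl , inj₂ h) with double-inj v u (ℕP.suc-injective h)
...   | refl = RL
adjacent-sound (R i u) (L j v) e | inj₂ (inj₁ (_ , _ , r)) = ⊥-elim (true≢false (trans (sym (isRight-R i u)) r))
adjacent-sound (R i u) (L j v) e | inj₂ (inj₂ (refl , h , _)) with double-inj v u (ℕP.suc-injective h)
...   | refl = RL←

diff-shift : ∀ m j → + m ℤ.- + j ≡ + suc m ℤ.- + suc j
diff-shift m j = sym (trans (ℤP.[+m]-[+n]≡m⊖n (suc m) (suc j)) (trans (ℤP.[1+m]⊖[1+n]≡m⊖n m j) (sym (ℤP.[+m]-[+n]≡m⊖n m j))))

opaque
  adj : Cell → Cell → Bool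
  adj x y = adjacent (emb x) (emb y)

  adj-false : ∀ {x y} → ¬ Adj x y → adj x y ≡ false
  adj-false {x} {y} h with adjacent (emb x) (emb y) in e
  ... | false = refl
  ... | true  = ⊥-elim (h (adjacent-sound x y e))

  adj-LR : ∀ j u → adj (L j u) (R j u) ≡ true
  adj-LR j u rewrite ≡ᵇ-refl j | ≡ℤᵇ-refl (diff-suc (u ℕ.+ u) j) = refl

  adj-RL : ∀ j u → adj (R j u) (L j (suc u)) ≡ true
  adj-RL j u rewrite ≡ᵇ-refl j | ≡ℤᵇ-refl (trans (diff-suc (suc (u ℕ.+ u)) j) (cong (λ n → + suc n ℤ.- + j) (sym (ℕP.+-suc u u)))) = refl

  adj-LR→ : ∀ j u → adj (L j u) (R (suc j) u) ≡ true
  adj-LR→ j u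
    rewrite ≡ℤᵇ-refl (diff-shift (u ℕ.+ u) j) | ≡ᵇ-refl j | isRight-L j u = BoolP.∨-zeroʳ _

level-inj : ∀ x y → column x ≡ column y → level x ≡ level y → x ≡ y
level-inj (L i u) (L j v) refl e = cong (L i) (double-inj u v e)
level-inj (R i u) (R j v) refl e = cong (R i) (double-inj u v (ℕP.suc-injective e))
level-inj (L i u) (R j v) c e = ⊥-elim (even≢odd u v e)
level-inj (R i u) (L j v) c e = ⊥-elim (even≢odd v u (sym e))

opaque
  _==_ : Cell → Cell → Bool
  x == y = emb x ≡Tᵇ emb y

  ==-true : ∀ {x y} → (x == y) ≡ true → x ≡ y
  ==-true {x} {y} e = go x y (trans (sym (cong₂ _≡Tᵇ_ (emb-level x) (emb-level y))) e)
    where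
    go : ∀ x y → ((column x , + level x ℤ.- + column x) ≡Tᵇ (column y , + level y ℤ.- + column y)) ≡ true → x ≡ y
    go x y e with ∧-true e
    ... | c , h = level-inj x y c′ (ℕP.+-cancelʳ-≡ (column x) _ _ (trans (cong (level x ℕ.+_) c′) (diff-inj (level x) (column x) (level y) (column y) (≡ℤᵇ-true h))))
      where
      c′ : column x ≡ column y
      c′ = ≡ᵇ-true {column x} {column y} c

  ==-refl : ∀ x → (x == x) ≡ true
  ==-refl x = trans (cong₂ _∧_ (≡ᵇ-refl (proj₁ (emb x))) (≡ℤᵇ-refl {proj₂ (emb x)} refl)) refl

  ==-false : ∀ {x y} → x ≢ y → (x == y) ≡ false
  ==-false {x} {y} ne with x == y in e
  ... | false = refl
  ... | true  = ⊥-elim (ne (==-true e))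

-- Tilings counted on a fixed list of cells

Pred : Set
Pred = Cell → Bool

_∖_ : Pred → Cell → Pred
(P ∖ y) z = not (y == z) ∧ P z

sumOver : {A : Set} → (A → ℕ) → List A → ℕ
sumOver f []       = 0
sumOver f (x ∷ xs) = f x ℕ.+ sumOver f xs

when : Bool → ℕ → ℕ
when b n = if b then n else 0

-- The list stays as it is and the predicate of present cells shrinks. Thus the order of the cells
-- survives all removals, and the position in the strip is known at every moment.
cnt : List Cell → Pred → ℕ
cnt []       P = 1
cnt (x ∷ xs) P = if P x then sumOver (λ y → when (adj x y ∧ P y) (cnt xs (P ∖ y))) xs else cnt xs P

sumOver-cong : {A : Set} {f g : A → ℕ} → (∀ x → f x ≡ g x) → ∀ xs → sumOver f xs ≡ sumOver g xs
sumOver-cong h []       = refl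
sumOver-cong h (x ∷ xs) = cong₂ ℕ._+_ (h x) (sumOver-cong h xs)

select : Pred → List Cell → List Cell
select P = filter (λ x → P x Bool.≟ true)

filter-sum : (q : Triangle → Bool) (g : Triangle → ℕ) (P : Pred) → ∀ xs →
  sumℕ (map g (filter (λ y → q y Bool.≟ true) (map emb (select P xs)))) ≡ sumOver (λ y → when (q (emb y) ∧ P y) (g (emb y))) xs
filter-sum q g P [] = refl
filter-sum q g P (x ∷ xs) with P x
... | false rewrite BoolP.∧-zeroʳ (q (emb x)) = filter-sum q g P xs
... | true  rewrite BoolP.∧-identityʳ (q (emb x)) with q (emb x)
...   | true  = cong (g (emb x) ℕ.+_) (filter-sum q g P xs)
...   | false = filter-sum q g P xs

opaque
  unfolding _==_

  removeT-select : ∀ y P xs → removeT (emb y) (map emb (select P xs)) ≡ map emb (select (P ∖ y) xs)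
  removeT-select y P [] = refl
  removeT-select y P (x ∷ xs) with P x | y == x in e
  ... | false | true  = removeT-select y P xs
  ... | false | false = removeT-select y P xs
  ... | true  | true  rewrite e = removeT-select y P xs
  ... | true  | false rewrite e = cong (emb x ∷_) (removeT-select y P xs)

select-∖-length : ∀ y P xs → length (select (P ∖ y) xs) ℕ.≤ length (select P xs)
select-∖-length y P [] = ℕ.z≤n
select-∖-length y P (x ∷ xs) with P x | y == x
... | false | true  = select-∖-length y P xs
... | false | false = select-∖-length y P xs
... | true  | true  = ℕP.m≤n⇒m≤1+n (select-∖-length y P xs)
... | true  | false = ℕ.s≤s (select-∖-length y P xs)

opaque
  unfolding adj

  countTilings-cnt : ∀ n xs P → length (select P xs) ℕ.≤ n → countTilings n (map emb (select P xs)) ≡ cnt xs P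
  countTilings-cnt n [] P h = refl
  countTilings-cnt n (x ∷ xs) P h with P x
  ... | false = countTilings-cnt n xs P h
  ... | true  = go n h
    where
    go : ∀ n → suc (length (select P xs)) ℕ.≤ n → countTilings n (emb x ∷ map emb (select P xs)) ≡ sumOver (λ y → when (adj x y ∧ P y) (cnt xs (P ∖ y))) xs
    go (suc n) (ℕ.s≤s h) = trans (filter-sum (adjacent (emb x)) (λ t → countTilings n (removeT t (map emb (select P xs)))) P xs)
      (sumOver-cong (λ y → cong (when (adj x y ∧ P y)) (trans (cong (countTilings n) (removeT-select y P xs))
        (countTilings-cnt n xs (P ∖ y) (ℕP.≤-trans (select-∖-length y P xs) h)))) xs)

M-cnt : ∀ xs P → M (map emb (select P xs)) ≡ cnt xs P
M-cnt xs P = countTilings-cnt (length (map emb (select P xs))) xs P (ℕP.≤-reflexive (sym (LP.length-map emb (select P xs))))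

-- Left and right triangles of a strip alternate upwards. In this order only R j u and R (j + 1) u
-- come after L j u as neighbours, and only L j (u + 1) comes after R j u.
pairs : ℕ → ℕ → ℕ → List Cell
pairs j u zero    = []
pairs j u (suc m) = L j u ∷ R j u ∷ pairs j (suc u) m

strips : ℕ → ℕ → ℕ → List Cell
strips U j zero    = []
strips U j (suc n) = pairs j 0 U ++ strips U (suc j) n

sumOver-++ : {A : Set} (f : A → ℕ) (xs ys : List A) → sumOver f (xs ++ ys) ≡ sumOver f xs ℕ.+ sumOver f ys
sumOver-++ f []       ys = refl
sumOver-++ f (x ∷ xs) ys = trans (cong (f x ℕ.+_) (sumOver-++ f xs ys)) (sym (ℕP.+-assoc (f x) _ _))

sumOver-0 : {A : Set} (f : A → ℕ) {xs : List A} → All (λ x → f x ≡ 0) xs → sumOver f xs ≡ 0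
sumOver-0 f []       = refl
sumOver-0 f (e ∷ es) = cong₂ ℕ._+_ e (sumOver-0 f es)

All-pairs : ∀ {P : Cell → Set} j u m → (∀ v → u ℕ.≤ v → P (L j v) × P (R j v)) → All P (pairs j u m)
All-pairs j u zero    h = []
All-pairs j u (suc m) h = proj₁ (h u ℕP.≤-refl) ∷ proj₂ (h u ℕP.≤-refl) ∷ All-pairs j (suc u) m (λ v p → h v (ℕP.<⇒≤ p))

All-strips : ∀ {P : Cell → Set} U j n → (∀ y → j ℕ.≤ column y → P y) → All P (strips U j n)
All-strips U j zero    h = []
All-strips U j (suc n) h = AllP.++⁺ (All-pairs j 0 U (λ v _ → h (L j v) ℕP.≤-refl , h (R j v) ℕP.≤-refl))
                                    (All-strips U (suc j) n (λ y p → h y (ℕP.<⇒≤ p)))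

module _ (Q : Pred) (F : Cell → ℕ) where

  term : Cell → Cell → ℕ
  term x y = when (adj x y ∧ Q y) (F y)

  term-0 : ∀ {x y} → ¬ Adj x y → term x y ≡ 0
  term-0 {x} {y} h = cong (λ b → when (b ∧ Q y) (F y)) (adj-false {x} {y} h)

  -- In the last strip the list contains no partner on the right; the hypothesis for n = 0 makes the
  -- second term vanish then.
  sum-L : ∀ U j u m n → u ℕ.< U → (n ≡ 0 → Q (R (suc j) u) ≡ false) →
    sumOver (term (L j u)) (R j u ∷ pairs j (suc u) m ++ strips U (suc j) n) ≡
    when (Q (R j u)) (F (R j u)) ℕ.+ when (Q (R (suc j) u)) (F (R (suc j) u))
  sum-L U j u m n u<U h = cong₂ ℕ._+_ (cong (λ b → when (b ∧ Q (R j u)) (F (R j u))) (adj-LR j u))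
    (trans (sumOver-++ _ (pairs j (suc u) m) _) (cong₂ ℕ._+_
      (sumOver-0 _ (All-pairs j (suc u) m (λ v p → term-0 (λ ()) ,
        term-0 (λ { LR → ℕP.<-irrefl refl p ; LR′ → ℕP.<-irrefl refl (ℕP.<-trans (ℕP.n<1+n _) p) }))))
      (next n h)))
    where
    inPairs : ∀ w m → w ℕ.≤ u → u ℕ.< w ℕ.+ m → sumOver (term (L j u)) (pairs (suc j) w m) ≡ when (Q (R (suc j) u)) (F (R (suc j) u))
    inPairs w zero    p q = ⊥-elim (ℕP.<-irrefl refl (ℕP.<-≤-trans q (subst (ℕ._≤ u) (sym (ℕP.+-identityʳ w)) p)))
    inPairs w (suc m) p q with w ℕ.≟ u
    ... | yes refl = trans (cong₂ ℕ._+_ (term-0 {L j u} {L (suc j) u} (λ ())) (cong₂ ℕ._+_ (cong (λ b → when (b ∧ Q (R (suc j) u)) (F (R (suc j) u))) (adj-LR→ j u))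
        (sumOver-0 _ (All-pairs (suc j) (suc u) m (λ v p → term-0 (λ ()) , term-0 (λ { LR→ → ℕP.<-irrefl refl p })))))) (ℕP.+-identityʳ _)
    ... | no  w≢u  = trans (cong₂ ℕ._+_ (term-0 {L j u} {L (suc j) w} (λ ())) (cong₂ ℕ._+_ (term-0 {L j u} {R (suc j) w} (λ { LR→ → w≢u refl }))
        (inPairs (suc w) m (ℕP.≤∧≢⇒< p w≢u) (subst (u ℕ.<_) (ℕP.+-suc w m) q)))) refl
    next : ∀ n → (n ≡ 0 → Q (R (suc j) u) ≡ false) → sumOver (term (L j u)) (strips U (suc j) n) ≡ when (Q (R (suc j) u)) (F (R (suc j) u))
    next zero    h = sym (cong (λ b → when b (F (R (suc j) u))) (h refl))
    next (suc n) h = trans (sumOver-++ _ (pairs (suc j) 0 U) _) (trans (cong₂ ℕ._+_ (inPairs 0 U ℕ.z≤n u<U)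
      (sumOver-0 _ (All-strips U (suc (suc j)) n (λ { (L _ _) p → term-0 (λ ()) ; (R i v) p → term-0 (far p) })))) (ℕP.+-identityʳ _))
      where
      far : ∀ {i v} → suc (suc j) ℕ.≤ i → ¬ Adj (L j u) (R i v)
      far p LR  = ℕP.<-irrefl refl (ℕP.<⇒≤ p)
      far p LR′ = ℕP.<-irrefl refl (ℕP.<⇒≤ p)
      far p LR→ = ℕP.<-irrefl refl p

  -- All other neighbours of R j u stand before it in the list. At the top of the strip the
  -- remaining one is missing from the list, hence the hypothesis for m = 0.
  sum-R : ∀ U j u m n → (m ≡ 0 → Q (L j (suc u)) ≡ false) →
    sumOver (term (R j u)) (pairs j (suc u) m ++ strips U (suc j) n) ≡ when (Q (L j (suc u))) (F (L j (suc u)))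
  sum-R U j u m n h = trans (sumOver-++ _ (pairs j (suc u) m) _)
    (trans (cong₂ ℕ._+_ (first m h) (sumOver-0 _ (All-strips U (suc j) n (λ { (R _ _) p → term-0 (λ ()) ; (L i v) p → term-0 (far p) })))) (ℕP.+-identityʳ _))
    where
    far : ∀ {i v} → suc j ℕ.≤ i → ¬ Adj (R j u) (L i v)
    far p RL  = ℕP.<-irrefl refl p
    far p RL′ = ℕP.<-irrefl refl p
    far p RL← = ℕP.<-irrefl refl (ℕP.<⇒≤ p)
    first : ∀ m → (m ≡ 0 → Q (L j (suc u)) ≡ false) → sumOver (term (R j u)) (pairs j (suc u) m) ≡ when (Q (L j (suc u))) (F (L j (suc u)))
    first zero    h = sym (cong (λ b → when b (F (L j (suc u)))) (h refl))
    first (suc m) h = trans (cong₂ ℕ._+_ (cong (λ b → when (b ∧ Q (L j (suc u))) (F (L j (suc u)))) (adj-RL j u))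
      (cong₂ ℕ._+_ (term-0 {R j u} {R j (suc u)} (λ ())) (sumOver-0 _ (All-pairs j (suc (suc u)) m
        (λ v p → term-0 (λ { RL → ℕP.<-irrefl refl (ℕP.<-trans (ℕP.n<1+n _) p) ; RL′ → ℕP.<-irrefl refl p }) , term-0 (λ ())))))) (ℕP.+-identityʳ _)

∖-same : ∀ (Q : Pred) y → (Q ∖ y) y ≡ false
∖-same Q y = cong (λ b → not b ∧ Q y) (==-refl y)

∖-other : ∀ (Q : Pred) {y z} → y ≢ z → (Q ∖ y) z ≡ Q z
∖-other Q {y} {z} ne = cong (λ b → not b ∧ Q z) (==-false ne)

-- Transfer of the determinant across one strip

gate : Bool → ℚ → ℚ
gate b x = if b then x else 0ℚ

nat-when : ∀ b n → nat (when b n) ≡ gate b (nat n)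
nat-when true  n = refl
nat-when false n = nat-0

one : Bool → Fun → List Fun
one b f = if b then f ∷ [] else []

_[_↦false] : (ℕ → Bool) → ℕ → ℕ → Bool
(x [ u ↦false]) v = if v ℕ.≡ᵇ u then false else x v

↦false-same : ∀ x u → (x [ u ↦false]) u ≡ false
↦false-same x u = cong (λ b → if b then false else x u) (≡ᵇ-refl u)

↦false-other : ∀ x {u v} → v ≢ u → (x [ u ↦false]) v ≡ x v
↦false-other x {u} {v} ne = cong (λ b → if b then false else x v) (≡ᵇ-false ne)

-- The transfer across strip j.  The R-triangles of the strip that are still present are the points s where
-- paths enter; x u tells that R (suc j) u has not been matched to the left, i.e. that a path enters there.
module Strip (U j n : ℕ) (Pr : Pred) (s : ℕ → Bool)
  (cur nxt : ℕ → Fun) (ins ins′ : ℕ → List Fun) (D : List Fun → ℚ) where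

  A B : ℕ → Bool
  A u = Pr (L j u)
  B u = Pr (R (suc j) u)

  -- At an inner column an entering path is seen at the triangle on the right; at the right side of
  -- the hexagon only the left one exists. The disjunction serves both.
  fin : (ℕ → Bool) → ℕ → List Fun
  fin x v = ins′ v ++ one ((A v ∨ B v) ∧ x v) (nxt v)

  lst : (ℕ → Bool) → ℕ → List Fun
  lst x zero    = []
  lst x (suc u) = lst x u ++ fin x u

  rest : ℕ → ℕ → List Fun
  rest u zero    = []
  rest u (suc m) = ins u ++ one (s u) (cur u) ++ rest (suc u) m

  record Agrees (Q : Pred) (x : ℕ → Bool) : Set where
    field
      qN  : ∀ v → Q (R (suc j) v) ≡ B v ∧ x v
      qLn : ∀ v → Q (L (suc j) v) ≡ Pr (L (suc j) v)
      qF  : ∀ y → suc (suc j) ℕ.≤ column y → Q y ≡ Pr y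
      xd  : ∀ v → A v ≡ true → B v ≡ false → x v ≡ true

  -- The state before L j u is treated. f tells that L j u is already covered from below, that is,
  -- that a path has just stepped up to edge u.
  record Inv (Q : Pred) (u : ℕ) (f : Bool) (x : ℕ → Bool) : Set where
    field
      ag  : Agrees Q x
      qR  : ∀ v → u ℕ.≤ v → Q (R j v) ≡ s v
      qL₀ : Q (L j u) ≡ A u ∧ not f
      qL  : ∀ v → u ℕ.< v → Q (L j v) ≡ A v
      fA  : f ≡ true → A u ≡ true × ins u ≡ []
      xT  : ∀ v → u ℕ.≤ v → x v ≡ true
    open Agrees ag public

  advance : ∀ {Q u f x} → Inv Q u f x → Inv Q (suc u) false x
  advance {u = u} i = record
    { ag = ag ; qR = λ v p → qR v (ℕP.<⇒≤ p) ; qL₀ = trans (qL (suc u) ℕP.≤-refl) (sym (BoolP.∧-identityʳ _))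
    ; qL = λ v p → qL v (ℕP.<⇒≤ p) ; fA = λ () ; xT = λ v p → xT v (ℕP.<⇒≤ p) }
    where open Inv i

  down : ∀ {Q u x} → Inv Q (suc u) false x → Inv (Q ∖ R j u) (suc u) false x
  down {Q} {u} i = record
    { ag = record { qN = λ v → trans (∖-other Q (λ ())) (qN v) ; qLn = λ v → trans (∖-other Q (λ ())) (qLn v)
                  ; qF = λ y p → trans (∖-other Q (λ { refl → ℕP.<-irrefl refl (ℕP.<⇒≤ p) })) (qF y p) ; xd = xd }
    ; qR = λ v p → trans (∖-other Q (λ { refl → ℕP.<-irrefl refl p })) (qR v p)
    ; qL₀ = trans (∖-other Q (λ ())) qL₀ ; qL = λ v p → trans (∖-other Q (λ ())) (qL v p) ; fA = λ () ; xT = xT }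
    where open Inv i

  right : ∀ {Q u x} → B u ≡ true → Inv Q (suc u) false x → Inv (Q ∖ R (suc j) u) (suc u) false (x [ u ↦false])
  right {Q} {u} {x} Bu i = record
    { ag = record { qN = qN′ ; qLn = λ v → trans (∖-other Q (λ ())) (qLn v)
                  ; qF = λ y p → trans (∖-other Q (λ { refl → ℕP.<-irrefl refl p })) (qF y p) ; xd = xd′ }
    ; qR = λ v p → trans (∖-other Q (λ ())) (qR v p)
    ; qL₀ = trans (∖-other Q (λ ())) qL₀ ; qL = λ v p → trans (∖-other Q (λ ())) (qL v p) ; fA = λ ()
    ; xT = λ v p → trans (↦false-other x (λ { refl → ℕP.<-irrefl refl p })) (xT v p) }
    where
    open Inv i
    qN′ : ∀ v → (Q ∖ R (suc j) u) (R (suc j) v) ≡ B v ∧ (x [ u ↦false]) v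
    qN′ v with v ℕ.≟ u
    ... | yes refl = trans (∖-same Q (R (suc j) u)) (sym (trans (cong (B u ∧_) (↦false-same x u)) (BoolP.∧-zeroʳ _)))
    ... | no  v≢u  = trans (∖-other Q (λ { refl → v≢u refl })) (trans (qN v) (cong (B v ∧_) (sym (↦false-other x v≢u))))
    xd′ : ∀ v → A v ≡ true → B v ≡ false → (x [ u ↦false]) v ≡ true
    xd′ v p q with v ℕ.≟ u
    ... | yes refl = ⊥-elim (true≢false (trans (sym Bu) q))
    ... | no  v≢u  = trans (↦false-other x v≢u) (xd v p q)

  up : ∀ {Q u x} → A u ≡ true → ins u ≡ [] → Inv Q u false x → Inv (Q ∖ L j u) u true x
  up {Q} {u} Au iu i = record
    { ag = record { qN = λ v → trans (∖-other Q (λ ())) (qN v) ; qLn = λ v → trans (∖-other Q (λ ())) (qLn v)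
                  ; qF = λ y p → trans (∖-other Q (λ { refl → ℕP.<-irrefl refl (ℕP.<⇒≤ p) })) (qF y p) ; xd = xd }
    ; qR = λ v p → trans (∖-other Q (λ ())) (qR v p)
    ; qL₀ = trans (∖-same Q (L j u)) (sym (BoolP.∧-zeroʳ _))
    ; qL = λ v p → trans (∖-other Q (λ { refl → ℕP.<-irrefl refl p })) (qL v p) ; fA = λ _ → Au , iu ; xT = xT }
    where open Inv i

  -- D is linear along a path step (`hsplit`) and vanishes when neighbouring paths meet (`hdup`).
  -- `H₁` keeps meeting paths adjacent in the list, `H₂` and `H₃` let carried rows become paths only
  -- where the left triangle is missing, and `H₄` says that a left triangle without right neighbour
  -- must be used by a path.
  module Transfer
    (AU  : A U ≡ false)
    (B₀  : n ≡ 0 → ∀ v → B v ≡ false)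
    (hsplit : ∀ u pre post → s u ≡ true → D (pre ++ cur u ∷ post) ≡
       gate (A u) (D (pre ++ nxt u ∷ post)) + gate (A (suc u)) (D (pre ++ nxt (suc u) ∷ post)))
    (hdup : ∀ pre f post → D (pre ++ f ∷ f ∷ post) ≡ 0ℚ)
    (H₁ : ∀ u → s u ≡ true → A (suc u) ≡ true → ins (suc u) ≡ [])
    (H₂ : ∀ u → A u ≡ true → ins u ≡ ins′ u)
    (H₃ : ∀ u → A u ≡ false → ins u ≡ ins′ u ++ one (B u) (nxt u))
    (H₄ : ∀ u x f m → A u ≡ true → B u ≡ false → D (lst x u ++ ins′ u ++ one f (nxt (suc u)) ++ rest (suc u) m) ≡ 0ℚ)
    (IH : ∀ Q x → Agrees Q x → nat (cnt (strips U (suc j) n) Q) ≡ D (lst x U)) where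

    lst-↦ : ∀ x u v → v ℕ.≤ u → lst (x [ u ↦false]) v ≡ lst x v
    lst-↦ x u zero    h = refl
    lst-↦ x u (suc v) h = cong₂ _++_ (lst-↦ x u v (ℕP.<⇒≤ h))
      (cong (λ b → ins′ v ++ one ((A v ∨ B v) ∧ b) (nxt v)) (↦false-other x (λ e → ℕP.<-irrefl e h)))

    fin-true : ∀ {x u} → x u ≡ true → A u ≡ true → fin x u ≡ ins′ u ++ nxt u ∷ []
    fin-true {x} {u} xu Au = cong₂ (λ a b → ins′ u ++ one ((a ∨ B u) ∧ b) (nxt u)) Au xu

    fin-false : ∀ x u → fin (x [ u ↦false]) u ≡ ins′ u
    fin-false x u = trans (cong (λ b → ins′ u ++ one b (nxt u)) (trans (cong ((A u ∨ B u) ∧_) (↦false-same x u)) (BoolP.∧-zeroʳ _))) (LP.++-identityʳ _)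

    fin-wall : ∀ {x u} → x u ≡ true → A u ≡ false → fin x u ≡ ins u
    fin-wall {x} {u} xu Au = trans (cong₂ (λ a b → ins′ u ++ one ((a ∨ B u) ∧ b) (nxt u)) Au xu)
      (trans (cong (λ b → ins′ u ++ one b (nxt u)) (BoolP.∧-identityʳ (B u))) (sym (H₃ u Au)))

    -- Halfway through the strip the rows below edge u belong to column j + 1 and the others still
    -- to column j. Each matching decision converts one more row.
    claim : ∀ m u f x Q → u ℕ.+ m ≡ U → Inv Q u f x →
      nat (cnt (pairs j u m ++ strips U (suc j) n) Q) ≡ D (lst x u ++ one f (nxt u) ++ rest u m)

    afterR : ∀ m u x Q → suc u ℕ.+ m ≡ U → Inv Q (suc u) false x → Q (R j u) ≡ true → s u ≡ true →
      nat (cnt (R j u ∷ pairs j (suc u) m ++ strips U (suc j) n) Q) ≡ gate (A (suc u)) (D (lst x (suc u) ++ nxt (suc u) ∷ rest (suc u) m))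
    afterR m u x Q e i qr su rewrite qr = begin
      nat (sumOver (term Q (λ y → cnt ps (Q ∖ y)) (R j u)) ps)
        ≡⟨ cong nat (sum-R Q (λ y → cnt ps (Q ∖ y)) U j u m n (λ { refl → trans qLs (trans (cong A (trans (sym (ℕP.+-identityʳ _)) e)) AU) })) ⟩
      nat (when (Q (L j (suc u))) (cnt ps (Q ∖ L j (suc u))))
        ≡⟨ trans (nat-when (Q (L j (suc u))) _) (cong (λ b → gate b (nat (cnt ps (Q ∖ L j (suc u))))) qLs) ⟩
      gate (A (suc u)) (nat (cnt ps (Q ∖ L j (suc u))))
        ≡⟨ step ⟩
      gate (A (suc u)) (D (lst x (suc u) ++ nxt (suc u) ∷ rest (suc u) m)) ∎
      where
      open ≡-Reasoning
      open Inv i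
      ps = pairs j (suc u) m ++ strips U (suc j) n
      qLs : Q (L j (suc u)) ≡ A (suc u)
      qLs = trans qL₀ (BoolP.∧-identityʳ _)
      step : gate (A (suc u)) (nat (cnt ps (Q ∖ L j (suc u)))) ≡ gate (A (suc u)) (D (lst x (suc u) ++ nxt (suc u) ∷ rest (suc u) m))
      step with A (suc u) in eA
      ... | false = refl
      ... | true  = claim m (suc u) true x (Q ∖ L j (suc u)) e (up eA (H₁ u su eA) i)

    afterNoR : ∀ m u x Q → suc u ℕ.+ m ≡ U → Inv Q (suc u) false x → Q (R j u) ≡ false →
      nat (cnt (R j u ∷ pairs j (suc u) m ++ strips U (suc j) n) Q) ≡ D (lst x (suc u) ++ rest (suc u) m)
    afterNoR m u x Q e i qr rewrite qr = claim m (suc u) false x Q e i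

    claim zero u f x Q e i = begin
      nat (cnt (strips U (suc j) n) Q)  ≡⟨ IH Q x ag ⟩
      D (lst x U)                       ≡⟨ cong D (sym (trans (cong₂ (λ v g → lst x v ++ one g (nxt u) ++ []) u≡U (f≡ f refl)) (LP.++-identityʳ _))) ⟩
      D (lst x u ++ one f (nxt u) ++ []) ∎
      where
      open ≡-Reasoning
      open Inv i
      u≡U : u ≡ U
      u≡U = trans (sym (ℕP.+-identityʳ u)) e
      f≡ : ∀ g → f ≡ g → g ≡ false
      f≡ false _ = refl
      f≡ true  q = ⊥-elim (true≢false (trans (sym (proj₁ (fA q))) (trans (cong A u≡U) AU)))
    claim (suc m) u f x Q e i = go (A u) f (s u) refl refl refl
      where
      open ≡-Reasoning
      open Inv i
      ps = pairs j (suc u) m ++ strips U (suc j) n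
      r  = rest (suc u) m
      X  = lst x u
      x′ = x [ u ↦false]
      xu : x u ≡ true
      xu = xT u ℕP.≤-refl
      e′ : suc u ℕ.+ m ≡ U
      e′ = trans (sym (ℕP.+-suc u m)) e
      u<U : u ℕ.< U
      u<U = subst (u ℕ.<_) e′ (ℕP.m≤m+n (suc u) m)
      i′ : Inv Q (suc u) false x
      i′ = advance i
      qRu : Q (R j u) ≡ s u
      qRu = qR u ℕP.≤-refl
      X′ : lst x′ (suc u) ≡ X ++ ins′ u
      X′ = cong₂ _++_ (lst-↦ x u u ℕP.≤-refl) (fin-false x u)
      skipL : Q (L j u) ≡ false → cnt (L j u ∷ R j u ∷ ps) Q ≡ cnt (R j u ∷ ps) Q
      skipL q = cong (λ b → if b then sumOver (term Q (λ y → cnt (R j u ∷ ps) (Q ∖ y)) (L j u)) (R j u ∷ ps) else cnt (R j u ∷ ps) Q) q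
      takeL : Q (L j u) ≡ true → nat (cnt (L j u ∷ R j u ∷ ps) Q) ≡
        gate (s u) (nat (cnt (R j u ∷ ps) (Q ∖ R j u))) + gate (B u) (nat (cnt (R j u ∷ ps) (Q ∖ R (suc j) u)))
      takeL q = begin
        nat (cnt (L j u ∷ R j u ∷ ps) Q)
          ≡⟨ cong (λ b → nat (if b then sumOver (term Q (λ y → cnt (R j u ∷ ps) (Q ∖ y)) (L j u)) (R j u ∷ ps) else cnt (R j u ∷ ps) Q)) q ⟩
        nat (sumOver (term Q (λ y → cnt (R j u ∷ ps) (Q ∖ y)) (L j u)) (R j u ∷ ps))
          ≡⟨ cong nat (sum-L Q (λ y → cnt (R j u ∷ ps) (Q ∖ y)) U j u m n u<U (λ n0 → trans qNu (B₀ n0 u))) ⟩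
        nat (when (Q (R j u)) (cnt (R j u ∷ ps) (Q ∖ R j u)) ℕ.+ when (Q (R (suc j) u)) (cnt (R j u ∷ ps) (Q ∖ R (suc j) u)))
          ≡⟨ trans (nat-+ _ _) (cong₂ _+_ (nat-when (Q (R j u)) _) (nat-when (Q (R (suc j) u)) _)) ⟩
        gate (Q (R j u)) (nat (cnt (R j u ∷ ps) (Q ∖ R j u))) + gate (Q (R (suc j) u)) (nat (cnt (R j u ∷ ps) (Q ∖ R (suc j) u)))
          ≡⟨ cong₂ (λ a b → gate a (nat (cnt (R j u ∷ ps) (Q ∖ R j u))) + gate b (nat (cnt (R j u ∷ ps) (Q ∖ R (suc j) u)))) qRu qNu ⟩
        gate (s u) (nat (cnt (R j u ∷ ps) (Q ∖ R j u))) + gate (B u) (nat (cnt (R j u ∷ ps) (Q ∖ R (suc j) u))) ∎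
        where
        qNu : Q (R (suc j) u) ≡ B u
        qNu = trans (qN u) (trans (cong (B u ∧_) xu) (BoolP.∧-identityʳ _))
      qR-right : (Q ∖ R (suc j) u) (R j u) ≡ s u
      qR-right = trans (∖-other Q (λ ())) qRu
      go : ∀ a g t → A u ≡ a → f ≡ g → s u ≡ t → nat (cnt (L j u ∷ R j u ∷ ps) Q) ≡ D (X ++ one f (nxt u) ++ ins u ++ one (s u) (cur u) ++ r)
      go true false true eA ef es = begin
        nat (cnt (L j u ∷ R j u ∷ ps) Q)
          ≡⟨ takeL (trans qL₀ (cong₂ (λ a b → a ∧ not b) eA ef)) ⟩
        gate (s u) (nat (cnt (R j u ∷ ps) (Q ∖ R j u))) + gate (B u) (nat (cnt (R j u ∷ ps) (Q ∖ R (suc j) u)))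
          ≡⟨ cong₂ _+_ (trans (cong (λ b → gate b (nat (cnt (R j u ∷ ps) (Q ∖ R j u)))) es) (afterNoR m u x (Q ∖ R j u) e′ (down i′) (∖-same Q (R j u)))) rightPart ⟩
        D (lst x (suc u) ++ r) + gate (A (suc u)) (D ((X ++ ins′ u) ++ nxt (suc u) ∷ r))
          ≡⟨ cong₂ _+_ (trans (cong D (trans (cong (λ l → (X ++ l) ++ r) (fin-true {x} xu eA)) (trans (cong (_++ r) (sym (LP.++-assoc X (ins′ u) _))) (LP.++-assoc (X ++ ins′ u) _ r))))
                              (cong (λ a → gate a (D ((X ++ ins′ u) ++ nxt u ∷ r))) (sym eA))) refl ⟩
        gate (A u) (D ((X ++ ins′ u) ++ nxt u ∷ r)) + gate (A (suc u)) (D ((X ++ ins′ u) ++ nxt (suc u) ∷ r))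
          ≡⟨ sym (hsplit u (X ++ ins′ u) r es) ⟩
        D ((X ++ ins′ u) ++ cur u ∷ r)
          ≡⟨ cong D (trans (LP.++-assoc X (ins′ u) _) (cong₂ (λ l k → X ++ l ++ k ++ r) (sym (H₂ u eA)) (cong (λ b → one b (cur u)) (sym es)))) ⟩
        D (X ++ ins u ++ one (s u) (cur u) ++ r)
          ≡⟨ cong (λ g → D (X ++ one g (nxt u) ++ ins u ++ one (s u) (cur u) ++ r)) (sym ef) ⟩
        D (X ++ one f (nxt u) ++ ins u ++ one (s u) (cur u) ++ r) ∎
        where
        rightPart : gate (B u) (nat (cnt (R j u ∷ ps) (Q ∖ R (suc j) u))) ≡ gate (A (suc u)) (D ((X ++ ins′ u) ++ nxt (suc u) ∷ r))
        rightPart with B u in eB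
        ... | true  = trans (afterR m u x′ (Q ∖ R (suc j) u) e′ (right eB i′) (trans qR-right es) es) (cong (λ l → gate (A (suc u)) (D (l ++ nxt (suc u) ∷ r))) X′)
        ... | false with A (suc u)
        ...   | false = refl
        -- L j u has no partner on the right, so this branch counts nothing, whereas the splitting
        -- of the row still produces its term; that term is zero.
        ...   | true  = sym (trans (cong D (LP.++-assoc X (ins′ u) _)) (H₄ u x true m eA eB))
      go true false false eA ef es = begin
        nat (cnt (L j u ∷ R j u ∷ ps) Q)
          ≡⟨ takeL (trans qL₀ (cong₂ (λ a b → a ∧ not b) eA ef)) ⟩
        gate (s u) (nat (cnt (R j u ∷ ps) (Q ∖ R j u))) + gate (B u) (nat (cnt (R j u ∷ ps) (Q ∖ R (suc j) u)))
          ≡⟨ trans (cong₂ _+_ (cong (λ b → gate b (nat (cnt (R j u ∷ ps) (Q ∖ R j u)))) es) rightPart) (+-identityˡ _) ⟩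
        D (X ++ ins′ u ++ r)
          ≡⟨ cong D (cong₂ (λ l k → X ++ l ++ k ++ r) (sym (H₂ u eA)) (cong (λ b → one b (cur u)) (sym es))) ⟩
        D (X ++ ins u ++ one (s u) (cur u) ++ r)
          ≡⟨ cong (λ g → D (X ++ one g (nxt u) ++ ins u ++ one (s u) (cur u) ++ r)) (sym ef) ⟩
        D (X ++ one f (nxt u) ++ ins u ++ one (s u) (cur u) ++ r) ∎
        where
        rightPart : gate (B u) (nat (cnt (R j u ∷ ps) (Q ∖ R (suc j) u))) ≡ D (X ++ ins′ u ++ r)
        rightPart with B u in eB
        ... | true  = trans (afterNoR m u x′ (Q ∖ R (suc j) u) e′ (right eB i′) (trans qR-right es)) (cong D (trans (cong (_++ r) X′) (LP.++-assoc X (ins′ u) r)))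
        ... | false = sym (H₄ u x false m eA eB)
      go true true true eA ef es = begin
        nat (cnt (L j u ∷ R j u ∷ ps) Q)
          ≡⟨ cong nat (skipL (trans qL₀ (trans (cong (λ b → A u ∧ not b) ef) (BoolP.∧-zeroʳ _)))) ⟩
        nat (cnt (R j u ∷ ps) Q)
          ≡⟨ afterR m u x Q e′ i′ (trans qRu es) es ⟩
        gate (A (suc u)) (D (lst x (suc u) ++ nxt (suc u) ∷ r))
          ≡⟨ cong (λ l → gate (A (suc u)) (D (l ++ nxt (suc u) ∷ r))) (cong (X ++_) (trans (fin-true {x} xu eA) (cong (_++ nxt u ∷ []) i0))) ⟩
        gate (A (suc u)) (D ((X ++ nxt u ∷ []) ++ nxt (suc u) ∷ r))
          -- L j u is taken, so the path at u has to step up. The level step would repeat the row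
          -- `nxt u` of the path that came from below, and is added as a zero.
          ≡⟨ sym (trans (+-congʳ dup) (+-identityˡ _)) ⟩
        gate (A u) (D ((X ++ nxt u ∷ []) ++ nxt u ∷ r)) + gate (A (suc u)) (D ((X ++ nxt u ∷ []) ++ nxt (suc u) ∷ r))
          ≡⟨ sym (hsplit u (X ++ nxt u ∷ []) r es) ⟩
        D ((X ++ nxt u ∷ []) ++ cur u ∷ r)
          ≡⟨ cong D (LP.++-assoc X _ _) ⟩
        D (X ++ nxt u ∷ cur u ∷ r)
          ≡⟨ cong₂ (λ l k → D (X ++ nxt u ∷ l ++ one k (cur u) ++ r)) (sym (proj₂ (fA ef))) (sym es) ⟩
        D (X ++ nxt u ∷ ins u ++ one (s u) (cur u) ++ r)
          ≡⟨ cong (λ g → D (X ++ one g (nxt u) ++ ins u ++ one (s u) (cur u) ++ r)) (sym ef) ⟩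
        D (X ++ one f (nxt u) ++ ins u ++ one (s u) (cur u) ++ r) ∎
        where
        i0 : ins′ u ≡ []
        i0 = trans (sym (H₂ u eA)) (proj₂ (fA ef))
        dup : gate (A u) (D ((X ++ nxt u ∷ []) ++ nxt u ∷ r)) ≡ 0ℚ
        dup = trans (cong₂ gate eA (trans (cong D (LP.++-assoc X _ _)) (hdup X (nxt u) r))) refl
      go true true false eA ef es = begin
        nat (cnt (L j u ∷ R j u ∷ ps) Q)
          ≡⟨ cong nat (skipL (trans qL₀ (trans (cong (λ b → A u ∧ not b) ef) (BoolP.∧-zeroʳ _)))) ⟩
        nat (cnt (R j u ∷ ps) Q)
          ≡⟨ afterNoR m u x Q e′ i′ (trans qRu es) ⟩
        D (lst x (suc u) ++ r)
          ≡⟨ cong D (trans (cong (λ l → (X ++ l) ++ r) (trans (fin-true {x} xu eA) (cong (_++ nxt u ∷ []) i0))) (LP.++-assoc X _ r)) ⟩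
        D (X ++ nxt u ∷ r)
          ≡⟨ cong₂ (λ l k → D (X ++ nxt u ∷ l ++ one k (cur u) ++ r)) (sym (proj₂ (fA ef))) (sym es) ⟩
        D (X ++ nxt u ∷ ins u ++ one (s u) (cur u) ++ r)
          ≡⟨ cong (λ g → D (X ++ one g (nxt u) ++ ins u ++ one (s u) (cur u) ++ r)) (sym ef) ⟩
        D (X ++ one f (nxt u) ++ ins u ++ one (s u) (cur u) ++ r) ∎
        where
        i0 : ins′ u ≡ []
        i0 = trans (sym (H₂ u eA)) (proj₂ (fA ef))
      go false true t eA ef es = ⊥-elim (true≢false (trans (sym (proj₁ (fA ef))) eA))
      go false false true eA ef es = begin
        nat (cnt (L j u ∷ R j u ∷ ps) Q)
          ≡⟨ cong nat (skipL (trans qL₀ (cong (_∧ not f) eA))) ⟩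
        nat (cnt (R j u ∷ ps) Q)
          ≡⟨ afterR m u x Q e′ i′ (trans qRu es) es ⟩
        gate (A (suc u)) (D (lst x (suc u) ++ nxt (suc u) ∷ r))
          ≡⟨ cong (λ l → gate (A (suc u)) (D ((X ++ l) ++ nxt (suc u) ∷ r))) (fin-wall {x} xu eA) ⟩
        gate (A (suc u)) (D ((X ++ ins u) ++ nxt (suc u) ∷ r))
          ≡⟨ sym (trans (cong (λ a → gate a (D ((X ++ ins u) ++ nxt u ∷ r)) + gate (A (suc u)) (D ((X ++ ins u) ++ nxt (suc u) ∷ r))) eA) (+-identityˡ _)) ⟩
        gate (A u) (D ((X ++ ins u) ++ nxt u ∷ r)) + gate (A (suc u)) (D ((X ++ ins u) ++ nxt (suc u) ∷ r))
          ≡⟨ sym (hsplit u (X ++ ins u) r es) ⟩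
        D ((X ++ ins u) ++ cur u ∷ r)
          ≡⟨ cong D (trans (LP.++-assoc X (ins u) _) (cong (λ k → X ++ ins u ++ one k (cur u) ++ r) (sym es))) ⟩
        D (X ++ ins u ++ one (s u) (cur u) ++ r)
          ≡⟨ cong (λ g → D (X ++ one g (nxt u) ++ ins u ++ one (s u) (cur u) ++ r)) (sym ef) ⟩
        D (X ++ one f (nxt u) ++ ins u ++ one (s u) (cur u) ++ r) ∎
      go false false false eA ef es = begin
        nat (cnt (L j u ∷ R j u ∷ ps) Q)
          ≡⟨ cong nat (skipL (trans qL₀ (cong (_∧ not f) eA))) ⟩
        nat (cnt (R j u ∷ ps) Q)
          ≡⟨ afterNoR m u x Q e′ i′ (trans qRu es) ⟩
        D (lst x (suc u) ++ r)
          ≡⟨ cong D (trans (cong (λ l → (X ++ l) ++ r) (fin-wall {x} xu eA)) (LP.++-assoc X (ins u) r)) ⟩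
        D (X ++ ins u ++ r)
          ≡⟨ cong (λ k → D (X ++ ins u ++ one k (cur u) ++ r)) (sym es) ⟩
        D (X ++ ins u ++ one (s u) (cur u) ++ r)
          ≡⟨ cong (λ g → D (X ++ one g (nxt u) ++ ins u ++ one (s u) (cur u) ++ r)) (sym ef) ⟩
        D (X ++ one f (nxt u) ++ ins u ++ one (s u) (cur u) ++ r) ∎

    transfer : ∀ Q → (∀ v → Q (R j v) ≡ s v) → (∀ v → Q (L j v) ≡ A v) → (∀ y → suc j ℕ.≤ column y → Q y ≡ Pr y) →
      nat (cnt (strips U j (suc n)) Q) ≡ D (rest 0 U)
    transfer Q qR qL qF = claim U 0 false (λ _ → true) Q refl (record
      { ag = record { qN = λ v → trans (qF (R (suc j) v) ℕP.≤-refl) (sym (BoolP.∧-identityʳ _)) ; qLn = λ v → qF (L (suc j) v) ℕP.≤-refl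
                    ; qF = λ y p → qF y (ℕP.<⇒≤ p) ; xd = λ _ _ _ → refl }
      ; qR = λ v _ → qR v ; qL₀ = trans (qL 0) (sym (BoolP.∧-identityʳ _)) ; qL = λ v _ → qL v ; fA = λ () ; xT = λ _ _ → refl })

-- The hexagon in terms of columns and edges

bool-iff : ∀ {x y} → (x ≡ true → y ≡ true) → (y ≡ true → x ≡ true) → x ≡ y
bool-iff {true}  {y}     f g = sym (f refl)
bool-iff {false} {true}  f g = g refl
bool-iff {false} {false} f g = refl

∧-intro : ∀ {x y} → x ≡ true → y ≡ true → x ∧ y ≡ true
∧-intro refl refl = refl

∧-false₂ : ∀ x y → x ∧ y ∧ false ≡ false
∧-false₂ x y = trans (cong (x ∧_) (BoolP.∧-zeroʳ y)) (BoolP.∧-zeroʳ x)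

not-true⇒false : ∀ {x} → ¬ (x ≡ true) → x ≡ false
not-true⇒false {false} h = refl
not-true⇒false {true}  h = ⊥-elim (h refl)

T⇒true : ∀ {x} → T x → x ≡ true
T⇒true {true} _ = refl

true⇒T : ∀ {x} → x ≡ true → T x
true⇒T refl = _

≤ᵇ-true : ∀ {m n} → (m ℕ.≤ᵇ n) ≡ true → m ℕ.≤ n
≤ᵇ-true {m} {n} e = ℕP.≤ᵇ⇒≤ m n (true⇒T e)

≤⇒≤ᵇ-true : ∀ {m n} → m ℕ.≤ n → (m ℕ.≤ᵇ n) ≡ true
≤⇒≤ᵇ-true p = T⇒true (ℕP.≤⇒≤ᵇ p)

<ᵇ-true : ∀ {m n} → (m ℕ.<ᵇ n) ≡ true → m ℕ.< n
<ᵇ-true {m} {n} e = ℕP.<ᵇ⇒< m n (true⇒T e)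

<⇒<ᵇ-true : ∀ {m n} → m ℕ.< n → (m ℕ.<ᵇ n) ≡ true
<⇒<ᵇ-true p = T⇒true (ℕP.<⇒<ᵇ p)

≤-diff⁻ : ∀ x y z w → + x ℤ.- + y ℤ.≤ + z ℤ.- + w → x ℕ.+ w ℕ.≤ z ℕ.+ y
≤-diff⁻ x y z w h = ℤP.drop‿+≤+ (subst₂ ℤ._≤_ (lem (+ x) (+ y) (+ w)) (lem₂ (+ z) (+ w) (+ y)) (ℤP.+-monoˡ-≤ (+ y ℤ.+ + w) h))
  where
  lem : ∀ x y w → (x ℤ.- y) ℤ.+ (y ℤ.+ w) ≡ x ℤ.+ w
  lem = solve-∀ ℤ-ring
  lem₂ : ∀ z w y → (z ℤ.- w) ℤ.+ (y ℤ.+ w) ≡ z ℤ.+ y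
  lem₂ = solve-∀ ℤ-ring

≤-diff⁺ : ∀ x y z w → x ℕ.+ w ℕ.≤ z ℕ.+ y → + x ℤ.- + y ℤ.≤ + z ℤ.- + w
≤-diff⁺ x y z w h = subst₂ ℤ._≤_ (lem (+ x) (+ y) (+ w)) (lem₂ (+ z) (+ w) (+ y)) (ℤP.+-monoˡ-≤ (ℤ.- (+ y ℤ.+ + w)) (ℤ.+≤+ h))
  where
  lem : ∀ x y w → (x ℤ.+ w) ℤ.+ (ℤ.- (y ℤ.+ w)) ≡ x ℤ.- y
  lem = solve-∀ ℤ-ring
  lem₂ : ∀ z w y → (z ℤ.+ y) ℤ.+ (ℤ.- (y ℤ.+ w)) ≡ z ℤ.- w
  lem₂ = solve-∀ ℤ-ring

≤ᵇ-diff : ∀ x y z w → (+ x ℤ.- + y ℤ.≤ᵇ + z ℤ.- + w) ≡ (x ℕ.+ w ℕ.≤ᵇ z ℕ.+ y)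
≤ᵇ-diff x y z w = bool-iff
  (λ e → ≤⇒≤ᵇ-true (≤-diff⁻ x y z w (ℤP.≤ᵇ⇒≤ (true⇒T e))))
  (λ e → T⇒true (ℤP.≤⇒≤ᵇ (≤-diff⁺ x y z w (≤ᵇ-true e))))

diff-pred : ∀ m n → (+ m ℤ.- + n) ℤ.- + 1 ≡ + m ℤ.- + suc n
diff-pred m n = trans (lem (+ m) (+ n)) refl
  where
  lem : ∀ m n → (m ℤ.- n) ℤ.- + 1 ≡ m ℤ.- (+ 1 ℤ.+ n)
  lem = solve-∀ ℤ-ring

-- The height of the vertical side is x - y.
module Height (p b c x y : ℕ) where

  bottom : ∀ i → (botH c i ℤ.≤ᵇ + x ℤ.- + y) ≡ ((i ∸ c) ℕ.+ y ℕ.≤ᵇ x ℕ.+ (i ⊓ c))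
  bottom i = ≤ᵇ-diff (i ∸ c) (i ⊓ c) x y

  top : ∀ i → (+ x ℤ.- + y ℤ.≤ᵇ topH p b i) ≡ (x ℕ.+ (i ∸ b) ℕ.≤ᵇ (2 ℕ.* p ℕ.+ (i ⊓ b)) ℕ.+ y)
  top i = ≤ᵇ-diff x y (2 ℕ.* p ℕ.+ (i ⊓ b)) (i ∸ b)

  bottom⁻ : ∀ i → (botH c i ℤ.≤ᵇ (+ x ℤ.- + y) ℤ.- + 1) ≡ ((i ∸ c) ℕ.+ suc y ℕ.≤ᵇ x ℕ.+ (i ⊓ c))
  bottom⁻ i = trans (cong (botH c i ℤ.≤ᵇ_) (diff-pred x y)) (≤ᵇ-diff (i ∸ c) (i ⊓ c) x (suc y))

  top⁺ : ∀ i → ((+ x ℤ.- + y) ℤ.+ + 1 ℤ.≤ᵇ topH p b i) ≡ (suc x ℕ.+ (i ∸ b) ℕ.≤ᵇ (2 ℕ.* p ℕ.+ (i ⊓ b)) ℕ.+ y)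
  top⁺ i = trans (cong (ℤ._≤ᵇ topH p b i) (diff-suc x y)) (≤ᵇ-diff (suc x) y (2 ℕ.* p ℕ.+ (i ⊓ b)) (i ∸ b))

∸+⊓ : ∀ i c → (i ∸ c) ℕ.+ (i ⊓ c) ≡ i
∸+⊓ i c = trans (ℕP.+-comm (i ∸ c) (i ⊓ c)) (trans (cong (ℕ._+ (i ∸ c)) (ℕP.⊓-comm i c)) (ℕP.m⊓n+n∸m≡n c i))

halve-≤ : ∀ {m n} → m ℕ.+ m ℕ.≤ n ℕ.+ n → m ℕ.≤ n
halve-≤ {m} {n} h with m ℕ.≤? n
... | yes p = p
... | no  p = ⊥-elim (ℕP.<-irrefl refl (ℕP.<-≤-trans (ℕP.+-mono-< (ℕP.≰⇒> p) (ℕP.≰⇒> p)) h))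

double-≤ : ∀ {m n} → m ℕ.≤ n → m ℕ.+ m ℕ.≤ n ℕ.+ n
double-≤ h = ℕP.+-mono-≤ h h

halve-< : ∀ {m n} → suc (m ℕ.+ m) ℕ.≤ n ℕ.+ n → m ℕ.< n
halve-< {m} {n} h with n ℕ.≤? m
... | yes p = ⊥-elim (ℕP.<-irrefl refl (ℕP.≤-trans h (double-≤ p)))
... | no  p = ℕP.≰⇒> p

hexcol : (p b c j u : ℕ) → Bool
hexcol p b c j u = ((j ∸ c) ℕ.≤ᵇ u) ∧ (u ℕ.<ᵇ p ℕ.+ (j ⊓ b))

hexcol-intro : ∀ p b c j u → j ℕ.≤ c ℕ.+ u → u ℕ.< p ℕ.+ j → u ℕ.< p ℕ.+ b → hexcol p b c j u ≡ true
hexcol-intro p b c j u h₁ h₂ h₃ = ∧-intro (≤⇒≤ᵇ-true (ℕP.m≤n+o⇒m∸n≤o j c h₁))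
  (<⇒<ᵇ-true (subst (u ℕ.<_) (sym (ℕP.+-distribˡ-⊓ p j b)) (ℕP.⊓-glb h₂ h₃)))

-- Adding j clears the signs in botH and topH and turns both inequalities into doubled ones.
module _ (p b c j u : ℕ) where

  lower⁻ : (j ∸ c) ℕ.+ j ℕ.≤ (u ℕ.+ u) ℕ.+ (j ⊓ c) → j ∸ c ℕ.≤ u
  lower⁻ h = halve-≤ (ℕP.+-cancelʳ-≤ (j ⊓ c) _ _ (subst (ℕ._≤ (u ℕ.+ u) ℕ.+ (j ⊓ c)) (trans (cong ((j ∸ c) ℕ.+_) (sym (∸+⊓ j c))) (sym (ℕP.+-assoc (j ∸ c) _ _))) h))

  lower⁺ : j ∸ c ℕ.≤ u → (j ∸ c) ℕ.+ j ℕ.≤ (u ℕ.+ u) ℕ.+ (j ⊓ c)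
  lower⁺ h = subst (ℕ._≤ (u ℕ.+ u) ℕ.+ (j ⊓ c)) (trans (ℕP.+-assoc (j ∸ c) _ _) (cong ((j ∸ c) ℕ.+_) (∸+⊓ j c))) (ℕP.+-monoˡ-≤ (j ⊓ c) (double-≤ h))

  upper-sum : (2 ℕ.* p ℕ.+ (j ⊓ b)) ℕ.+ j ≡ ((p ℕ.+ (j ⊓ b)) ℕ.+ (p ℕ.+ (j ⊓ b))) ℕ.+ (j ∸ b)
  upper-sum = trans (cong ((2 ℕ.* p ℕ.+ (j ⊓ b)) ℕ.+_) (sym (∸+⊓ j b))) (lem p (j ⊓ b) (j ∸ b))
    where
    lem : ∀ p x y → (2 ℕ.* p ℕ.+ x) ℕ.+ (y ℕ.+ x) ≡ ((p ℕ.+ x) ℕ.+ (p ℕ.+ x)) ℕ.+ y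
    lem = solve-∀ ℕ-ring

  upper⁻ : suc (suc (u ℕ.+ u)) ℕ.+ (j ∸ b) ℕ.≤ (2 ℕ.* p ℕ.+ (j ⊓ b)) ℕ.+ j → u ℕ.< p ℕ.+ (j ⊓ b)
  upper⁻ h = halve-< (ℕP.<⇒≤ (ℕP.+-cancelʳ-≤ (j ∸ b) _ _ (subst (suc (suc (u ℕ.+ u)) ℕ.+ (j ∸ b) ℕ.≤_) upper-sum h)))

  upper⁺ : u ℕ.< p ℕ.+ (j ⊓ b) → suc (suc (u ℕ.+ u)) ℕ.+ (j ∸ b) ℕ.≤ (2 ℕ.* p ℕ.+ (j ⊓ b)) ℕ.+ j
  upper⁺ h = subst (suc (suc (u ℕ.+ u)) ℕ.+ (j ∸ b) ℕ.≤_) (sym upper-sum)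
    (ℕP.+-monoˡ-≤ (j ∸ b) (subst (ℕ._≤ (p ℕ.+ (j ⊓ b)) ℕ.+ (p ℕ.+ (j ⊓ b))) (cong suc (ℕP.+-suc u u)) (double-≤ h)))

suc∸≤ : ∀ j c → suc j ∸ c ℕ.≤ suc (j ∸ c)
suc∸≤ j zero    = ℕP.≤-refl
suc∸≤ zero (suc c) = ℕP.≤-trans (ℕP.≤-reflexive (ℕP.0∸n≡0 c)) ℕ.z≤n
suc∸≤ (suc j) (suc c) = suc∸≤ j c

∸≤suc∸ : ∀ j c → j ∸ c ℕ.≤ suc j ∸ c
∸≤suc∸ j c = ℕP.∸-monoˡ-≤ c (ℕP.n≤1+n j)

edge height : Cell → ℕ
edge (L j u) = suc j
edge (R j u) = j
height (L j u) = u
height (R j u) = u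

module Region (p b c : ℕ) where

  N U : ℕ
  N = b ℕ.+ c
  U = p ℕ.+ b

  hx : ℕ → ℕ → Bool
  hx = hexcol p b c

  -- The vertical side decides: from one column to the next the boundary moves by half a unit, so
  -- the condition on the apex follows from those on the ends of the side.
  inHex-R : ∀ j u → inHex p b c (emb (R j u)) ≡ (j ℕ.<ᵇ N) ∧ hx j u
  inHex-R j u rewrite isRight-R j u
    | Height.bottom⁻ p b c (suc (u ℕ.+ u)) j j | Height.top⁺ p b c (suc (u ℕ.+ u)) j j
    | Height.bottom p b c (suc (u ℕ.+ u)) j (suc j) | Height.top p b c (suc (u ℕ.+ u)) j (suc j)
    = cong ((j ℕ.<ᵇ N) ∧_) (bool-iff
      (λ e → let (e₁ , e′) = ∧-true e ; (e₂ , _) = ∧-true e′ in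
         ∧-intro (≤⇒≤ᵇ-true (low⁻ (≤ᵇ-true e₁))) (<⇒<ᵇ-true (upper⁻ p b c j u (≤ᵇ-true e₂))))
      (λ e → let (e₁ , e₂) = ∧-true e in
         ∧-intro (≤⇒≤ᵇ-true (low⁺ (≤ᵇ-true e₁)))
        (∧-intro (≤⇒≤ᵇ-true (upper⁺ p b c j u (<ᵇ-true e₂)))
        (∧-intro (≤⇒≤ᵇ-true (low (≤ᵇ-true e₁))) (≤⇒≤ᵇ-true (upp (<ᵇ-true e₂)))))))
    where
    low⁻ : (j ∸ c) ℕ.+ suc j ℕ.≤ suc (u ℕ.+ u) ℕ.+ (j ⊓ c) → j ∸ c ℕ.≤ u
    low⁻ h = lower⁻ p b c j u (ℕ.s≤s⁻¹ (subst (ℕ._≤ suc (u ℕ.+ u) ℕ.+ (j ⊓ c)) (ℕP.+-suc (j ∸ c) j) h))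
    low⁺ : j ∸ c ℕ.≤ u → (j ∸ c) ℕ.+ suc j ℕ.≤ suc (u ℕ.+ u) ℕ.+ (j ⊓ c)
    low⁺ h = subst (ℕ._≤ suc (u ℕ.+ u) ℕ.+ (j ⊓ c)) (sym (ℕP.+-suc (j ∸ c) j)) (ℕ.s≤s (lower⁺ p b c j u h))
    low : j ∸ c ℕ.≤ u → (suc j ∸ c) ℕ.+ j ℕ.≤ suc (u ℕ.+ u) ℕ.+ (suc j ⊓ c)
    low h = ℕ.s≤s⁻¹ (subst₂ ℕ._≤_ (ℕP.+-suc (suc j ∸ c) j) (cong (λ z → suc z ℕ.+ (suc j ⊓ c)) (ℕP.+-suc u u))
      (lower⁺ p b c (suc j) (suc u) (ℕP.≤-trans (suc∸≤ j c) (ℕ.s≤s h))))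
    upp : u ℕ.< p ℕ.+ (j ⊓ b) → suc (u ℕ.+ u) ℕ.+ (suc j ∸ b) ℕ.≤ (2 ℕ.* p ℕ.+ (suc j ⊓ b)) ℕ.+ j
    upp h = ℕ.s≤s⁻¹ (subst (suc (suc (u ℕ.+ u)) ℕ.+ (suc j ∸ b) ℕ.≤_) (ℕP.+-suc (2 ℕ.* p ℕ.+ (suc j ⊓ b)) j)
      (upper⁺ p b c (suc j) u (ℕP.<-≤-trans h (ℕP.+-monoʳ-≤ p (ℕP.⊓-monoˡ-≤ b (ℕP.n≤1+n j))))))

  inHex-L : ∀ j u → inHex p b c (emb (L j u)) ≡ (j ℕ.<ᵇ N) ∧ hx (suc j) u
  inHex-L j u rewrite isRight-L j u
    | Height.bottom⁻ p b c (u ℕ.+ u) j (suc j) | Height.top⁺ p b c (u ℕ.+ u) j (suc j)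
    | Height.bottom p b c (u ℕ.+ u) j j | Height.top p b c (u ℕ.+ u) j j
    = cong ((j ℕ.<ᵇ N) ∧_) (bool-iff
      (λ e → let (e₁ , e′) = ∧-true e ; (e₂ , _) = ∧-true e′ in
         ∧-intro (≤⇒≤ᵇ-true (lower⁻ p b c (suc j) u (≤ᵇ-true e₁))) (<⇒<ᵇ-true (upp⁻ (≤ᵇ-true e₂))))
      (λ e → let (e₁ , e₂) = ∧-true e in
         ∧-intro (≤⇒≤ᵇ-true (lower⁺ p b c (suc j) u (≤ᵇ-true e₁)))
        (∧-intro (≤⇒≤ᵇ-true (upp⁺ (<ᵇ-true e₂)))
        (∧-intro (≤⇒≤ᵇ-true (lower⁺ p b c j u (ℕP.≤-trans (∸≤suc∸ j c) (≤ᵇ-true e₁))))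
                 (≤⇒≤ᵇ-true (upp (<ᵇ-true e₂)))))))
    where
    ⊓-suc : suc j ⊓ b ℕ.≤ suc (j ⊓ b)
    ⊓-suc = ℕP.⊓-monoʳ-≤ (suc j) (ℕP.n≤1+n b)
    upp⁻ : suc (u ℕ.+ u) ℕ.+ (suc j ∸ b) ℕ.≤ (2 ℕ.* p ℕ.+ (suc j ⊓ b)) ℕ.+ j → u ℕ.< p ℕ.+ (suc j ⊓ b)
    upp⁻ h = upper⁻ p b c (suc j) u (subst (suc (suc (u ℕ.+ u)) ℕ.+ (suc j ∸ b) ℕ.≤_) (sym (ℕP.+-suc (2 ℕ.* p ℕ.+ (suc j ⊓ b)) j)) (ℕ.s≤s h))
    upp⁺ : u ℕ.< p ℕ.+ (suc j ⊓ b) → suc (u ℕ.+ u) ℕ.+ (suc j ∸ b) ℕ.≤ (2 ℕ.* p ℕ.+ (suc j ⊓ b)) ℕ.+ j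
    upp⁺ h = ℕ.s≤s⁻¹ (subst (suc (suc (u ℕ.+ u)) ℕ.+ (suc j ∸ b) ℕ.≤_) (ℕP.+-suc (2 ℕ.* p ℕ.+ (suc j ⊓ b)) j) (upper⁺ p b c (suc j) u h))
    upp : u ℕ.< p ℕ.+ (suc j ⊓ b) → (u ℕ.+ u) ℕ.+ (j ∸ b) ℕ.≤ (2 ℕ.* p ℕ.+ (j ⊓ b)) ℕ.+ j
    upp h = subst ((u ℕ.+ u) ℕ.+ (j ∸ b) ℕ.≤_) (sym (upper-sum p b c j u)) (ℕP.+-monoˡ-≤ (j ∸ b) (double-≤
      (ℕ.s≤s⁻¹ (ℕP.≤-trans h (ℕP.≤-trans (ℕP.+-monoʳ-≤ p ⊓-suc) (ℕP.≤-reflexive (ℕP.+-suc p (j ⊓ b))))))))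

  inHex-emb : ∀ y → inHex p b c (emb y) ≡ (column y ℕ.<ᵇ N) ∧ hx (edge y) (height y)
  inHex-emb (L j u) = inHex-L j u
  inHex-emb (R j u) = inHex-R j u

  emb-line : ∀ y → level y ≡ p ℕ.+ column y → emb y ≡ (column y , + p)
  emb-line y e = trans (emb-level y) (cong (column y ,_) (trans (cong (λ n → + n ℤ.- + column y) e) (lem (+ p) (+ column y))))
    where
    lem : ∀ p j → (p ℤ.+ j) ℤ.- j ≡ p
    lem = solve-∀ ℤ-ring

  inHex-line : ∀ y → level y ≡ p ℕ.+ column y → column y ℕ.< N → hx (edge y) (height y) ≡ true → inHex p b c (column y , + p) ≡ true
  inHex-line y e h₁ h₂ = trans (cong (inHex p b c) (sym (emb-line y e))) (trans (inHex-emb y) (∧-intro (<⇒<ᵇ-true h₁) h₂))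

  module _ (i x y : ℕ) where

    private
      tooLow : ∀ j → j ℕ.≤ suc i → x ℕ.+ i ℕ.< y → ((j ∸ c) ℕ.+ suc y ℕ.≤ᵇ x ℕ.+ (j ⊓ c)) ≡ false
      tooLow j j≤ h = not-true⇒false λ e → ℕP.<-irrefl refl (begin-strict
        y                        <⟨ ℕP.n<1+n y ⟩
        suc y                    ≤⟨ ℕP.m≤n+m (suc y) (j ∸ c) ⟩
        (j ∸ c) ℕ.+ suc y        ≤⟨ ≤ᵇ-true e ⟩
        x ℕ.+ (j ⊓ c)            ≤⟨ ℕP.+-monoʳ-≤ x (ℕP.≤-trans (ℕP.m⊓n≤m j c) j≤) ⟩
        x ℕ.+ suc i              ≡⟨ ℕP.+-suc x i ⟩
        suc (x ℕ.+ i)            ≤⟨ h ⟩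
        y ∎)
        where open ℕP.≤-Reasoning

      tooHigh : ∀ j → i ℕ.≤ j → (U ℕ.+ U) ℕ.+ y ℕ.≤ x ℕ.+ i → (suc x ℕ.+ (j ∸ b) ℕ.≤ᵇ (2 ℕ.* p ℕ.+ (j ⊓ b)) ℕ.+ y) ≡ false
      tooHigh j i≤ h = not-true⇒false λ e → ℕP.<-irrefl refl (begin-strict
        x ℕ.+ i                                          ≤⟨ ℕP.+-monoʳ-≤ x i≤ ⟩
        x ℕ.+ j                                          <⟨ ℕP.n<1+n _ ⟩
        suc x ℕ.+ j                                      ≡⟨ cong (suc x ℕ.+_) (sym (∸+⊓ j b)) ⟩
        suc x ℕ.+ ((j ∸ b) ℕ.+ (j ⊓ b))                  ≡⟨ sym (ℕP.+-assoc (suc x) (j ∸ b) (j ⊓ b)) ⟩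
        (suc x ℕ.+ (j ∸ b)) ℕ.+ (j ⊓ b)                  ≤⟨ ℕP.+-monoˡ-≤ (j ⊓ b) (≤ᵇ-true e) ⟩
        ((2 ℕ.* p ℕ.+ (j ⊓ b)) ℕ.+ y) ℕ.+ (j ⊓ b)        ≤⟨ ℕP.+-mono-≤ (ℕP.+-monoˡ-≤ y (ℕP.+-monoʳ-≤ (2 ℕ.* p) (ℕP.m⊓n≤n j b))) (ℕP.m⊓n≤n j b) ⟩
        ((2 ℕ.* p ℕ.+ b) ℕ.+ y) ℕ.+ b                    ≡⟨ lem p b y ⟩
        (U ℕ.+ U) ℕ.+ y                                  ≤⟨ h ⟩
        x ℕ.+ i ∎)
        where
        open ℕP.≤-Reasoning
        lem : ∀ p b y → ((2 ℕ.* p ℕ.+ b) ℕ.+ y) ℕ.+ b ≡ ((p ℕ.+ b) ℕ.+ (p ℕ.+ b)) ℕ.+ y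
        lem = solve-∀ ℕ-ring

    -- The search window of `Hex` exceeds the edges 0, ..., U - 1 of each strip. This lemma and the
    -- next discard the excess below and above.
    outside-low : x ℕ.+ i ℕ.< y → inHex p b c (i , + x ℤ.- + y) ≡ false
    outside-low h rewrite Height.bottom⁻ p b c x y (suc i) | Height.bottom⁻ p b c x y i | tooLow i (ℕP.n≤1+n i) h | tooLow (suc i) ℕP.≤-refl h
      with isRight (i , + x ℤ.- + y)
    ... | true  = BoolP.∧-zeroʳ _
    ... | false = BoolP.∧-zeroʳ _

    outside-high : (U ℕ.+ U) ℕ.+ y ℕ.≤ x ℕ.+ i → inHex p b c (i , + x ℤ.- + y) ≡ false
    outside-high h rewrite Height.top⁺ p b c x y (suc i) | Height.top⁺ p b c x y i | tooHigh i ℕP.≤-refl h | tooHigh (suc i) (ℕP.n≤1+n i) h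
      with isRight (i , + x ℤ.- + y)
    ... | true  = ∧-false₂ (i ℕ.<ᵇ N) (botH c i ℤ.≤ᵇ (+ x ℤ.- + y) ℤ.- + 1)
    ... | false = ∧-false₂ (i ℕ.<ᵇ N) (botH c (suc i) ℤ.≤ᵇ (+ x ℤ.- + y) ℤ.- + 1)

-- Lists of triangles

upTo≡range : ∀ n → upTo n ≡ range 0 n
upTo≡range n = go id n 0 (λ i → refl)
  where
  go : ∀ (f : ℕ → ℕ) n r → (∀ i → f i ≡ r ℕ.+ i) → applyUpTo f n ≡ range r n
  go f zero    r h = refl
  go f (suc n) r h = cong₂ _∷_ (trans (h 0) (ℕP.+-identityʳ r)) (go (f ∘ suc) n (suc r) (λ i → trans (h (suc i)) (ℕP.+-suc r i)))

keep : {A : Set} → (A → Bool) → List A → List A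
keep P = filter (λ x → P x Bool.≟ true)

keep-++ : {A : Set} (P : A → Bool) (xs ys : List A) → keep P (xs ++ ys) ≡ keep P xs ++ keep P ys
keep-++ P xs ys = LP.filter-++ (λ x → P x Bool.≟ true) xs ys

keep-none : {A : Set} (P : A → Bool) {xs : List A} → All (λ x → P x ≡ false) xs → keep P xs ≡ []
keep-none P []       = refl
keep-none P (_∷_ {x} e es) rewrite e = keep-none P es

keep-all : {A : Set} (P : A → Bool) {xs : List A} → All (λ x → P x ≡ true) xs → keep P xs ≡ xs
keep-all P []       = refl
keep-all P (_∷_ {x} e es) rewrite e = cong (x ∷_) (keep-all P es)

keep-keep : {A : Set} (P Q : A → Bool) → ∀ xs → keep P (keep Q xs) ≡ keep (λ x → Q x ∧ P x) xs
keep-keep P Q [] = refl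
keep-keep P Q (x ∷ xs) with Q x
... | false = keep-keep P Q xs
... | true with P x
...   | true  = cong (x ∷_) (keep-keep P Q xs)
...   | false = keep-keep P Q xs

keep-map : {A B : Set} (P : B → Bool) (f : A → B) → ∀ xs → keep P (map f xs) ≡ map f (keep (P ∘ f) xs)
keep-map P f [] = refl
keep-map P f (x ∷ xs) with P (f x)
... | true  = cong (f x ∷_) (keep-map P f xs)
... | false = keep-map P f xs

keep-cong : {A : Set} {P Q : A → Bool} → (∀ x → P x ≡ Q x) → ∀ xs → keep P xs ≡ keep Q xs
keep-cong h [] = refl
keep-cong {P = P} {Q} h (x ∷ xs) with P x | Q x | h x
... | true  | .true  | refl = cong (x ∷_) (keep-cong h xs)
... | false | .false | refl = keep-cong h xs

All-map : {A B : Set} {P : B → Set} (f : A → B) {xs : List A} → All (P ∘ f) xs → All P (map f xs)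
All-map f []       = []
All-map f (e ∷ es) = e ∷ All-map f es

take-map-range : {A : Set} (f : ℕ → A) (m : ℕ) (ys : List A) → ∀ r → take m (map f (range r m) ++ ys) ≡ map f (range r m)
take-map-range f zero    ys r = refl
take-map-range f (suc m) ys r = cong (f r ∷_) (take-map-range f m ys (suc r))

module Lists (p b c d : ℕ) (dN : dbl d ℕ.≤ b ℕ.+ c) (onHex : ∀ i → i ℕ.< dbl d → inHex p b c (i , + p) ≡ true) where
  open Region p b c

  removed : Cell → Bool
  removed y = (column y ℕ.<ᵇ dbl d) ∧ (level y ℕ.≡ᵇ p ℕ.+ column y)

  region : Pred
  region y = ((column y ℕ.<ᵇ N) ∧ hx (edge y) (height y)) ∧ not (removed y)

  onLine : ℕ → Triangle
  onLine i = i , + p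

  -- In the first 2 d strips the triangle on l lies in the hexagon, so filtering skips none of them
  -- and the labels 1, ..., 2 d are the strips 0, ..., 2 d - 1.
  taken : take (2 ℕ.* d) (onL p b c) ≡ map onLine (range 0 (dbl d))
  taken = begin
    take (2 ℕ.* d) (keep (inHex p b c) (map onLine (upTo N)))
      ≡⟨ cong₂ (λ m l → take m (keep (inHex p b c) (map onLine l))) (dbl≡2* d) (trans (upTo≡range N)
           (trans (cong (range 0) (sym (ℕP.m+[n∸m]≡n dN))) (range-++ 0 (dbl d) (N ∸ dbl d)))) ⟩
    take (dbl d) (keep (inHex p b c) (map onLine (range 0 (dbl d) ++ range (dbl d) (N ∸ dbl d))))
      ≡⟨ cong (take (dbl d)) (trans (cong (keep (inHex p b c)) (LP.map-++ onLine (range 0 (dbl d)) _)) (keep-++ (inHex p b c) (map onLine (range 0 (dbl d))) _)) ⟩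
    take (dbl d) (keep (inHex p b c) (map onLine (range 0 (dbl d))) ++ keep (inHex p b c) (map onLine (range (dbl d) (N ∸ dbl d))))
      ≡⟨ cong (λ l → take (dbl d) (l ++ keep (inHex p b c) (map onLine (range (dbl d) (N ∸ dbl d)))))
           (keep-all (inHex p b c) (All-map onLine (All-range _ 0 (dbl d) (λ k _ h → onHex k h)))) ⟩
    take (dbl d) (map onLine (range 0 (dbl d)) ++ keep (inHex p b c) (map onLine (range (dbl d) (N ∸ dbl d))))
      ≡⟨ take-map-range onLine (dbl d) (keep (inHex p b c) (map onLine (range (dbl d) (N ∸ dbl d)))) 0 ⟩
    map onLine (range 0 (dbl d)) ∎
    where open ≡-Reasoning

  mem⁻ : ∀ i t r n → memT (i , t) (map onLine (range r n)) ≡ true → (r ℕ.≤ i × i ℕ.< r ℕ.+ n) × t ≡ + p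
  mem⁻ i t r (suc n) e with ∨-true e
  ... | inj₁ h with ∧-true h
  ...   | h₁ , h₂ with ≡ᵇ-true {i} {r} h₁
  ...     | refl = (ℕP.≤-refl , subst (r ℕ.<_) (sym (ℕP.+-suc r n)) (ℕ.s≤s (ℕP.m≤m+n r n))) , ≡ℤᵇ-true h₂
  mem⁻ i t r (suc n) e | inj₂ h with mem⁻ i t (suc r) n h
  ... | (h₁ , h₂) , h₃ = (ℕP.<⇒≤ h₁ , subst (i ℕ.<_) (sym (ℕP.+-suc r n)) h₂) , h₃

  mem⁺ : ∀ i r n → r ℕ.≤ i → i ℕ.< r ℕ.+ n → memT (i , + p) (map onLine (range r n)) ≡ true
  mem⁺ i r zero h₁ h₂ = ⊥-elim (ℕP.<-irrefl refl (ℕP.<-≤-trans h₂ (subst (ℕ._≤ i) (sym (ℕP.+-identityʳ r)) h₁)))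
  mem⁺ i r (suc n) h₁ h₂ with i ℕ.≟ r
  ... | yes refl = cong₂ (λ x y → (x ∧ y) ∨ memT (i , + p) (map onLine (range (suc r) n))) (≡ᵇ-refl i) (≡ℤᵇ-refl {+ p} refl)
  ... | no  i≢r  = trans (cong (((i ℕ.≡ᵇ r) ∧ (+ p ≡ℤᵇ + p)) ∨_) (mem⁺ i (suc r) n (ℕP.≤∧≢⇒< h₁ (i≢r ∘ sym)) (subst (i ℕ.<_) (ℕP.+-suc r n) h₂))) (BoolP.∨-zeroʳ _)

  removed-mem : ∀ y → memT (emb y) (map onLine (range 0 (dbl d))) ≡ removed y
  removed-mem y = trans (cong (λ T → memT T (map onLine (range 0 (dbl d)))) (emb-level y)) (bool-iff
    (λ e → let ((_ , h₁) , h₂) = mem⁻ (column y) (+ level y ℤ.- + column y) 0 (dbl d) e in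
       ∧-intro (<⇒<ᵇ-true h₁) (T⇒true (ℕP.≡⇒≡ᵇ (level y) (p ℕ.+ column y)
         (trans (sym (ℕP.+-identityʳ (level y))) (diff-inj (level y) (column y) p 0 (trans h₂ (sym (ℤP.+-identityʳ (+ p)))))))))
    (λ e → let (h₁ , h₂) = ∧-true e in
       trans (cong (λ T → memT T (map onLine (range 0 (dbl d)))) (trans (sym (emb-level y)) (emb-line y (≡ᵇ-true h₂))))
             (mem⁺ (column y) 0 (dbl d) ℕ.z≤n (<ᵇ-true h₁))))

  inRegion : Triangle → Bool
  inRegion T = inHex p b c T ∧ not (memT T (map onLine (range 0 (dbl d))))

  region-emb : ∀ y → inRegion (emb y) ≡ region y
  region-emb y = cong₂ (λ x z → x ∧ not z) (inHex-emb y) (removed-mem y)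

  N′ : ℕ
  N′ = 2 ℕ.* (p ℕ.+ b ℕ.+ c) ℕ.+ 1

  atHeight : ℕ → ℕ → Triangle
  atHeight i k = i , + k ℤ.- + N′

  -- Consecutive cells of `pairs` have consecutive heights. So the order of `Hex` is that of
  -- `strips`, and the two lists agree without any rearrangement.
  pairs-emb : ∀ i u m k → k ℕ.+ i ≡ N′ ℕ.+ (u ℕ.+ u) → map emb (pairs i u m) ≡ map (atHeight i) (range k (m ℕ.+ m))
  pairs-emb i u zero    k h = refl
  pairs-emb i u (suc m) k h = trans
    (cong₂ _∷_ (cong (i ,_) (same (u ℕ.+ u) k h)) (cong₂ _∷_ (cong (i ,_) (same (suc (u ℕ.+ u)) (suc k) (trans (cong suc h) (sym (ℕP.+-suc N′ (u ℕ.+ u))))))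
      (pairs-emb i (suc u) m (suc (suc k)) (trans (cong (suc ∘ suc) h) (lem N′ u)))))
    (cong (λ z → map (atHeight i) (k ∷ range (suc k) z)) (sym (ℕP.+-suc m m)))
    where
    lem : ∀ n u → suc (suc (n ℕ.+ (u ℕ.+ u))) ≡ n ℕ.+ (suc u ℕ.+ suc u)
    lem = solve-∀ ℕ-ring
    same : ∀ v k → k ℕ.+ i ≡ N′ ℕ.+ v → + v ℤ.- + i ≡ + k ℤ.- + N′
    same v k h = ℤP.≤-antisym (≤-diff⁺ v i k N′ (ℕP.≤-reflexive (trans (ℕP.+-comm v N′) (sym h)))) (≤-diff⁺ k N′ v i (ℕP.≤-reflexive (trans h (ℕP.+-comm N′ v))))

  column-list : ∀ i → i ℕ.< N → keep inRegion (map (i ,_) (heightRange N′)) ≡ map emb (select region (pairs i 0 U))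
  column-list i i<N = begin
    keep inRegion (map (i ,_) (map (λ k → + k ℤ.- + N′) (upTo (suc (2 ℕ.* N′)))))
      ≡⟨ cong (keep inRegion) (trans (sym (LP.map-∘ (upTo (suc (2 ℕ.* N′))))) (cong (map (atHeight i)) (trans (upTo≡range _) split))) ⟩
    keep inRegion (map (atHeight i) (range 0 k₀ ++ range k₀ (U ℕ.+ U) ++ range (k₀ ℕ.+ (U ℕ.+ U)) k₁))
      ≡⟨ cong (keep inRegion) (trans (LP.map-++ (atHeight i) (range 0 k₀) _) (cong (map (atHeight i) (range 0 k₀) ++_) (LP.map-++ (atHeight i) (range k₀ (U ℕ.+ U)) _))) ⟩
    keep inRegion (map (atHeight i) (range 0 k₀) ++ map (atHeight i) (range k₀ (U ℕ.+ U)) ++ map (atHeight i) (range (k₀ ℕ.+ (U ℕ.+ U)) k₁))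
      ≡⟨ trans (keep-++ inRegion (map (atHeight i) (range 0 k₀)) _) (cong₂ _++_ low (trans (keep-++ inRegion (map (atHeight i) (range k₀ (U ℕ.+ U))) _) (trans (cong₂ _++_ refl high) (LP.++-identityʳ _)))) ⟩
    keep inRegion (map (atHeight i) (range k₀ (U ℕ.+ U)))
      ≡⟨ cong (keep inRegion) (sym (pairs-emb i 0 U k₀ (trans k₀+i (sym (ℕP.+-identityʳ N′))))) ⟩
    keep inRegion (map emb (pairs i 0 U))
      ≡⟨ trans (keep-map inRegion emb (pairs i 0 U)) (cong (map emb) (keep-cong region-emb (pairs i 0 U))) ⟩
    map emb (select region (pairs i 0 U)) ∎
    where
    open ≡-Reasoning
    k₀ k₁ : ℕ
    k₀ = N′ ∸ i
    i≤N′ : i ℕ.≤ N′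
    i≤N′ = ℕP.≤-trans (ℕP.<⇒≤ i<N) (subst (N ℕ.≤_) (lem p b c) (ℕP.m≤m+n N _))
      where
      lem : ∀ p b c → (b ℕ.+ c) ℕ.+ (2 ℕ.* p ℕ.+ b ℕ.+ c ℕ.+ 1) ≡ 2 ℕ.* (p ℕ.+ b ℕ.+ c) ℕ.+ 1
      lem = solve-∀ ℕ-ring
    k₀+i : k₀ ℕ.+ i ≡ N′
    k₀+i = ℕP.m∸n+n≡m i≤N′
    fits : k₀ ℕ.+ (U ℕ.+ U) ℕ.≤ suc (2 ℕ.* N′)
    fits = ℕP.≤-trans (ℕP.+-mono-≤ (ℕP.m∸n≤m N′ i) (subst (U ℕ.+ U ℕ.≤_) (lem p b c) (ℕP.m≤m+n (U ℕ.+ U) _))) (ℕP.≤-reflexive (lem₂ N′))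
      where
      lem : ∀ p b c → ((p ℕ.+ b) ℕ.+ (p ℕ.+ b)) ℕ.+ (c ℕ.+ c ℕ.+ 2) ≡ suc (2 ℕ.* (p ℕ.+ b ℕ.+ c) ℕ.+ 1)
      lem = solve-∀ ℕ-ring
      lem₂ : ∀ n → n ℕ.+ suc n ≡ suc (2 ℕ.* n)
      lem₂ = solve-∀ ℕ-ring
    k₁ = suc (2 ℕ.* N′) ∸ (k₀ ℕ.+ (U ℕ.+ U))
    split : range 0 (suc (2 ℕ.* N′)) ≡ range 0 k₀ ++ range k₀ (U ℕ.+ U) ++ range (k₀ ℕ.+ (U ℕ.+ U)) k₁
    split = trans (cong (range 0) (trans (sym (ℕP.m+[n∸m]≡n fits)) (ℕP.+-assoc k₀ (U ℕ.+ U) k₁)))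
      (trans (range-++ 0 k₀ ((U ℕ.+ U) ℕ.+ k₁)) (cong (range 0 k₀ ++_) (range-++ k₀ (U ℕ.+ U) k₁)))
    low : keep inRegion (map (atHeight i) (range 0 k₀)) ≡ []
    low = keep-none inRegion (All-map (atHeight i) (All-range _ 0 k₀ (λ k _ h →
      cong (_∧ not (memT (atHeight i k) (map onLine (range 0 (dbl d))))) (outside-low i k N′ (subst (k ℕ.+ i ℕ.<_) k₀+i (ℕP.+-monoˡ-< i h))))))
    high : keep inRegion (map (atHeight i) (range (k₀ ℕ.+ (U ℕ.+ U)) k₁)) ≡ []
    high = keep-none inRegion (All-map (atHeight i) (All-range _ (k₀ ℕ.+ (U ℕ.+ U)) k₁ (λ k h _ →
      cong (_∧ not (memT (atHeight i k) (map onLine (range 0 (dbl d))))) (outside-high i k N′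
        (ℕP.≤-trans (ℕP.≤-reflexive (trans (cong ((U ℕ.+ U) ℕ.+_) (sym k₀+i)) (lem U k₀ i))) (ℕP.+-monoˡ-≤ i h))))))
      where
      lem : ∀ u k i → (u ℕ.+ u) ℕ.+ (k ℕ.+ i) ≡ (k ℕ.+ (u ℕ.+ u)) ℕ.+ i
      lem = solve-∀ ℕ-ring

  columns-list : ∀ j n → j ℕ.+ n ≡ N →
    keep inRegion (concatMap (λ i → map (i ,_) (heightRange N′)) (range j n)) ≡ map emb (select region (strips U j n))
  columns-list j zero    h = refl
  columns-list j (suc n) h = begin
    keep inRegion (map (j ,_) (heightRange N′) ++ concatMap (λ i → map (i ,_) (heightRange N′)) (range (suc j) n))
      ≡⟨ keep-++ inRegion (map (j ,_) (heightRange N′)) _ ⟩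
    keep inRegion (map (j ,_) (heightRange N′)) ++ keep inRegion (concatMap (λ i → map (i ,_) (heightRange N′)) (range (suc j) n))
      ≡⟨ cong₂ _++_ (column-list j (subst (j ℕ.<_) h (ℕP.m<m+n j (ℕ.s≤s ℕ.z≤n)))) (columns-list (suc j) n (trans (sym (ℕP.+-suc j n)) h)) ⟩
    map emb (select region (pairs j 0 U)) ++ map emb (select region (strips U (suc j) n))
      ≡⟨ sym (trans (cong (map emb) (keep-++ region (pairs j 0 U) _)) (LP.map-++ emb (select region (pairs j 0 U)) _)) ⟩
    map emb (select region (pairs j 0 U ++ strips U (suc j) n)) ∎
    where open ≡-Reasoning

  M-region : M (HexD p b c d) ≡ cnt (strips U 0 N) region
  M-region = trans (cong M (begin
    keep (λ T → not (memT T (take (2 ℕ.* d) (onL p b c)))) (keep (inHex p b c) all)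
      ≡⟨ cong (λ l → keep (λ T → not (memT T l)) (keep (inHex p b c) all)) taken ⟩
    keep (λ T → not (memT T (map onLine (range 0 (dbl d))))) (keep (inHex p b c) all)
      ≡⟨ keep-keep _ (inHex p b c) all ⟩
    keep inRegion all
      ≡⟨ cong (λ l → keep inRegion (concatMap (λ i → map (i ,_) (heightRange N′)) l)) (upTo≡range N) ⟩
    keep inRegion (concatMap (λ i → map (i ,_) (heightRange N′)) (range 0 N))
      ≡⟨ columns-list 0 N refl ⟩
    map emb (select region (strips U 0 N)) ∎)) (M-cnt (strips U 0 N) region)
    where
    open ≡-Reasoning
    all = concatMap (λ i → map (i ,_) (heightRange N′)) (upTo N)

HexD-0 : ∀ p b c → HexD p b c 0 ≡ Hex p b c
HexD-0 p b c = keep-all (λ _ → true) (All.universal (λ _ → refl) (Hex p b c))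

module Membership (p b c d : ℕ) (dN : dbl d ℕ.≤ b ℕ.+ c) (onHex : ∀ i → i ℕ.< dbl d → inHex p b c (i , + p) ≡ true) where
  open Region p b c
  open Lists p b c d dN onHex

  Removed : Cell → Set
  Removed y = column y ℕ.< dbl d × level y ≡ p ℕ.+ column y

  removed⁻ : ∀ y → removed y ≡ true → Removed y
  removed⁻ y e = let (h₁ , h₂) = ∧-true {column y ℕ.<ᵇ dbl d} {level y ℕ.≡ᵇ p ℕ.+ column y} e in <ᵇ-true h₁ , ≡ᵇ-true h₂

  removed⁺ : ∀ y → Removed y → removed y ≡ true
  removed⁺ y (h₁ , h₂) = ∧-intro (<⇒<ᵇ-true h₁) (T⇒true (ℕP.≡⇒≡ᵇ _ _ h₂))

  region⁻ : ∀ y → region y ≡ true → column y ℕ.< N × hx (edge y) (height y) ≡ true × ¬ Removed y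
  region⁻ y e with ∧-true {(column y ℕ.<ᵇ N) ∧ hx (edge y) (height y)} {not (removed y)} e
  ... | h , h′ with ∧-true {column y ℕ.<ᵇ N} {hx (edge y) (height y)} h
  ...   | h₁ , h₂ = <ᵇ-true h₁ , h₂ , (λ r → true≢false (trans (sym (removed⁺ y r)) (not-true h′)))

  region⁺ : ∀ y → column y ℕ.< N → hx (edge y) (height y) ≡ true → ¬ Removed y → region y ≡ true
  region⁺ y h₁ h₂ h₃ = ∧-intro (∧-intro (<⇒<ᵇ-true h₁) h₂) (cong not (not-true⇒false (h₃ ∘ removed⁻ y)))

  region-false : ∀ y → column y ℕ.< N → hx (edge y) (height y) ≡ true → region y ≡ false → Removed y
  region-false y h₁ h₂ e = go (removed y) refl
    where
    go : ∀ z → removed y ≡ z → Removed y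
    go true  r = removed⁻ y r
    go false r = ⊥-elim (true≢false (trans (sym (∧-intro (∧-intro (<⇒<ᵇ-true h₁) h₂) (cong not r))) e))

  region-removed : ∀ y → Removed y → region y ≡ false
  region-removed y r = not-true⇒false (λ h → proj₂ (proj₂ (region⁻ y h)) r)

-- From strips to determinants of path counts

module _ {A B : Set} (m : A → B → ℚ) where

  det-rowSum : ∀ pre r r₁ r₂ post {bs} → All (λ b → m r b ≡ m r₁ b + m r₂ b) bs →
    det m (pre ++ r ∷ post) bs ≡ det m (pre ++ r₁ ∷ post) bs + det m (pre ++ r₂ ∷ post) bs
  det-rowSum pre r r₁ r₂ post {bs} h = begin
    det m (pre ++ r ∷ post) bs
      ≡⟨ det-move m pre r post bs ⟩
    sgn (length pre) * altS (λ b cs → m r b * det m (pre ++ post) cs) bs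
      ≡⟨ *-congˡ (trans (altS-congP (λ b → m r b ≡ m r₁ b + m r₂ b) (λ b cs e _ → trans (*-congʳ e) (*-distribʳ (m r₁ b) (m r₂ b) (det m (pre ++ post) cs))) h)
           (altS-+ (λ b cs → m r₁ b * det m (pre ++ post) cs) (λ b cs → m r₂ b * det m (pre ++ post) cs) bs)) ⟩
    sgn (length pre) * (det m (r₁ ∷ pre ++ post) bs + det m (r₂ ∷ pre ++ post) bs)
      ≡⟨ *-distribˡ _ _ _ ⟩
    sgn (length pre) * det m (r₁ ∷ pre ++ post) bs + sgn (length pre) * det m (r₂ ∷ pre ++ post) bs
      ≡⟨ cong₂ _+_ (sym (det-move m pre r₁ post bs)) (sym (det-move m pre r₂ post bs)) ⟩
    det m (pre ++ r₁ ∷ post) bs + det m (pre ++ r₂ ∷ post) bs ∎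
    where open ≡-Reasoning

  det-zeroCol : ∀ {as bs c} → c ∈ bs → All (λ a → m a c ≡ 0ℚ) as → det m as bs ≡ 0ℚ
  det-zeroCol {as} {bs} {c} p z with MemP.∈-∃++ p
  ... | pre , post , refl = trans (det-transpose m as (pre ++ c ∷ post)) (det-zeroRow (flip m) pre c post z)

∈-range⁺ : ∀ {k} r n → r ℕ.≤ k → k ℕ.< r ℕ.+ n → k ∈ range r n
∈-range⁺ {k} r zero    h₁ h₂ = ⊥-elim (ℕP.<-irrefl refl (ℕP.<-≤-trans h₂ (subst (ℕ._≤ k) (sym (ℕP.+-identityʳ r)) h₁)))
∈-range⁺ {k} r (suc n) h₁ h₂ with r ℕ.≟ k
... | yes refl = here refl
... | no  r≢k  = there (∈-range⁺ (suc r) n (ℕP.≤∧≢⇒< h₁ r≢k) (subst (k ℕ.<_) (ℕP.+-suc r n) h₂))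

det-δ : ∀ r n → det [_≟_] (range r n) (range r n) ≡ 1ℚ
det-δ r zero    = refl
det-δ r (suc n) = trans (det-block [_≟_] (r ∷ []) (range (suc r) n) (r ∷ []) (range (suc r) n) refl
    (λ { i k (here refl) q → [≟]-false {i} {k} (λ e → ℕP.<-irrefl e (proj₁ (∈-range (suc r) n q))) }))
  (trans (cong₂ _*_ (trans (x-0 _) (trans (*-comm _ 1ℚ) (trans (*-identityˡ _) ([≟]-true {r} refl)))) (det-δ (suc r) n)) (*-identityˡ 1ℚ))

gather : (ℕ → List Fun) → ℕ → ℕ → List Fun
gather g u zero    = []
gather g u (suc m) = g u ++ gather g (suc u) m

gather-cong : ∀ {g h} u m → (∀ v → u ℕ.≤ v → v ℕ.< u ℕ.+ m → g v ≡ h v) → gather g u m ≡ gather h u m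
gather-cong u zero    e = refl
gather-cong u (suc m) e = cong₂ _++_ (e u ℕP.≤-refl (subst (u ℕ.<_) (sym (ℕP.+-suc u m)) (ℕ.s≤s (ℕP.m≤m+n u m))))
  (gather-cong (suc u) m (λ v p q → e v (ℕP.<⇒≤ p) (subst (v ℕ.<_) (sym (ℕP.+-suc u m)) q)))

gather-+ : ∀ g u m n → gather g u (m ℕ.+ n) ≡ gather g u m ++ gather g (u ℕ.+ m) n
gather-+ g u zero    n = cong (λ v → gather g v n) (sym (ℕP.+-identityʳ u))
gather-+ g u (suc m) n = trans (cong (g u ++_) (trans (gather-+ g (suc u) m n) (cong (λ v → gather g (suc u) m ++ gather g v n) (sym (ℕP.+-suc u m)))))
  (sym (LP.++-assoc (g u) _ _))

gather-snoc : ∀ g m → gather g 0 (suc m) ≡ gather g 0 m ++ g m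
gather-snoc g m = trans (cong (gather g 0) (ℕP.+-comm 1 m)) (trans (gather-+ g 0 m 1) (cong (gather g 0 m ++_) (LP.++-identityʳ (g m))))

gather-[] : ∀ {g} u m → (∀ v → u ℕ.≤ v → v ℕ.< u ℕ.+ m → g v ≡ []) → gather g u m ≡ []
gather-[] u m e = trans (gather-cong u m e) (empty u m)
  where
  empty : ∀ u m → gather (λ _ → []) u m ≡ []
  empty u zero    = refl
  empty u (suc m) = empty (suc u) m

gather-map : ∀ {g} (f : ℕ → Fun) u m → (∀ v → u ℕ.≤ v → v ℕ.< u ℕ.+ m → g v ≡ f v ∷ []) → gather g u m ≡ map f (range u m)
gather-map f u m e = trans (gather-cong u m e) (single u m)
  where
  single : ∀ u m → gather (λ v → f v ∷ []) u m ≡ map f (range u m)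
  single u zero    = refl
  single u (suc m) = cong (f u ∷_) (single (suc u) m)

module Columns (p b c : ℕ) (P : Pred) (w : Walls) (ins : ℕ → ℕ → List Fun) where

  N U : ℕ
  N = b ℕ.+ c
  U = p ℕ.+ b

  A B : ℕ → ℕ → Bool
  A j u = P (L j u)
  B j u = P (R j u)

  f : ℕ → ℕ → ℕ → Fun
  f n j u k = pc w n j u k

  K : List ℕ
  K = range b p

  D : List Fun → ℚ
  D fs = det (λ g k → g k) fs K

  -- A carried row is released, as a path that enters at edge v, where the left triangle is missing
  -- and the right one is present; otherwise it stays carried.
  ins′ : ℕ → ℕ → List Fun
  ins′ j v = if not (A j v) ∧ B (suc j) v then [] else ins j v

  -- What is assumed of a region: inside the hexagon a left triangle is missing exactly at a wall,
  -- and the carried rows account for the paths that start in the interior.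
  module Induction
    (A-hex : ∀ j u → A j u ≡ true → hexcol p b c (suc j) u ≡ true)
    (A-open : ∀ j u → A j u ≡ true → w (suc j) u ≡ false)
    (A-wall : ∀ j u → suc j ℕ.≤ N → A j u ≡ false → hexcol p b c (suc j) u ≡ true → w (suc j) u ≡ true)
    (B-hex : ∀ j u → B j u ≡ true → hexcol p b c j u ≡ true)
    (B-N : ∀ v → B N v ≡ false)
    (A⇒B : ∀ j u → suc j ℕ.< N → A j u ≡ true → B (suc j) u ≡ true)
    (ins-clear : ∀ j u → B j u ≡ true → A j (suc u) ≡ true → ins j (suc u) ≡ [])
    (ins-tip : ∀ j n u → suc j ℕ.+ n ≡ N → A j u ≡ false → B (suc j) u ≡ true → ins j u ≡ f n (suc j) u ∷ [])
    (ins-last : ∀ j v → suc j ≡ N → ins j v ≡ one (hexcol p b c N v ∧ not (A j v)) (f 0 (suc j) v))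
    (ins-step : ∀ j → suc j ℕ.< N → ∀ (x : ℕ → Bool) (g : ℕ → Fun) →
      gather (λ v → ins′ j v ++ one (B (suc j) v ∧ x v) (g v)) 0 U ≡ gather (λ v → ins (suc j) v ++ one (B (suc j) v ∧ x v) (g v)) 0 U)
    where

    hexcol-top : ∀ j u → hexcol p b c j u ≡ true → u ℕ.< p ℕ.+ b
    hexcol-top j u h = ℕP.<-≤-trans (<ᵇ-true (proj₂ (∧-true {j ∸ c ℕ.≤ᵇ u} h))) (ℕP.+-monoʳ-≤ p (ℕP.m⊓n≤n j b))

    hexcol-left : ∀ j u → hexcol p b c j u ≡ true → u ℕ.< p ℕ.+ j
    hexcol-left j u h = ℕP.<-≤-trans (<ᵇ-true (proj₂ (∧-true {j ∸ c ℕ.≤ᵇ u} h))) (ℕP.+-monoʳ-≤ p (ℕP.m⊓n≤m j b))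

    N∸c : N ∸ c ≡ b
    N∸c = ℕP.m+n∸n≡m b c

    hexcol-N⁻ : ∀ v → hexcol p b c N v ≡ true → b ℕ.≤ v
    hexcol-N⁻ v h = subst (ℕ._≤ v) N∸c (≤ᵇ-true (proj₁ (∧-true {N ∸ c ℕ.≤ᵇ v} {v ℕ.<ᵇ p ℕ.+ (N ⊓ b)} h)))

    hexcol-N⁺ : ∀ v → b ℕ.≤ v → v ℕ.< b ℕ.+ p → hexcol p b c N v ≡ true
    hexcol-N⁺ v h₁ h₂ = hexcol-intro p b c N v (subst (ℕ._≤ c ℕ.+ v) (ℕP.+-comm c b) (ℕP.+-monoʳ-≤ c h₁))
      (ℕP.<-≤-trans v<U (ℕP.+-monoʳ-≤ p (ℕP.m≤m+n b c))) v<U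
      where
      v<U : v ℕ.< p ℕ.+ b
      v<U = subst (v ℕ.<_) (ℕP.+-comm b p) h₂

    arr-0 : ∀ n j v k → pc w n j v k ≡ 0ℚ → arr w n j v k ≡ 0ℚ
    arr-0 n j v k e with w j v
    ... | true  = refl
    ... | false = e

    -- The slanted sides of the hexagon need no walls. Below the lower right side every exit is too
    -- high to be reached, and above the upper right side every exit lies too low; what is missing
    -- between them is a wall.
    arr-gate : ∀ n j v k → suc j ℕ.+ n ≡ N → v ℕ.< p ℕ.+ suc j → b ℕ.≤ k → k ℕ.< b ℕ.+ p →
      arr w n (suc j) v k ≡ gate (A j v) (f n (suc j) v k)
    arr-gate n j v k e vj bk kp with A j v in eA
    ... | true  = cong (λ z → if z then 0ℚ else pc w n (suc j) v k) (A-open j v eA)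
    ... | false with suc j ℕ.≤? c ℕ.+ v | v ℕ.<? p ℕ.+ b
    ...   | no  h | _     = arr-0 n (suc j) v k (pc-above w n (suc j) v k (ℕP.<-≤-trans (ℕP.+-cancelˡ-< c (v ℕ.+ n) b
              (subst (ℕ._< c ℕ.+ b) (ℕP.+-assoc c v n) (subst ((c ℕ.+ v) ℕ.+ n ℕ.<_) (trans e (ℕP.+-comm b c)) (ℕP.+-monoˡ-< n (ℕP.≰⇒> h))))) bk))
    ...   | yes h | no h′ = arr-0 n (suc j) v k (pc-below w n (suc j) v k (ℕP.<-≤-trans kp (subst (ℕ._≤ v) (ℕP.+-comm p b) (ℕP.≮⇒≥ h′))))
    ...   | yes h | yes h′ = cong (λ z → if z then 0ℚ else pc w n (suc j) v k)
              (A-wall j v (subst (suc j ℕ.≤_) e (ℕP.m≤m+n (suc j) n)) eA (hexcol-intro p b c (suc j) v h vj h′))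

    D-gate : ∀ x g pre post → D (pre ++ (λ k → gate x (g k)) ∷ post) ≡ gate x (D (pre ++ g ∷ post))
    D-gate true  g pre post = refl
    D-gate false g pre post = det-zeroRow (λ h k → h k) pre (λ k → 0ℚ) post (All.universal (λ _ → refl) K)

    D-dup : ∀ pre g post → D (pre ++ g ∷ g ∷ post) ≡ 0ℚ
    D-dup pre g post = trans (det-move (λ h k → h k) pre g (g ∷ post) K)
      (trans (*-congˡ (det-dup (λ h k → h k) K (∈-pre pre))) (*-zeroʳ _))

    All-one : ∀ {Q : Fun → Set} x g → Q g → All Q (one x g)
    All-one true  g q = q ∷ []
    All-one false g q = []

    Count : ℕ → ℕ → Set
    Count n j = j ℕ.+ suc n ≡ N → ∀ (Q : Pred) (x : ℕ → Bool) → (∀ v → Q (R j v) ≡ B j v ∧ x v) → (∀ v → Q (L j v) ≡ A j v) →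
      (∀ y → suc j ℕ.≤ column y → Q y ≡ P y) →
      nat (cnt (strips U j (suc n)) Q) ≡ D (gather (λ u → ins j u ++ one (B j u ∧ x u) (f (suc n) j u)) 0 U)

    -- The list produced by the transfer is the starting list of the next strip. In the last strip
    -- it consists of the trivial paths at the exits, whose determinant is 1.
    count-step : ∀ n j → (∀ m → n ≡ suc m → Count m (suc j)) → Count n j
    count-step n j rec e Q x qR qL qF = trans (S.Transfer.transfer AU B₀ hsplit D-dup H₁ H₂ H₃ H₄ (λ Q x ag → IH n refl Q x ag) Q qR qL qF) (cong D (rest≡ 0 U))
      where
      s : ℕ → Bool
      s u = B j u ∧ x u
      module S = Strip U j n P s (f (suc n) j) (f n (suc j)) (ins j) (ins′ j) D
      e′ : suc j ℕ.+ n ≡ N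
      e′ = trans (sym (ℕP.+-suc j n)) e
      rest≡ : ∀ u m → S.rest u m ≡ gather (λ u → ins j u ++ one (B j u ∧ x u) (f (suc n) j u)) u m
      rest≡ u zero    = refl
      rest≡ u (suc m) = trans (cong (λ l → ins j u ++ one (s u) (f (suc n) j u) ++ l) (rest≡ (suc u) m)) (sym (LP.++-assoc (ins j u) _ _))
      lst≡ : ∀ x u → S.lst x u ≡ gather (S.fin x) 0 u
      lst≡ x zero    = refl
      lst≡ x (suc u) = trans (cong (_++ S.fin x u) (lst≡ x u)) (sym (gather-snoc (S.fin x) u))
      AU : A j U ≡ false
      AU = not-true⇒false (λ h → ℕP.<-irrefl refl (hexcol-top (suc j) U (A-hex j U h)))
      B₀ : n ≡ 0 → ∀ v → B (suc j) v ≡ false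
      B₀ refl v = trans (cong (λ i → B i v) (trans (sym (ℕP.+-identityʳ (suc j))) e′)) (B-N v)
      hsplit : ∀ u pre post → s u ≡ true → D (pre ++ f (suc n) j u ∷ post) ≡
        gate (A j u) (D (pre ++ f n (suc j) u ∷ post)) + gate (A j (suc u)) (D (pre ++ f n (suc j) (suc u) ∷ post))
      hsplit u pre post su = trans
        (det-rowSum (λ h k → h k) pre (f (suc n) j u) (λ k → gate (A j u) (f n (suc j) u k)) (λ k → gate (A j (suc u)) (f n (suc j) (suc u) k)) post
          (All-range _ b p (λ k h₁ h₂ → cong₂ _+_ (arr-gate n j u k e′ (ℕP.<-trans u< (ℕP.+-monoʳ-< p (ℕP.n<1+n j))) h₁ h₂)
            (arr-gate n j (suc u) k e′ (subst (suc u ℕ.<_) (sym (ℕP.+-suc p j)) (ℕ.s≤s u<)) h₁ h₂))))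
        (cong₂ _+_ (D-gate (A j u) (f n (suc j) u) pre post) (D-gate (A j (suc u)) (f n (suc j) (suc u)) pre post))
        where
        u< : u ℕ.< p ℕ.+ j
        u< = hexcol-left j u (B-hex j u (proj₁ (∧-true {B j u} {x u} su)))
      H₁ : ∀ u → s u ≡ true → A j (suc u) ≡ true → ins j (suc u) ≡ []
      H₁ u su = ins-clear j u (proj₁ (∧-true {B j u} {x u} su))
      H₂ : ∀ u → A j u ≡ true → ins j u ≡ ins′ j u
      H₂ u eA = cong (λ z → if not z ∧ B (suc j) u then [] else ins j u) (sym eA)
      H₃ : ∀ u → A j u ≡ false → ins j u ≡ ins′ j u ++ one (B (suc j) u) (f n (suc j) u)
      H₃ u eA = trans (go (B (suc j) u) refl) (cong (λ z → (if not z ∧ B (suc j) u then [] else ins j u) ++ one (B (suc j) u) (f n (suc j) u)) (sym eA))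
        where
        go : ∀ z → B (suc j) u ≡ z → ins j u ≡ (if z then [] else ins j u) ++ one z (f n (suc j) u)
        go true  eB = ins-tip j n u e′ eA eB
        go false eB = sym (LP.++-identityʳ _)
      module Last (n0 : n ≡ 0) where
        j≡N : suc j ≡ N
        j≡N = trans (sym (trans (cong (suc j ℕ.+_) n0) (ℕP.+-identityʳ (suc j)))) e′
        ins≡ : ∀ v → ins j v ≡ one (hexcol p b c N v ∧ not (A j v)) (f n (suc j) v)
        ins≡ v = trans (ins-last j v j≡N) (cong (λ m → one (hexcol p b c N v ∧ not (A j v)) (f m (suc j) v)) (sym n0))
        f-0 : ∀ {v u} → v ≢ u → f n (suc j) v u ≡ 0ℚ
        f-0 {v} {u} ne = trans (cong (λ m → pc w m (suc j) v u) n0) ([≟]-false {v} {u} ne)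
        ins-0 : ∀ {v u} → v ≢ u → All (λ g → g u ≡ 0ℚ) (ins j v)
        ins-0 {v} {u} ne = subst (All (λ g → g u ≡ 0ℚ)) (sym (ins≡ v)) (All-one (hexcol p b c N v ∧ not (A j v)) (f n (suc j) v) (f-0 ne))
        ins′-0 : ∀ {v u} → v ≢ u → All (λ g → g u ≡ 0ℚ) (ins′ j v)
        ins′-0 {v} {u} ne with not (A j v) ∧ B (suc j) v
        ... | true  = []
        ... | false = ins-0 ne
        lst-0 : ∀ x u v → v ℕ.≤ u → All (λ g → g u ≡ 0ℚ) (S.lst x v)
        lst-0 x u zero    h = []
        lst-0 x u (suc v) h = AllP.++⁺ (lst-0 x u v (ℕP.<⇒≤ h)) (AllP.++⁺ (ins′-0 (λ e → ℕP.<-irrefl e h)) (All-one ((A j v ∨ B (suc j) v) ∧ x v) (f n (suc j) v) (f-0 (λ e → ℕP.<-irrefl e h))))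
        rest-0 : ∀ u v m → u ℕ.< v → All (λ g → g u ≡ 0ℚ) (S.rest v m)
        rest-0 u v zero    h = []
        rest-0 u v (suc m) h = AllP.++⁺ (ins-0 (λ e → ℕP.<-irrefl (sym e) h)) (AllP.++⁺ (All-one (s v) (f (suc n) j v) (pc-below w (suc n) j v u h)) (rest-0 u (suc v) m (ℕP.<-trans h (ℕP.n<1+n v))))
        -- Here u is an exit that no row of the list reaches: the rows below are trivial paths at
        -- other exits, and those above never come down. So the determinant has a zero column.
        H₄′ : ∀ u x g m → A j u ≡ true → D (S.lst x u ++ ins′ j u ++ one g (f n (suc j) (suc u)) ++ S.rest (suc u) m) ≡ 0ℚ
        H₄′ u x g m eA = det-zeroCol (λ h k → h k) (∈-range⁺ b p (hexcol-N⁻ u hx) (subst (u ℕ.<_) (ℕP.+-comm p b) (hexcol-top N u hx)))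
          (AllP.++⁺ (lst-0 x u u ℕP.≤-refl) (AllP.++⁺ (subst (All (λ g → g u ≡ 0ℚ)) (sym none) [])
            (AllP.++⁺ (All-one g (f n (suc j) (suc u)) (f-0 (ℕP.1+n≢n))) (rest-0 u (suc u) m (ℕP.n<1+n u)))))
          where
          hx : hexcol p b c N u ≡ true
          hx = subst (λ i → hexcol p b c i u ≡ true) j≡N (A-hex j u eA)
          none : ins′ j u ≡ []
          none = trans (sym (H₂ u eA)) (trans (ins≡ u) (cong (λ z → one z (f n (suc j) u)) (trans (cong (λ z → hexcol p b c N u ∧ not z) eA) (BoolP.∧-zeroʳ _))))
        fin≡ : ∀ x → (∀ v → A j v ≡ true → B (suc j) v ≡ false → x v ≡ true) → ∀ v → S.fin x v ≡ one (hexcol p b c N v) (f n (suc j) v)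
        fin≡ x xd v = go (A j v) refl
          where
          hx : A j v ≡ true → hexcol p b c N v ≡ true
          hx eA = subst (λ i → hexcol p b c i v ≡ true) j≡N (A-hex j v eA)
          eB : B (suc j) v ≡ false
          eB = B₀ n0 v
          go : ∀ z → A j v ≡ z → S.fin x v ≡ one (hexcol p b c N v) (f n (suc j) v)
          go true eA = begin
            S.fin x v
              ≡⟨ cong₂ (λ l z → l ++ one z (f n (suc j) v)) (trans (sym (H₂ v eA)) (ins≡ v)) (cong₂ (λ y z → (y ∨ B (suc j) v) ∧ z) eA (xd v eA eB)) ⟩
            one (hexcol p b c N v ∧ not (A j v)) (f n (suc j) v) ++ f n (suc j) v ∷ []
              ≡⟨ cong (λ z → one z (f n (suc j) v) ++ f n (suc j) v ∷ []) (trans (cong (λ z → hexcol p b c N v ∧ not z) eA) (BoolP.∧-zeroʳ _)) ⟩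
            f n (suc j) v ∷ []
              ≡⟨ cong (λ z → one z (f n (suc j) v)) (sym (hx eA)) ⟩
            one (hexcol p b c N v) (f n (suc j) v) ∎
            where open ≡-Reasoning
          go false eA = begin
            S.fin x v
              ≡⟨ cong₂ (λ y z → (if not y ∧ z then [] else ins j v) ++ one ((y ∨ z) ∧ x v) (f n (suc j) v)) eA eB ⟩
            ins j v ++ []
              ≡⟨ trans (LP.++-identityʳ _) (ins≡ v) ⟩
            one (hexcol p b c N v ∧ not (A j v)) (f n (suc j) v)
              ≡⟨ cong (λ z → one z (f n (suc j) v)) (trans (cong (λ z → hexcol p b c N v ∧ not z) eA) (BoolP.∧-identityʳ _)) ⟩
            one (hexcol p b c N v) (f n (suc j) v) ∎
            where open ≡-Reasoning
        lst-N : ∀ x → (∀ v → A j v ≡ true → B (suc j) v ≡ false → x v ≡ true) → S.lst x U ≡ map (f n (suc j)) K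
        lst-N x xd = begin
          S.lst x U                           ≡⟨ lst≡ x U ⟩
          gather (S.fin x) 0 U                ≡⟨ gather-cong 0 U (λ v _ _ → fin≡ x xd v) ⟩
          gather last 0 U                     ≡⟨ trans (cong (gather last 0) (ℕP.+-comm p b)) (gather-+ last 0 b p) ⟩
          gather last 0 b ++ gather last b p  ≡⟨ cong₂ _++_
            (gather-[] 0 b (λ v _ v<b → cong (λ z → one z (f n (suc j) v)) (not-true⇒false (λ h → ℕP.<-irrefl refl (ℕP.<-≤-trans v<b (hexcol-N⁻ v h))))))
            (gather-map (f n (suc j)) b p (λ v h₁ h₂ → cong (λ z → one z (f n (suc j) v)) (hexcol-N⁺ v h₁ h₂))) ⟩
          map (f n (suc j)) K                 ∎
          where
          open ≡-Reasoning
          last : ℕ → List Fun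
          last v = one (hexcol p b c N v) (f n (suc j) v)
        D-last : D (map (f n (suc j)) K) ≡ 1ℚ
        D-last = trans (cong (λ L → det (λ h k → h k) (map (f n (suc j)) K) L) (sym (LP.map-id K)))
          (trans (det-map (λ h k → h k) (f n (suc j)) id K K) (trans (det-cong (λ v k → cong (λ m → pc w m (suc j) v k) n0) K K) (det-δ b p)))
      H₄ : ∀ u x g m → A j u ≡ true → B (suc j) u ≡ false → D (S.lst x u ++ ins′ j u ++ one g (f n (suc j) (suc u)) ++ S.rest (suc u) m) ≡ 0ℚ
      H₄ u x g m eA eB with n ℕ.≟ 0
      ... | yes n0 = Last.H₄′ n0 u x g m eA
      ... | no  n≢0 = ⊥-elim (true≢false (trans (sym (A⇒B j u (subst (suc j ℕ.<_) e′ (ℕP.m<m+n (suc j) (ℕP.n≢0⇒n>0 n≢0))) eA)) eB))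
      IH : ∀ n′ → n ≡ n′ → ∀ Q x → S.Agrees Q x → nat (cnt (strips U (suc j) n) Q) ≡ D (S.lst x U)
      IH zero n0 Q x ag = trans (cong (λ m → nat (cnt (strips U (suc j) m) Q)) n0)
        (trans nat-1 (sym (trans (cong D (Last.lst-N n0 x (S.Agrees.xd ag))) (Last.D-last n0))))
      IH (suc m) eq Q x ag = begin
        nat (cnt (strips U (suc j) n) Q)
          ≡⟨ cong (λ m → nat (cnt (strips U (suc j) m) Q)) eq ⟩
        nat (cnt (strips U (suc j) (suc m)) Q)
          ≡⟨ rec m eq (trans (cong (suc j ℕ.+_) (sym eq)) e′) Q x (S.Agrees.qN ag) (S.Agrees.qLn ag) (S.Agrees.qF ag) ⟩
        D (gather (λ v → ins (suc j) v ++ one (B (suc j) v ∧ x v) (f (suc m) (suc j) v)) 0 U)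
          ≡⟨ cong D (sym (ins-step j j<N x (f (suc m) (suc j)))) ⟩
        D (gather (λ v → ins′ j v ++ one (B (suc j) v ∧ x v) (f (suc m) (suc j) v)) 0 U)
          ≡⟨ cong D (gather-cong 0 U (λ v _ _ → cong₂ (λ z m → ins′ j v ++ one (z ∧ x v) (f m (suc j) v)) (sym (A∨B v)) (sym eq))) ⟩
        D (gather (S.fin x) 0 U)
          ≡⟨ cong D (sym (lst≡ x U)) ⟩
        D (S.lst x U) ∎
        where
        open ≡-Reasoning
        j<N : suc j ℕ.< N
        j<N = subst (suc j ℕ.<_) (trans (cong (suc j ℕ.+_) (sym eq)) e′) (ℕP.m<m+n (suc j) (ℕ.s≤s ℕ.z≤n))
        A∨B : ∀ v → A j v ∨ B (suc j) v ≡ B (suc j) v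
        A∨B v with A j v in eA
        ... | true  = sym (A⇒B j v j<N eA)
        ... | false = refl

    count : ∀ n j → Count n j
    count zero    j = count-step zero j (λ m ())
    count (suc n) j = count-step (suc n) j (λ { m refl → count n (suc j) })

    -- The transfer needs at least one strip; the hexagon without strips is left to the caller.
    count-all : nat (cnt (strips U 0 N) P) ≡ D (gather (λ u → ins 0 u ++ one (B 0 u) (f N 0 u)) 0 U) ⊎ N ≡ 0
    count-all = go N refl
      where
      go : ∀ n → N ≡ n → nat (cnt (strips U 0 N) P) ≡ D (gather (λ u → ins 0 u ++ one (B 0 u) (f N 0 u)) 0 U) ⊎ N ≡ 0
      go zero    e = inj₂ e
      go (suc n) e = inj₁ (trans (cong (λ m → nat (cnt (strips U 0 m) P)) e)
        (trans (count n 0 (sym e) P (λ _ → true) (λ v → sym (BoolP.∧-identityʳ (B 0 v))) (λ v → refl) (λ y _ → refl))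
          (cong D (gather-cong 0 U (λ v _ _ → cong₂ (λ z m → ins 0 v ++ one z (f m 0 v)) (BoolP.∧-identityʳ (B 0 v)) (sym e))))))

-- The regions for p = 2 a and p = 2 a + 1

half : ∀ i → Σ ℕ λ m → i ≡ dbl m ⊎ i ≡ suc (dbl m)
half zero    = 0 , inj₁ refl
half (suc i) with half i
... | m , inj₁ e = m , inj₂ (cong suc e)
... | m , inj₂ e = suc m , inj₁ (cong suc e)

dbl-mono : ∀ {m n} → m ℕ.≤ n → dbl m ℕ.≤ dbl n
dbl-mono ℕ.z≤n     = ℕ.z≤n
dbl-mono (ℕ.s≤s h) = ℕ.s≤s (ℕ.s≤s (dbl-mono h))

dbl-< : ∀ {m n} → dbl m ℕ.< dbl n → m ℕ.< n
dbl-< {m} {n} h with n ℕ.≤? m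
... | yes q = ⊥-elim (ℕP.<-irrefl refl (ℕP.<-≤-trans h (dbl-mono q)))
... | no  q = ℕP.≰⇒> q

⌊dbl/2⌋ : ∀ m → ⌊ dbl m /2⌋ ≡ m
⌊dbl/2⌋ zero    = refl
⌊dbl/2⌋ (suc m) = cong suc (⌊dbl/2⌋ m)

⌊suc-dbl/2⌋ : ∀ m → ⌊ suc (dbl m) /2⌋ ≡ m
⌊suc-dbl/2⌋ zero    = refl
⌊suc-dbl/2⌋ (suc m) = cong suc (⌊suc-dbl/2⌋ m)

not-odd : ∀ u n → u ℕ.+ u ≢ suc (dbl n)
not-odd u n e = even≢odd u n (trans e (cong suc (dbl≡+ n)))

W⁻ : ∀ a d j u → W a d j u ≡ true → j ℕ.< dbl d × u ℕ.+ u ≡ dbl a ℕ.+ j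
W⁻ a (suc d) zero    u e = ℕ.s≤s ℕ.z≤n , trans (cong (λ n → n ℕ.+ n) (≡ᵇ-true {u} {a} e)) (trans (sym (dbl≡+ a)) (sym (ℕP.+-identityʳ _)))
W⁻ a (suc d) (suc (suc j)) u e with W⁻ (suc a) d j u e
... | h₁ , h₂ = ℕ.s≤s (ℕ.s≤s h₁) , trans h₂ (sym (trans (ℕP.+-suc (dbl a) (suc j)) (cong suc (ℕP.+-suc (dbl a) j))))

W⁺ : ∀ a d j u → j ℕ.< dbl d → u ℕ.+ u ≡ dbl a ℕ.+ j → W a d j u ≡ true
W⁺ a (suc d) zero    u h e = T⇒true (ℕP.≡⇒≡ᵇ u a (dbl-inj u a (trans e (ℕP.+-identityʳ _))))
W⁺ a (suc d) (suc zero) u h e = ⊥-elim (not-odd u a (trans e (ℕP.+-comm (dbl a) 1)))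
W⁺ a (suc d) (suc (suc j)) u (ℕ.s≤s (ℕ.s≤s h)) e = W⁺ (suc a) d j u h (trans e (trans (ℕP.+-suc (dbl a) (suc j)) (cong suc (ℕP.+-suc (dbl a) j))))

D-map : ∀ (F : ℕ → Fun) is ks → det (λ g k → g k) (map F is) ks ≡ det F is ks
D-map F is ks = trans (cong (det (λ g k → g k) (map F is)) (sym (LP.map-id ks))) (det-map (λ g k → g k) F id is ks)

-- Nothing else is emitted at position c, so the row e may be emitted one position later without
-- changing the list.
gather-move : ∀ (e : Fun) (h : ℕ → List Fun) c u m → h c ≡ [] → u ℕ.≤ c → suc c ℕ.< u ℕ.+ m →
  gather (λ v → one (v ℕ.≡ᵇ c) e ++ h v) u m ≡ gather (λ v → one (v ℕ.≡ᵇ suc c) e ++ h v) u m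
gather-move e h c u zero hc u≤c c< = ⊥-elim (ℕP.<-irrefl refl (ℕP.≤-<-trans u≤c (ℕP.<-trans (ℕP.n<1+n c) (subst (suc c ℕ.<_) (ℕP.+-identityʳ u) c<))))
gather-move e h c u (suc m) hc u≤c c< with u ℕ.≟ c
... | yes refl = swap m c<
  where
  swap : ∀ m → suc c ℕ.< c ℕ.+ suc m → gather (λ v → one (v ℕ.≡ᵇ c) e ++ h v) c (suc m) ≡ gather (λ v → one (v ℕ.≡ᵇ suc c) e ++ h v) c (suc m)
  swap zero    c< = ⊥-elim (ℕP.<-irrefl (ℕP.+-comm 1 c) c<)
  swap (suc m) c< = trans
      (cong₂ _++_ (cong₂ (λ z l → one z e ++ l) (≡ᵇ-refl c) hc) (cong₂ _++_ (cong (λ z → one z e ++ h (suc c)) (≡ᵇ-false {suc c} {c} ℕP.1+n≢n)) same))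
      (sym (cong₂ _++_ (cong₂ (λ z l → one z e ++ l) (≡ᵇ-false {c} {suc c} (ℕP.1+n≢n ∘ sym)) hc) (cong₂ _++_ (cong (λ z → one z e ++ h (suc c)) (≡ᵇ-refl c)) refl)))
    where
    same : gather (λ v → one (v ℕ.≡ᵇ c) e ++ h v) (suc (suc c)) m ≡ gather (λ v → one (v ℕ.≡ᵇ suc c) e ++ h v) (suc (suc c)) m
    same = gather-cong (suc (suc c)) m (λ v p _ → cong (λ z → one z e ++ h v) (trans
      (≡ᵇ-false {v} {c} (λ { refl → ℕP.<-irrefl refl (ℕP.<-trans (ℕP.n<1+n v) p) }))
      (sym (≡ᵇ-false {v} {suc c} (λ { refl → ℕP.<-irrefl refl p })))))
... | no u≢c = cong₂ _++_
      (cong (λ z → one z e ++ h u) (trans (≡ᵇ-false u≢c) (sym (≡ᵇ-false {u} {suc c} (λ { refl → ℕP.<-irrefl refl u≤c })))))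
      (gather-move e h c (suc u) m hc (ℕP.≤∧≢⇒< u≤c u≢c) (subst (suc c ℕ.<_) (ℕP.+-suc u m) c<))

module Even (a d u v : ℕ) where

  p b c : ℕ
  p = dbl a
  b = d ℕ.+ u
  c = d ℕ.+ v

  d≤b : d ℕ.≤ b
  d≤b = ℕP.m≤m+n d u

  d≤c : d ℕ.≤ c
  d≤c = ℕP.m≤m+n d v

  dN : dbl d ℕ.≤ b ℕ.+ c
  dN = subst (ℕ._≤ b ℕ.+ c) (sym (dbl≡+ d)) (ℕP.+-mono-≤ d≤b d≤c)

  open Region p b c using (N; hx; inHex-line)

  hx-line : ∀ m → m ℕ.< d → hx (suc (dbl m)) (a ℕ.+ m) ≡ true
  hx-line m m<d = hexcol-intro p b c (suc (dbl m)) (a ℕ.+ m)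
    (ℕP.≤-trans (ℕP.≤-reflexive (cong suc (dbl≡+ m))) (ℕP.+-mono-≤ (ℕP.≤-trans m<d d≤c) (ℕP.m≤n+m m a)))
    (subst (a ℕ.+ m ℕ.<_) (sym (trans (cong₂ (λ x y → x ℕ.+ suc y) (dbl≡+ a) (dbl≡+ m)) (lem a m))) (ℕ.s≤s (ℕP.m≤m+n (a ℕ.+ m) (a ℕ.+ m))))
    (ℕP.+-mono-≤-< (subst (a ℕ.≤_) (sym (dbl≡+ a)) (ℕP.m≤m+n a a)) (ℕP.<-≤-trans m<d d≤b))
    where
    lem : ∀ a m → (a ℕ.+ a) ℕ.+ suc (m ℕ.+ m) ≡ suc ((a ℕ.+ m) ℕ.+ (a ℕ.+ m))
    lem = solve-∀ ℕ-ring

  level≡ : ∀ m → (a ℕ.+ m) ℕ.+ (a ℕ.+ m) ≡ dbl a ℕ.+ dbl m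
  level≡ m = trans (sym (dbl≡+ (a ℕ.+ m))) (dbl-+ a m)

  onHex : ∀ i → i ℕ.< dbl d → inHex p b c (i , + p) ≡ true
  onHex i h with half i
  ... | m , inj₁ refl = inHex-line (L (dbl m) (a ℕ.+ m)) (level≡ m) (ℕP.<-≤-trans h dN) (hx-line m (dbl-< h))
  ... | m , inj₂ refl = inHex-line (R (suc (dbl m)) (a ℕ.+ m)) (trans (cong suc (level≡ m)) (sym (ℕP.+-suc (dbl a) (dbl m)))) (ℕP.<-≤-trans h dN)
                          (hx-line m (dbl-< (ℕP.<-trans (ℕP.n<1+n _) h)))

  open Lists p b c d dN onHex using (region; M-region)
  open Membership p b c d dN onHex

  -- The two triangles of a removed lozenge share the vertical side a + m of column 2 m + 1. The
  -- walls therefore stand in the odd columns, which is `W` delayed by one.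
  w : Walls
  w = delay (W a d)

  none : ℕ → ℕ → List Fun
  none _ _ = []

  open Columns p b c region w none using (A; B; f; D; U; ins′; module Induction)

  -- The removed triangles alternate L, R and end with an R.
  next-removed : ∀ j u → j ℕ.< dbl d → u ℕ.+ u ≡ dbl a ℕ.+ j → suc j ℕ.< dbl d
  next-removed j u h e = ℕP.≤∧≢⇒< h (λ j≡ → not-odd u (a ℕ.+ j′ j≡) (trans e (odd j≡)))
    where
    j′ : suc j ≡ dbl d → ℕ
    j′ _ = ℕ.pred d
    odd : ∀ j≡ → dbl a ℕ.+ j ≡ suc (dbl (a ℕ.+ j′ j≡))
    odd j≡ = go d j≡
      where
      go : ∀ d → suc j ≡ dbl d → dbl a ℕ.+ j ≡ suc (dbl (a ℕ.+ ℕ.pred d))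
      go (suc d) q = trans (cong (dbl a ℕ.+_) (ℕP.suc-injective q)) (trans (ℕP.+-suc (dbl a) (dbl d)) (cong suc (sym (dbl-+ a d))))

  if-same : ∀ {X : Set} z {x : X} → (if z then x else x) ≡ x
  if-same true  = refl
  if-same false = refl

  A-no : ∀ j u → suc j ℕ.≤ N → A j u ≡ false → hx (suc j) u ≡ true → suc j ℕ.< dbl d × j ℕ.< dbl d × u ℕ.+ u ≡ dbl a ℕ.+ j
  A-no j u jN eA h with region-false (L j u) jN h eA
  ... | r₁ , r₂ = next-removed j u r₁ r₂ , r₁ , r₂

  A-hex : ∀ j u → A j u ≡ true → hx (suc j) u ≡ true
  A-hex j u e = proj₁ (proj₂ (region⁻ (L j u) e))

  A-open : ∀ j u → A j u ≡ true → w (suc j) u ≡ false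
  A-open j u e = not-true⇒false (λ h → proj₂ (proj₂ (region⁻ (L j u) e)) (W⁻ a d j u h))

  A-wall : ∀ j u → suc j ℕ.≤ N → A j u ≡ false → hx (suc j) u ≡ true → w (suc j) u ≡ true
  A-wall j u jN e h = let (_ , r₁ , r₂) = A-no j u jN e h in W⁺ a d j u r₁ r₂

  B-hex : ∀ j u → B j u ≡ true → hx j u ≡ true
  B-hex j u e = proj₁ (proj₂ (region⁻ (R j u) e))

  B-N : ∀ v → B N v ≡ false
  B-N v = not-true⇒false (λ e → ℕP.<-irrefl refl (proj₁ (region⁻ (R N v) e)))

  A⇒B : ∀ j u → suc j ℕ.< N → A j u ≡ true → B (suc j) u ≡ true
  A⇒B j u jN e = let (_ , h , nr) = region⁻ (L j u) e in
    region⁺ (R (suc j) u) jN h (λ { (r₁ , r₂) → nr (ℕP.<-trans (ℕP.n<1+n j) r₁ , ℕP.suc-injective (trans r₂ (ℕP.+-suc (dbl a) j))) })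

  none-clear : ∀ j u → B j u ≡ true → A j (suc u) ≡ true → none j (suc u) ≡ []
  none-clear _ _ _ _ = refl

  -- At every vertical side both triangles are removed or neither is, so no path starts inside the
  -- hexagon.
  no-tip : ∀ j n u → suc j ℕ.+ n ≡ N → A j u ≡ false → B (suc j) u ≡ true → none j u ≡ f n (suc j) u ∷ []
  no-tip j n u jn eA eB = let (h₁ , h₂ , nr) = region⁻ (R (suc j) u) eB
                              (r₁ , _ , r₂) = A-no j u (ℕP.<⇒≤ h₁) eA h₂ in
    ⊥-elim (nr (r₁ , trans (cong suc r₂) (sym (ℕP.+-suc (dbl a) j))))

  none-last : ∀ j v → suc j ≡ N → none j v ≡ one (hx N v ∧ not (A j v)) (f 0 (suc j) v)
  none-last j v jN = sym (cong (λ z → one z (f 0 (suc j) v)) (not-true⇒false (λ e → let (h , nA) = ∧-true {hx N v} e in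
    ℕP.<-irrefl refl (ℕP.<-≤-trans (proj₁ (A-no j v (ℕP.≤-reflexive jN) (not-true nA) (subst (λ i → hx i v ≡ true) (sym jN) h))) (subst (dbl d ℕ.≤_) (sym jN) dN)))))

  none-step : ∀ j → suc j ℕ.< N → ∀ (x : ℕ → Bool) (g : ℕ → Fun) →
    gather (λ v → ins′ j v ++ one (B (suc j) v ∧ x v) (g v)) 0 U ≡ gather (λ v → none (suc j) v ++ one (B (suc j) v ∧ x v) (g v)) 0 U
  none-step j _ x g = gather-cong 0 U (λ v _ _ → cong (_++ one (B (suc j) v ∧ x v) (g v)) (if-same (not (A j v) ∧ B (suc j) v)))

  open Induction A-hex A-open A-wall B-hex B-N A⇒B none-clear no-tip none-last none-step

  open Diagonal a using (Xv≡XZ; Xv≡Xh)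
  open Hats a using (Xh)
  open Intrusion a using (XZ)

  start : 0 ℕ.< N → ∀ i → i ℕ.< p → B 0 i ≡ true
  start N>0 i h = region⁺ (R 0 i) N>0 (hexcol-intro p b c 0 i ℕ.z≤n (ℕP.<-≤-trans h (ℕP.m≤m+n p 0)) (ℕP.<-≤-trans h (ℕP.m≤m+n p b)))
    (λ { (_ , e) → even≢odd a i (sym (trans e (trans (ℕP.+-identityʳ _) (dbl≡+ a)))) })

  start⁻ : ∀ i → B 0 i ≡ true → i ℕ.< p
  start⁻ i e = subst (i ℕ.<_) (ℕP.+-identityʳ p) (hexcol-left 0 i (proj₁ (proj₂ (region⁻ (R 0 i) e))))

  starts : 0 ℕ.< N → gather (λ i → one (B 0 i) (f N 0 i)) 0 U ≡ map (f N 0) (range 0 p)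
  starts N>0 = trans (gather-+ _ 0 p b) (trans (cong₂ _++_
    (gather-map (f N 0) 0 p (λ i _ h → cong (λ z → one z (f N 0 i)) (start N>0 i h)))
    (gather-[] p b (λ i h _ → cong (λ z → one z (f N 0 i)) (not-true⇒false (λ e → ℕP.<-irrefl refl (ℕP.<-≤-trans (start⁻ i e) h))))))
    (LP.++-identityʳ _))

  count-XZ : nat (cnt (strips U 0 N) region) ≡ XZ d N b
  count-XZ with count-all
  ... | inj₂ e = trans (cong (λ n → nat (cnt (strips U 0 n) region)) e) (trans nat-1 (sym (trans (cong₂ (XZ d) e (ℕP.m+n≡0⇒m≡0 b e)) (det-δ 0 p))))
  ... | inj₁ e with N ℕ.≟ 0
  ...   | yes e₀ = trans (cong (λ n → nat (cnt (strips U 0 n) region)) e₀) (trans nat-1 (sym (trans (cong₂ (XZ d) e₀ (ℕP.m+n≡0⇒m≡0 b e₀)) (det-δ 0 p))))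
  ...   | no  n0 = trans e (trans (cong D (starts (ℕP.n≢0⇒n>0 n0))) (D-map (f N 0) (range 0 p) (range b p)))

  M-even : nat (M (HexD p b c d)) ≡ Xh d u v
  M-even = trans (cong nat M-region) (trans count-XZ (trans (cong (λ n → XZ d n b) N≡) (trans (sym (Xv≡XZ d u v)) (Xv≡Xh d u v))))
    where
    lem : ∀ d u v → (d ℕ.+ u) ℕ.+ (d ℕ.+ v) ≡ (d ℕ.+ d) ℕ.+ (u ℕ.+ v)
    lem = solve-∀ ℕ-ring
    N≡ : N ≡ dbl d ℕ.+ (u ℕ.+ v)
    N≡ = trans (lem d u v) (cong (ℕ._+ (u ℕ.+ v)) (sym (dbl≡+ d)))

module Odd (a d u v : ℕ) where

  p b c : ℕ
  p = suc (dbl a)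
  b = d ℕ.+ u
  c = d ℕ.+ v

  d≤b : d ℕ.≤ b
  d≤b = ℕP.m≤m+n d u

  d≤c : d ℕ.≤ c
  d≤c = ℕP.m≤m+n d v

  dN : dbl d ℕ.≤ b ℕ.+ c
  dN = subst (ℕ._≤ b ℕ.+ c) (sym (dbl≡+ d)) (ℕP.+-mono-≤ d≤b d≤c)

  open Region p b c using (N; hx; inHex-line)

  a≤dbl : a ℕ.≤ dbl a
  a≤dbl = subst (a ℕ.≤_) (sym (dbl≡+ a)) (ℕP.m≤m+n a a)

  hx-line : ∀ m → m ℕ.≤ d → hx (dbl m) (a ℕ.+ m) ≡ true
  hx-line m m≤d = hexcol-intro p b c (dbl m) (a ℕ.+ m)
    (ℕP.≤-trans (ℕP.≤-reflexive (dbl≡+ m)) (ℕP.+-mono-≤ (ℕP.≤-trans m≤d d≤c) (ℕP.m≤n+m m a)))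
    (ℕ.s≤s (ℕP.+-mono-≤ a≤dbl (subst (m ℕ.≤_) (sym (dbl≡+ m)) (ℕP.m≤m+n m m))))
    (ℕ.s≤s (ℕP.+-mono-≤ a≤dbl (ℕP.≤-trans m≤d d≤b)))

  level≡ : ∀ m → (a ℕ.+ m) ℕ.+ (a ℕ.+ m) ≡ dbl a ℕ.+ dbl m
  level≡ m = trans (sym (dbl≡+ (a ℕ.+ m))) (dbl-+ a m)

  level-suc : ∀ m → (a ℕ.+ suc m) ℕ.+ (a ℕ.+ suc m) ≡ suc (dbl a) ℕ.+ suc (dbl m)
  level-suc m = trans (level≡ (suc m)) (ℕP.+-suc (dbl a) (suc (dbl m)))

  onHex : ∀ i → i ℕ.< dbl d → inHex p b c (i , + p) ≡ true
  onHex i h with half i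
  ... | m , inj₁ refl = inHex-line (R (dbl m) (a ℕ.+ m)) (cong suc (level≡ m)) (ℕP.<-≤-trans h dN) (hx-line m (ℕP.<⇒≤ (dbl-< h)))
  ... | m , inj₂ refl = inHex-line (L (suc (dbl m)) (a ℕ.+ suc m)) (level-suc m) (ℕP.<-≤-trans h dN) (hx-line (suc m) (dbl-< (ℕP.<-trans (ℕP.n<1+n _) h)))

  open Lists p b c d dN onHex using (region; M-region)
  open Membership p b c d dN onHex

  -- The d bowties have vertical sides at heights a + m of the columns 2 m for m = 0, ..., d, hence
  -- d + 1 walls. The first is the missing start on the left side; at the last one no path may
  -- arrive, and there the tip path starts.
  w : Walls
  w = W a (suc d)

  tip : Fun
  tip k = pc w (N ∸ dbl d) (dbl d) (a ℕ.+ d) k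

  -- The path starting at the tip of the intrusion is carried along, at the height of the intrusion.
  ins : ℕ → ℕ → List Fun
  ins j u = one ((j ℕ.<ᵇ dbl d) ∧ (u ℕ.≡ᵇ suc (a ℕ.+ ⌊ j /2⌋))) tip

  open Columns p b c region w ins using (A; B; f; D; U; K; ins′; module Induction)

  ins-empty : ∀ j u → ¬ (j ℕ.< dbl d × u ≡ suc (a ℕ.+ ⌊ j /2⌋)) → ins j u ≡ []
  ins-empty j u h = cong (λ z → one z tip) (not-true⇒false (λ e → let (e₁ , e₂) = ∧-true {j ℕ.<ᵇ dbl d} e in h (<ᵇ-true e₁ , ≡ᵇ-true e₂)))

  tip-column : ∀ j → suc j ≡ dbl d → j ℕ.< dbl d × suc (a ℕ.+ ⌊ j /2⌋) ≡ a ℕ.+ d × dbl a ℕ.+ dbl d ≡ suc (dbl a) ℕ.+ j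
  tip-column j e = ℕP.≤-reflexive e , go d e , trans (cong (dbl a ℕ.+_) (sym e)) (ℕP.+-suc (dbl a) j)
    where
    go : ∀ d → suc j ≡ dbl d → suc (a ℕ.+ ⌊ j /2⌋) ≡ a ℕ.+ d
    go (suc d) e = trans (cong (λ i → suc (a ℕ.+ ⌊ i /2⌋)) (ℕP.suc-injective e)) (trans (cong (λ i → suc (a ℕ.+ i)) (⌊suc-dbl/2⌋ d)) (sym (ℕP.+-suc a d)))

  tip-removed : ∀ j u → suc j ≡ dbl d → u ℕ.+ u ≡ suc (dbl a) ℕ.+ j → u ≡ a ℕ.+ d
  tip-removed j u e r = dbl-inj u (a ℕ.+ d) (trans r (trans (sym (proj₂ (proj₂ (tip-column j e)))) (sym (dbl-+ a d))))

  ins-at-tip : ∀ j n u → suc j ℕ.+ n ≡ N → suc j ≡ dbl d → u ≡ a ℕ.+ d → ins j u ≡ f n (suc j) u ∷ []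
  ins-at-tip j n u jn e refl = trans
    (cong (λ z → one z tip) (∧-intro (<⇒<ᵇ-true (proj₁ (tip-column j e))) (T⇒true (ℕP.≡⇒≡ᵇ u _ (sym (proj₁ (proj₂ (tip-column j e))))))))
    (cong (_∷ []) (cong₂ (λ n j k → pc w n j (a ℕ.+ d) k) (trans (cong₂ _∸_ (sym jn) (sym e)) (ℕP.m+n∸m≡n (suc j) n)) (sym e)))

  A-no : ∀ j u → suc j ℕ.≤ N → A j u ≡ false → hx (suc j) u ≡ true → j ℕ.< dbl d × u ℕ.+ u ≡ suc (dbl a) ℕ.+ j
  A-no j u jN eA h = region-false (L j u) jN h eA

  -- Neighbouring bowties share a vertical side, where both triangles are gone. Only at the last
  -- side, in column 2 d, is the left triangle removed and the right one not.
  A-no-B : ∀ j u → A j u ≡ false → B (suc j) u ≡ true → suc j ≡ dbl d × u ≡ a ℕ.+ d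
  A-no-B j u eA eB with region⁻ (R (suc j) u) eB
  ... | h₁ , h₂ , nr with A-no j u (ℕP.<⇒≤ h₁) eA h₂
  ...   | r₁ , r₂ with suc j ℕ.≟ dbl d
  ...     | yes e = e , tip-removed j u e r₂
  ...     | no ne = ⊥-elim (nr (ℕP.≤∧≢⇒< r₁ ne , trans (cong suc r₂) (sym (cong suc (ℕP.+-suc (dbl a) j)))))

  A-open : ∀ j u → A j u ≡ true → w (suc j) u ≡ false
  A-open j u e = not-true⇒false (λ h → let (h₁ , h₂) = W⁻ a (suc d) (suc j) u h in
    proj₂ (proj₂ (region⁻ (L j u) e)) (ℕP.≤∧≢⇒< (ℕ.s≤s⁻¹ (ℕ.s≤s⁻¹ h₁)) (λ { refl → not-odd u (a ℕ.+ d) (trans h₂ (trans (ℕP.+-suc (dbl a) (dbl d)) (cong suc (sym (dbl-+ a d))))) })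
      , trans h₂ (ℕP.+-suc (dbl a) j)))

  ins-clear : ∀ j u → B j u ≡ true → A j (suc u) ≡ true → ins j (suc u) ≡ []
  ins-clear j u eB eA = ins-empty j (suc u) (λ { (h , e) → go j h (ℕP.suc-injective e) eA eB })
    where
    go : ∀ j → j ℕ.< dbl d → u ≡ a ℕ.+ ⌊ j /2⌋ → A j (suc u) ≡ true → B j u ≡ true → ⊥
    go j h e eA eB with half j
    ... | m , inj₁ refl = proj₂ (proj₂ (region⁻ (R (dbl m) u) eB)) (h ,
            cong suc (trans (cong (λ x → x ℕ.+ x) (trans e (cong (a ℕ.+_) (⌊dbl/2⌋ m)))) (level≡ m)))
    ... | m , inj₂ refl = proj₂ (proj₂ (region⁻ (L (suc (dbl m)) (suc u)) eA)) (h ,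
            trans (cong (λ x → x ℕ.+ x) (trans (cong suc (trans e (cong (a ℕ.+_) (⌊suc-dbl/2⌋ m)))) (sym (ℕP.+-suc a m)))) (level-suc m))

  -- The removals can extend to the right side of the hexagon. Then the tip is an exit, and the
  -- carried row is the path of length 0.
  ins-last : ∀ j v → suc j ≡ N → ins j v ≡ one (hx N v ∧ not (A j v)) (f 0 (suc j) v)
  ins-last j v jN = go (hx N v ∧ not (A j v)) refl
    where
    jn : suc j ℕ.+ 0 ≡ N
    jn = trans (ℕP.+-identityʳ (suc j)) jN
    last : j ℕ.< dbl d → suc j ≡ dbl d
    last h = ℕP.≤-antisym h (subst (dbl d ℕ.≤_) (sym jN) dN)
    go : ∀ z → hx N v ∧ not (A j v) ≡ z → ins j v ≡ one z (f 0 (suc j) v)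
    go true e = let (h , nA) = ∧-true {hx N v} e
                    (r₁ , r₂) = A-no j v (ℕP.≤-reflexive jN) (not-true nA) (subst (λ i → hx i v ≡ true) (sym jN) h) in
      ins-at-tip j 0 v jn (last r₁) (tip-removed j v (last r₁) r₂)
    go false e = ins-empty j v (λ { (h , q) → true≢false (trans (sym (∧-intro (hexN (last h) q) (cong not (region-removed (L j v) (h , rem (last h) q))))) e) })
      where
      v≡ : suc j ≡ dbl d → v ≡ suc (a ℕ.+ ⌊ j /2⌋) → v ≡ a ℕ.+ d
      v≡ t q = trans q (proj₁ (proj₂ (tip-column j t)))
      hexN : suc j ≡ dbl d → v ≡ suc (a ℕ.+ ⌊ j /2⌋) → hx N v ≡ true
      hexN t q = trans (cong₂ hx (trans (sym jN) t) (v≡ t q)) (hx-line d ℕP.≤-refl)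
      rem : suc j ≡ dbl d → v ≡ suc (a ℕ.+ ⌊ j /2⌋) → v ℕ.+ v ≡ suc (dbl a) ℕ.+ j
      rem t q = trans (cong (λ x → x ℕ.+ x) (v≡ t q)) (trans (level≡ d) (proj₂ (proj₂ (tip-column j t))))

  -- The intrusion rises by one edge in every second column. The carried row then has to pass a
  -- position whose right triangle is removed, so no other row stands in its way.
  ins-step : ∀ j → suc j ℕ.< N → ∀ (x : ℕ → Bool) (g : ℕ → Fun) →
    gather (λ v → ins′ j v ++ one (B (suc j) v ∧ x v) (g v)) 0 U ≡ gather (λ v → ins (suc j) v ++ one (B (suc j) v ∧ x v) (g v)) 0 U
  ins-step j jN x g with suc j ℕ.<? dbl d
  ... | no ¬lt = gather-cong 0 U (λ v _ _ → cong (_++ one (B (suc j) v ∧ x v) (g v)) (trans (none v) (sym (ins-empty (suc j) v (¬lt ∘ proj₁)))))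
    where
    none : ∀ v → ins′ j v ≡ []
    none v with not (A j v) ∧ B (suc j) v in eq
    ... | true  = refl
    ... | false = ins-empty j v (λ { (h , q) → true≢false (trans (sym (both (ℕP.≤-antisym h (ℕP.≮⇒≥ ¬lt)) q)) eq) })
      where
      both : suc j ≡ dbl d → v ≡ suc (a ℕ.+ ⌊ j /2⌋) → not (A j v) ∧ B (suc j) v ≡ true
      both t q = ∧-intro (cong not (region-removed (L j v) (proj₁ (tip-column j t) , trans (cong (λ x → x ℕ.+ x) v≡) (trans (level≡ d) (proj₂ (proj₂ (tip-column j t)))))))
        (region⁺ (R (suc j) v) jN (trans (cong₂ hx t v≡) (hx-line d ℕP.≤-refl)) (λ r → ¬lt (proj₁ r)))
        where
        v≡ : v ≡ a ℕ.+ d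
        v≡ = trans q (proj₁ (proj₂ (tip-column j t)))
  ... | yes lt = trans (gather-cong 0 U (λ v _ _ → cong (_++ h v) (trans (same v) (cong (λ z → one (z ∧ (v ℕ.≡ᵇ suc (a ℕ.+ ⌊ j /2⌋))) tip) (<⇒<ᵇ-true (ℕP.<-trans (ℕP.n<1+n j) lt))))))
      (trans (move (half j)) (gather-cong 0 U (λ v _ _ → cong (λ z → one (z ∧ (v ℕ.≡ᵇ suc (a ℕ.+ ⌊ suc j /2⌋))) tip ++ h v) (sym (<⇒<ᵇ-true lt)))))
    where
    h : ℕ → List Fun
    h v = one (B (suc j) v ∧ x v) (g v)
    same : ∀ v → ins′ j v ≡ ins j v
    same v with not (A j v) ∧ B (suc j) v in eq
    ... | false = refl
    ... | true  = let (nA , eB) = ∧-true {not (A j v)} eq in ⊥-elim (ℕP.<-irrefl (proj₁ (A-no-B j v (not-true nA) eB)) lt)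
    move : (Σ ℕ λ m → j ≡ dbl m ⊎ j ≡ suc (dbl m)) → gather (λ v → one (v ℕ.≡ᵇ suc (a ℕ.+ ⌊ j /2⌋)) tip ++ h v) 0 U ≡ gather (λ v → one (v ℕ.≡ᵇ suc (a ℕ.+ ⌊ suc j /2⌋)) tip ++ h v) 0 U
    move (m , inj₁ e) = cong (λ i → gather (λ v → one (v ℕ.≡ᵇ suc (a ℕ.+ i)) tip ++ h v) 0 U)
      (trans (trans (cong ⌊_/2⌋ e) (⌊dbl/2⌋ m)) (sym (trans (cong (⌊_/2⌋ ∘ suc) e) (⌊suc-dbl/2⌋ m))))
    move (m , inj₂ e) = begin
      gather (λ v → one (v ℕ.≡ᵇ suc (a ℕ.+ ⌊ j /2⌋)) tip ++ h v) 0 U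
        ≡⟨ cong (λ i → gather (λ v → one (v ℕ.≡ᵇ i) tip ++ h v) 0 U) (trans (cong (λ i → suc (a ℕ.+ i)) (trans (cong ⌊_/2⌋ e) (⌊suc-dbl/2⌋ m))) (sym (ℕP.+-suc a m))) ⟩
      gather (λ v → one (v ℕ.≡ᵇ a ℕ.+ suc m) tip ++ h v) 0 U
        ≡⟨ gather-move tip h (a ℕ.+ suc m) 0 U gone ℕ.z≤n fits ⟩
      gather (λ v → one (v ℕ.≡ᵇ suc (a ℕ.+ suc m)) tip ++ h v) 0 U
        ≡⟨ cong (λ i → gather (λ v → one (v ℕ.≡ᵇ suc (a ℕ.+ i)) tip ++ h v) 0 U) (sym (trans (cong (⌊_/2⌋ ∘ suc) e) (⌊dbl/2⌋ (suc m)))) ⟩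
      gather (λ v → one (v ℕ.≡ᵇ suc (a ℕ.+ ⌊ suc j /2⌋)) tip ++ h v) 0 U ∎
      where
      open ≡-Reasoning
      j≡ : suc j ≡ dbl (suc m)
      j≡ = cong suc e
      gone : h (a ℕ.+ suc m) ≡ []
      gone = cong (λ z → one (z ∧ x (a ℕ.+ suc m)) (g (a ℕ.+ suc m))) (region-removed (R (suc j) (a ℕ.+ suc m))
        (lt , cong suc (trans (level≡ (suc m)) (cong (dbl a ℕ.+_) (sym j≡)))))
      fits : suc (a ℕ.+ suc m) ℕ.< U
      fits = ℕ.s≤s (ℕP.+-mono-≤-< a≤dbl (ℕP.<-≤-trans (dbl-< (subst (ℕ._< dbl d) j≡ lt)) d≤b))

  A-hex : ∀ j u → A j u ≡ true → hx (suc j) u ≡ true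
  A-hex j u e = proj₁ (proj₂ (region⁻ (L j u) e))

  A-wall : ∀ j u → suc j ℕ.≤ N → A j u ≡ false → hx (suc j) u ≡ true → w (suc j) u ≡ true
  A-wall j u jN e h = let (r₁ , r₂) = A-no j u jN e h in
    W⁺ a (suc d) (suc j) u (ℕ.s≤s (ℕP.m≤n⇒m≤1+n r₁)) (trans r₂ (sym (ℕP.+-suc (dbl a) j)))

  B-hex : ∀ j u → B j u ≡ true → hx j u ≡ true
  B-hex j u e = proj₁ (proj₂ (region⁻ (R j u) e))

  B-N : ∀ v → B N v ≡ false
  B-N v = not-true⇒false (λ e → ℕP.<-irrefl refl (proj₁ (region⁻ (R N v) e)))

  A⇒B : ∀ j u → suc j ℕ.< N → A j u ≡ true → B (suc j) u ≡ true
  A⇒B j u jN e = let (_ , h , nr) = region⁻ (L j u) e in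
    region⁺ (R (suc j) u) jN h (λ { (r₁ , r₂) → nr (ℕP.<-trans (ℕP.n<1+n j) r₁ , trans (ℕP.suc-injective r₂) (ℕP.+-suc (dbl a) j)) })

  ins-tip : ∀ j n u → suc j ℕ.+ n ≡ N → A j u ≡ false → B (suc j) u ≡ true → ins j u ≡ f n (suc j) u ∷ []
  ins-tip j n u jn eA eB = let (e₁ , e₂) = A-no-B j u eA eB in ins-at-tip j n u jn e₁ e₂

  open Induction A-hex A-open A-wall B-hex B-N A⇒B ins-clear ins-tip ins-last ins-step

  open Diagonal a using (YM; YT≡; Yv; Yv≡Yh)
  open Hats a using (Yh)
  open Intrusion a using (idx; YT)

  start : 0 ℕ.< N → ∀ i → i ℕ.< p → i ≢ a → B 0 i ≡ true
  start N>0 i h i≢a = region⁺ (R 0 i) N>0 (hexcol-intro p b c 0 i ℕ.z≤n (ℕP.<-≤-trans h (ℕP.m≤m+n p 0)) (ℕP.<-≤-trans h (ℕP.m≤m+n p b)))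
    (λ { (_ , e) → i≢a (dbl-inj i a (trans (ℕP.suc-injective e) (ℕP.+-identityʳ _))) })

  start⁻ : ∀ i → B 0 i ≡ true → i ℕ.< p
  start⁻ i e = subst (i ℕ.<_) (ℕP.+-identityʳ p) (hexcol-left 0 i (proj₁ (proj₂ (region⁻ (R 0 i) e))))

  F : ℕ → Fun
  F = f N 0

  starts : ∀ g → (∀ i → i ≢ a → i ℕ.< p → g i ≡ F i ∷ []) → g a ≡ tip ∷ [] → (∀ i → p ℕ.≤ i → g i ≡ []) →
    gather g 0 U ≡ map F (range 0 a) ++ tip ∷ map F (range (suc a) a)
  starts g h₁ h₂ h₃ = begin
    gather g 0 U
      ≡⟨ cong (gather g 0) (trans (cong (λ x → suc x ℕ.+ b) (dbl≡+ a)) (trans (cong suc (ℕP.+-assoc a a b)) (sym (ℕP.+-suc a (a ℕ.+ b))))) ⟩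
    gather g 0 (a ℕ.+ suc (a ℕ.+ b))
      ≡⟨ trans (gather-+ g 0 a (suc (a ℕ.+ b))) (cong (λ l → gather g 0 a ++ g a ++ l) (gather-+ g (suc a) a b)) ⟩
    gather g 0 a ++ g a ++ gather g (suc a) a ++ gather g (suc (a ℕ.+ a)) b
      ≡⟨ cong₂ _++_ (gather-map F 0 a (λ i _ h → h₁ i (λ { refl → ℕP.<-irrefl refl h }) (ℕP.m<n⇒m<1+n (ℕP.<-≤-trans h a≤dbl))))
          (cong₂ _++_ h₂ (trans (cong₂ _++_ (gather-map F (suc a) a (λ i h h′ → h₁ i (λ { refl → ℕP.<-irrefl refl h }) (subst (i ℕ.<_) (cong suc (sym (dbl≡+ a))) h′)))
             (gather-[] (suc (a ℕ.+ a)) b (λ i h _ → h₃ i (subst (ℕ._≤ i) (cong suc (sym (dbl≡+ a))) h)))) (LP.++-identityʳ _))) ⟩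
    map F (range 0 a) ++ tip ∷ map F (range (suc a) a) ∎
    where open ≡-Reasoning

  -- With d = 0 the tip row is the ordinary path from height a. With d > 0 that start is removed and
  -- the carried row is emitted at position a + 1; in both cases it stands between the a lower and
  -- the a upper paths.
  states : 0 ℕ.< N → gather (λ i → ins 0 i ++ one (B 0 i) (F i)) 0 U ≡ map F (range 0 a) ++ tip ∷ map F (range (suc a) a)
  states N>0 with d ℕ.≟ 0
  ... | yes d0 = starts (λ i → ins 0 i ++ one (B 0 i) (F i))
      (λ i i≢a h → trans (cong (_++ one (B 0 i) (F i)) (none i)) (cong (λ z → one z (F i)) (start N>0 i h i≢a)))
      (trans (cong (_++ one (B 0 a) (F a)) (none a)) (trans (cong (λ z → one z (F a)) present) (cong (_∷ []) F≡tip)))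
      (λ i h → trans (cong (_++ one (B 0 i) (F i)) (none i)) (cong (λ z → one z (F i)) (not-true⇒false (λ e → ℕP.<-irrefl refl (ℕP.<-≤-trans (start⁻ i e) h)))))
    where
    none : ∀ i → ins 0 i ≡ []
    none i = ins-empty 0 i (λ { (h , _) → ℕP.<-irrefl refl (subst (λ d → 0 ℕ.< dbl d) d0 h) })
    present : B 0 a ≡ true
    present = region⁺ (R 0 a) N>0 (subst (λ n → hx 0 n ≡ true) (ℕP.+-identityʳ a) (hx-line 0 ℕ.z≤n)) (λ { (h , _) → ℕP.<-irrefl refl (subst (λ d → 0 ℕ.< dbl d) d0 h) })
    F≡tip : F a ≡ tip
    F≡tip = sym (trans (cong (λ d′ → λ k → pc w (N ∸ dbl d′) (dbl d′) (a ℕ.+ d′) k) d0) (cong (λ i → λ k → pc w N 0 i k) (ℕP.+-identityʳ a)))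
  ... | no d≢0 = trans (gather-cong 0 U (λ i _ _ → cong (_++ h i) (cong₂ (λ z n → one (z ∧ (i ℕ.≡ᵇ suc n)) tip) (<⇒<ᵇ-true d>0) (ℕP.+-identityʳ a))))
      (trans (sym (gather-move tip h a 0 U gone ℕ.z≤n (ℕ.s≤s (subst (ℕ._≤ dbl a ℕ.+ b) (ℕP.+-comm a 1) (ℕP.+-mono-≤ a≤dbl (ℕP.≤-trans (ℕP.n≢0⇒n>0 d≢0) d≤b))))))
        (starts (λ i → one (i ℕ.≡ᵇ a) tip ++ h i)
          (λ i i≢a lt → cong₂ (λ z z′ → one z tip ++ one z′ (F i)) (≡ᵇ-false i≢a) (start N>0 i lt i≢a))
          (cong₂ (λ z l → one z tip ++ l) (≡ᵇ-refl a) gone)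
          (λ i le → cong₂ (λ z z′ → one z tip ++ one z′ (F i)) (≡ᵇ-false {i} {a} (λ { refl → ℕP.<-irrefl refl (ℕP.≤-trans le a≤dbl) }))
            (not-true⇒false (λ e → ℕP.<-irrefl refl (ℕP.<-≤-trans (start⁻ i e) le))))))
    where
    d>0 : 0 ℕ.< dbl d
    d>0 = ℕP.≤-trans (ℕ.s≤s ℕ.z≤n) (dbl-mono (ℕP.n≢0⇒n>0 d≢0))
    h : ℕ → List Fun
    h i = one (B 0 i) (F i)
    gone : h a ≡ []
    gone = cong (λ z → one z (F a)) (region-removed (R 0 a) (d>0 , cong suc (trans (sym (dbl≡+ a)) (sym (ℕP.+-identityʳ _)))))

  N≡ : N ≡ (u ℕ.+ v) ℕ.+ dbl d
  N≡ = trans (lem d u v) (cong ((u ℕ.+ v) ℕ.+_) (sym (dbl≡+ d)))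
    where
    lem : ∀ d u v → (d ℕ.+ u) ℕ.+ (d ℕ.+ v) ≡ (u ℕ.+ v) ℕ.+ (d ℕ.+ d)
    lem = solve-∀ ℕ-ring

  det-YT : D (map F (range 0 a) ++ tip ∷ map F (range (suc a) a)) ≡ sgn a * YT d (u ℕ.+ v) b
  det-YT = begin
    D (map F (range 0 a) ++ tip ∷ map F (range (suc a) a))
      ≡⟨ det-move (λ g k → g k) (map F (range 0 a)) tip (map F (range (suc a) a)) K ⟩
    sgn (length (map F (range 0 a))) * D (tip ∷ map F (range 0 a) ++ map F (range (suc a) a))
      ≡⟨ cong₂ (λ n L → sgn n * D (tip ∷ L)) (trans (LP.length-map F (range 0 a)) (length-range 0 a)) (sym (LP.map-++ F (range 0 a) (range (suc a) a))) ⟩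
    sgn a * D (tip ∷ map F idx)
      ≡⟨ *-congˡ (begin
          D (tip ∷ map F idx)
            ≡⟨ cong₂ (λ L L′ → det (λ g k → g k) (tip ∷ L) L′) (LP.map-∘ idx) (sym (LP.map-id K)) ⟩
          det (λ g k → g k) (map G′ (nothing ∷ map just idx)) (map id K)
            ≡⟨ det-map (λ g k → g k) G′ id (nothing ∷ map just idx) K ⟩
          det G′ (nothing ∷ map just idx) K
            ≡⟨ det-congP {m = G′} {m′ = YM d (u ℕ.+ v)} ok (_∈ K) (λ { nothing k _ _ → tip≡ k ; (just i) k i≢a _ → F≡ i k i≢a }) {nothing ∷ map just idx} {K} all-ok (All.tabulate id) ⟩
          det (YM d (u ℕ.+ v)) (nothing ∷ map just idx) K
            ≡⟨ sym (YT≡ d (u ℕ.+ v) b) ⟩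
          YT d (u ℕ.+ v) b ∎) ⟩
    sgn a * YT d (u ℕ.+ v) b ∎
    where
    open ≡-Reasoning
    G′ : Maybe ℕ → Fun
    G′ nothing  = tip
    G′ (just i) = F i
    ok : Maybe ℕ → Set
    ok nothing  = ℕ
    ok (just i) = i ≢ a
    ne : ∀ {i} → i ∈ idx → i ≢ a
    ne p refl with MemP.∈-++⁻ (range 0 a) p
    ... | inj₁ q = ℕP.<-irrefl refl (proj₂ (∈-range 0 a q))
    ... | inj₂ q = ℕP.<-irrefl refl (proj₁ (∈-range (suc a) a q))
    all-ok : All ok (nothing ∷ map just idx)
    all-ok = 0 ∷ AllP.map⁺ (All.tabulate ne)
    tip≡ : ∀ k → tip k ≡ YM d (u ℕ.+ v) nothing k
    tip≡ k = trans (pc-cong w noWall (N ∸ dbl d) (dbl d) (a ℕ.+ d) k (λ i x → W-clear′ a d i x))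
      (trans (pc-free noWall (N ∸ dbl d) (dbl d) (a ℕ.+ d) k (λ _ _ → refl))
        (cong₂ (λ n i → pc noWall n 0 i k) (trans (cong (_∸ dbl d) N≡) (ℕP.m+n∸n≡m (u ℕ.+ v) (dbl d))) (ℕP.+-comm a d)))
    F≡ : ∀ i k → i ≢ a → F i k ≡ YM d (u ℕ.+ v) (just i) k
    F≡ i k i≢a = trans (cong (λ n → pc w n 0 i k) N≡) (sym (cong (λ z → if z then 0ℚ else pc w ((u ℕ.+ v) ℕ.+ dbl d) 0 i k) (≡ᵇ-false i≢a)))

  empty : N ≡ 0 → nat (cnt (strips U 0 N) region) ≡ sgn a * YT d (u ℕ.+ v) b
  empty e = trans (cong (λ n → nat (cnt (strips U 0 n) region)) e) (trans nat-1 (sym (begin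
    sgn a * Yv d u v     ≡⟨ *-congˡ (Yv≡Yh d u v) ⟩
    sgn a * Yh d u v     ≡⟨ cong₂ (λ d u → sgn a * Yh d u v) (ℕP.m+n≡0⇒m≡0 d b0) (ℕP.m+n≡0⇒n≡0 d b0) ⟩
    sgn a * (sgn a * MM p 0 v)  ≡⟨ *-congˡ (*-congˡ (MM-0 p v)) ⟩
    sgn a * (sgn a * 1ℚ) ≡⟨ trans (sym (*-assoc _ _ _)) (trans (*-congʳ (sgn² a)) (*-identityˡ 1ℚ)) ⟩
    1ℚ                   ∎)))
    where
    open ≡-Reasoning
    b0 : b ≡ 0
    b0 = ℕP.m+n≡0⇒m≡0 b e

  M-odd : nat (M (HexD p b c d)) ≡ sgn a * Yh d u v
  M-odd = trans (cong nat M-region) (trans (go (N ℕ.≟ 0) count-all) (*-congˡ (Yv≡Yh d u v)))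
    where
    go : Dec (N ≡ 0) → nat (cnt (strips U 0 N) region) ≡ D (gather (λ i → ins 0 i ++ one (B 0 i) (F i)) 0 U) ⊎ N ≡ 0 →
      nat (cnt (strips U 0 N) region) ≡ sgn a * YT d (u ℕ.+ v) b
    go _        (inj₂ e) = empty e
    go (yes e)  (inj₁ _) = empty e
    go (no N≢0) (inj₁ e) = trans e (trans (cong D (states (ℕP.n≢0⇒n>0 N≢0))) det-YT)

-- Shifted factorials and the duplication formula

opaque
  unfolding nat

  ℚ*≡ : ∀ x y → x ℚ.* y ≡ x * y
  ℚ*≡ x y = refl

  sub-add : ∀ x → (x ℚ.+ 1ℚ) ℚ.- 1ℚ ≡ x
  sub-add x = trans (ℚP.+-assoc x 1ℚ (ℚ.- 1ℚ)) (ℚP.+-identityʳ x)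

-- P plays the gamma function along the arithmetic progression x, so that integers and half-integers
-- are treated at once.
module Progression (x P : ℕ → ℚ) (x-suc : ∀ n → x (suc n) ≡ x n ℚ.+ 1ℚ) (P-suc : ∀ n → P (suc n) ≡ P n * x n) (NZ-P : ∀ n → NZ (P n)) where

  rising : ∀ k n → risingℕ (x n) k * P n ≡ P (k ℕ.+ n)
  rising zero    n = *-identityˡ (P n)
  rising (suc k) n = begin
    (x n ℚ.* risingℕ (x n ℚ.+ 1ℚ) k) * P n   ≡⟨ *-congʳ (trans (ℚ*≡ _ _) (cong (λ y → x n * risingℕ y k) (sym (x-suc n)))) ⟩
    (x n * risingℕ (x (suc n)) k) * P n      ≡⟨ trans (*-congʳ (*-comm _ _)) (trans (*-assoc _ _ _) (*-congˡ (*-comm _ _))) ⟩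
    risingℕ (x (suc n)) k * (P n * x n)      ≡⟨ *-congˡ (sym (P-suc n)) ⟩
    risingℕ (x (suc n)) k * P (suc n)        ≡⟨ rising k (suc n) ⟩
    P (k ℕ.+ suc n)                          ≡⟨ cong P (ℕP.+-suc k n) ⟩
    P (suc k ℕ.+ n)                          ∎
    where open ≡-Reasoning

  falling : ∀ k r → fallingBelow (x (k ℕ.+ r)) k * P r ≡ P (k ℕ.+ r)
  falling zero    r = *-identityˡ (P r)
  falling (suc k) r = begin
    ((x (suc k ℕ.+ r) ℚ.- 1ℚ) ℚ.* fallingBelow (x (suc k ℕ.+ r) ℚ.- 1ℚ) k) * P r
      ≡⟨ *-congʳ (trans (ℚ*≡ _ _) (cong (λ y → y * fallingBelow y k) (trans (cong (ℚ._- 1ℚ) (x-suc (k ℕ.+ r))) (sub-add _)))) ⟩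
    (x (k ℕ.+ r) * fallingBelow (x (k ℕ.+ r)) k) * P r
      ≡⟨ trans (*-assoc _ _ _) (*-congˡ (falling k r)) ⟩
    x (k ℕ.+ r) * P (k ℕ.+ r)
      ≡⟨ trans (*-comm _ _) (sym (P-suc (k ℕ.+ r))) ⟩
    P (suc k ℕ.+ r) ∎
    where open ≡-Reasoning

  -- The extended shifted factorial is a quotient of gamma values for either sign of z; this is what
  -- its definition for negative n is made for.
  poch-ratio : ∀ n r z → + n ℤ.+ z ≡ + r → poch (x n) z ≡ P r * inv (P n)
  poch-ratio n r (+ k) e = begin
    risingℕ (x n) k                        ≡⟨ sym (trans (*-congˡ (inv-*ʳ (P n) (NZ-P n))) (trans (*-comm _ 1ℚ) (*-identityˡ _))) ⟩
    risingℕ (x n) k * (P n * inv (P n))    ≡⟨ sym (*-assoc _ _ _) ⟩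
    (risingℕ (x n) k * P n) * inv (P n)    ≡⟨ *-congʳ (trans (rising k n) (cong P (trans (ℕP.+-comm k n) (ℤP.+-injective e)))) ⟩
    P r * inv (P n)                        ∎
    where open ≡-Reasoning
  poch-ratio n r ℤ.-[1+ k ] e = *-cancelˡ F NZ-F (begin
    F * inv F               ≡⟨ inv-*ʳ F NZ-F ⟩
    1ℚ                      ≡⟨ sym (inv-*ʳ (P n) (NZ-P n)) ⟩
    P n * inv (P n)         ≡⟨ *-congʳ (sym fall) ⟩
    (F * P r) * inv (P n)   ≡⟨ *-assoc _ _ _ ⟩
    F * (P r * inv (P n))   ∎)
    where
    open ≡-Reasoning
    F : ℚ
    F = fallingBelow (x n) (suc k)
    lem : ∀ n k → n ≡ k ℤ.+ (n ℤ.+ ℤ.- k)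
    lem = solve-∀ ℤ-ring
    n≡ : n ≡ suc k ℕ.+ r
    n≡ = ℤP.+-injective (trans (lem (+ n) (+ suc k)) (cong (λ z → (+ suc k) ℤ.+ z) e))
    fall : F * P r ≡ P n
    fall = trans (cong (λ m → fallingBelow (x m) (suc k) * P r) n≡) (trans (falling (suc k) r) (cong P (sym n≡)))
    NZ-F : NZ F
    NZ-F f0 = NZ-P n (trans (sym fall) (zero* f0))

-- The quotient of gamma values Γ(n + ½) / Γ(½).
hf ihf : ℕ → ℚ
hf zero    = 1ℚ
hf (suc n) = hf n * (nat n + ½)
ihf n = inv (hf n)

pow2 : ℕ → ℚ
pow2 zero    = 1ℚ
pow2 (suc n) = nat 2 * pow2 n

opaque
  unfolding nat

  ½+½ : ½ + ½ ≡ 1ℚ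
  ½+½ = refl

  half-arg : ∀ n → fromℕ n ℚ.+ ½ ≡ nat n + ½
  half-arg n = refl

  fromℕ≡nat : ∀ n → fromℕ n ≡ nat n
  fromℕ≡nat n = refl

  fromℕ-suc : ∀ n → fromℕ (suc n) ≡ fromℕ n ℚ.+ 1ℚ
  fromℕ-suc n = trans (nat-suc n) (+-comm 1ℚ (nat n))

  half-suc : ∀ n → fromℕ (suc n) ℚ.+ ½ ≡ (fromℕ n ℚ.+ ½) ℚ.+ 1ℚ
  half-suc n = trans (+-congʳ (nat-suc n)) (lem (nat n) ½)
    where
    lem : ∀ n h → (1ℚ + n) + h ≡ (n + h) + 1ℚ
    lem = solve-∀ ℚ-ring

  half-pred : ∀ n → fromℕ (suc n) ℚ.- ½ ≡ fromℕ n ℚ.+ ½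
  half-pred n = trans (cong (ℚ._- ½) (nat-suc n)) (trans (cong (λ z → (z ℚ.+ nat n) ℚ.- ½) (sym ½+½)) (lem (nat n) ½))
    where
    lem : ∀ n h → ((h + h) + n) - h ≡ n + h
    lem = solve-∀ ℚ-ring

  double-half : ∀ x h → (1ℚ + 1ℚ) * (x + h) ≡ (h + h) + (x + x)
  double-half = solve-∀ ℚ-ring

nat-2 : nat 2 ≡ 1ℚ + 1ℚ
nat-2 = trans (nat-+ 1 1) (cong₂ _+_ nat-1 nat-1)

two-half : ∀ n → nat 2 * (nat n + ½) ≡ nat (suc (dbl n))
two-half n = trans (*-congʳ nat-2) (trans (double-half (nat n) ½) (trans (cong₂ _+_ ½+½ (sym (nat-dbl n))) (sym (nat-suc (dbl n)))))

two-suc : ∀ n → nat 2 * nat (suc n) ≡ nat (suc (suc (dbl n)))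
two-suc n = trans (sym (nat-* 2 (suc n))) (cong nat (trans (lem n) (cong (suc ∘ suc) (sym (dbl≡+ n)))))
  where
  lem : ∀ n → 2 ℕ.* suc n ≡ suc (suc (n ℕ.+ n))
  lem = solve-∀ ℕ-ring

NZ-half : ∀ n → NZ (nat n + ½)
NZ-half n e = NZ-nat (dbl n) (trans (sym (two-half n)) (trans (*-congˡ e) (*-zeroʳ _)))

NZ-hf : ∀ n → NZ (hf n)
NZ-hf zero    = 1≢0
NZ-hf (suc n) = NZ-* (NZ-hf n) (NZ-half n)

hf-ihf : ∀ n → hf n * ihf n ≡ 1ℚ
hf-ihf n = inv-*ʳ (hf n) (NZ-hf n)

NZ-pow2 : ∀ n → NZ (pow2 n)
NZ-pow2 zero    = 1≢0
NZ-pow2 (suc n) = NZ-* (NZ-nat 1) (NZ-pow2 n)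

pow2-+ : ∀ m n → pow2 (m ℕ.+ n) ≡ pow2 m * pow2 n
pow2-+ zero    n = sym (*-identityˡ _)
pow2-+ (suc m) n = trans (*-congˡ (pow2-+ m n)) (sym (*-assoc _ _ _))

opaque
  unfolding ℚ-ring

  dup-odd : ∀ h x f t p → ((h * x) * f) * (t * p) ≡ (t * x) * ((h * f) * p)
  dup-odd = solve-∀ ℚ-ring

  dup-even : ∀ h x y f t p → ((h * x) * (y * f)) * (t * (t * p)) ≡ (t * y) * ((t * x) * ((h * f) * p))
  dup-even = solve-∀ ℚ-ring

-- The duplication formula of the gamma function.
dup₀ : ∀ n → (hf n * fac n) * pow2 (dbl n) ≡ fac (dbl n)
dup₀ zero    = trans (*-congʳ (*-identityˡ _)) (*-identityˡ _)
dup₀ (suc n) = trans (dup-even (hf n) (nat n + ½) (nat (suc n)) (fac n) (nat 2) (pow2 (dbl n)))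
  (cong₂ _*_ (two-suc n) (cong₂ _*_ (two-half n) (dup₀ n)))

dup₁ : ∀ n → (hf (suc n) * fac n) * pow2 (suc (dbl n)) ≡ fac (suc (dbl n))
dup₁ n = trans (dup-odd (hf n) (nat n + ½) (fac n) (nat 2) (pow2 (dbl n))) (cong₂ _*_ (two-half n) (dup₀ n))

Near : ℕ → ℕ → Set
Near x r = r ≡ x ⊎ r ≡ suc x

dupE : ∀ {u v m r} → v ≡ r ℕ.+ m → Near (u ℕ.+ m) r → (hf (suc (u ℕ.+ m)) * fac r) * pow2 (suc (u ℕ.+ v)) ≡ fac (suc (u ℕ.+ v))
dupE {u} {m = m} refl (inj₁ refl) = trans (cong (λ n → (hf (suc (u ℕ.+ m)) * fac (u ℕ.+ m)) * pow2 (suc n)) e) (trans (dup₁ (u ℕ.+ m)) (cong (fac ∘ suc) (sym e)))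
  where
  lem : ∀ u m → u ℕ.+ ((u ℕ.+ m) ℕ.+ m) ≡ (u ℕ.+ m) ℕ.+ (u ℕ.+ m)
  lem = solve-∀ ℕ-ring
  e : u ℕ.+ ((u ℕ.+ m) ℕ.+ m) ≡ dbl (u ℕ.+ m)
  e = trans (lem u m) (sym (dbl≡+ (u ℕ.+ m)))
dupE {u} {m = m} refl (inj₂ refl) = trans (cong (λ n → (hf (suc (u ℕ.+ m)) * fac (suc (u ℕ.+ m))) * pow2 n) e) (trans (dup₀ (suc (u ℕ.+ m))) (cong fac (sym e)))
  where
  lem : ∀ u m → suc (u ℕ.+ (suc (u ℕ.+ m) ℕ.+ m)) ≡ suc (u ℕ.+ m) ℕ.+ suc (u ℕ.+ m)
  lem = solve-∀ ℕ-ring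
  e : suc (u ℕ.+ (suc (u ℕ.+ m) ℕ.+ m)) ≡ dbl (suc (u ℕ.+ m))
  e = trans (lem u m) (sym (dbl≡+ (suc (u ℕ.+ m))))

-- With m the rounded-down half of v - u, the numbers u + m and r = v - m are equal or consecutive.
-- The two gamma arguments then differ by ½ in one direction or the other, so the duplication
-- formula holds for both parities. The same holds for `dupE`.
dupO : ∀ {u v m r} → v ≡ r ℕ.+ m → Near (u ℕ.+ m) r → (hf r * fac (u ℕ.+ m)) * pow2 (u ℕ.+ v) ≡ fac (u ℕ.+ v)
dupO {u} {m = m} refl (inj₁ refl) = trans (cong (λ n → (hf (u ℕ.+ m) * fac (u ℕ.+ m)) * pow2 n) e) (trans (dup₀ (u ℕ.+ m)) (cong fac (sym e)))
  where
  lem : ∀ u m → u ℕ.+ ((u ℕ.+ m) ℕ.+ m) ≡ (u ℕ.+ m) ℕ.+ (u ℕ.+ m)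
  lem = solve-∀ ℕ-ring
  e : u ℕ.+ ((u ℕ.+ m) ℕ.+ m) ≡ dbl (u ℕ.+ m)
  e = trans (lem u m) (sym (dbl≡+ (u ℕ.+ m)))
dupO {u} {m = m} refl (inj₂ refl) = trans (cong (λ n → (hf (suc (u ℕ.+ m)) * fac (u ℕ.+ m)) * pow2 n) e) (trans (dup₁ (u ℕ.+ m)) (cong fac (sym e)))
  where
  lem : ∀ u m → u ℕ.+ (suc (u ℕ.+ m) ℕ.+ m) ≡ suc ((u ℕ.+ m) ℕ.+ (u ℕ.+ m))
  lem = solve-∀ ℕ-ring
  e : u ℕ.+ (suc (u ℕ.+ m) ℕ.+ m) ≡ suc (dbl (u ℕ.+ m))
  e = trans (lem u m) (cong suc (sym (dbl≡+ (u ℕ.+ m))))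

/2-suc : ∀ n → suc (suc n) ℕ./ 2 ≡ suc (n ℕ./ 2)
/2-suc n = ℕD.m/n≡1+[m∸n]/n {suc (suc n)} {2} (ℕ.s≤s (ℕ.s≤s ℕ.z≤n))

dbl/2 : ∀ m → dbl m ℕ./ 2 ≡ m
dbl/2 zero    = refl
dbl/2 (suc m) = trans (/2-suc (dbl m)) (cong suc (dbl/2 m))

suc-dbl/2 : ∀ m → suc (dbl m) ℕ./ 2 ≡ m
suc-dbl/2 zero    = refl
suc-dbl/2 (suc m) = trans (/2-suc (suc (dbl m))) (cong suc (suc-dbl/2 m))

midpoint : ∀ u v → u ℕ.≤ v → Σ ℕ λ r → v ≡ r ℕ.+ (v ∸ u) ℕ./ 2 × Near (u ℕ.+ (v ∸ u) ℕ./ 2) r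
midpoint u v h with half (v ∸ u)
... | m , inj₁ e rewrite trans (cong (ℕ._/ 2) e) (dbl/2 m) = u ℕ.+ m , trans v≡ (trans (cong (u ℕ.+_) (dbl≡+ m)) (sym (ℕP.+-assoc u m m))) , inj₁ refl
  where
  v≡ : v ≡ u ℕ.+ dbl m
  v≡ = trans (sym (ℕP.m+[n∸m]≡n h)) (cong (u ℕ.+_) e)
... | m , inj₂ e rewrite trans (cong (ℕ._/ 2) e) (suc-dbl/2 m) = suc (u ℕ.+ m) , trans v≡ (trans (ℕP.+-suc u (dbl m)) (cong suc (trans (cong (u ℕ.+_) (dbl≡+ m)) (sym (ℕP.+-assoc u m m))))) , inj₂ refl
  where
  v≡ : v ≡ u ℕ.+ suc (dbl m)
  v≡ = trans (sym (ℕP.m+[n∸m]≡n h)) (cong (u ℕ.+_) e)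

opaque
  unfolding ℚ-ring

  regroup-num : ∀ X ih F iA S₁ iX S₂ iZ → (((X * ih) * (F * iA)) * (S₁ * iX)) * (S₂ * iZ) ≡ (X * iX) * ((iA * ih) * ((iZ * F) * (S₁ * S₂)))
  regroup-num = solve-∀ ℚ-ring

  regroup-den : ∀ Y ihak Fu ik S₁ iY S₂ iav → (((Y * ihak) * (Fu * ik)) * (S₁ * iY)) * (S₂ * iav) ≡ (Y * iY) * ((ihak * ik) * ((Fu * iav) * (S₁ * S₂)))
  regroup-den = solve-∀ ℚ-ring

  regroup-hat₁ : ∀ P hak iA Fk ih ihak ik → ((P * (hak * iA)) * (Fk * ih)) * (ihak * ik) ≡ ((hak * ihak) * (Fk * ik)) * (P * (iA * ih))
  regroup-hat₁ = solve-∀ ℚ-ring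

  regroup-hat₂ : ∀ S iu iZ F Fav iS Fu iav Q → ((S * (iu * iZ)) * ((F * Fav) * iS)) * ((Fu * iav) * Q) ≡ ((Fu * iu) * (Fav * iav)) * ((S * (Q * iS)) * (iZ * F))
  regroup-hat₂ = solve-∀ ℚ-ring

  interchange : ∀ x y z w → (x * y) * (z * w) ≡ (x * z) * (y * w)
  interchange = solve-∀ ℚ-ring

  regroup-hat₃ : ∀ P w S T Q iS z → (P * w) * (((S * T) * (Q * iS)) * z) ≡ ((Q * (T * P)) * iS) * (w * (z * S))
  regroup-hat₃ = solve-∀ ℚ-ring

one-* : ∀ {x y} → x ≡ 1ℚ → x * y ≡ y
one-* refl = *-identityˡ _

ones : ∀ {x y} → x ≡ 1ℚ → y ≡ 1ℚ → x * y ≡ 1ℚ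
ones p q = trans (one-* p) q

-- Both factors of the product formula have this shape.
factor : ∀ {X iX Y iY hak ihak Fk ik Fu iu Fav iav S₁ S₂ T S S₁′ S₂′ P S′ iS′} ih F iA iZ →
  X * iX ≡ 1ℚ → Y * iY ≡ 1ℚ → hak * ihak ≡ 1ℚ → Fk * ik ≡ 1ℚ → Fu * iu ≡ 1ℚ → Fav * iav ≡ 1ℚ →
  (S₁ * S₂) * T ≡ S → (S₁′ * S₂′) * (T * P) ≡ S′ → S′ * iS′ ≡ 1ℚ →
  (((X * ih) * (F * iA)) * (S₁ * iX)) * (S₂ * iZ) ≡
  (((P * (hak * iA)) * (Fk * ih)) * ((S * (iu * iZ)) * ((F * Fav) * iS′))) * ((((Y * ihak) * (Fu * ik)) * (S₁′ * iY)) * (S₂′ * iav))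
factor {X} {iX} {Y} {iY} {hak} {ihak} {Fk} {ik} {Fu} {iu} {Fav} {iav} {S₁} {S₂} {T} {S} {S₁′} {S₂′} {P} {S′} {iS′} ih F iA iZ hX hY hh hk hu ha refl refl hS = begin
  (((X * ih) * (F * iA)) * (S₁ * iX)) * (S₂ * iZ)
    ≡⟨ trans (regroup-num X ih F iA S₁ iX S₂ iZ) (one-* hX) ⟩
  (iA * ih) * ((iZ * F) * (S₁ * S₂))
    ≡⟨ sym (begin
        (((P * (hak * iA)) * (Fk * ih)) * ((((S₁ * S₂) * T) * (iu * iZ)) * ((F * Fav) * iS′))) * ((ihak * ik) * ((Fu * iav) * (S₁′ * S₂′)))
          ≡⟨ interchange _ _ _ _ ⟩
        (((P * (hak * iA)) * (Fk * ih)) * (ihak * ik)) * (((((S₁ * S₂) * T) * (iu * iZ)) * ((F * Fav) * iS′)) * ((Fu * iav) * (S₁′ * S₂′)))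
          ≡⟨ cong₂ _*_ (trans (regroup-hat₁ P hak iA Fk ih ihak ik) (one-* (ones hh hk)))
                       (trans (regroup-hat₂ ((S₁ * S₂) * T) iu iZ F Fav iS′ Fu iav (S₁′ * S₂′)) (one-* (ones hu ha))) ⟩
        (P * (iA * ih)) * ((((S₁ * S₂) * T) * ((S₁′ * S₂′) * iS′)) * (iZ * F))
          ≡⟨ trans (regroup-hat₃ P (iA * ih) (S₁ * S₂) T (S₁′ * S₂′) iS′ (iZ * F)) (one-* hS) ⟩
        (iA * ih) * ((iZ * F) * (S₁ * S₂)) ∎) ⟩
  (((P * (hak * iA)) * (Fk * ih)) * ((((S₁ * S₂) * T) * (iu * iZ)) * ((F * Fav) * iS′))) * ((ihak * ik) * ((Fu * iav) * (S₁′ * S₂′)))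
    ≡⟨ *-congˡ (sym (trans (regroup-den Y ihak Fu ik S₁′ iY S₂′ iav) (one-* hY))) ⟩
  (((P * (hak * iA)) * (Fk * ih)) * ((((S₁ * S₂) * T) * (iu * iZ)) * ((F * Fav) * iS′))) * ((((Y * ihak) * (Fu * ik)) * (S₁′ * iY)) * (S₂′ * iav)) ∎
  where open ≡-Reasoning

div-cancel : ∀ {x y z} → NZ z → x ≡ y * z → x * inv z ≡ y
div-cancel {y = y} {z} nz refl = trans (*-assoc _ _ _) (trans (*-congˡ (inv-*ʳ z nz)) (trans (*-comm _ 1ℚ) (*-identityˡ _)))

NZ-ihf : ∀ n → NZ (ihf n)
NZ-ihf n = NZ-unit (hf-ihf n)

inv-unique : ∀ {x y z} → NZ x → x * y ≡ 1ℚ → x * z ≡ 1ℚ → y ≡ z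
inv-unique {x} nx p q = *-cancelˡ x nx (trans p (sym q))

module Nat = Progression (λ n → fromℕ (suc n)) fac (λ n → fromℕ-suc (suc n)) (λ n → trans (*-comm _ _) (*-congˡ (sym (fromℕ≡nat (suc n))))) NZ-fac
module Half = Progression (λ n → fromℕ n ℚ.+ ½) hf half-suc (λ n → *-congˡ (sym (half-arg n))) NZ-hf

exp₁ : ∀ n b s r → n ℕ.+ b ≡ r ℕ.+ s → + n ℤ.+ (+ b ℤ.- + s) ≡ + r
exp₁ n b s r e = trans (lem (+ n) (+ b) (+ s)) (trans (cong (λ x → + x ℤ.- + s) e) (lem₂ (+ r) (+ s)))
  where
  lem : ∀ n b s → n ℤ.+ (b ℤ.- s) ≡ (n ℤ.+ b) ℤ.- s
  lem = solve-∀ ℤ-ring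
  lem₂ : ∀ r s → (r ℤ.+ s) ℤ.- s ≡ r
  lem₂ = solve-∀ ℤ-ring

exp₂ : ∀ n b s t r → n ℕ.+ b ≡ r ℕ.+ (s ℕ.+ t) → + n ℤ.+ (+ b ℤ.- + s ℤ.- + t) ≡ + r
exp₂ n b s t r e = trans (cong (λ z → (+ n) ℤ.+ z) (lem (+ b) (+ s) (+ t))) (exp₁ n b (s ℕ.+ t) r e)
  where
  lem : ∀ b s t → (b ℤ.- s) ℤ.- t ≡ b ℤ.- (s ℤ.+ t)
  lem = solve-∀ ℤ-ring

exp₃ : ∀ n m r → n ≡ r ℕ.+ m → + n ℤ.+ (ℤ.- (+ m)) ≡ + r
exp₃ n m r e = trans (cong (λ x → (+ x) ℤ.+ (ℤ.- (+ m))) e) (lem (+ r) (+ m))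
  where
  lem : ∀ r m → (r ℤ.+ m) ℤ.+ (ℤ.- m) ≡ r
  lem = solve-∀ ℤ-ring

opaque
  unfolding nat

  quot : ∀ p₁ p₂ p₃ p₄ p₅ p₆ p₇ p₈ → (p₁ ℚ.* p₂ ℚ.* p₃ ℚ.* p₄) ÷' (p₅ ℚ.* p₆ ℚ.* p₇ ℚ.* p₈) ≡
    (((p₁ * p₂) * p₃) * p₄) * inv (((p₅ * p₆) * p₇) * p₈)
  quot p₁ p₂ p₃ p₄ p₅ p₆ p₇ p₈ = refl

  swap-factors : ∀ p q r s → ((p * q) * r) * s ≡ ((q * p) * s) * r
  swap-factors = solve-∀ ℚ-ring

  regroup-f : ∀ h f p q i i′ g g′ j j′ p′ → (((h * f) * (p * q)) * (i * i′)) * ((g * g′) * (j * (j′ * p′))) ≡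
    ((f * i′) * ((p * p′) * (g′ * j′))) * ((q * (h * i)) * (g * j))
  regroup-f = solve-∀ ℚ-ring

  regroup-i : ∀ h f p j j′ p′ → ((h * f) * p) * (j * (j′ * p′)) ≡ (h * j) * ((f * j′) * (p * p′))
  regroup-i = solve-∀ ℚ-ring

  pull-4 : ∀ t p x y z → ((t * (t * p)) * x) * y * z ≡ (t * t) * ((p * x) * y * z)
  pull-4 = solve-∀ ℚ-ring

cong₄ : ∀ {A B : Set} (f : A → A → A → A → B) {x x′ y y′ z z′ w w′} → x ≡ x′ → y ≡ y′ → z ≡ z′ → w ≡ w′ → f x y z w ≡ f x′ y′ z′ w′
cong₄ f refl refl refl refl = refl

ifac-dbl : ∀ n → ifac (dbl n) ≡ ihf n * (ifac n * inv (pow2 (dbl n)))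
ifac-dbl n = inv-unique (NZ-fac (dbl n)) (fac-ifac (dbl n)) (trans (*-congʳ (sym (dup₀ n)))
  (trans (regroup-i (hf n) (fac n) (pow2 (dbl n)) (ihf n) (ifac n) (inv (pow2 (dbl n))))
    (ones (hf-ihf n) (ones (fac-ifac n) (inv-*ʳ _ (NZ-pow2 (dbl n)))))))

fac-dbl : ∀ k a → fac (dbl (k ℕ.+ a)) ≡ (hf (k ℕ.+ a) * fac (k ℕ.+ a)) * (pow2 (dbl k) * pow2 (dbl a))
fac-dbl k a = trans (sym (dup₀ (k ℕ.+ a))) (*-congˡ (trans (cong pow2 (dbl-+ k a)) (pow2-+ (dbl k) (dbl a))))

module Factors (a : ℕ) where
  open Hats a

  -- The duplication formula in both central binomial coefficients: the powers of 2 that belong to k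
  -- cancel, and 4 to the power a is left over, to be used up by the duplication in u and v.
  fe-hf : ∀ k → fe k ≡ (pow2 (dbl a) * (hf (a ℕ.+ k) * ifac (a ℕ.+ k))) * (fac k * ihf k)
  fe-hf k = begin
    fe k
      ≡⟨ cong₂ (λ x y → (x * (ifac n * ifac n)) * ((fac k * fac k) * y)) (fac-dbl k a) (ifac-dbl k) ⟩
    (((hf n * fac n) * (pow2 (dbl k) * pow2 (dbl a))) * (ifac n * ifac n)) * ((fac k * fac k) * (ihf k * (ifac k * inv (pow2 (dbl k)))))
      ≡⟨ regroup-f (hf n) (fac n) (pow2 (dbl k)) (pow2 (dbl a)) (ifac n) (ifac n) (fac k) (fac k) (ihf k) (ifac k) (inv (pow2 (dbl k))) ⟩
    ((fac n * ifac n) * ((pow2 (dbl k) * inv (pow2 (dbl k))) * (fac k * ifac k))) * ((pow2 (dbl a) * (hf n * ifac n)) * (fac k * ihf k))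
      ≡⟨ one-* (ones (fac-ifac n) (ones (inv-*ʳ _ (NZ-pow2 (dbl k))) (fac-ifac k))) ⟩
    (pow2 (dbl a) * (hf n * ifac n)) * (fac k * ihf k)
      ≡⟨ cong (λ n → (pow2 (dbl a) * (hf n * ifac n)) * (fac k * ihf k)) (ℕP.+-comm k a) ⟩
    (pow2 (dbl a) * (hf (a ℕ.+ k) * ifac (a ℕ.+ k))) * (fac k * ihf k) ∎
    where
    open ≡-Reasoning
    n : ℕ
    n = k ℕ.+ a

  fo-hf : ∀ k → fo k ≡ (pow2 (dbl a) * (hf (suc (a ℕ.+ k)) * ifac (a ℕ.+ k))) * (fac k * ihf (suc k))
  fo-hf k = begin
    fo k
      ≡⟨ cong₂ (λ x y → (x * (ifac n * ifac (suc n))) * ((fac k * fac (suc k)) * y)) (fac-dbl (suc k) a) (ifac-dbl (suc k)) ⟩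
    (((hf (suc n) * fac (suc n)) * (pow2 (dbl (suc k)) * pow2 (dbl a))) * (ifac n * ifac (suc n))) * ((fac k * fac (suc k)) * (ihf (suc k) * (ifac (suc k) * inv (pow2 (dbl (suc k))))))
      ≡⟨ regroup-f (hf (suc n)) (fac (suc n)) (pow2 (dbl (suc k))) (pow2 (dbl a)) (ifac n) (ifac (suc n)) (fac k) (fac (suc k)) (ihf (suc k)) (ifac (suc k)) (inv (pow2 (dbl (suc k)))) ⟩
    ((fac (suc n) * ifac (suc n)) * ((pow2 (dbl (suc k)) * inv (pow2 (dbl (suc k)))) * (fac (suc k) * ifac (suc k)))) * ((pow2 (dbl a) * (hf (suc n) * ifac n)) * (fac k * ihf (suc k)))
      ≡⟨ one-* (ones (fac-ifac (suc n)) (ones (inv-*ʳ _ (NZ-pow2 (dbl (suc k)))) (fac-ifac (suc k)))) ⟩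
    (pow2 (dbl a) * (hf (suc n) * ifac n)) * (fac k * ihf (suc k))
      ≡⟨ cong (λ n → (pow2 (dbl a) * (hf (suc n) * ifac n)) * (fac k * ihf (suc k))) (ℕP.+-comm k a) ⟩
    (pow2 (dbl a) * (hf (suc (a ℕ.+ k)) * ifac (a ℕ.+ k))) * (fac k * ihf (suc k)) ∎
    where
    open ≡-Reasoning
    n : ℕ
    n = k ℕ.+ a

  termE termO : ℕ → ℕ → ℕ → ℚ
  termE b c k =
          (poch (fromℕ k ℚ.+ ½) (+ b ℤ.- + (2 ℕ.* k))
            ℚ.* poch (fromℕ (a ℕ.+ k ℕ.+ 1)) (+ b ℤ.- + (2 ℕ.* k) ℤ.- + 1)
            ℚ.* poch (fromℕ (b ∸ k) ℚ.+ ½) (+ ((c ∸ b) ℕ./ 2))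
            ℚ.* poch (fromℕ (c ∸ k)) (ℤ.- (+ ((c ∸ b) ℕ./ 2))))
          ÷' (poch (fromℕ (a ℕ.+ k) ℚ.+ ½) (+ b ℤ.- + (2 ℕ.* k))
            ℚ.* poch (fromℕ (k ℕ.+ 1)) (+ b ℤ.- + (2 ℕ.* k) ℤ.- + 1)
            ℚ.* poch (fromℕ (a ℕ.+ b ∸ k) ℚ.+ ½) (+ ((c ∸ b) ℕ./ 2))
            ℚ.* poch (fromℕ (a ℕ.+ c ∸ k)) (ℤ.- (+ ((c ∸ b) ℕ./ 2))))
  termO b c k =
          (poch (fromℕ (a ℕ.+ k ℕ.+ 1)) (+ c ℤ.- + (2 ℕ.* k))
            ℚ.* poch (fromℕ (k ℕ.+ 1) ℚ.+ ½) (+ c ℤ.- + (2 ℕ.* k) ℤ.- + 2)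
            ℚ.* poch (fromℕ (b ∸ k)) (+ ((c ∸ b) ℕ./ 2))
            ℚ.* poch (fromℕ (c ∸ k) ℚ.- ½) (ℤ.- (+ ((c ∸ b) ℕ./ 2))))
          ÷' (poch (fromℕ (k ℕ.+ 1)) (+ c ℤ.- + (2 ℕ.* k) ℤ.- + 1)
            ℚ.* poch (fromℕ (a ℕ.+ k ℕ.+ 1) ℚ.+ ½) (+ c ℤ.- + (2 ℕ.* k) ℤ.- + 1)
            ℚ.* poch (fromℕ (a ℕ.+ b ∸ k ℕ.+ 1)) (+ ((c ∸ b) ℕ./ 2))
            ℚ.* poch (fromℕ (a ℕ.+ c ∸ k) ℚ.+ ½) (ℤ.- (+ ((c ∸ b) ℕ./ 2))))

  module _ (k u v : ℕ) (u≤v : u ℕ.≤ v) where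

    private
      b c m r : ℕ
      b = suc (k ℕ.+ u)
      c = suc (k ℕ.+ v)
      m = (c ∸ b) ℕ./ 2
      mid = midpoint u v u≤v
      r = proj₁ mid
      m≡ : m ≡ (v ∸ u) ℕ./ 2
      m≡ = cong (ℕ._/ 2) (ℕP.[m+n]∸[m+o]≡n∸o k v u)
      v≡ : v ≡ r ℕ.+ m
      v≡ = trans (proj₁ (proj₂ mid)) (cong (r ℕ.+_) (sym m≡))
      near : Near (u ℕ.+ m) r
      near = subst (λ m → Near (u ℕ.+ m) r) (sym m≡) (proj₂ (proj₂ mid))
      near+ : ∀ e → Near ((e ℕ.+ u) ℕ.+ m) (e ℕ.+ r)
      near+ e with near
      ... | inj₁ q = inj₁ (trans (cong (e ℕ.+_) q) (sym (ℕP.+-assoc e u m)))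
      ... | inj₂ q = inj₂ (trans (cong (e ℕ.+_) q) (trans (ℕP.+-suc e (u ℕ.+ m)) (cong suc (sym (ℕP.+-assoc e u m)))))
      v≡+ : ∀ e → e ℕ.+ v ≡ (e ℕ.+ r) ℕ.+ m
      v≡+ e = trans (cong (e ℕ.+_) v≡) (sym (ℕP.+-assoc e r m))
      ∸k : ∀ x → suc (k ℕ.+ x) ∸ k ≡ suc x
      ∸k x = trans (cong (_∸ k) (sym (ℕP.+-suc k x))) (ℕP.m+n∸m≡n k (suc x))
      a∸k : ∀ x → a ℕ.+ suc (k ℕ.+ x) ∸ k ≡ suc (a ℕ.+ x)
      a∸k x = trans (cong (_∸ k) (lem a k x)) (ℕP.m+n∸m≡n k (suc (a ℕ.+ x)))
        where
        lem : ∀ a k x → a ℕ.+ suc (k ℕ.+ x) ≡ k ℕ.+ suc (a ℕ.+ x)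
        lem = solve-∀ ℕ-ring
      +1 : ∀ x → x ℕ.+ 1 ≡ suc x
      +1 x = ℕP.+-comm x 1
      twice : ∀ e → (e ℕ.+ u) ℕ.+ (e ℕ.+ v) ≡ dbl e ℕ.+ (u ℕ.+ v)
      twice e = trans (lem e u v) (cong (ℕ._+ (u ℕ.+ v)) (sym (dbl≡+ e)))
        where
        lem : ∀ e u v → (e ℕ.+ u) ℕ.+ (e ℕ.+ v) ≡ (e ℕ.+ e) ℕ.+ (u ℕ.+ v)
        lem = solve-∀ ℕ-ring
      +m : ∀ n → + n ℤ.+ + m ≡ + (n ℕ.+ m)
      +m n = refl
      l₁ : ∀ k x → k ℕ.+ suc (k ℕ.+ x) ≡ suc x ℕ.+ 2 ℕ.* k
      l₁ = solve-∀ ℕ-ring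
      l₂ : ∀ a k x → (a ℕ.+ k) ℕ.+ suc (k ℕ.+ x) ≡ (a ℕ.+ x) ℕ.+ (2 ℕ.* k ℕ.+ 1)
      l₂ = solve-∀ ℕ-ring
      l₅ : ∀ a k x → (a ℕ.+ k) ℕ.+ suc (k ℕ.+ x) ≡ suc (a ℕ.+ x) ℕ.+ 2 ℕ.* k
      l₅ = solve-∀ ℕ-ring
      l₆ : ∀ k x → k ℕ.+ suc (k ℕ.+ x) ≡ x ℕ.+ (2 ℕ.* k ℕ.+ 1)
      l₆ = solve-∀ ℕ-ring
      l₇ : ∀ k x → suc k ℕ.+ suc (k ℕ.+ x) ≡ x ℕ.+ (2 ℕ.* k ℕ.+ 2)
      l₇ = solve-∀ ℕ-ring
      l₈ : ∀ a k x → suc (a ℕ.+ k) ℕ.+ suc (k ℕ.+ x) ≡ suc (a ℕ.+ x) ℕ.+ (2 ℕ.* k ℕ.+ 1)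
      l₈ = solve-∀ ℕ-ring

    -- All eight shifted factorials become quotients of values of `fac` and `hf`. Most cancel; the
    -- others combine by duplication, once for u and v and once for a + u and a + v.
    termE-hat : termE b c k ≡ fe k * G u v
    termE-hat = begin
      termE b c k
        ≡⟨ quot _ _ _ _ _ _ _ _ ⟩
      _ ≡⟨ cong₂ (λ x y → x * inv y)
            (cong₄ (λ x y z w → ((x * y) * z) * w)
              (Half.poch-ratio k (suc u) (+ b ℤ.- + (2 ℕ.* k)) (exp₁ k b (2 ℕ.* k) (suc u) (l₁ k u)))
              (trans (cong (λ n → poch (fromℕ n) (+ b ℤ.- + (2 ℕ.* k) ℤ.- + 1)) (+1 (a ℕ.+ k))) (Nat.poch-ratio (a ℕ.+ k) (a ℕ.+ u) (+ b ℤ.- + (2 ℕ.* k) ℤ.- + 1) (exp₂ (a ℕ.+ k) b (2 ℕ.* k) 1 (a ℕ.+ u) (l₂ a k u))))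
              (trans (cong (λ n → poch (fromℕ n ℚ.+ ½) (+ m)) (∸k u)) (Half.poch-ratio (suc u) (suc u ℕ.+ m) (+ m) (+m (suc u))))
              (trans (cong (λ n → poch (fromℕ n) (ℤ.- (+ m))) (∸k v)) (Nat.poch-ratio v r (ℤ.- (+ m)) (exp₃ v m r v≡))))
            (cong₄ (λ x y z w → ((x * y) * z) * w)
              (Half.poch-ratio (a ℕ.+ k) (suc (a ℕ.+ u)) (+ b ℤ.- + (2 ℕ.* k)) (exp₁ (a ℕ.+ k) b (2 ℕ.* k) (suc (a ℕ.+ u)) (l₅ a k u)))
              (trans (cong (λ n → poch (fromℕ n) (+ b ℤ.- + (2 ℕ.* k) ℤ.- + 1)) (+1 k)) (Nat.poch-ratio k u (+ b ℤ.- + (2 ℕ.* k) ℤ.- + 1) (exp₂ k b (2 ℕ.* k) 1 u (l₆ k u))))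
              (trans (cong (λ n → poch (fromℕ n ℚ.+ ½) (+ m)) (a∸k u)) (Half.poch-ratio (suc (a ℕ.+ u)) (suc (a ℕ.+ u) ℕ.+ m) (+ m) (+m (suc (a ℕ.+ u)))))
              (trans (cong (λ n → poch (fromℕ n) (ℤ.- (+ m))) (a∸k v)) (Nat.poch-ratio (a ℕ.+ v) (a ℕ.+ r) (ℤ.- (+ m)) (exp₃ (a ℕ.+ v) m (a ℕ.+ r) (v≡+ a))))) ⟩
      num * inv den
        ≡⟨ div-cancel NZ-den (trans (factor (ihf k) (fac (a ℕ.+ u)) (ifac (a ℕ.+ k)) (ifac v)
             (hf-ihf (suc u)) (hf-ihf (suc (a ℕ.+ u))) (hf-ihf (a ℕ.+ k)) (fac-ifac k) (fac-ifac u) (fac-ifac (a ℕ.+ v))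
             (dupE {u} v≡ near) dup′ (fac-ifac (suc (dbl a) ℕ.+ (u ℕ.+ v))))
             (*-congʳ (*-congʳ (sym (fe-hf k))))) ⟩
      fe k * G u v ∎
      where
      open ≡-Reasoning
      num den : ℚ
      num = (((hf (suc u) * ihf k) * (fac (a ℕ.+ u) * ifac (a ℕ.+ k))) * (hf (suc u ℕ.+ m) * ihf (suc u))) * (fac r * ifac v)
      den = (((hf (suc (a ℕ.+ u)) * ihf (a ℕ.+ k)) * (fac u * ifac k)) * (hf (suc (a ℕ.+ u) ℕ.+ m) * ihf (suc (a ℕ.+ u)))) * (fac (a ℕ.+ r) * ifac (a ℕ.+ v))
      NZ-den : NZ den
      NZ-den = NZ-* (NZ-* (NZ-* (NZ-* (NZ-hf (suc (a ℕ.+ u))) (NZ-ihf (a ℕ.+ k))) (NZ-* (NZ-fac u) (NZ-ifac k)))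
        (NZ-* (NZ-hf (suc (a ℕ.+ u) ℕ.+ m)) (NZ-ihf (suc (a ℕ.+ u))))) (NZ-* (NZ-fac (a ℕ.+ r)) (NZ-ifac (a ℕ.+ v)))
      dup′ : (hf (suc (a ℕ.+ u) ℕ.+ m) * fac (a ℕ.+ r)) * (pow2 (suc (u ℕ.+ v)) * pow2 (dbl a)) ≡ fac (suc (dbl a) ℕ.+ (u ℕ.+ v))
      dup′ = trans (*-congˡ (trans (*-comm _ _) (trans (sym (pow2-+ (dbl a) (suc (u ℕ.+ v)))) (cong pow2 (trans (ℕP.+-suc (dbl a) (u ℕ.+ v)) (cong suc (sym (twice a))))))))
        (trans (dupE {a ℕ.+ u} (v≡+ a) (near+ a)) (cong (fac ∘ suc) (twice a)))

    -- Here the duplication in a + 1 + u and a + 1 + v yields 4 to the power a + 1, one factor 4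
    -- more than `fo` contains. These factors are what the prefix 1 / 4^d compensates.
    termO-hat : termO b c k ≡ (nat 2 * nat 2) * (fo k * H u v)
    termO-hat = begin
      termO b c k
        ≡⟨ quot _ _ _ _ _ _ _ _ ⟩
      _ ≡⟨ cong₂ (λ x y → x * inv y)
            (cong₄ (λ x y z w → ((x * y) * z) * w)
              (trans (cong (λ n → poch (fromℕ n) (+ c ℤ.- + (2 ℕ.* k))) (+1 (a ℕ.+ k))) (Nat.poch-ratio (a ℕ.+ k) (suc (a ℕ.+ v)) (+ c ℤ.- + (2 ℕ.* k)) (exp₁ (a ℕ.+ k) c (2 ℕ.* k) (suc (a ℕ.+ v)) (l₅ a k v))))
              (trans (cong (λ n → poch (fromℕ n ℚ.+ ½) (+ c ℤ.- + (2 ℕ.* k) ℤ.- + 2)) (+1 k)) (Half.poch-ratio (suc k) v (+ c ℤ.- + (2 ℕ.* k) ℤ.- + 2) (exp₂ (suc k) c (2 ℕ.* k) 2 v (l₇ k v))))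
              (trans (cong (λ n → poch (fromℕ n) (+ m)) (∸k u)) (Nat.poch-ratio u (u ℕ.+ m) (+ m) (+m u)))
              (trans (cong (λ x → poch x (ℤ.- (+ m))) (trans (cong (λ n → fromℕ n ℚ.- ½) (∸k v)) (half-pred v))) (Half.poch-ratio v r (ℤ.- (+ m)) (exp₃ v m r v≡))))
            (cong₄ (λ x y z w → ((x * y) * z) * w)
              (trans (cong (λ n → poch (fromℕ n) (+ c ℤ.- + (2 ℕ.* k) ℤ.- + 1)) (+1 k)) (Nat.poch-ratio k v (+ c ℤ.- + (2 ℕ.* k) ℤ.- + 1) (exp₂ k c (2 ℕ.* k) 1 v (l₆ k v))))
              (trans (cong (λ n → poch (fromℕ n ℚ.+ ½) (+ c ℤ.- + (2 ℕ.* k) ℤ.- + 1)) (+1 (a ℕ.+ k))) (Half.poch-ratio (suc (a ℕ.+ k)) (suc (a ℕ.+ v)) (+ c ℤ.- + (2 ℕ.* k) ℤ.- + 1) (exp₂ (suc (a ℕ.+ k)) c (2 ℕ.* k) 1 (suc (a ℕ.+ v)) (l₈ a k v))))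
              (trans (cong (λ n → poch (fromℕ n) (+ m)) (trans (cong (ℕ._+ 1) (a∸k u)) (+1 (suc (a ℕ.+ u))))) (Nat.poch-ratio (suc (a ℕ.+ u)) (suc (a ℕ.+ u) ℕ.+ m) (+ m) (+m (suc (a ℕ.+ u)))))
              (trans (cong (λ n → poch (fromℕ n ℚ.+ ½) (ℤ.- (+ m))) (a∸k v)) (Half.poch-ratio (suc (a ℕ.+ v)) (suc a ℕ.+ r) (ℤ.- (+ m)) (exp₃ (suc (a ℕ.+ v)) m (suc a ℕ.+ r) (v≡+ (suc a)))))) ⟩
      num * inv den
        ≡⟨ div-cancel NZ-den (begin
             num
               ≡⟨ trans (swap-factors _ _ _ _) (factor (ihf (suc k)) (fac (suc (a ℕ.+ v))) (ifac (a ℕ.+ k)) (ifac u)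
                    (hf-ihf v) (hf-ihf (suc (a ℕ.+ v))) (hf-ihf (suc (a ℕ.+ k))) (fac-ifac k) (fac-ifac v) (fac-ifac (suc (a ℕ.+ u)))
                    (dupO {u} v≡ near) dup′ (fac-ifac (suc (suc (dbl a)) ℕ.+ (u ℕ.+ v)))) ⟩
             (((pow2 (dbl (suc a)) * (hf (suc (a ℕ.+ k)) * ifac (a ℕ.+ k))) * (fac k * ihf (suc k)))
               * ((fac (u ℕ.+ v) * (ifac v * ifac u)) * ((fac (suc (a ℕ.+ v)) * fac (suc (a ℕ.+ u))) * ifac (suc (suc (dbl a)) ℕ.+ (u ℕ.+ v))))) * den′
               ≡⟨ cong₂ _*_ (trans (pull-4 (nat 2) (pow2 (dbl a)) _ _ _) (*-congˡ (cong₂ _*_ (sym (fo-hf k))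
                    (cong₂ _*_ (*-congˡ (*-comm _ _)) (*-congʳ (*-comm _ _)))))) (swap-factors _ _ _ _) ⟩
             ((nat 2 * nat 2) * (fo k * H u v)) * den ∎) ⟩
      (nat 2 * nat 2) * (fo k * H u v) ∎
      where
      open ≡-Reasoning
      num den den′ : ℚ
      num = (((fac (suc (a ℕ.+ v)) * ifac (a ℕ.+ k)) * (hf v * ihf (suc k))) * (fac (u ℕ.+ m) * ifac u)) * (hf r * ihf v)
      den = (((fac v * ifac k) * (hf (suc (a ℕ.+ v)) * ihf (suc (a ℕ.+ k)))) * (fac (suc (a ℕ.+ u) ℕ.+ m) * ifac (suc (a ℕ.+ u)))) * (hf (suc a ℕ.+ r) * ihf (suc (a ℕ.+ v)))
      den′ = (((hf (suc (a ℕ.+ v)) * ihf (suc (a ℕ.+ k))) * (fac v * ifac k)) * (hf (suc a ℕ.+ r) * ihf (suc (a ℕ.+ v)))) * (fac (suc (a ℕ.+ u) ℕ.+ m) * ifac (suc (a ℕ.+ u)))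
      NZ-den : NZ den
      NZ-den = NZ-* (NZ-* (NZ-* (NZ-* (NZ-fac v) (NZ-ifac k)) (NZ-* (NZ-hf (suc (a ℕ.+ v))) (NZ-ihf (suc (a ℕ.+ k)))))
        (NZ-* (NZ-fac (suc (a ℕ.+ u) ℕ.+ m)) (NZ-ifac (suc (a ℕ.+ u))))) (NZ-* (NZ-hf (suc a ℕ.+ r)) (NZ-ihf (suc (a ℕ.+ v))))
      dup′ : (hf (suc a ℕ.+ r) * fac (suc (a ℕ.+ u) ℕ.+ m)) * (pow2 (u ℕ.+ v) * pow2 (dbl (suc a))) ≡ fac (suc (suc (dbl a)) ℕ.+ (u ℕ.+ v))
      dup′ = trans (*-congˡ (trans (*-comm _ _) (trans (sym (pow2-+ (dbl (suc a)) (u ℕ.+ v))) (cong pow2 (sym (twice (suc a)))))))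
        (trans (dupO {suc a ℕ.+ u} (v≡+ (suc a)) (near+ (suc a))) (cong fac (twice (suc a))))

-- The product formulas

prodℚ-snoc : ∀ xs y → prodℚ (xs ++ y ∷ []) ≡ prodℚ xs * y
prodℚ-snoc []       y = trans (ℚ*≡ y 1ℚ) (*-comm y 1ℚ)
prodℚ-snoc (x ∷ xs) y = trans (ℚ*≡ x _) (trans (*-congˡ (prodℚ-snoc xs y)) (trans (sym (*-assoc _ _ _)) (*-congʳ (sym (ℚ*≡ x (prodℚ xs))))))

prodRange-suc : ∀ n F → prodRange (suc n) F ≡ prodRange n F * F n
prodRange-suc n F = trans (cong (λ l → prodℚ (map F l)) (trans (upTo≡range (suc n)) (range-snoc 0 n)))
  (trans (cong prodℚ (LP.map-++ F (range 0 n) (n ∷ []))) (trans (prodℚ-snoc (map F (range 0 n)) (F n))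
    (*-congʳ (cong (λ l → prodℚ (map F l)) (sym (upTo≡range n))))))

-- For fixed b and c the k-th factor belongs to the passage from k to k + 1 removals, where the
-- coordinates are b - k - 1 and c - k - 1.
telescope : ∀ (Z g : ℕ → ℕ → ℕ → ℚ) → (∀ d u v → Z (suc d) u v ≡ Z d (suc u) (suc v) * g d u v) → ∀ (F : ℕ → ℚ) {b c} d {u v} →
  b ≡ d ℕ.+ u → c ≡ d ℕ.+ v → (∀ k → k ℕ.< d → F k ≡ g k (b ∸ suc k) (c ∸ suc k)) → Z 0 b c * prodRange d F ≡ Z d u v
telescope Z g step F zero refl refl h = trans (*-comm _ 1ℚ) (*-identityˡ _)
telescope Z g step F {b} {c} (suc d) {u} {v} b≡ c≡ h = begin
  Z 0 b c * prodRange (suc d) F         ≡⟨ trans (*-congˡ (prodRange-suc d F)) (sym (*-assoc _ _ _)) ⟩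
  (Z 0 b c * prodRange d F) * F d       ≡⟨ cong₂ _*_ (telescope Z g step F d (trans b≡ (sym (ℕP.+-suc d u))) (trans c≡ (sym (ℕP.+-suc d v))) (λ k k<d → h k (ℕP.m<n⇒m<1+n k<d)))
                                                    (trans (h d (ℕP.n<1+n d)) (cong₂ (g d) (diff b≡) (diff c≡))) ⟩
  Z d (suc u) (suc v) * g d u v         ≡⟨ sym (step d u v) ⟩
  Z (suc d) u v                         ∎
  where
  open ≡-Reasoning
  diff : ∀ {b u} → b ≡ suc d ℕ.+ u → b ∸ suc d ≡ u
  diff {u = u} refl = ℕP.m+n∸m≡n d u

opaque
  unfolding nat

  quotient : ∀ m n → fromℕ m ÷' fromℕ n ≡ nat m * inv (nat n)
  quotient m n = refl

  inv-fromℕ : ∀ n x → inv (fromℕ n) ℚ.* x ≡ inv (nat n) * x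
  inv-fromℕ n x = refl

  four-step : ∀ t p y f → (t * (t * p)) * (y * f) ≡ (p * y) * ((t * t) * f)
  four-step = solve-∀ ℚ-ring

  shuffle₂ : ∀ i x s y → (i * x) * (s * y) ≡ i * (s * (y * x))
  shuffle₂ = solve-∀ ℚ-ring

  shuffle₃ : ∀ i s q x → i * (s * (q * x)) ≡ (q * i) * (s * x)
  shuffle₃ = solve-∀ ℚ-ring

nat-4^ : ∀ d → nat (4 ℕ.^ d) ≡ pow2 (dbl d)
nat-4^ zero    = nat-1
nat-4^ (suc d) = trans (nat-* 4 (4 ℕ.^ d)) (trans (cong₂ _*_ (nat-* 2 2) (nat-4^ d)) (*-assoc _ _ _))

module _ (a b c d : ℕ) (d≤b : d ≤ b) (b≤c : b ≤ c) where
  open Hats a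
  open Factors a

  private
    u v : ℕ
    u = b ∸ d
    v = c ∸ d
    b≡ : b ≡ d ℕ.+ u
    b≡ = sym (ℕP.m+[n∸m]≡n d≤b)
    c≡ : c ≡ d ℕ.+ v
    c≡ = sym (ℕP.m+[n∸m]≡n (ℕP.≤-trans d≤b b≤c))
    suc-∸ : ∀ {k x} → k ℕ.< x → suc (k ℕ.+ (x ∸ suc k)) ≡ x
    suc-∸ h = ℕP.m+[n∸m]≡n h

  termE≡ : ∀ k → k ℕ.< d → termE b c k ≡ fe k * G (b ∸ suc k) (c ∸ suc k)
  termE≡ k k<d = trans (cong₂ (λ b c → termE b c k) (sym (suc-∸ k<b)) (sym (suc-∸ (ℕP.<-≤-trans k<b b≤c)))) (termE-hat k _ _ (ℕP.∸-monoˡ-≤ (suc k) b≤c))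
    where
    k<b : k ℕ.< b
    k<b = ℕP.<-≤-trans k<d d≤b

  termO≡ : ∀ k → k ℕ.< d → termO b c k ≡ (nat 2 * nat 2) * (fo k * H (b ∸ suc k) (c ∸ suc k))
  termO≡ k k<d = trans (cong₂ (λ b c → termO b c k) (sym (suc-∸ k<b)) (sym (suc-∸ (ℕP.<-≤-trans k<b b≤c)))) (termO-hat k _ _ (ℕP.∸-monoˡ-≤ (suc k) b≤c))
    where
    k<b : k ℕ.< b
    k<b = ℕP.<-≤-trans k<d d≤b

  even-case : fromℕ (M (HexD (2 ℕ.* a) b c d)) ÷' fromℕ (M (Hex (2 ℕ.* a) b c)) ≡ prodRange d (termE b c)
  even-case = begin
    fromℕ (M (HexD (2 ℕ.* a) b c d)) ÷' fromℕ (M (Hex (2 ℕ.* a) b c))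
      ≡⟨ quotient (M (HexD (2 ℕ.* a) b c d)) (M (Hex (2 ℕ.* a) b c)) ⟩
    nat (M (HexD (2 ℕ.* a) b c d)) * inv (nat (M (Hex (2 ℕ.* a) b c)))
      ≡⟨ cong₂ (λ x y → x * inv y)
          (trans (cong (λ p → nat (M (HexD p b c d))) (dbl≡2* a)) (trans (cong₂ (λ b c → nat (M (HexD (dbl a) b c d))) b≡ c≡) (Even.M-even a d u v)))
          (trans (cong (λ p → nat (M (Hex p b c))) (dbl≡2* a)) (trans (cong (λ R → nat (M R)) (sym (HexD-0 (dbl a) b c))) (Even.M-even a 0 b c))) ⟩
    Xh d u v * inv (Xh 0 b c)
      ≡⟨ div-cancel (NZ-Xh 0 b c) (trans (sym (telescope Xh (λ d u v → fe d * G u v) (λ _ _ _ → refl) (termE b c) d b≡ c≡ termE≡)) (*-comm _ _)) ⟩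
    prodRange d (termE b c) ∎
    where open ≡-Reasoning

  odd-case : fromℕ (M (HexD (2 ℕ.* a ℕ.+ 1) b c d)) ÷' fromℕ (M (Hex (2 ℕ.* a ℕ.+ 1) b c)) ≡ inv (fromℕ (4 ℕ.^ d)) ℚ.* prodRange d (termO b c)
  odd-case = begin
    fromℕ (M (HexD (2 ℕ.* a ℕ.+ 1) b c d)) ÷' fromℕ (M (Hex (2 ℕ.* a ℕ.+ 1) b c))
      ≡⟨ quotient (M (HexD (2 ℕ.* a ℕ.+ 1) b c d)) (M (Hex (2 ℕ.* a ℕ.+ 1) b c)) ⟩
    nat (M (HexD (2 ℕ.* a ℕ.+ 1) b c d)) * inv (nat (M (Hex (2 ℕ.* a ℕ.+ 1) b c)))
      ≡⟨ cong₂ (λ x y → x * inv y)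
          (trans (cong (λ p → nat (M (HexD p b c d))) p≡) (trans (cong₂ (λ b c → nat (M (HexD (suc (dbl a)) b c d))) b≡ c≡) (Odd.M-odd a d u v)))
          (trans (cong (λ p → nat (M (Hex p b c))) p≡) (trans (cong (λ R → nat (M R)) (sym (HexD-0 (suc (dbl a)) b c))) (Odd.M-odd a 0 b c))) ⟩
    (sgn a * Yh d u v) * inv (sgn a * Yh 0 b c)
      ≡⟨ div-cancel (NZ-* NZ-sgn (NZ-Yh 0 b c)) (sym (begin
          (inv (pow2 (dbl d)) * Π) * (sgn a * Yh 0 b c)
            ≡⟨ trans (shuffle₂ _ _ _ _) (*-congˡ (*-congˡ (trans (*-congʳ (sym (*-identityˡ _))) tele))) ⟩
          inv (pow2 (dbl d)) * (sgn a * (pow2 (dbl d) * Yh d u v))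
            ≡⟨ trans (shuffle₃ _ _ _ _) (one-* (inv-*ʳ _ (NZ-pow2 (dbl d)))) ⟩
          sgn a * Yh d u v ∎)) ⟩
    inv (pow2 (dbl d)) * Π
      ≡⟨ sym (trans (inv-fromℕ (4 ℕ.^ d) Π) (cong (λ x → inv x * Π) (nat-4^ d))) ⟩
    inv (fromℕ (4 ℕ.^ d)) ℚ.* Π ∎
    where
    open ≡-Reasoning
    Π : ℚ
    Π = prodRange d (termO b c)
    p≡ : 2 ℕ.* a ℕ.+ 1 ≡ suc (dbl a)
    p≡ = trans (ℕP.+-comm (2 ℕ.* a) 1) (cong suc (dbl≡2* a))
    NZ-sgn : NZ (sgn a)
    NZ-sgn = NZ-unit (sgn² a)
    tele : (1ℚ * Yh 0 b c) * Π ≡ pow2 (dbl d) * Yh d u v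
    -- The factors 4 of the terms are absorbed by telescoping `Yh` multiplied with 4 to the power d.
    tele = telescope (λ d u v → pow2 (dbl d) * Yh d u v) (λ d u v → (nat 2 * nat 2) * (fo d * H u v))
      (λ d u v → four-step (nat 2) (pow2 (dbl d)) (Yh d (suc u) (suc v)) (fo d * H u v)) (termO b c) d b≡ c≡ termO≡

theorem2p1 : (a b c d : ℕ) → d ≤ b → b ≤ c →
    (fromℕ (M (HexD (2 ℕ.* a) b c d)) ÷' fromℕ (M (Hex (2 ℕ.* a) b c))
      ≡ prodRange d (λ k →
          (poch (fromℕ k ℚ.+ ½) (+ b ℤ.- + (2 ℕ.* k))
            ℚ.* poch (fromℕ (a ℕ.+ k ℕ.+ 1)) (+ b ℤ.- + (2 ℕ.* k) ℤ.- + 1)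
            ℚ.* poch (fromℕ (b ∸ k) ℚ.+ ½) (+ ((c ∸ b) ℕ./ 2))
            ℚ.* poch (fromℕ (c ∸ k)) (ℤ.- (+ ((c ∸ b) ℕ./ 2))))
          ÷' (poch (fromℕ (a ℕ.+ k) ℚ.+ ½) (+ b ℤ.- + (2 ℕ.* k))
            ℚ.* poch (fromℕ (k ℕ.+ 1)) (+ b ℤ.- + (2 ℕ.* k) ℤ.- + 1)
            ℚ.* poch (fromℕ (a ℕ.+ b ∸ k) ℚ.+ ½) (+ ((c ∸ b) ℕ./ 2))
            ℚ.* poch (fromℕ (a ℕ.+ c ∸ k)) (ℤ.- (+ ((c ∸ b) ℕ./ 2))))))
    ×
    (fromℕ (M (HexD (2 ℕ.* a ℕ.+ 1) b c d)) ÷' fromℕ (M (Hex (2 ℕ.* a ℕ.+ 1) b c))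
      ≡ inv (fromℕ (4 ℕ.^ d)) ℚ.* prodRange d (λ k →
          (poch (fromℕ (a ℕ.+ k ℕ.+ 1)) (+ c ℤ.- + (2 ℕ.* k))
            ℚ.* poch (fromℕ (k ℕ.+ 1) ℚ.+ ½) (+ c ℤ.- + (2 ℕ.* k) ℤ.- + 2)
            ℚ.* poch (fromℕ (b ∸ k)) (+ ((c ∸ b) ℕ./ 2))
            ℚ.* poch (fromℕ (c ∸ k) ℚ.- ½) (ℤ.- (+ ((c ∸ b) ℕ./ 2))))
          ÷' (poch (fromℕ (k ℕ.+ 1)) (+ c ℤ.- + (2 ℕ.* k) ℤ.- + 1)
            ℚ.* poch (fromℕ (a ℕ.+ k ℕ.+ 1) ℚ.+ ½) (+ c ℤ.- + (2 ℕ.* k) ℤ.- + 1)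
            ℚ.* poch (fromℕ (a ℕ.+ b ∸ k ℕ.+ 1)) (+ ((c ∸ b) ℕ./ 2))
            ℚ.* poch (fromℕ (a ℕ.+ c ∸ k) ℚ.+ ½) (ℤ.- (+ ((c ∸ b) ℕ./ 2))))))
theorem2p1 a b c d d≤b b≤c = even-case a b c d d≤b b≤c , odd-case a b c d d≤b b≤c
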